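{- Let $p_0\in(0,1)$ and the integer $d\ge1$ be constants. There is an algorithm which, given an instance $\mathcal I$ of a $d$-ary CSP on $n$ variables, a parameter $t$, and a parameter $p\in[p_0,1-p_0]$ with $pn$ an integer, runs in time $n^{O(d)}$ and either finds a kernel of $\mathcal I$ on at most $C\cdot t^2$ variables or certifies that $OPT\ge AVG+t$, under the global cardinality constraint $\sum_{i=1}^n x_i=(1-2p)n$, where $$C=160\,d^2\cdot 30^d\left(\Big(\tfrac{1-p_0}{p_0}\Big)^2+\Big(\tfrac{p_0}{1-p_0}\Big)^2\right)^d\cdot(d!)^{3d^2}\cdot\Big(\tfrac1{2p_0}\Big)^{4d}.$$
   Context: A $d$-ary CSP instance $\mathcal I$ consists of variables $x_1,\dots,x_n\in\{\pm1\}$ and constraints $C_1,\dots,C_m$, where $C_i$ consists of $d$ variables $x_{i_1},\dots,x_{i_d}$ and a predicate $P_i\subseteq\{ -1,1\}^d$; an assignment satisfies $C_i$ iff $(x_{i_1},\dots,x_{i_d})\in P_i$. Let $\mathrm{val}_{\mathcal I}(\alpha)$ be the number of constraints satisfied by $\alpha\in\{\pm1\}^n$. It is given by the multilinear polynomial $f_{\mathcal I}$ of degree at most $d$ obtained from $\sum_{i=1}^m\sum_{\sigma\in P_i}2^{ -d}\prod_{j=1}^d(1+\sigma_jx_{i_j})$. Under the global cardinality constraint, $OPT=\max\{\mathrm{val}_{\mathcal I}(\alpha):\alpha\in\{\pm1\}^n,\ \sum_i\alpha_i=(1-2p)n\}$, and $AVG$ is the expectation of $\mathrm{val}_{\mathcal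 I}(\alpha)$ for $\alpha$ uniformly random among all $\alpha\in\{\pm1\}^n$ with $\sum_i\alpha_i=(1-2p)n$. "Finding a kernel on at most $K$ variables" means outputting a set of at most $K$ of the variables together with a multilinear polynomial of degree at most $d$ that depends only on these variables and that equals $f_{\mathcal I}(\alpha)$ for every $\alpha\in\{\pm1\}^n$ with $\sum_i\alpha_i=(1-2p)n$.
   Formalization: The running time is bounded by a constant times max(n^d, input length)^c rather than n^{O(d)} alone: constraints may repeat and t may be long, so no bound in n alone can hold; for inputs of length n^{O(d)} this is n^{O(d)}. -}

module Defs where

open import Data.Bool.Base using (Bool; true; false; _xor_)
  renaming (if_then_else_ to ifᵇ_then_else_)
open import Data.Fin.Base using (Fin; toℕ)
open import Data.Fin.Subset using (Subset; ⊥; ⁅_⁆; _⊆_; ∣_∣)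
open import Data.Integer.Base using (ℤ; +_; -[1+_])
open import Data.List.Base
  using (List; []; _∷_; [_]; map; concatMap; cartesianProductWith; filter; filterᵇ; foldr; length)
open import Data.List.Extrema.Nat using (max)
open import Data.List.Relation.Unary.All using (All)
open import Data.Nat.Base as ℕ using (ℕ; zero; suc; _!)
open import Data.Nat.Binary.Base using (ℕᵇ; 2[1+_]; 1+[2_]; fromℕ)
open import Data.Product.Base using (_×_; _,_; Σ-syntax; ∃-syntax)
open import Data.Rational.Base
  using (ℚ; 0ℚ; 1ℚ; ½; -_; _+_; _-_; _*_; _/_; 1/_; _≤_; _<_; ≢-nonZero; ↥_; ↧ₙ_; +-*-rawSemiring)
  renaming (∣_∣ to ∣_∣ℚ)
open import Data.Rational.Properties using (_≟_)
open import Data.Sign.Base using (Sign) renaming (+ to ⊕; - to ⊖)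
open import Data.Vec.Base as Vec using (Vec; []; _∷_; lookup; zipWith; _[_]≔_)
open import Relation.Binary.PropositionalEquality.Core using (_≡_)
open import Relation.Nullary.Decidable.Core using (yes; no)

open import Algebra.Definitions.RawSemiring +-*-rawSemiring public using (_^_)

fromNat : ℕ → ℚ
fromNat n = + n / 1

-- Total reciprocal, with 0 ⁻¹ = 0.
infix 9 _⁻¹
_⁻¹ : ℚ → ℚ
q ⁻¹ with q ≟ 0ℚ
... | yes _   = 0ℚ
... | no  q≢0 = 1/_ q {{≢-nonZero q≢0}}

sumℚ : List ℚ → ℚ
sumℚ = foldr _+_ 0ℚ

mean : List ℚ → ℚ
mean xs = sumℚ xs * fromNat (length xs) ⁻¹

------------------------------------------------------------------------
-- Real numbers: Cauchy sequences of rationals, with pointwise arithmetic.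
-- The order is defined on the underlying sequences, so that an arithmetic
-- expression in a real can be compared without repackaging it as a real.

record ℝ : Set where
  field
    seq    : ℕ → ℚ
    cauchy : ∀ ε → 0ℚ < ε →
             ∃[ N ] (∀ i j → N ℕ.≤ i → N ℕ.≤ j → ∣ seq i - seq j ∣ℚ ≤ ε)
open ℝ public

const : ℚ → ℕ → ℚ
const q _ = q

infix 4 _≤ˢ_ _<ˢ_

_≤ˢ_ : (ℕ → ℚ) → (ℕ → ℚ) → Set
x ≤ˢ y = ∀ ε → 0ℚ < ε → ∃[ N ] (∀ i → N ℕ.≤ i → x i ≤ y i + ε)

_<ˢ_ : (ℕ → ℚ) → (ℕ → ℚ) → Set
x <ˢ y = ∃[ ε ] (0ℚ < ε × ∃[ N ] (∀ i → N ℕ.≤ i → x i + ε ≤ y i))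

-- For a real p₀ strictly between 0 and 1 all the denominators below are
-- eventually bounded away from 0 along seq p₀, so λ i → C d (seq p₀ i)
-- represents the real number C(p₀).
C : ℕ → ℚ → ℚ
C d q = fromNat (160 ℕ.* d ℕ.^ 2 ℕ.* 30 ℕ.^ d)
      * (((1ℚ - q) * q ⁻¹) ^ 2 + (q * (1ℚ - q) ⁻¹) ^ 2) ^ d
      * fromNat ((d !) ℕ.^ (3 ℕ.* d ℕ.^ 2))
      * ((fromNat 2 * q) ⁻¹) ^ (4 ℕ.* d)

------------------------------------------------------------------------
-- Constraint satisfaction problems over {±1}

vectors : {A : Set} → List A → ∀ n → List (Vec A n)
vectors as zero    = [ [] ]
vectors as (suc n) = cartesianProductWith _∷_ as (vectors as n)

Assignment : ℕ → Set
Assignment n = Vec Sign n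

signs : List Sign
signs = ⊖ ∷ ⊕ ∷ []

±1 : Sign → ℚ
±1 ⊕ = 1ℚ
±1 ⊖ = - 1ℚ

record Constraint (d n : ℕ) : Set where
  field
    vars      : Vec (Fin n) d
    predicate : Vec Sign d → Bool
open Constraint public

CSP : ℕ → ℕ → Set
CSP d n = List (Constraint d n)

satisfies : ∀ {d n} → Assignment n → Constraint d n → Bool
satisfies α c = predicate c (Vec.map (lookup α) (vars c))

val : ∀ {d n} → CSP d n → Assignment n → ℕ
val I α = length (filterᵇ (satisfies α) I)

total : ∀ {n} → Assignment n → ℚ
total α = sumℚ (map ±1 (Vec.toList α))

InSlice : ∀ {n} → ℚ → Assignment n → Set
InSlice {n} p α = total α ≡ (1ℚ - fromNat 2 * p) * fromNat n

slice : ∀ n → ℚ → List (Assignment n)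
slice n p = filter (λ α → total α ≟ (1ℚ - fromNat 2 * p) * fromNat n) (vectors signs n)

OPT : ∀ {d n} → CSP d n → ℚ → ℕ
OPT {n = n} I p = max 0 (map (val I) (slice n p))

AVG : ∀ {d n} → CSP d n → ℚ → ℚ
AVG {n = n} I p = mean (map (λ α → fromNat (val I α)) (slice n p))

------------------------------------------------------------------------
-- Multilinear polynomials

-- (a , S) is the term a · ∏_{i∈S} xᵢ; a polynomial is the sum of its terms.
Term : ℕ → Set
Term n = ℚ × Subset n

Poly : ℕ → Set
Poly n = List (Term n)

-- Multiplication reduces xᵢ² to 1, hence the symmetric difference.
_⊛_ : ∀ {n} → Poly n → Poly n → Poly n
_⊛_ = cartesianProductWith (λ { (a , S) (b , T) → a * b , zipWith _xor_ S T })

monomial : ∀ {n} → Subset n → Assignment n → ℚ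
monomial S α = Vec.foldr _ _*_ 1ℚ (zipWith (λ b s → ifᵇ b then ±1 s else 1ℚ) S α)

eval : ∀ {n} → Poly n → Assignment n → ℚ
eval f α = sumℚ (map (λ { (a , S) → a * monomial S α }) f)

f[_] : ∀ {d n} → CSP d n → Poly n
f[_] {d} {n} I = concatMap perConstraint I
  where
  1+_·x_ : Sign → Fin n → Poly n
  1+ s ·x i = (1ℚ , ⊥) ∷ (±1 s , ⁅ i ⁆) ∷ []

  perConstraint : Constraint d n → Poly n
  perConstraint c =
    concatMap (λ σ → Vec.foldr _ _⊛_ [ (½ ^ d , ⊥) ] (zipWith 1+_·x_ σ (vars c)))
              (filterᵇ (predicate c) (vectors signs d))

------------------------------------------------------------------------
-- Model of computation: WHILE programs over binary trees. Every evaluated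
-- subexpression is charged the full size of its value, so sharing is not
-- free and the time is polynomially related to Turing machine time.

data Tree : Set where
  leaf : Tree
  node : Tree → Tree → Tree

size : Tree → ℕ
size leaf       = 1
size (node a b) = suc (size a ℕ.+ size b)

data Expr (k : ℕ) : Set where
  var   : Fin k → Expr k
  nil   : Expr k
  cons  : Expr k → Expr k → Expr k
  hd tl : Expr k → Expr k

infixr 5 _⨾_
data Cmd (k : ℕ) : Set where
  skip              : Cmd k
  _:=_              : Fin k → Expr k → Cmd k
  _⨾_               : Cmd k → Cmd k → Cmd k
  if_then_else_     : Fin k → Cmd k → Cmd k → Cmd k
  while_loop_       : Fin k → Cmd k → Cmd k

Store : ℕ → Set
Store = Vec Tree

left right : Tree → Tree
left leaf        = leaf
left (node a _)  = a
right leaf       = leaf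
right (node _ b) = b

⟦_⟧ : ∀ {k} → Expr k → Store k → Tree
⟦ var x ⟧    s = lookup s x
⟦ nil ⟧      s = leaf
⟦ cons a b ⟧ s = node (⟦ a ⟧ s) (⟦ b ⟧ s)
⟦ hd a ⟧     s = left (⟦ a ⟧ s)
⟦ tl a ⟧     s = right (⟦ a ⟧ s)

cost : ∀ {k} → Expr k → Store k → ℕ
cost e@(var _)    s = size (⟦ e ⟧ s)
cost e@nil        s = size (⟦ e ⟧ s)
cost e@(cons a b) s = cost a s ℕ.+ cost b s ℕ.+ size (⟦ e ⟧ s)
cost e@(hd a)     s = cost a s ℕ.+ size (⟦ e ⟧ s)
cost e@(tl a)     s = cost a s ℕ.+ size (⟦ e ⟧ s)

-- c ⊢ s ⇓ s′ [ τ ]: started in store s, command c halts in store s′ after time τ.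
infix 4 _⊢_⇓_[_]
data _⊢_⇓_[_] {k : ℕ} : Cmd k → Store k → Store k → ℕ → Set where
  skip : ∀ {s} → skip ⊢ s ⇓ s [ 1 ]
  assign : ∀ {s x e} → (x := e) ⊢ s ⇓ s [ x ]≔ ⟦ e ⟧ s [ suc (cost e s) ]
  compose : ∀ {c c′ s s′ s″ τ τ′} →
            c ⊢ s ⇓ s′ [ τ ] → c′ ⊢ s′ ⇓ s″ [ τ′ ] → (c ⨾ c′) ⊢ s ⇓ s″ [ τ ℕ.+ τ′ ]
  if-node : ∀ {x c c′ s s′ a b τ} → lookup s x ≡ node a b →
            c ⊢ s ⇓ s′ [ τ ] → (if x then c else c′) ⊢ s ⇓ s′ [ suc τ ]
  if-leaf : ∀ {x c c′ s s′ τ} → lookup s x ≡ leaf →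
            c′ ⊢ s ⇓ s′ [ τ ] → (if x then c else c′) ⊢ s ⇓ s′ [ suc τ ]
  while-node : ∀ {x c s s′ s″ a b τ τ′} → lookup s x ≡ node a b →
               c ⊢ s ⇓ s′ [ τ ] → (while x loop c) ⊢ s′ ⇓ s″ [ τ′ ] →
               (while x loop c) ⊢ s ⇓ s″ [ suc (τ ℕ.+ τ′) ]
  while-leaf : ∀ {x c s} → lookup s x ≡ leaf → (while x loop c) ⊢ s ⇓ s [ 1 ]

record Program : Set where
  field
    extra : ℕ
    body  : Cmd (suc extra)
open Program public

-- The input and the output are held in the first variable; the other
-- variables are initially leaves.
_on_outputs_inTime_ : Program → Tree → Tree → ℕ → Set
A on u outputs v inTime τ =
  Σ[ s ∈ Store (extra A) ] (body A ⊢ u ∷ Vec.replicate _ leaf ⇓ v ∷ s [ τ ])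

------------------------------------------------------------------------
-- Injective encodings of the data as trees; numbers are in (bijective) binary.

codeBool : Bool → Tree
codeBool false = leaf
codeBool true  = node leaf leaf

codeList : {A : Set} → (A → Tree) → List A → Tree
codeList code []       = leaf
codeList code (a ∷ as) = node (code a) (codeList code as)

codeVec : {A : Set} → (A → Tree) → ∀ {n} → Vec A n → Tree
codeVec code v = codeList code (Vec.toList v)

codeSign : Sign → Tree
codeSign ⊖ = leaf
codeSign ⊕ = node leaf leaf

codeℕᵇ : ℕᵇ → Tree
codeℕᵇ ℕᵇ.zero  = leaf
codeℕᵇ 2[1+ b ] = node (codeBool false) (codeℕᵇ b)
codeℕᵇ 1+[2 b ] = node (codeBool true) (codeℕᵇ b)

codeℕ : ℕ → Tree
codeℕ n = codeℕᵇ (fromℕ n)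

codeℤ : ℤ → Tree
codeℤ (+ n)    = node (codeBool false) (codeℕ n)
codeℤ -[1+ n ] = node (codeBool true) (codeℕ n)

codeℚ : ℚ → Tree
codeℚ q = node (codeℤ (↥ q)) (codeℕ (↧ₙ q))

-- A predicate is given by the list of its elements.
codeConstraint : ∀ {d n} → Constraint d n → Tree
codeConstraint {d} c =
  node (codeVec (λ i → codeℕ (toℕ i)) (vars c))
       (codeList (codeVec codeSign) (filterᵇ (predicate c) (vectors signs d)))

codeInput : ∀ {d n} → CSP d n → ℚ → ℚ → Tree
codeInput {n = n} I t p =
  node (node (codeℕ n) (codeList codeConstraint I)) (node (codeℚ t) (codeℚ p))

data Output (n : ℕ) : Set where
  kernel    : Subset n → Poly n → Output n
  OPT≥AVG+t : Output n

codeOutput : ∀ {n} → Output n → Tree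
codeOutput (kernel S g) =
  node (codeVec codeBool S)
       (codeList (λ { (a , T) → node (codeℚ a) (codeVec codeBool T) }) g)
codeOutput OPT≥AVG+t = leaf

------------------------------------------------------------------------

record IsKernel {d n} (I : CSP d n) (p : ℚ) (S : Subset n) (g : Poly n) : Set where
  field
    degree≤d : All (λ { (_ , T) → ∣ T ∣ ℕ.≤ d }) g
    varsIn   : All (λ { (_ , T) → T ⊆ S }) g
    agrees   : ∀ α → InSlice p α → eval g α ≡ eval f[ I ] α

Correct : ∀ {d n} → ℝ → CSP d n → (t p : ℚ) → Output n → Set
Correct {d} p₀ I t p (kernel S g) =
  const (fromNat ∣ S ∣) ≤ˢ (λ i → C d (seq p₀ i) * t ^ 2) × IsKernel I p S g
Correct p₀ I t p OPT≥AVG+t = AVG I p + t ≤ fromNat (OPT I p)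

-- n^{O(d)} time, with an absolute exponent factor c and with K a constant
-- depending on d and p₀. The input has to be read, and a list of constraints
-- may contain repetitions (and t many digits), so the length of the input
-- enters the bound; whenever that length is n^{O(d)}, as it is for distinct
-- constraints and t of n^{O(d)} digits, the bound is n^{O(d)}.
timeBound : (c K d n : ℕ) → Tree → ℕ
timeBound c K d n input = K ℕ.* (n ℕ.^ d ℕ.⊔ size input) ℕ.^ c

module Submission where

-- Let k = pn, and call the assignments with k entries ⊖ the slice. Starting from a
-- point β of the slice, the algorithm visits all points at distance at most d swaps
-- of two variables, and greedily collects a set H of disjoint pairs of variables
-- whose exchange changes the value at a visited point.
--
-- Since the value has degree d, all differences with respect to more than d disjoint
-- swaps vanish. Hence a function of degree d which vanishes at the visited points
-- vanishes on the slice, the value is invariant under swaps outside H, and on the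
-- slice it is the Newton interpolation polynomial of degree d in the variables of H.
-- If H has more members than β has entries ⊕, all variables are used instead.
--
-- If H is large, then OPT is large. For r = d, …, 1 take a maximal family of r-tuples
-- P of disjoint pairs with nonzero difference Δ_P of order r, disjoint from each other
-- and from the earlier tuples. The Δ_P are invariant under the pairs of the other
-- tuples, so under the density ∏ (1 + sgn Δ_P) the mean value exceeds AVG by 2⁻ʳ times
-- the sum of the means of |Δ_P|, and each of these is bounded below by counting the
-- points at which a maximal nonvanishing difference extending P is active. After the
-- level r = 1 every pair of H meets one of the tuples, so |H| ≤ A (OPT − AVG) for a
-- constant A with A² ≤ C. The algorithm certifies if A t ≤ |H|, and otherwise
-- |H| ≤ |H|² ≤ A² t² ≤ C t².
--
-- The algorithm is written in a language of terms over trees which compiles to WHILE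
-- programs; sizes and times of terms are bounded by polynomials, which are computed
-- along the structure of the terms.

-- The levels run downwards in r for the sake of independence. Once every difference of order r + 1
-- avoiding the used variables X vanishes, a difference Δ_P of order r avoiding X does not change
-- under swaps outside P and X. The factors 1 + sgn Δ_P of one level then do not disturb each other,
-- and their gains add up. At r = d this holds from the start, since differences of order d + 1
-- vanish.
--
-- The lower bound for the mean of |Δ_P| rests on integrality: a maximal nonvanishing difference is
-- at least 1 in absolute value wherever its pairs carry opposite signs on the slice, and this is a
-- constant fraction of the slice because k and n - k are both proportional to n.
--
-- All estimates see p₀ only through an integer ρ, with 1 ≤ ρ p₀ ≤ 8/5 as soon as some p is
-- admissible. The upper bound is what keeps A² below C.
--
-- The exponent of the running time must not depend on d, hence `main` is one fixed term, and d, A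
-- and the interpolation coefficients reach it as data.

-- Compiling terms over trees to WHILE programs, with time bounds.

module Machine where
  open import Defs hiding (_^_; eval)
  open import Data.Fin.Base using (Fin; zero; suc)
  open import Data.Bool.Base using (true; T)
  open import Data.Nat.Base
  open import Data.Nat.Properties
  open import Data.Product.Base using (_×_; _,_; Σ-syntax)
  open import Data.Vec.Base as Vec using (Vec; []; _∷_; lookup)
  open import Data.Vec.Properties using (lookup-map)
  open import Function.Base using (_∘_)
  open import Relation.Binary.PropositionalEquality using (_≡_; refl; sym; trans; cong; subst)
  open import Data.Nat.Tactic.RingSolver using (solve-∀)

  infixr 6 _▹_
  -- A call keeps a private context: `at` restricts the environment to the arguments, so a subterm
  -- is verified and timed in its own variables. Neither `at` nor `wk` compiles to code; both only
  -- change the table of depths.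
  data Tm : ℕ → Set where
    ref     : ∀ {k} → Fin k → Tm k
    wk      : ∀ {k} → Tm k → Tm (suc k)
    at      : ∀ {j k} → Vec (Fin k) j → Tm j → Tm k
    lf      : ∀ {k} → Tm k
    _▹_     : ∀ {k} → Tm k → Tm k → Tm k
    fst snd : ∀ {k} → Tm k → Tm k
    ifn     : ∀ {k} → Tm k → Tm k → Tm k → Tm k
    bind    : ∀ {k} → Tm k → Tm (suc k) → Tm k
    loop    : ∀ {k} → Tm k → Tm k → Tm (2 + k) → Tm k

  iteT : Tree → Tree → Tree → Tree
  iteT leaf       a b = b
  iteT (node _ _) a b = a

  fold : (Tree → Tree → Tree) → Tree → Tree → Tree
  fold g a leaf       = a
  fold g a (node x l) = fold g (g a x) l

  run : ∀ {k} → Tm k → Vec Tree k → Tree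
  run (ref i)      ρ       = lookup ρ i
  run (wk e)       (_ ∷ ρ) = run e ρ
  run (at xs e)    ρ       = run e (Vec.map (lookup ρ) xs)
  run lf           ρ       = leaf
  run (a ▹ b)      ρ       = node (run a ρ) (run b ρ)
  run (fst e)      ρ       = left (run e ρ)
  run (snd e)      ρ       = right (run e ρ)
  run (ifn c a b)  ρ       = iteT (run c ρ) (run a ρ) (run b ρ)
  run (bind e b)   ρ       = run b (run e ρ ∷ ρ)
  run (loop l i b) ρ       = fold (λ a x → run b (a ∷ x ∷ ρ)) (run i ρ) (run l ρ)

  -- Register 0 holds a stack; comp loc e pushes the value of e, where loc i is the
  -- depth at which the i-th variable of the environment lies. Register 1 holds the
  -- value tested by a conditional or a loop.
  r0 r1 : Fin 2
  r0 = zero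
  r1 = suc zero

  ⌜_⌝ : Expr 1 → Expr 2
  ⌜ var _ ⌝    = var r0
  ⌜ nil ⌝      = nil
  ⌜ cons a b ⌝ = cons ⌜ a ⌝ ⌜ b ⌝
  ⌜ hd a ⌝     = hd ⌜ a ⌝
  ⌜ tl a ⌝     = tl ⌜ a ⌝

  tls : ℕ → Expr 1
  tls zero    = var zero
  tls (suc j) = tl (tls j)

  pushE : ℕ → Expr 1
  pushE j = cons (hd (tls j)) (tls 0)

  -- Between rounds the stack of a loop starts with the remaining list and the accumulator. `openE`
  -- rearranges these to accumulator, head and tail for the body, and `closeE` restores the first
  -- form with the new accumulator.
  pairE fstE sndE popE openE closeE : Expr 1
  pairE  = cons (cons (hd (tls 1)) (hd (tls 0))) (tls 2)
  fstE   = cons (hd (hd (tls 0))) (tls 1)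
  sndE   = cons (tl (hd (tls 0))) (tls 1)
  popE   = cons (hd (tls 0)) (tls 2)
  openE  = cons (hd (tls 1)) (cons (hd (hd (tls 0))) (cons (tl (hd (tls 0))) (tls 2)))
  closeE = cons (hd (tls 3)) (cons (hd (tls 0)) (tls 4))

  ext : ∀ {k} → (Fin k → ℕ) → Fin (suc k) → ℕ
  ext loc zero    = 0
  ext loc (suc i) = suc (loc i)

  -- Inside a loop the stack carries the accumulator, the current element and the rest of the list.
  -- The rest is invisible to the body, so the outer variables move down by 3 although the body
  -- gains only 2 variables.
  ext₂ : ∀ {k} → (Fin k → ℕ) → Fin (2 + k) → ℕ
  ext₂ loc zero          = 0
  ext₂ loc (suc zero)    = 1
  ext₂ loc (suc (suc i)) = 3 + loc i

  comp : ∀ {k} → (Fin k → ℕ) → Tm k → Cmd 2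
  iter : ∀ {k} → (Fin k → ℕ) → Tm (2 + k) → Cmd 2

  comp loc (ref i)      = r0 := ⌜ pushE (loc i) ⌝
  comp loc (wk e)       = comp (loc ∘ suc) e
  comp loc (at xs e)    = comp (loc ∘ lookup xs) e
  comp loc lf           = r0 := ⌜ cons nil (tls 0) ⌝
  comp loc (a ▹ b)      = comp loc a ⨾ comp (suc ∘ loc) b ⨾ r0 := ⌜ pairE ⌝
  comp loc (fst e)      = comp loc e ⨾ r0 := ⌜ fstE ⌝
  comp loc (snd e)      = comp loc e ⨾ r0 := ⌜ sndE ⌝
  comp loc (ifn c a b)  = comp loc c ⨾ r1 := ⌜ hd (tls 0) ⌝ ⨾ r0 := ⌜ tls 1 ⌝ ⨾
                          (if r1 then comp loc a else comp loc b)
  comp loc (bind e b)   = comp loc e ⨾ comp (ext loc) b ⨾ r0 := ⌜ popE ⌝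
  comp loc (loop l i b) = comp loc i ⨾ comp (suc ∘ loc) l ⨾ r1 := ⌜ hd (tls 0) ⌝ ⨾
                          (while r1 loop iter loc b) ⨾ r0 := ⌜ tls 1 ⌝

  iter loc b = r0 := ⌜ openE ⌝ ⨾ comp (ext₂ loc) b ⨾ r0 := ⌜ closeE ⌝ ⨾ r1 := ⌜ hd (tls 0) ⌝

  rights : ℕ → Tree → Tree
  rights zero    s = s
  rights (suc j) s = right (rights j s)

  rights-node : ∀ j v s → rights (suc j) (node v s) ≡ rights j s
  rights-node zero    v s = refl
  rights-node (suc j) v s = cong right (rights-node j v s)

  -- `depth` bounds the price of an access: a variable at depth j is reached by j tails, each
  -- charged at most the size of the stack.
  record Holds {k} (loc : Fin k → ℕ) (s : Tree) (ρ : Vec Tree k) : Set where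
    constructor holds
    field
      found : ∀ i → left (rights (loc i) s) ≡ lookup ρ i
      depth : ∀ i → loc i ≤ size s
  open Holds

  -- `W` bounds the stack at entry. Register 1 may hold anything before and after, so fragments can
  -- be chained without an invariant for it.
  Exec : ∀ {k} → Tm k → Vec Tree k → (W T : ℕ) → Set
  Exec e ρ W T = ∀ loc s r → Holds loc s ρ → size s ≤ W →
    Σ[ r′ ∈ Tree ] Σ[ τ ∈ ℕ ]
      (τ ≤ T × comp loc e ⊢ s ∷ r ∷ [] ⇓ node (run e ρ) s ∷ r′ ∷ [] [ τ ])

  0<size : ∀ t → 0 < size t
  0<size leaf       = z<s
  0<size (node _ _) = z<s

  size-left : ∀ t → size (left t) ≤ size t
  size-left leaf       = ≤-refl
  size-left (node a b) = ≤-trans (m≤m+n (size a) (size b)) (n≤1+n _)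

  size-right : ∀ t → size (right t) ≤ size t
  size-right leaf       = ≤-refl
  size-right (node a b) = ≤-trans (m≤n+m (size b) (size a)) (n≤1+n _)

  size-iteT : ∀ c a b {B} → size a ≤ B → size b ≤ B → size (iteT c a b) ≤ B
  size-iteT leaf       a b p q = q
  size-iteT (node _ _) a b p q = p

  -- Coefficients of bounds linear in the size of the stack, for the size of the value and for the
  -- cost of an expression.
  weight costW : Expr 1 → ℕ
  weight (var _)    = 1
  weight nil        = 1
  weight (cons a b) = suc (weight a + weight b)
  weight (hd a)     = weight a
  weight (tl a)     = weight a
  costW (var _)    = 1
  costW nil        = 1
  costW (cons a b) = costW a + costW b + suc (weight a + weight b)
  costW (hd a)     = costW a + weight a
  costW (tl a)     = costW a + weight a

  module _ (s r : Tree) (Z : ℕ) (s≤Z : size s ≤ Z) where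
    private
      1≤Z : 1 ≤ Z
      1≤Z = ≤-trans (0<size s) s≤Z

    value-bound : ∀ e → size (⟦ ⌜ e ⌝ ⟧ (s ∷ r ∷ [])) ≤ weight e * Z
    value-bound (var _)    = ≤-trans s≤Z (m≤m+n Z 0)
    value-bound nil        = ≤-trans 1≤Z (m≤m+n Z 0)
    value-bound (cons a b) =
      +-mono-≤ 1≤Z (≤-trans (+-mono-≤ (value-bound a) (value-bound b))
                            (≤-reflexive (sym (*-distribʳ-+ Z (weight a) (weight b)))))
    value-bound (hd a)     = ≤-trans (size-left (⟦ ⌜ a ⌝ ⟧ (s ∷ r ∷ []))) (value-bound a)
    value-bound (tl a)     = ≤-trans (size-right (⟦ ⌜ a ⌝ ⟧ (s ∷ r ∷ []))) (value-bound a)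

    cost-bound : ∀ e → cost ⌜ e ⌝ (s ∷ r ∷ []) ≤ costW e * Z
    cost-bound (var _)    = value-bound (var zero)
    cost-bound nil        = value-bound nil
    cost-bound (cons a b) = ≤-trans
      (+-mono-≤ (+-mono-≤ (cost-bound a) (cost-bound b)) (value-bound (cons a b)))
      (≤-reflexive (sym (trans (*-distribʳ-+ Z (costW a + costW b) _)
                               (cong (_+ suc (weight a + weight b) * Z) (*-distribʳ-+ Z (costW a) (costW b))))))
    cost-bound (hd a)     = ≤-trans (+-mono-≤ (cost-bound a) (value-bound (hd a)))
      (≤-reflexive (sym (*-distribʳ-+ Z (costW a) (weight a))))
    cost-bound (tl a)     = ≤-trans (+-mono-≤ (cost-bound a) (value-bound (tl a)))
      (≤-reflexive (sym (*-distribʳ-+ Z (costW a) (weight a))))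

    assign-bound : ∀ e {c} → suc (costW e) ≤ c → suc (cost ⌜ e ⌝ (s ∷ r ∷ [])) ≤ c * Z
    assign-bound e c≥ = ≤-trans (+-mono-≤ 1≤Z (cost-bound e)) (*-monoˡ-≤ Z c≥)

  ≤-by : ∀ {m n} → (m ≤ᵇ n) ≡ true → m ≤ n
  ≤-by {m} {n} eq = ≤ᵇ⇒≤ m n (subst T (sym eq) _)

  exec-mono : ∀ {k} {e : Tm k} {ρ W W′ T T′} → W′ ≤ W → T ≤ T′ → Exec e ρ W T → Exec e ρ W′ T′
  exec-mono W′≤W T≤T′ E loc s r h s≤ =
    let r′ , τ , τ≤ , D = E loc s r h (≤-trans s≤ W′≤W) in r′ , τ , ≤-trans τ≤ T≤T′ , D

  pushed : ∀ {k} {loc : Fin k → ℕ} {s ρ} v → Holds loc s ρ → Holds (suc ∘ loc) (node v s) ρ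
  pushed {loc = loc} {s} v h = holds
    (λ i → trans (cong left (rights-node (loc i) v s)) (found h i))
    (λ i → s≤s (≤-trans (depth h i) (m≤n+m _ (size v))))

  bound : ∀ {k} {loc : Fin k → ℕ} {s ρ} v → Holds loc s ρ → Holds (ext loc) (node v s) (v ∷ ρ)
  bound {k} {loc} {s} {ρ} v h = holds f dp
    where
    f : ∀ i → left (rights (ext loc i) (node v s)) ≡ lookup (v ∷ ρ) i
    f zero    = refl
    f (suc i) = found (pushed v h) i
    dp : ∀ i → ext loc i ≤ size (node v s)
    dp zero    = z≤n
    dp (suc i) = depth (pushed v h) i

  bound₂ : ∀ {k} {loc : Fin k → ℕ} {s ρ} a x l → Holds loc s ρ →
           Holds (ext₂ loc) (node a (node x (node l s))) (a ∷ x ∷ ρ)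
  bound₂ {k} {loc} {s} {ρ} a x l h = holds f dp
    where
    h₃ = pushed a (pushed x (pushed l h))
    f : ∀ i → left (rights (ext₂ loc i) (node a (node x (node l s)))) ≡ lookup (a ∷ x ∷ ρ) i
    f zero          = refl
    f (suc zero)    = refl
    f (suc (suc i)) = found h₃ i
    dp : ∀ i → ext₂ loc i ≤ size (node a (node x (node l s)))
    dp zero          = z≤n
    dp (suc zero)    = s≤s z≤n
    dp (suc (suc i)) = depth h₃ i

  tls-value : ∀ j s r → ⟦ ⌜ tls j ⌝ ⟧ (s ∷ r ∷ []) ≡ rights j s
  tls-value zero    s r = refl
  tls-value (suc j) s r = cong right (tls-value j s r)

  tls-weight : ∀ j → weight (tls j) ≡ 1
  tls-weight zero    = refl
  tls-weight (suc j) = tls-weight j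

  tls-costW : ∀ j → costW (tls j) ≡ suc j
  tls-costW zero    = refl
  tls-costW (suc j) rewrite tls-costW j | tls-weight j = +-comm (suc j) 1

  exec-ref : ∀ {k} i {ρ : Vec Tree k} {W} → Exec (ref i) ρ W ((W + 7) * W)
  exec-ref {k} i {ρ} {W} loc s r h s≤ = r , _ ,
    assign-bound s r W s≤ (pushE (loc i)) (≤-trans (≤-reflexive eq) (+-monoˡ-≤ 7 (≤-trans (depth h i) s≤))) ,
    subst (λ v → comp loc (ref i) ⊢ s ∷ r ∷ [] ⇓ node v s ∷ r ∷ [] [ _ ])
          (trans (cong left (tls-value (loc i) s r)) (found h i)) assign
    where
    eq : suc (costW (pushE (loc i))) ≡ loc i + 7
    eq rewrite tls-costW (loc i) | tls-weight (loc i) = lem (loc i)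
      where
      lem : ∀ j → suc (suc j + 1 + 1 + 3) ≡ j + 7
      lem = solve-∀

  exec-lf : ∀ {k} {ρ : Vec Tree k} {W} → Exec lf ρ W (7 * W)
  exec-lf {ρ = ρ} {W} loc s r h s≤ = r , _ , assign-bound s r W s≤ (cons nil (tls 0)) {7} (≤-by refl) , assign

  exec-wk : ∀ {k} {e : Tm k} {v ρ W T} → Exec e ρ W T → Exec (wk e) (v ∷ ρ) W T
  exec-wk E loc s r h s≤ = E (loc ∘ suc) s r (holds (found h ∘ suc) (depth h ∘ suc)) s≤

  exec-at : ∀ {j k} (xs : Vec (Fin k) j) {e : Tm j} {ρ W T} →
            Exec e (Vec.map (lookup ρ) xs) W T → Exec (at xs e) ρ W T
  exec-at xs {ρ = ρ} E loc s r h s≤ = E (loc ∘ lookup xs) s r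
    (holds (λ i → trans (found h (lookup xs i)) (sym (lookup-map i (lookup ρ) xs))) (depth h ∘ lookup xs)) s≤

  exec-▹ : ∀ {k} {a b : Tm k} {ρ W Ta Tb} → Exec a ρ W Ta → Exec b ρ (suc (size (run a ρ) + W)) Tb →
           Exec (a ▹ b) ρ W (Ta + (Tb + 20 * (2 + size (run a ρ) + size (run b ρ) + W)))
  exec-▹ {a = a} {b} {ρ} {W} Ea Eb loc s r h s≤ =
    let x  = run a ρ
        y  = run b ρ
        r₁ , τ₁ , τ₁≤ , D₁ = Ea loc s r h s≤
        r₂ , τ₂ , τ₂≤ , D₂ = Eb (suc ∘ loc) (node x s) r₁ (pushed x h) (s≤s (+-monoʳ-≤ (size x) s≤))
        le : size (node y (node x s)) ≤ 2 + size x + size y + W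
        le = ≤-trans (≤-reflexive (lem (size x) (size y) (size s))) (+-monoʳ-≤ (2 + size x + size y) s≤)
    in r₂ , _ , +-mono-≤ τ₁≤ (+-mono-≤ τ₂≤ (assign-bound (node y (node x s)) r₂ _ le pairE {20} (≤-by refl))) ,
       compose D₁ (compose D₂ assign)
    where
    lem : ∀ x y s → suc (y + suc (x + s)) ≡ 2 + x + y + s
    lem = solve-∀

  exec-fst : ∀ {k} {e : Tm k} {ρ W T} → Exec e ρ W T → Exec (fst e) ρ W (T + 20 * suc (size (run e ρ) + W))
  exec-fst {e = e} {ρ} E loc s r h s≤ =
    let r₁ , τ₁ , τ₁≤ , D₁ = E loc s r h s≤
    in r₁ , _ , +-mono-≤ τ₁≤ (assign-bound (node (run e ρ) s) r₁ _ (s≤s (+-monoʳ-≤ (size (run e ρ)) s≤)) fstE {20} (≤-by refl)) ,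
       compose D₁ assign

  exec-snd : ∀ {k} {e : Tm k} {ρ W T} → Exec e ρ W T → Exec (snd e) ρ W (T + 20 * suc (size (run e ρ) + W))
  exec-snd {e = e} {ρ} E loc s r h s≤ =
    let r₁ , τ₁ , τ₁≤ , D₁ = E loc s r h s≤
    in r₁ , _ , +-mono-≤ τ₁≤ (assign-bound (node (run e ρ) s) r₁ _ (s≤s (+-monoʳ-≤ (size (run e ρ)) s≤)) sndE {20} (≤-by refl)) ,
       compose D₁ assign

  exec-bind : ∀ {k} {e : Tm k} {b ρ W Te Tb} → Exec e ρ W Te → Exec b (run e ρ ∷ ρ) (suc (size (run e ρ) + W)) Tb →
              Exec (bind e b) ρ W (Te + (Tb + 20 * (2 + size (run e ρ) + size (run b (run e ρ ∷ ρ)) + W)))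
  exec-bind {e = e} {b} {ρ} {W} Ee Eb loc s r h s≤ =
    let x  = run e ρ
        y  = run b (x ∷ ρ)
        r₁ , τ₁ , τ₁≤ , D₁ = Ee loc s r h s≤
        r₂ , τ₂ , τ₂≤ , D₂ = Eb (ext loc) (node x s) r₁ (bound x h) (s≤s (+-monoʳ-≤ (size x) s≤))
        le : size (node y (node x s)) ≤ 2 + size x + size y + W
        le = ≤-trans (≤-reflexive (lem (size x) (size y) (size s))) (+-monoʳ-≤ (2 + size x + size y) s≤)
    in r₂ , _ , +-mono-≤ τ₁≤ (+-mono-≤ τ₂≤ (assign-bound (node y (node x s)) r₂ _ le popE {20} (≤-by refl))) ,
       compose D₁ (compose D₂ assign)
    where
    lem : ∀ x y s → suc (y + suc (x + s)) ≡ 2 + x + y + s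
    lem = solve-∀

  branch-time : ∀ {W s} v r {τ₁ τ₂ Tc T′} → size s ≤ W → τ₁ ≤ Tc → τ₂ ≤ T′ →
    τ₁ + (suc (cost {2} ⌜ hd (tls 0) ⌝ (node v s ∷ r ∷ [])) +
         (suc (cost {2} ⌜ tls 1 ⌝ (node v s ∷ v ∷ [])) + τ₂))
    ≤ Tc + 20 * suc (size v + W) + T′
  branch-time {W} {s} v r {Tc = Tc} {T′} s≤ p q =
    ≤-trans (+-mono-≤ p (+-mono-≤ (assign-bound (node v s) r Z zle (hd (tls 0)) {4} (≤-by refl))
                        (+-mono-≤ (assign-bound (node v s) v Z zle (tls 1) {4} (≤-by refl)) q)))
    (≤-trans (≤-reflexive (lem Tc Z T′)) (+-monoˡ-≤ T′ (+-monoʳ-≤ Tc (*-monoˡ-≤ Z (≤-by {8} {20} refl)))))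
    where
    Z = suc (size v + W)
    zle : size (node v s) ≤ Z
    zle = s≤s (+-monoʳ-≤ (size v) s≤)
    lem : ∀ t z u → t + (4 * z + (4 * z + u)) ≡ t + 8 * z + u
    lem = solve-∀

  exec-ifn : ∀ {k} {c a b : Tm k} {ρ W Tc Ta Tb} → Exec c ρ W Tc → Exec a ρ W Ta → Exec b ρ W Tb →
             Exec (ifn c a b) ρ W (Tc + 20 * suc (size (run c ρ) + W) + suc (Ta + Tb))
  exec-ifn {c = c} {a} {b} {ρ} {W} {Tc} {Ta} {Tb} Ec Ea Eb loc s r h s≤
    with run c ρ | Ec loc s r h s≤
  ... | leaf | r₁ , τ₁ , τ₁≤ , D₁ =
    let r₂ , τ₂ , τ₂≤ , D₂ = Eb loc s leaf h s≤
    in r₂ , _ , branch-time leaf r₁ s≤ τ₁≤ (s≤s (≤-trans τ₂≤ (m≤n+m Tb Ta))) ,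
       compose D₁ (compose assign (compose assign (if-leaf refl D₂)))
  ... | v@(node _ _) | r₁ , τ₁ , τ₁≤ , D₁ =
    let r₂ , τ₂ , τ₂≤ , D₂ = Ea loc s v h s≤
    in r₂ , _ , branch-time v r₁ s≤ τ₁≤ (s≤s (≤-trans τ₂≤ (m≤m+n Ta Tb))) ,
       compose D₁ (compose assign (compose assign (if-node refl D₂)))

  spine : Tree → ℕ
  spine leaf       = 0
  spine (node _ l) = suc (spine l)

  spine≤size : ∀ t → spine t ≤ size t
  spine≤size leaf       = z≤n
  spine≤size (node x l) = s≤s (≤-trans (spine≤size l) (m≤n+m _ (size x)))

  -- A run of a loop in which every accumulator that actually occurs has size at most `B`. No bound
  -- for arbitrary accumulators is demanded of the body, so facts about the actual values can be
  -- used.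
  data Loops {k} (b : Tm (2 + k)) (ρ : Vec Tree k) (W B Tb : ℕ) : Tree → Tree → Set where
    done : ∀ {a} → size a ≤ B → Loops b ρ W B Tb a leaf
    next : ∀ {a x l} → size a ≤ B → Exec b (a ∷ x ∷ ρ) W Tb →
           Loops b ρ W B Tb (run b (a ∷ x ∷ ρ)) l → Loops b ρ W B Tb a (node x l)

  loops-size : ∀ {k} {b : Tm (2 + k)} {ρ W B Tb a l} → Loops b ρ W B Tb a l → size a ≤ B
  loops-size (done p)     = p
  loops-size (next p _ _) = p

  loops-result : ∀ {k} {b : Tm (2 + k)} {ρ W B Tb a l} → Loops b ρ W B Tb a l →
                 size (fold (λ a x → run b (a ∷ x ∷ ρ)) a l) ≤ B
  loops-result (done p)     = p
  loops-result (next _ _ L) = loops-result L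

  exec-while : ∀ {k} {b : Tm (2 + k)} {ρ W B L Tb a l} → Loops b ρ (2 + (B + L + W)) B Tb a l → size l ≤ L →
    ∀ loc s → Holds loc s ρ → size s ≤ W →
    Σ[ τ ∈ ℕ ] (τ ≤ spine l * (Tb + 60 * (3 + (B + B + L + W))) + 1
      × (while r1 loop iter loc b) ⊢ node l (node a s) ∷ l ∷ []
          ⇓ node leaf (node (fold (λ a x → run b (a ∷ x ∷ ρ)) a l) s) ∷ leaf ∷ [] [ τ ])
  exec-while (done _) l≤ loc s h s≤ = 1 , ≤-refl , while-leaf refl
  exec-while {b = b} {ρ} {W} {B} {L} {Tb} {a} {node x l} (next a≤ Eb Ls) l≤ loc s h s≤ =
    let v = run b (a ∷ x ∷ ρ)
        r₁ , τ₁ , τ₁≤ , D₁ = Eb (ext₂ loc) (node a (node x (node l s))) (node x l) (bound₂ a x l h) le₁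
        τ₂ , τ₂≤ , D₂ = exec-while Ls (≤-trans (≤-trans (m≤n+m (size l) (size x)) (n≤1+n _)) l≤) loc s h s≤
    in _ ,
       -- The coefficients 28, 24 and 4 belong to `openE`, `closeE` and the test; together with the
       -- step of the loop itself they stay below 60.
       ≤-trans (s≤s (+-mono-≤ (+-mono-≤ (assign-bound (node (node x l) (node a s)) (node x l) Z (le₂) openE {28} (≤-by refl))
         (+-mono-≤ τ₁≤ (+-mono-≤ (assign-bound (node v (node a (node x (node l s)))) r₁ Z (le₃ v (loops-size Ls)) closeE {24} (≤-by refl))
                                 (assign-bound (node l (node v s)) r₁ Z (le₄ v (loops-size Ls)) (hd (tls 0)) {4} (≤-by refl))))) τ₂≤))
         (fin (spine l)) ,
       while-node refl (compose assign (compose D₁ (compose assign assign))) D₂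
    where
    Z = 3 + (B + B + L + W)
    xl : size x + size l ≤ L
    xl = ≤-trans (n≤1+n _) l≤
    lem₁ : ∀ a x l s → suc (a + suc (x + suc (l + s))) ≡ 2 + (a + suc (x + l) + s)
    lem₁ = solve-∀
    le₁ : size (node a (node x (node l s))) ≤ 2 + (B + L + W)
    le₁ = ≤-trans (≤-reflexive (lem₁ (size a) (size x) (size l) (size s)))
                  (s≤s (s≤s (+-mono-≤ (+-mono-≤ a≤ l≤) s≤)))
    le₂ : size (node (node x l) (node a s)) ≤ Z
    le₂ = ≤-trans (≤-reflexive (lem (size a) (size (node x l)) (size s))) (s≤s (s≤s (≤-trans
            (+-mono-≤ (+-mono-≤ a≤ l≤) s≤) (≤-trans (+-monoˡ-≤ W (+-monoˡ-≤ L (m≤n+m B B))) (n≤1+n _)))))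
      where
      lem : ∀ a l s → suc (l + suc (a + s)) ≡ 2 + (a + l + s)
      lem = solve-∀
    le₃ : ∀ v → size v ≤ B → size (node v (node a (node x (node l s)))) ≤ Z
    le₃ v v≤ = ≤-trans (s≤s (+-mono-≤ v≤ le₁)) (≤-reflexive (lem B L W))
      where
      lem : ∀ b l w → suc (b + (2 + (b + l + w))) ≡ 3 + (b + b + l + w)
      lem = solve-∀
    le₄ : ∀ v → size v ≤ B → size (node l (node v s)) ≤ Z
    le₄ v v≤ = ≤-trans (s≤s (+-mono-≤ (≤-trans (m≤n+m (size l) (size x)) xl) (s≤s (+-mono-≤ v≤ s≤))))
       (≤-trans (≤-reflexive (lem B L W)) (s≤s (s≤s (≤-trans (+-monoˡ-≤ W (+-monoˡ-≤ L (m≤n+m B B))) (n≤1+n _)))))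
      where
      lem : ∀ b l w → suc (l + suc (b + w)) ≡ 2 + (b + l + w)
      lem = solve-∀
    fin : ∀ m → suc (28 * Z + (Tb + (24 * Z + 4 * Z)) + (m * (Tb + 60 * Z) + 1)) ≤ suc m * (Tb + 60 * Z) + 1
    fin m = ≤-trans (s≤s (≤-reflexive (lem Z Tb (m * (Tb + 60 * Z)))))
            (≤-trans (+-monoˡ-≤ (Tb + 56 * Z + m * (Tb + 60 * Z) + 1) (s≤s (z≤n {3 * Z + 2 + (B + B + L + W)})))
                     (≤-reflexive (lem₂ (B + B + L + W) Tb (m * (Tb + 60 * Z)))))
      where
      lem : ∀ z t u → 28 * z + (t + (24 * z + 4 * z)) + (u + 1) ≡ t + 56 * z + u + 1
      lem = solve-∀
      lem₂ : ∀ y t u → suc (3 * (3 + y) + 2 + y) + (t + 56 * (3 + y) + u + 1) ≡ t + 60 * (3 + y) + u + 1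
      lem₂ = solve-∀

  exec-loop : ∀ {k} {l i : Tm k} {b ρ W Ti Tl B Tb} → Exec i ρ W Ti → Exec l ρ (suc (size (run i ρ) + W)) Tl →
    Loops b ρ (2 + (B + size (run l ρ) + W)) B Tb (run i ρ) (run l ρ) →
    Exec (loop l i b) ρ W
      (Ti + (Tl + (size (run l ρ) * (Tb + 60 * (3 + (B + B + size (run l ρ) + W))) + 20 * (3 + (B + B + size (run l ρ) + W)))))
  exec-loop {l = l} {i} {b} {ρ} {W} {Ti} {Tl} {B} {Tb} Ei El Ls loc s r h s≤ =
    let a = run i ρ
        xs = run l ρ
        r₁ , τ₁ , τ₁≤ , D₁ = Ei loc s r h s≤
        r₂ , τ₂ , τ₂≤ , D₂ = El (suc ∘ loc) (node a s) r₁ (pushed a h) (s≤s (+-monoʳ-≤ (size a) s≤))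
        τ₃ , τ₃≤ , D₃ = exec-while Ls ≤-refl loc s h s≤
        f = fold (λ a x → run b (a ∷ x ∷ ρ)) a xs
    in leaf , _ ,
       +-mono-≤ τ₁≤ (+-mono-≤ τ₂≤ (≤-trans
         (+-mono-≤ (assign-bound (node xs (node a s)) r₂ Z (le (loops-size Ls)) (hd (tls 0)) {4} (≤-by refl))
         (+-mono-≤ τ₃≤ (assign-bound (node leaf (node f s)) leaf Z (le′ (loops-result Ls)) (tls 1) {4} (≤-by refl))))
         (fin (≤-trans (*-monoˡ-≤ (Tb + 60 * Z) (spine≤size xs)) ≤-refl)))) ,
       compose D₁ (compose D₂ (compose assign (compose D₃ assign)))
    where
    Z = 3 + (B + B + size (run l ρ) + W)
    lem : ∀ b l w → suc (l + suc (b + w)) ≡ 2 + (b + l + w)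
    lem = solve-∀
    le : ∀ {a} → size a ≤ B → size (node (run l ρ) (node a s)) ≤ Z
    le a≤ = ≤-trans (s≤s (+-monoʳ-≤ (size (run l ρ)) (s≤s (+-mono-≤ a≤ s≤))))
       (≤-trans (≤-reflexive (lem B (size (run l ρ)) W)) (s≤s (s≤s (≤-trans (+-monoˡ-≤ W (+-monoˡ-≤ (size (run l ρ)) (m≤n+m B B))) (n≤1+n _)))))
    le′ : ∀ {f} → size f ≤ B → size (node leaf (node f s)) ≤ Z
    le′ f≤ = s≤s (s≤s (s≤s (≤-trans (+-mono-≤ f≤ s≤) (+-monoˡ-≤ W (≤-trans (m≤m+n B B) (m≤m+n (B + B) _))))))
    fin : ∀ {m} → m ≤ size (run l ρ) * (Tb + 60 * Z) → 4 * Z + ((m + 1) + 4 * Z) ≤ size (run l ρ) * (Tb + 60 * Z) + 20 * Z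
    fin {m} m≤ = ≤-trans (≤-reflexive (lem₂ Z m)) (+-mono-≤ m≤ (≤-trans (+-monoʳ-≤ (8 * Z) {1} {Z} (s≤s z≤n))
        (≤-trans (≤-reflexive (+-comm (8 * Z) Z)) (*-monoˡ-≤ Z (≤-by {9} {20} refl)))))
      where
      lem₂ : ∀ z m → 4 * z + ((m + 1) + 4 * z) ≡ m + (8 * z + 1)
      lem₂ = solve-∀

-- Polynomial bounds for sizes and times, computed from the term.

module Growth where
  open Machine
  open import Defs hiding (_^_; eval)
  open import Data.Fin.Base using (Fin; zero; suc)
  open import Data.Maybe.Base using (Maybe; just; nothing; _>>=_)
  open import Data.Nat.Base
  open import Data.Nat.Properties
  open import Data.Product.Base using (_,_; Σ-syntax)
  open import Data.Vec.Base as Vec using (Vec; _∷_; lookup; replicate)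
  open import Data.Vec.Properties using (lookup-map; lookup-replicate)
  open import Data.Unit.Base using (⊤; tt)
  open import Relation.Binary.PropositionalEquality using (_≡_; refl; sym; trans; cong; subst; subst₂)
  open import Data.Nat.Tactic.RingSolver using (solve-∀)

  infixl 6 _⊞_
  infixl 7 _⊠_
  infixl 8 _⊙_
  data Pol : Set where
    X           : Pol
    con         : ℕ → Pol
    _⊞_ _⊠_ _⊙_ : Pol → Pol → Pol

  ⟪_⟫ : Pol → ℕ → ℕ
  ⟪ X ⟫     n = n
  ⟪ con c ⟫ n = c
  ⟪ P ⊞ Q ⟫ n = ⟪ P ⟫ n + ⟪ Q ⟫ n
  ⟪ P ⊠ Q ⟫ n = ⟪ P ⟫ n * ⟪ Q ⟫ n
  ⟪ P ⊙ Q ⟫ n = ⟪ P ⟫ (⟪ Q ⟫ n)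

  ⟪⟫-mono : ∀ P {m n} → m ≤ n → ⟪ P ⟫ m ≤ ⟪ P ⟫ n
  ⟪⟫-mono X       p = p
  ⟪⟫-mono (con c) p = ≤-refl
  ⟪⟫-mono (P ⊞ Q) p = +-mono-≤ (⟪⟫-mono P p) (⟪⟫-mono Q p)
  ⟪⟫-mono (P ⊠ Q) p = *-mono-≤ (⟪⟫-mono P p) (⟪⟫-mono Q p)
  ⟪⟫-mono (P ⊙ Q) p = ⟪⟫-mono P (⟪⟫-mono Q p)

  -- Only some monomial bound for arguments at least 1 is wanted, so degrees are added even at a
  -- sum, which avoids maxima.
  degree coeff : Pol → ℕ
  degree X       = 1
  degree (con c) = 0
  degree (P ⊞ Q) = degree P + degree Q
  degree (P ⊠ Q) = degree P + degree Q
  degree (P ⊙ Q) = degree Q * degree P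
  coeff X       = 1
  coeff (con c) = c
  coeff (P ⊞ Q) = coeff P + coeff Q
  coeff (P ⊠ Q) = coeff P * coeff Q
  -- `suc` keeps the argument handed to `P` at least 1 even if `coeff Q` is 0, as the bound for `P`
  -- requires.
  coeff (P ⊙ Q) = coeff P * suc (coeff Q) ^ degree P

  1≤^ : ∀ n e → 1 ≤ n → 1 ≤ n ^ e
  1≤^ n zero    p = ≤-refl
  1≤^ n (suc e) p = *-mono-≤ p (1≤^ n e p)

  ^-distribʳ-* : ∀ m n e → (m * n) ^ e ≡ m ^ e * n ^ e
  ^-distribʳ-* m n zero    = refl
  ^-distribʳ-* m n (suc e) = trans (cong (m * n *_) (^-distribʳ-* m n e)) (lem m n (m ^ e) (n ^ e))
    where
    lem : ∀ m n x y → m * n * (x * y) ≡ m * x * (n * y)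
    lem = solve-∀

  ⟪⟫-bound : ∀ P n → 1 ≤ n → ⟪ P ⟫ n ≤ coeff P * n ^ degree P
  ⟪⟫-bound X n 1≤n = ≤-reflexive (lem n)
    where
    lem : ∀ n → n ≡ 1 * (n * 1)
    lem = solve-∀
  ⟪⟫-bound (con c) n 1≤n = ≤-reflexive (sym (*-identityʳ c))
  ⟪⟫-bound (P ⊞ Q) n 1≤n = ≤-trans (+-mono-≤
    (≤-trans (⟪⟫-bound P n 1≤n) (*-monoʳ-≤ (coeff P) (≤-trans (≤-reflexive (sym (*-identityʳ (n ^ degree P)))) (*-monoʳ-≤ (n ^ degree P) (1≤^ n (degree Q) 1≤n)))))
    (≤-trans (⟪⟫-bound Q n 1≤n) (*-monoʳ-≤ (coeff Q) (≤-trans (≤-reflexive (sym (*-identityˡ (n ^ degree Q)))) (*-monoˡ-≤ (n ^ degree Q) (1≤^ n (degree P) 1≤n))))))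
    (≤-reflexive (trans (sym (*-distribʳ-+ _ (coeff P) (coeff Q))) (cong ((coeff P + coeff Q) *_) (sym (^-distribˡ-+-* n (degree P) (degree Q))))))
  ⟪⟫-bound (P ⊠ Q) n 1≤n = ≤-trans (*-mono-≤ (⟪⟫-bound P n 1≤n) (⟪⟫-bound Q n 1≤n))
    (≤-reflexive (trans (lem (coeff P) (coeff Q) (n ^ degree P) (n ^ degree Q)) (cong (coeff P * coeff Q *_) (sym (^-distribˡ-+-* n (degree P) (degree Q))))))
    where
    lem : ∀ a b x y → a * x * (b * y) ≡ a * b * (x * y)
    lem = solve-∀
  ⟪⟫-bound (P ⊙ Q) n 1≤n = ≤-trans (⟪⟫-mono P (≤-trans (⟪⟫-bound Q n 1≤n) (*-monoˡ-≤ (n ^ degree Q) (n≤1+n (coeff Q)))))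
    (≤-trans (⟪⟫-bound P _ (*-mono-≤ (s≤s (z≤n {coeff Q})) (1≤^ n (degree Q) 1≤n)))
    (≤-reflexive (trans (cong (coeff P *_) (trans (^-distribʳ-* (suc (coeff Q)) (n ^ degree Q) (degree P)) (cong (suc (coeff Q) ^ degree P *_) (^-*-assoc n (degree Q) (degree P)))))
                        (sym (*-assoc (coeff P) _ _)))))

  data AccB (g : Tree → Tree → Tree) (B : ℕ) : Tree → Tree → Set where
    done : ∀ {a} → size a ≤ B → AccB g B a leaf
    next : ∀ {a x l} → size a ≤ B → AccB g B (g a x) l → AccB g B a (node x l)

  acc-result : ∀ {g B a l} → AccB g B a l → size (fold g a l) ≤ B
  acc-result (done p)   = p
  acc-result (next _ A) = acc-result A

  acc-add : ∀ {g q L B} a l → (∀ a x → size x ≤ L → size (g a x) ≤ size a + q) → size l ≤ L →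
            size a + size l * q ≤ B → AccB g B a l
  acc-add a leaf h l≤ B≥ = done (≤-trans (m≤m+n _ _) B≥)
  acc-add {g} {q} a (node x l) h l≤ B≥ = next (≤-trans (m≤m+n _ _) B≥)
    (acc-add (g a x) l h (≤-trans (m≤n+m _ (size x)) xl)
      (≤-trans (+-monoˡ-≤ (size l * q) (h a x (≤-trans (m≤m+n _ (size l)) xl)))
      (≤-trans (≤-reflexive (+-assoc (size a) q (size l * q))) (≤-trans (+-monoʳ-≤ (size a) (*-monoˡ-≤ q (s≤s (m≤n+m (size l) (size x))))) B≥))))
    where
    xl = ≤-trans (n≤1+n _) l≤

  -- Size analysis, relative to a number a (the size of an accumulator). A term is
  -- flat if its size is polynomially bounded independently of a, and linear if its
  -- size is at most a plus such a bound. A loop whose body is flat or linear in the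
  -- accumulator has polynomially bounded accumulators.
  data Mark : Set where
    flat lin none : Mark

  _≤[_]_+_ : ℕ → Mark → ℕ → ℕ → Set
  m ≤[ flat ] a + V = m ≤ V
  m ≤[ lin ]  a + V = m ≤ a + V
  m ≤[ none ] a + V = ⊤

  ≤[]-mono : ∀ μ {m a V V′} → V ≤ V′ → m ≤[ μ ] a + V → m ≤[ μ ] a + V′
  ≤[]-mono flat V≤ p = ≤-trans p V≤
  ≤[]-mono lin  V≤ p = ≤-trans p (+-monoʳ-≤ _ V≤)
  ≤[]-mono none V≤ p = tt

  record Bds {k} (M : Vec Mark k) (a V : ℕ) (ρ : Vec Tree k) : Set where
    constructor bds
    field at-most : ∀ i → size (lookup ρ i) ≤[ lookup M i ] a + V
  open Bds public

  bds-mono : ∀ {k} {M : Vec Mark k} {a V V′ ρ} → V ≤ V′ → Bds M a V ρ → Bds M a V′ ρ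
  bds-mono {M = M} V≤ B = bds λ i → ≤[]-mono (lookup M i) V≤ (at-most B i)

  bds-∷ : ∀ {k} {M : Vec Mark k} {μ a V ρ t} → size t ≤[ μ ] a + V → Bds M a V ρ → Bds (μ ∷ M) a V (t ∷ ρ)
  bds-∷ t≤ B = bds λ { zero → t≤ ; (suc i) → at-most B i }

  bds-tail : ∀ {k} {μ} {M : Vec Mark k} {a V ρ t} → Bds (μ ∷ M) a V (t ∷ ρ) → Bds M a V ρ
  bds-tail B = bds λ i → at-most B (suc i)

  bds-map : ∀ {j k} (xs : Vec (Fin k) j) {M a V ρ} → Bds M a V ρ →
            Bds (Vec.map (lookup M) xs) a V (Vec.map (lookup ρ) xs)
  bds-map xs {M} {a} {V} {ρ} B = bds λ i → subst₂ (λ t μ → size t ≤[ μ ] a + V)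
    (sym (lookup-map i (lookup ρ) xs)) (sym (lookup-map i (lookup M) xs)) (at-most B (lookup xs i))

  -- The body of a nested loop is measured against its own accumulator. A bound relative to the
  -- accumulator of the enclosing loop says nothing about that one, so a linear mark is given up.
  outer : Mark → Mark
  outer flat = flat
  outer lin  = none
  outer none = none

  bds-outer : ∀ {k} {M : Vec Mark k} {a a′ V ρ} → Bds M a V ρ → Bds (Vec.map outer M) a′ V ρ
  bds-outer {M = M} B = bds λ i → subst (λ μ → _ ≤[ μ ] _ + _) (sym (lookup-map i outer M)) (h (lookup M i) (at-most B i))
    where
    h : ∀ μ {m a a′ V} → m ≤[ μ ] a + V → m ≤[ outer μ ] a′ + V
    h flat p = p
    h lin  p = tt
    h none p = tt

  Sized : ∀ {k} → Vec Mark k → Mark → Tm k → Set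
  Sized M μ e = Σ[ P ∈ Pol ] (∀ a V ρ → Bds M a V ρ → size (run e ρ) ≤[ μ ] a + ⟪ P ⟫ V)

  Class : ∀ {k} → Vec Mark k → Tm k → Set
  Class M e = Σ[ μ ∈ Mark ] Sized M μ e

  unknown : ∀ {k} {M : Vec Mark k} {e} → Class M e
  unknown = none , X , λ _ _ _ _ → tt

  join : Mark → Mark → Mark
  join flat flat = flat
  join flat lin  = lin
  join lin  flat = lin
  join lin  lin  = lin
  join _    _    = none

  -- Two linear components could double the accumulator in every round, which is exponential growth,
  -- so their pair is `none`. A conditional keeps just one of its branches, which is why `join` of
  -- two linear marks stays linear.
  node-mark : Mark → Mark → Mark
  node-mark flat flat = flat
  node-mark flat lin  = lin
  node-mark lin  flat = lin
  node-mark _    _    = none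

  ≤[]-node : ∀ μ ν {m n a V W} → m ≤[ μ ] a + V → n ≤[ ν ] a + W → suc (m + n) ≤[ node-mark μ ν ] a + suc (V + W)
  ≤[]-node flat flat p q = s≤s (+-mono-≤ p q)
  ≤[]-node flat lin {a = a} {V} {W} p q = ≤-trans (s≤s (+-mono-≤ p q)) (≤-reflexive (lem V a W))
    where
    lem : ∀ v a w → suc (v + (a + w)) ≡ a + suc (v + w)
    lem = solve-∀
  ≤[]-node lin flat {a = a} {V} {W} p q = ≤-trans (s≤s (+-mono-≤ p q)) (≤-reflexive (lem V a W))
    where
    lem : ∀ v a w → suc (a + v + w) ≡ a + suc (v + w)
    lem = solve-∀
  ≤[]-node flat none p q = tt
  ≤[]-node lin lin p q = tt
  ≤[]-node lin none p q = tt
  ≤[]-node none ν p q = tt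

  ≤[]-ite : ∀ μ ν {t x y a V W} → size x ≤[ μ ] a + V → size y ≤[ ν ] a + W → size (iteT t x y) ≤[ join μ ν ] a + (V + W)
  ≤[]-ite flat flat {t} {x} {y} p q = size-iteT t x y (≤-trans p (m≤m+n _ _)) (≤-trans q (m≤n+m _ _))
  ≤[]-ite flat lin {t} {x} {y} {a} p q = size-iteT t x y (≤-trans p (≤-trans (m≤m+n _ _) (m≤n+m _ a))) (≤-trans q (+-monoʳ-≤ a (m≤n+m _ _)))
  ≤[]-ite lin flat {t} {x} {y} {a} p q = size-iteT t x y (≤-trans p (+-monoʳ-≤ a (m≤m+n _ _))) (≤-trans q (≤-trans (m≤n+m _ _) (m≤n+m _ a)))
  ≤[]-ite lin lin {t} {x} {y} {a} p q = size-iteT t x y (≤-trans p (+-monoʳ-≤ a (m≤m+n _ _))) (≤-trans q (+-monoʳ-≤ a (m≤n+m _ _)))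
  ≤[]-ite flat none p q = tt
  ≤[]-ite lin none p q = tt
  ≤[]-ite none ν p q = tt

  ≤[]-≤ : ∀ μ {m n a V} → m ≤ n → n ≤[ μ ] a + V → m ≤[ μ ] a + V
  ≤[]-≤ flat m≤ p = ≤-trans m≤ p
  ≤[]-≤ lin  m≤ p = ≤-trans m≤ p
  ≤[]-≤ none m≤ p = tt

  inner : ∀ {k} → Vec Mark k → Vec Mark (2 + k)
  inner M = lin ∷ flat ∷ M

  BodyOK : ∀ {k} → Vec Mark k → Tm (2 + k) → Set
  BodyOK M b = Σ[ Q ∈ Pol ] (∀ V ρ a x → (∀ {a′} → Bds M a′ V ρ) → size x ≤ V →
                               size (run b (a ∷ x ∷ ρ)) ≤ size a + ⟪ Q ⟫ V)

  bodyOK : ∀ {k} {M : Vec Mark k} {b} → Class (inner M) b → Maybe (BodyOK M b)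
  bodyOK (flat , Q , q) = just (Q , λ V ρ a x B x≤ → ≤-trans (q (size a) V (a ∷ x ∷ ρ) (bds-∷ (m≤m+n _ V) (bds-∷ x≤ B))) (m≤n+m _ (size a)))
  bodyOK (lin , Q , q)  = just (Q , λ V ρ a x B x≤ → q (size a) V (a ∷ x ∷ ρ) (bds-∷ (m≤m+n _ V) (bds-∷ x≤ B)))
  bodyOK (none , _)     = nothing

  accs : ∀ {k} {M : Vec Mark k} {b} ((Q , _) : BodyOK M b) {V ρ L} a l → (∀ {a′} → Bds M a′ V ρ) → size l ≤ L →
         AccB (λ a x → run b (a ∷ x ∷ ρ)) (size a + L * ⟪ Q ⟫ (V + L)) a l
  accs {M = M} (Q , q) {V} {ρ} {L} a l B l≤ = acc-add {L = L} a l
    (λ a x x≤ → q (V + L) ρ a x (bds-mono (m≤m+n V L) B) (≤-trans x≤ (m≤n+m L V))) l≤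
    (+-monoʳ-≤ (size a) (*-monoˡ-≤ _ l≤))

  classify : ∀ {k} (M : Vec Mark k) (e : Tm k) → Class M e
  class-loop : ∀ {k} {M : Vec Mark k} {l i b} → Class M l → Class M i → Maybe (BodyOK (Vec.map outer M) b) → Class M (loop l i b)

  classify M (ref i) = lookup M i , X , λ a V ρ B → at-most B i
  classify (m ∷ M) (wk e) = let μ , P , p = classify M e in μ , P , λ { a V (t ∷ ρ) B → p a V ρ (bds-tail B) }
  classify M (at xs e) = let μ , P , p = classify (Vec.map (lookup M) xs) e in
    μ , P , λ a V ρ B → p a V (Vec.map (lookup ρ) xs) (bds-map xs B)
  classify M lf = flat , con 1 , λ a V ρ B → ≤-refl
  classify M (a ▹ b) = let μ , P , p = classify M a
                           ν , Q , q = classify M b in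
    node-mark μ ν , con 1 ⊞ (P ⊞ Q) , λ c V ρ B → ≤[]-node μ ν (p c V ρ B) (q c V ρ B)
  classify M (fst e) = let μ , P , p = classify M e in
    μ , P , λ a V ρ B → ≤[]-≤ μ (size-left (run e ρ)) (p a V ρ B)
  classify M (snd e) = let μ , P , p = classify M e in
    μ , P , λ a V ρ B → ≤[]-≤ μ (size-right (run e ρ)) (p a V ρ B)
  classify M (ifn c a b) = let μ , P , p = classify M a
                               ν , Q , q = classify M b in
    join μ ν , P ⊞ Q , λ c′ V ρ B → ≤[]-ite μ ν {run c ρ} {run a ρ} {run b ρ} (p c′ V ρ B) (q c′ V ρ B)
  classify M (bind e b) = let μ , P , p = classify M e
                              ν , Q , q = classify (μ ∷ M) b in
    ν , Q ⊙ (X ⊞ P) , λ a V ρ B → q a (V + ⟪ P ⟫ V) (run e ρ ∷ ρ)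
      (bds-∷ (≤[]-mono μ (m≤n+m _ V) (p a V ρ B)) (bds-mono (m≤m+n V _) B))
  classify M (loop l i b) = class-loop {l = l} {i} {b} (classify M l) (classify M i) (bodyOK {b = b} (classify (inner (Vec.map outer M)) b))

  class-loop {l = l} {i} {b} (flat , L , pl) (flat , I , pi) (just ok@(Q , _)) = flat , I ⊞ L ⊠ (Q ⊙ (X ⊞ L)) , λ a V ρ B →
    ≤-trans (acc-result (accs {b = b} ok (run i ρ) (run l ρ) (bds-outer B) (pl a V ρ B))) (+-monoˡ-≤ _ (pi a V ρ B))
  class-loop {l = l} {i} {b} (flat , L , pl) (lin , I , pi) (just ok@(Q , _)) = lin , I ⊞ L ⊠ (Q ⊙ (X ⊞ L)) , λ a V ρ B →
    ≤-trans (acc-result (accs {b = b} ok (run i ρ) (run l ρ) (bds-outer B) (pl a V ρ B)))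
      (≤-trans (+-monoˡ-≤ _ (pi a V ρ B)) (≤-reflexive (+-assoc a _ _)))
  class-loop {l = l} {i} {b} _ _ _ = unknown {e = loop l i b}

  all : ∀ k → Vec Mark k
  all k = replicate k flat

  record Bd {k} (V : ℕ) (ρ : Vec Tree k) : Set where
    constructor bd
    field small : ∀ i → size (lookup ρ i) ≤ V
  open Bd public

  bd-mono : ∀ {k} {V V′} {ρ : Vec Tree k} → V ≤ V′ → Bd V ρ → Bd V′ ρ
  bd-mono V≤ B = bd λ i → ≤-trans (small B i) V≤

  bd-∷ : ∀ {k} {V} {ρ : Vec Tree k} {t} → size t ≤ V → Bd V ρ → Bd V (t ∷ ρ)
  bd-∷ t≤ B = bd λ { zero → t≤ ; (suc i) → small B i }

  bd-map : ∀ {j k} (xs : Vec (Fin k) j) {V ρ} → Bd V ρ → Bd V (Vec.map (lookup ρ) xs)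
  bd-map xs {V} {ρ} B = bd λ i → ≤-trans (≤-reflexive (cong size (lookup-map i (lookup ρ) xs))) (small B (lookup xs i))

  bd-all : ∀ {k} {V a} {ρ : Vec Tree k} → Bd V ρ → Bds (all k) a V ρ
  bd-all {V = V} {a} {ρ} B = bds λ i → subst (λ μ → size (lookup ρ i) ≤[ μ ] a + V) (sym (lookup-replicate i flat)) (small B i)

  record Timed {k} (e : Tm k) : Set where
    constructor timed-by
    field
      sizeP timeP : Pol
      sized : ∀ V ρ → Bd V ρ → size (run e ρ) ≤ ⟪ sizeP ⟫ V
      exec  : ∀ V ρ → Bd V ρ → Exec e ρ V (⟪ timeP ⟫ V)
  open Timed public

  loops : ∀ {k} {b : Tm (2 + k)} {ρ V W B T a l L} → V ≤ W → B ≤ W → L ≤ W →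
          (∀ ρ′ → Bd W ρ′ → Exec b ρ′ W T) →
          Bd V ρ → AccB (λ a x → run b (a ∷ x ∷ ρ)) B a l → size l ≤ L → Loops b ρ W B T a l
  loops V≤ B≤ L≤ E B (done p) l≤ = done p
  loops {ρ = ρ} {l = node x l} V≤ B≤ L≤ E B (next p A) l≤ =
    next p (E _ (bd-∷ (≤-trans p B≤) (bd-∷ (≤-trans (≤-trans (m≤m+n _ (size l)) (≤-trans (n≤1+n _) l≤)) L≤) (bd-mono V≤ B))))
      (loops V≤ B≤ L≤ E B A (≤-trans (m≤n+m _ (size x)) (≤-trans (n≤1+n _) l≤)))

  loopT : (Tl Ti Tb I L Γ : Pol) → Pol
  loopT Tl Ti Tb I L Γ =
    Ti ⊞ (Tl ⊙ (con 1 ⊞ (I ⊞ X)) ⊞ (L ⊠ (Tb ⊙ (con 2 ⊞ (Γ ⊞ L ⊞ X)) ⊞ con 60 ⊠ Z) ⊞ con 20 ⊠ Z))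
    where Z = con 3 ⊞ (Γ ⊞ Γ ⊞ L ⊞ X)

  -- The bound `Γ` for the accumulators is left open: the size analysis supplies it in `timed-loop`,
  -- a separate argument about the actual values in `does-loop`.
  loop-exec : ∀ {k} {l i : Tm k} {b} (tₗ : Timed l) (tᵢ : Timed i) (tb : Timed b) Γ V ρ → Bd V ρ →
    AccB (λ a x → run b (a ∷ x ∷ ρ)) (⟪ Γ ⟫ V) (run i ρ) (run l ρ) →
    Exec (loop l i b) ρ V (⟪ loopT (timeP tₗ) (timeP tᵢ) (timeP tb) (sizeP tᵢ) (sizeP tₗ) Γ ⟫ V)
  loop-exec {l = l} {i} {b} tₗ tᵢ tb Γ V ρ B A =
      exec-mono {e = loop l i b} ≤-refl
        (+-monoʳ-≤ (⟪ timeP tᵢ ⟫ V) (+-monoʳ-≤ (⟪ timeP tₗ ⟫ (suc (⟪ sizeP tᵢ ⟫ V + V)))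
          (+-mono-≤ (*-mono-≤ (sized tₗ V ρ B) (+-monoʳ-≤ _ (*-monoʳ-≤ 60 zle))) (*-monoʳ-≤ 20 zle))))
        (exec-loop {l = l} {i} {b} (exec tᵢ V ρ B)
          (exec-mono {e = l} (s≤s (+-monoˡ-≤ V (sized tᵢ V ρ B))) ≤-refl
            (exec tₗ (suc (⟪ sizeP tᵢ ⟫ V + V)) ρ (bd-mono (≤-trans (m≤n+m V (⟪ sizeP tᵢ ⟫ V)) (n≤1+n _)) B)))
          (loops {V = V} {W = W} {L = size (run l ρ)} (≤-trans (m≤n+m V _) (m≤n+m _ 2))
            (≤-trans (≤-trans (m≤m+n _ _) (m≤m+n _ V)) (m≤n+m _ 2)) (≤-trans (≤-trans (m≤n+m _ (⟪ Γ ⟫ V)) (m≤m+n _ V)) (m≤n+m _ 2))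
            (λ ρ′ B′ → exec-mono {e = b} W≤ ≤-refl (exec tb (2 + (⟪ Γ ⟫ V + ⟪ sizeP tₗ ⟫ V + V)) ρ′ (bd-mono W≤ B′))) B A ≤-refl))
    where
    zle : 3 + (⟪ Γ ⟫ V + ⟪ Γ ⟫ V + size (run l ρ) + V) ≤ 3 + (⟪ Γ ⟫ V + ⟪ Γ ⟫ V + ⟪ sizeP tₗ ⟫ V + V)
    zle = +-monoʳ-≤ 3 (+-monoˡ-≤ V (+-monoʳ-≤ (⟪ Γ ⟫ V + ⟪ Γ ⟫ V) (sized tₗ V ρ B)))
    W = 2 + (⟪ Γ ⟫ V + size (run l ρ) + V)
    W≤ : W ≤ 2 + (⟪ Γ ⟫ V + ⟪ sizeP tₗ ⟫ V + V)
    W≤ = s≤s (s≤s (+-monoˡ-≤ V (+-monoʳ-≤ (⟪ Γ ⟫ V) (sized tₗ V ρ B))))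

  timed-▹ : ∀ {k} {a b : Tm k} → Timed a → Timed b → Timed (a ▹ b)
  timed-▹ {a = a} {b} (timed-by P Ta p ta) (timed-by Q Tb q tb) = timed-by (con 1 ⊞ (P ⊞ Q))
    (Ta ⊞ (Tb ⊙ (con 1 ⊞ (P ⊞ X)) ⊞ con 20 ⊠ (con 2 ⊞ P ⊞ Q ⊞ X)))
    (λ V ρ B → s≤s (+-mono-≤ (p V ρ B) (q V ρ B))) λ V ρ B →
      exec-mono {e = a ▹ b} ≤-refl (+-monoʳ-≤ (⟪ Ta ⟫ V) (+-monoʳ-≤ (⟪ Tb ⟫ (suc (⟪ P ⟫ V + V))) (*-monoʳ-≤ 20 (+-monoˡ-≤ V (+-mono-≤ (+-monoʳ-≤ 2 (p V ρ B)) (q V ρ B))))))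
        (exec-▹ {a = a} {b} (ta V ρ B) (exec-mono {e = b} (s≤s (+-monoˡ-≤ V (p V ρ B))) ≤-refl
          (tb (suc (⟪ P ⟫ V + V)) ρ (bd-mono (≤-trans (m≤n+m V (⟪ P ⟫ V)) (n≤1+n _)) B))))

  timed-ifn : ∀ {k} {c a b : Tm k} → Timed c → Timed a → Timed b → Timed (ifn c a b)
  timed-ifn {c = c} {a} {b} (timed-by P Tc p tc) (timed-by Q Ta q ta) (timed-by R Tb r tb) = timed-by (Q ⊞ R)
    (Tc ⊞ con 20 ⊠ (con 1 ⊞ (P ⊞ X)) ⊞ (con 1 ⊞ (Ta ⊞ Tb)))
    (λ V ρ B → size-iteT (run c ρ) (run a ρ) (run b ρ) (≤-trans (q V ρ B) (m≤m+n _ _)) (≤-trans (r V ρ B) (m≤n+m _ _))) λ V ρ B →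
      exec-mono {e = ifn c a b} ≤-refl (+-monoˡ-≤ _ (+-monoʳ-≤ (⟪ Tc ⟫ V) (*-monoʳ-≤ 20 (s≤s (+-monoˡ-≤ V (p V ρ B))))))
        (exec-ifn {c = c} {a} {b} (tc V ρ B) (ta V ρ B) (tb V ρ B))

  timed-bind : ∀ {k} {e : Tm k} {b} → Timed e → Timed b → Timed (bind e b)
  timed-bind {e = e} {b} (timed-by P Te p te) (timed-by Q Tb q tb) = timed-by (Q ⊙ (con 1 ⊞ (P ⊞ X)))
    (Te ⊞ (Tb ⊙ (con 1 ⊞ (P ⊞ X)) ⊞ con 20 ⊠ (con 2 ⊞ P ⊞ Q ⊙ (con 1 ⊞ (P ⊞ X)) ⊞ X)))
    (λ V ρ B → q _ _ (B′ V ρ B)) λ V ρ B →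
      exec-mono {e = bind e b} ≤-refl (+-monoʳ-≤ (⟪ Te ⟫ V) (+-monoʳ-≤ (⟪ Tb ⟫ (suc (⟪ P ⟫ V + V))) (*-monoʳ-≤ 20 (+-monoˡ-≤ V (+-mono-≤ (+-monoʳ-≤ 2 (p V ρ B)) (q _ _ (B′ V ρ B)))))))
        (exec-bind {e = e} {b} (te V ρ B) (exec-mono {e = b} (s≤s (+-monoˡ-≤ V (p V ρ B))) ≤-refl (tb (suc (⟪ P ⟫ V + V)) _ (B′ V ρ B))))
    where
    B′ : ∀ V ρ → Bd V ρ → Bd (suc (⟪ P ⟫ V + V)) (run e ρ ∷ ρ)
    B′ V ρ B = bd-∷ (≤-trans (p V ρ B) (≤-trans (m≤m+n _ V) (n≤1+n _))) (bd-mono (≤-trans (m≤n+m V (⟪ P ⟫ V)) (n≤1+n _)) B)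

  timed-loop : ∀ {k} {l i : Tm k} {b} → Timed l → Timed i → Timed b → BodyOK (all k) b → Timed (loop l i b)
  timed-loop {k} {l} {i} {b} tₗ tᵢ tb ok@(Q , _) = timed-by Γ (loopT (timeP tₗ) (timeP tᵢ) (timeP tb) (sizeP tᵢ) (sizeP tₗ) Γ)
    (λ V ρ B → acc-result (A V ρ B)) (λ V ρ B → loop-exec {l = l} {i} {b} tₗ tᵢ tb Γ V ρ B (A V ρ B))
    where
    Γ = sizeP tᵢ ⊞ sizeP tₗ ⊠ (Q ⊙ (X ⊞ sizeP tₗ))
    acc-mono : ∀ {g B B′ a l} → B ≤ B′ → AccB g B a l → AccB g B′ a l
    acc-mono B≤ (done p)   = done (≤-trans p B≤)
    acc-mono B≤ (next p A) = next (≤-trans p B≤) (acc-mono B≤ A)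
    A : ∀ V ρ → Bd V ρ → AccB (λ a x → run b (a ∷ x ∷ ρ)) (⟪ Γ ⟫ V) (run i ρ) (run l ρ)
    A V ρ B = acc-mono (+-monoˡ-≤ _ (sized tᵢ V ρ B)) (accs {b = b} ok (run i ρ) (run l ρ) (bd-all B) (sized tₗ V ρ B))

  -- The result is `nothing` only if some loop has a body that is neither flat nor linear in its
  -- accumulator. For a concrete term the type checker evaluates the analysis, and `timedOf`
  -- extracts the bounds.
  timed : ∀ {k} (e : Tm k) → Maybe (Timed e)
  timed (ref i) = just (timed-by X ((X ⊞ con 7) ⊠ X) (λ V ρ B → small B i) (λ V ρ B → exec-ref i))
  timed (wk e) = timed e >>= λ (timed-by P T p t) →
    just (timed-by P T (λ { V (v ∷ ρ) B → p V ρ (bd λ i → small B (suc i)) })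
                       (λ { V (v ∷ ρ) B → exec-wk {e = e} (t V ρ (bd λ i → small B (suc i))) }))
  timed (at xs e) = timed e >>= λ (timed-by P T p t) →
    just (timed-by P T (λ V ρ B → p V _ (bd-map xs B)) (λ V ρ B → exec-at xs {e} (t V _ (bd-map xs B))))
  timed lf = just (timed-by (con 1) (con 7 ⊠ X) (λ V ρ B → ≤-refl) (λ V ρ B → exec-lf {ρ = ρ}))
  timed (a ▹ b) = timed a >>= λ ta → timed b >>= λ tb → just (timed-▹ ta tb)
  timed (fst e) = timed e >>= λ (timed-by P T p t) →
    just (timed-by P (T ⊞ con 20 ⊠ (con 1 ⊞ (P ⊞ X))) (λ V ρ B → ≤-trans (size-left (run e ρ)) (p V ρ B)) λ V ρ B →
      exec-mono {e = fst e} ≤-refl (+-monoʳ-≤ (⟪ T ⟫ V) (*-monoʳ-≤ 20 (s≤s (+-monoˡ-≤ V (p V ρ B))))) (exec-fst {e = e} (t V ρ B)))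
  timed (snd e) = timed e >>= λ (timed-by P T p t) →
    just (timed-by P (T ⊞ con 20 ⊠ (con 1 ⊞ (P ⊞ X))) (λ V ρ B → ≤-trans (size-right (run e ρ)) (p V ρ B)) λ V ρ B →
      exec-mono {e = snd e} ≤-refl (+-monoʳ-≤ (⟪ T ⟫ V) (*-monoʳ-≤ 20 (s≤s (+-monoˡ-≤ V (p V ρ B))))) (exec-snd {e = e} (t V ρ B)))
  timed (ifn c a b) = timed c >>= λ tc → timed a >>= λ ta → timed b >>= λ tb → just (timed-ifn tc ta tb)
  timed (bind e b) = timed e >>= λ te → timed b >>= λ tb → just (timed-bind te tb)
  timed {k} (loop l i b) = timed l >>= λ tₗ → timed i >>= λ tᵢ → timed b >>= λ tb →
    bodyOK {b = b} (classify (inner (all k)) b) >>= λ ok → just (timed-loop {l = l} {i} {b} tₗ tᵢ tb ok)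

-- The algorithm as a term of the language.

module Terms where
  open Machine
  open Growth
  open import Defs hiding (_^_; eval)
  open import Data.Fin.Base using (Fin; zero; suc)
  open import Data.Maybe.Base using (just; is-just)
  open import Data.Bool.Base using (T)
  open import Data.Nat.Base
  open import Data.Vec.Base as Vec using ([]; _∷_)

  v0 : ∀ {k} → Tm (1 + k)
  v0 = ref zero
  v1 : ∀ {k} → Tm (2 + k)
  v1 = wk v0
  v2 : ∀ {k} → Tm (3 + k)
  v2 = wk v1
  v3 : ∀ {k} → Tm (4 + k)
  v3 = wk v2
  v4 : ∀ {k} → Tm (5 + k)
  v4 = wk v3
  v5 : ∀ {k} → Tm (6 + k)
  v5 = wk v4
  v6 : ∀ {k} → Tm (7 + k)
  v6 = wk v5
  v7 : ∀ {k} → Tm (8 + k)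
  v7 = wk v6
  v8 : ∀ {k} → Tm (9 + k)
  v8 = wk v7
  v9 : ∀ {k} → Tm (10 + k)
  v9 = wk v8

  i0 : ∀ {k} → Fin (1 + k)
  i0 = zero
  i1 : ∀ {k} → Fin (2 + k)
  i1 = suc zero
  i2 : ∀ {k} → Fin (3 + k)
  i2 = suc i1
  i3 : ∀ {k} → Fin (4 + k)
  i3 = suc i2
  i4 : ∀ {k} → Fin (5 + k)
  i4 = suc i3
  i5 : ∀ {k} → Fin (6 + k)
  i5 = suc i4
  i6 : ∀ {k} → Fin (7 + k)
  i6 = suc i5
  i7 : ∀ {k} → Fin (8 + k)
  i7 = suc i6
  i8 : ∀ {k} → Fin (9 + k)
  i8 = suc i7
  i9 : ∀ {k} → Fin (10 + k)
  i9 = suc i8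

  call1 : ∀ {k} → Tm 1 → Tm k → Tm k
  call1 f a = bind a (at (i0 ∷ []) f)
  call2 : ∀ {k} → Tm 2 → (a b : Tm k) → Tm k
  call2 f a b = bind a (bind (wk b) (at (i1 ∷ i0 ∷ []) f))
  call3 : ∀ {k} → Tm 3 → (a b c : Tm k) → Tm k
  call3 f a b c = bind a (bind (wk b) (bind (wk (wk c)) (at (i2 ∷ i1 ∷ i0 ∷ []) f)))
  call4 : ∀ {k} → Tm 4 → (a b c d : Tm k) → Tm k
  call4 f a b c d = bind a (bind (wk b) (bind (wk (wk c)) (bind (wk (wk (wk d))) (at (i3 ∷ i2 ∷ i1 ∷ i0 ∷ []) f))))
  call5 : ∀ {k} → Tm 5 → (a b c d e : Tm k) → Tm k
  call5 f a b c d e = bind a (bind (wk b) (bind (wk (wk c)) (bind (wk (wk (wk d))) (bind (wk (wk (wk (wk e))))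
    (at (i4 ∷ i3 ∷ i2 ∷ i1 ∷ i0 ∷ []) f)))))

  -- Natural numbers are also represented in unary, by the length of a list.
  yes′ : ∀ {k} → Tm k
  yes′ = lf ▹ lf

  -- `clipF` and `halfF` rebuild a number by counting along their second argument. The size analysis
  -- therefore bounds their values by that argument alone, whatever the first one is; this is how
  -- loops that double or recompute a number pass the analysis.
  subF eqlenF clipF appF getF halfF : Tm 2
  subF   = loop v1 v0 (snd v0)
  eqlenF = ifn (call2 subF v0 v1) lf (ifn (call2 subF v1 v0) lf yes′)
  clipF  = loop v1 lf (ifn (call2 subF v2 v0) (lf ▹ v0) v0)
  appF   = loop v0 v1 (lf ▹ v0)
  getF   = fst (call2 subF v0 v1)
  halfF  = loop v1 lf (ifn (call2 subF v2 (lf ▹ call2 appF v0 v0)) (lf ▹ v0) v0)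

  revF : Tm 1
  revF = loop v0 lf (v1 ▹ v0)

  digitF : Tm 2
  digitF = lf ▹ ifn v1 (call2 appF v0 v0) (lf ▹ call2 appF v0 v0)

  unaryC : Tm 2
  unaryC = loop (call1 revF v0) lf (call2 clipF (at (i0 ∷ i1 ∷ []) digitF) v3)

  -- leqF a x b y tests a·x ≤ b·y for unary a, b and binary x, y. The digits are
  -- processed from the least significant one on, with carries E and F: the
  -- condition a·x + E ≤ b·y + F is halved in every round.
  carryF : Tm 3
  carryF = ifn v0 (ifn (fst v0) (call2 appF v1 v2) (call2 appF v1 (call2 appF v1 v2))) v2

  roundF : Tm 4
  roundF = ifn (call2 subF v0 (call2 appF v2 v2)) (ifn (call2 subF v1 (call2 appF v3 v3)) v2 (lf ▹ v2)) v2

  -- The state holds the number of processed digits and the two carries. The digits are found again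
  -- by dropping that many from the inputs instead of being stored, and the carries are clipped, so
  -- only the counter is linear in the old state.
  leqStep : Tm 5
  leqStep = bind (call3 carryF (call2 subF v2 (fst v0)) v1 (fst (snd v0)))
           (bind (call3 carryF (call2 subF v5 (fst v1)) v4 (snd (snd v1)))
           (bind (call2 halfF v1 (lf ▹ call2 appF v3 v3))
           (bind (call2 halfF v1 (lf ▹ call2 appF v6 v6))
           ((lf ▹ fst v4) ▹ (call4 roundF v3 v2 v1 v0 ▹ v0)))))

  leqF : Tm 4
  leqF = bind (loop (call2 appF v1 v3) lf (call5 leqStep v0 v2 v3 v4 v5))
              (ifn (call2 subF (fst (snd v0)) (snd (snd v0))) lf yes′)

  eqbitF : Tm 2
  eqbitF = ifn v0 v1 (ifn v1 lf yes′)

  matchStep : Tm 4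
  matchStep = ifn (fst v0)
    (ifn (call2 eqbitF (fst (snd v0)) (call2 getF v2 (call2 unaryC v1 v3))) (yes′ ▹ snd (snd v0)) (lf ▹ lf)) v0

  matchF : Tm 4
  matchF = fst (loop v0 (yes′ ▹ v1) (call4 matchStep v0 v1 v4 v5))

  satF : Tm 3
  satF = loop (snd v0) lf (ifn v0 v0 (call4 matchF (fst v2) v1 v3 v4))

  valF : Tm 3
  valF = loop v0 lf (ifn (call3 satF v1 v3 v4) (lf ▹ v0) v0)

  swapF : Tm 4
  swapF = loop v3 lf (call2 getF v2 (ifn (call2 eqlenF v1 v3) v4 (ifn (call2 eqlenF v1 v4) v3 v1)) ▹ v0)

  -- The list built so far is its own counter: its length is the next index, copied by `clipF` to
  -- keep the step linear.
  idxF : Tm 1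
  idxF = loop v0 lf (call2 clipF v0 v2 ▹ v0)

  betaF : Tm 4
  betaF = loop v0 lf (ifn (call4 leqF (lf ▹ v1) v5 v3 v4) lf yes′ ▹ v0)

  expandF : Tm 2
  expandF = loop v0 lf (loop v3 v0 (loop v5 v0 (call4 swapF v5 v3 v1 v7 ▹ v0)))

  memF : Tm 2
  memF = loop v0 lf (ifn (call2 eqlenF v1 v3) yes′ v0)

  pairStep : Tm 7
  pairStep = ifn (call2 memF v0 v2) v0 (ifn (call2 memF v0 v1) v0
    (ifn (call2 eqlenF (call3 valF v5 v3 v6) (call3 valF v5 (call4 swapF v3 v2 v1 v4) v6)) v0 (v2 ▹ (v1 ▹ v0))))

  matchingF : Tm 4
  matchingF = loop v0 lf (loop v3 v0 (loop v5 v0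
    (at (i0 ∷ i1 ∷ i3 ∷ i5 ∷ i7 ∷ i8 ∷ i9 ∷ []) pairStep)))

  plusF minusF : Tm 1
  plusF  = loop v0 lf (ifn v1 (lf ▹ v0) v0)
  minusF = loop v0 lf (ifn v1 v0 (lf ▹ v0))

  chooseF : Tm 3
  chooseF = ifn (call2 subF v0 (call1 plusF v2)) v1 v0

  maskF : Tm 2
  maskF = loop v1 lf (call2 memF v2 v1 ▹ v0)

  certifyF : Tm 3
  certifyF = ifn (fst (fst v0)) yes′ (call4 leqF v2 (snd (fst v0)) v1 (snd v0))

  -- An entry consists of the coefficients still available, the point at which the
  -- objective function is to be evaluated, and the set of variables of the term.
  entry : ∀ {k} → Tm (1 + k) → Tm (1 + k) → Tm (1 + k) → Tm (1 + k)
  entry q s b = q ▹ ((s ▹ fst (snd v0)) ▹ (b ▹ snd (snd v0)))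

  entryStepBody : Tm 4
  entryStepBody = bind v1
    (ifn (ifn v4 (snd (fst v0)) lf)
      (entry half⁺ lf lf ▹ entry half⁻ lf yes′ ▹ entry half⁻ yes′ lf ▹ entry half⁺ yes′ yes′ ▹ entry (fst v0) yes′ lf ▹ v1)
      (entry (fst v0) yes′ lf ▹ v1))
    where
    half⁺ half⁻ : Tm 5
    half⁺ = fst (snd (fst v0))
    half⁻ = snd (snd (fst v0))

  entryStep : Tm 2
  entryStep = loop v0 lf entryStepBody

  entryLoop : Tm 3
  entryLoop = call2 entryStep v0 (call2 memF v2 v1)

  -- The counter is copied through `clipF`, since next to the linear second component a linear
  -- counter would be rejected by the size analysis.
  fillStep : Tm 5
  fillStep = ifn (call2 memF v3 v1) (call2 clipF (fst v0) v4 ▹ (call2 getF v2 v1 ▹ snd v0))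
    (ifn (fst v0) (call2 clipF (snd (fst v0)) v4 ▹ (lf ▹ snd v0)) (lf ▹ (yes′ ▹ snd v0)))

  extF : Tm 5
  extF = snd (loop v2 (call2 subF v3 (call1 minusF v0) ▹ lf) (at (i0 ∷ i1 ∷ i2 ∷ i3 ∷ i6 ∷ []) fillStep))

  outputF : Tm 6
  outputF = loop v0 lf (bind (call5 extF (fst (snd v1)) v3 v4 v5 v6)
    (loop v8 v1 (ifn (call3 satF v1 v2 v9) ((fst (fst v4) ▹ snd (snd v4)) ▹ v0) v0)))

  -- Arguments: the points, the base point, the indices, n, the constraints.
  chosenF : Tm 5
  chosenF = call3 chooseF (at (i0 ∷ i2 ∷ i4 ∷ i3 ∷ []) matchingF) v2 v1

  -- Arguments: the entries, the chosen variables, the indices, the base point, n, the constraints.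
  answerF : Tm 6
  answerF = call2 maskF v1 v2 ▹ bind (call1 minusF v3) (at (i1 ∷ i2 ∷ i3 ∷ i0 ∷ i5 ∷ i6 ∷ []) outputF)

  ballStep : Tm 2
  ballStep = call2 expandF v0 v1

  -- The input is in variable 0; variable 1 holds the constants d, A and the coefficients.
  main : Tm 2
  main = bind (loop (call1 revF (fst (fst v0))) lf (at (i0 ∷ i1 ∷ []) digitF))
         (bind (call1 idxF v0)
         (bind (call4 betaF v0 v1 (snd (fst (snd (snd v2)))) (snd (snd (snd v2))))
         (bind (loop (fst v4) (v0 ▹ lf) (at (i0 ∷ i3 ∷ []) ballStep))
         (bind (bind (snd (fst v4)) (at (i1 ∷ i2 ∷ i3 ∷ i4 ∷ i0 ∷ []) chosenF))
         (ifn (call3 certifyF (fst (snd v5)) v0 (fst (snd v6))) lf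
         (bind (loop v3 ((snd (snd v6) ▹ (lf ▹ lf)) ▹ lf) (at (i0 ∷ i1 ∷ i2 ∷ []) entryLoop))
               (bind (snd (fst v6)) (at (i1 ∷ i2 ∷ i5 ∷ i4 ∷ i6 ∷ i0 ∷ []) answerF))))))))

  timedOf : ∀ {k} (e : Tm k) → T (is-just (timed e)) → Timed e
  timedOf e ok with timed e
  ... | just t = t

-- Correctness of unary arithmetic and of the conversion from binary.

module Numbers where
  open Machine
  open Terms
  open import Defs hiding (_^_; eval; if_then_else_)
  open import Data.Bool.Base using (Bool; true; false; T; if_then_else_)
  open import Data.Nat.Base
  open import Data.Nat.Properties
  open import Data.Nat.Binary.Base as ℕᵇ using (ℕᵇ; 2[1+_]; 1+[2_]; toℕ)
  open import Data.Unit.Base using (tt)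
  open import Data.Vec.Base using ([]; _∷_)
  open import Function.Base using (_∘_)
  open import Relation.Binary.PropositionalEquality using (_≡_; refl; sym; trans; cong; cong₂; subst; module ≡-Reasoning)
  open import Data.Nat.Tactic.RingSolver using (solve-∀)

  truth : Tree → Bool
  truth leaf       = false
  truth (node _ _) = true

  iteT-if : ∀ t a b → iteT t a b ≡ (if truth t then a else b)
  iteT-if leaf       a b = refl
  iteT-if (node _ _) a b = refl

  un : ℕ → Tree
  un zero    = leaf
  un (suc m) = node leaf (un m)

  spine-un : ∀ m → spine (un m) ≡ m
  spine-un zero    = refl
  spine-un (suc m) = cong suc (spine-un m)

  truth-spine : ∀ t → truth t ≡ (0 <ᵇ spine t)
  truth-spine leaf       = refl
  truth-spine (node _ _) = refl

  <ᵇ-∸ : ∀ a z → (0 <ᵇ (z ∸ a)) ≡ (a <ᵇ z)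
  <ᵇ-∸ zero    z       = refl
  <ᵇ-∸ (suc a) zero    = refl
  <ᵇ-∸ (suc a) (suc z) = <ᵇ-∸ a z

  bool-ext : ∀ {a b} → (T a → T b) → (T b → T a) → a ≡ b
  bool-ext {false} {false} f g = refl
  bool-ext {false} {true}  f g with () ← g tt
  bool-ext {true}  {false} f g with () ← f tt
  bool-ext {true}  {true}  f g = refl

  ≤ᵇ-ext : ∀ {m n p q} → (m ≤ n → p ≤ q) → (p ≤ q → m ≤ n) → (m ≤ᵇ n) ≡ (p ≤ᵇ q)
  ≤ᵇ-ext {m} {n} {p} {q} f g = bool-ext (≤⇒≤ᵇ ∘ f ∘ ≤ᵇ⇒≤ m n) (≤⇒≤ᵇ ∘ g ∘ ≤ᵇ⇒≤ p q)

  T-true : ∀ {b} → b ≡ true → T b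
  T-true refl = tt

  <ᵇ-true : ∀ {m n} → m < n → (m <ᵇ n) ≡ true
  <ᵇ-true {m} {n} p with m <ᵇ n | <⇒<ᵇ p
  ... | true | _ = refl

  right-rights : ∀ j s → right (rights j s) ≡ rights j (right s)
  right-rights zero    s = refl
  right-rights (suc j) s = cong right (right-rights j s)

  fold-right : ∀ z c → fold (λ a _ → right a) z c ≡ rights (spine c) z
  fold-right z leaf       = refl
  fold-right z (node _ c) = trans (fold-right (right z) c) (sym (right-rights (spine c) z))

  run-sub : ∀ z a → run subF (z ∷ a ∷ []) ≡ rights (spine a) z
  run-sub z a = fold-right z a

  spine-right : ∀ t → spine (right t) ≡ pred (spine t)
  spine-right leaf       = refl
  spine-right (node _ _) = refl

  spine-rights : ∀ j z → spine (rights j z) ≡ spine z ∸ j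
  spine-rights zero    z = refl
  spine-rights (suc j) z = trans (spine-right (rights j z)) (trans (cong pred (spine-rights j z)) (pred[m∸n]≡m∸[1+n] (spine z) j))

  spine-sub : ∀ z a → spine (run subF (z ∷ a ∷ [])) ≡ spine z ∸ spine a
  spine-sub z a = trans (cong spine (run-sub z a)) (spine-rights (spine a) z)

  truth-sub : ∀ z a → truth (run subF (z ∷ a ∷ [])) ≡ (spine a <ᵇ spine z)
  truth-sub z a = trans (truth-spine (run subF (z ∷ a ∷ []))) (trans (cong (0 <ᵇ_) (spine-sub z a)) (<ᵇ-∸ (spine a) (spine z)))

  ≡ᵇ-<ᵇ : ∀ m n → (if m <ᵇ n then leaf else (if n <ᵇ m then leaf else node leaf leaf)) ≡ codeBool (m ≡ᵇ n)
  ≡ᵇ-<ᵇ zero    zero    = refl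
  ≡ᵇ-<ᵇ zero    (suc n) = refl
  ≡ᵇ-<ᵇ (suc m) zero    = refl
  ≡ᵇ-<ᵇ (suc m) (suc n) = ≡ᵇ-<ᵇ m n

  run-eqlen : ∀ a b → run eqlenF (a ∷ b ∷ []) ≡ codeBool (spine a ≡ᵇ spine b)
  run-eqlen a b = begin
    iteT (run subF (a ∷ b ∷ [])) leaf (iteT (run subF (b ∷ a ∷ [])) leaf (node leaf leaf))
      ≡⟨ cong (iteT (run subF (a ∷ b ∷ [])) leaf) (iteT-if (run subF (b ∷ a ∷ [])) leaf (node leaf leaf)) ⟩
    iteT (run subF (a ∷ b ∷ [])) leaf (if truth (run subF (b ∷ a ∷ [])) then leaf else node leaf leaf)
      ≡⟨ iteT-if (run subF (a ∷ b ∷ [])) leaf _ ⟩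
    (if truth (run subF (a ∷ b ∷ [])) then leaf else (if truth (run subF (b ∷ a ∷ [])) then leaf else node leaf leaf))
      ≡⟨ cong₂ (λ x y → if x then leaf else (if y then leaf else node leaf leaf)) (truth-sub a b) (truth-sub b a) ⟩
    (if spine b <ᵇ spine a then leaf else (if spine a <ᵇ spine b then leaf else node leaf leaf))
      ≡⟨ ≡ᵇ-<ᵇ (spine b) (spine a) ⟩
    codeBool (spine b ≡ᵇ spine a)
      ≡⟨ cong codeBool (≡ᵇ-sym (spine b) (spine a)) ⟩
    codeBool (spine a ≡ᵇ spine b) ∎
    where
    open ≡-Reasoning
    ≡ᵇ-sym : ∀ m n → (m ≡ᵇ n) ≡ (n ≡ᵇ m)
    ≡ᵇ-sym zero    zero    = refl
    ≡ᵇ-sym zero    (suc n) = refl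
    ≡ᵇ-sym (suc m) zero    = refl
    ≡ᵇ-sym (suc m) (suc n) = ≡ᵇ-sym m n

  ⊓-step : ∀ m c z → (if m <ᵇ z then (suc m + c) ⊓ z else (m + c) ⊓ z) ≡ (m + suc c) ⊓ z
  ⊓-step m c z with m <ᵇ z in eq
  ... | true  = cong (_⊓ z) (sym (+-suc m c))
  ... | false = trans (m≥n⇒m⊓n≡n (≤-trans z≤m (m≤m+n m c))) (sym (m≥n⇒m⊓n≡n (≤-trans z≤m (m≤m+n m (suc c)))))
    where
    z≤m : z ≤ m
    z≤m = ≮⇒≥ (λ m<z → subst T (trans (sym (<ᵇ-true m<z)) eq) tt)

  run-clip-from : ∀ z m c → m ≤ spine z →
    fold (λ a _ → iteT (run subF (z ∷ a ∷ [])) (node leaf a) a) (un m) c ≡ un ((m + spine c) ⊓ spine z)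
  run-clip-from z m leaf m≤ = cong un (sym (trans (cong (_⊓ spine z) (+-identityʳ m)) (m≤n⇒m⊓n≡m m≤)))
  run-clip-from z m (node x c) m≤
    rewrite iteT-if (run subF (z ∷ un m ∷ [])) (node leaf (un m)) (un m) | truth-sub z (un m) | spine-un m
    with m <ᵇ spine z in eq | ⊓-step m (spine c) (spine z)
  ... | true  | st = trans (run-clip-from z (suc m) c (<ᵇ⇒< m (spine z) (T-true eq))) (cong un st)
  ... | false | st = trans (run-clip-from z m c m≤) (cong un st)

  run-clip : ∀ z c → run clipF (z ∷ c ∷ []) ≡ un (spine c ⊓ spine z)
  run-clip z c = run-clip-from z 0 c z≤n

  spine-app : ∀ a z → spine (run appF (a ∷ z ∷ [])) ≡ spine a + spine z
  spine-app leaf       z = refl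
  spine-app (node x a) z = trans (spine-app a (node leaf z)) (+-suc (spine a) (spine z))

  foldr′ : (Tree → Tree → Tree) → Tree → Tree → Tree
  foldr′ g a leaf       = a
  foldr′ g a (node x l) = g (foldr′ g a l) x

  fold-rev : ∀ g a l r → fold g a (fold (λ acc x → node x acc) r l) ≡ fold g (foldr′ g a l) r
  fold-rev g a leaf       r = refl
  fold-rev g a (node x l) r = fold-rev g a l (node x r)

  parityDigit : Tree → ℕ
  parityDigit leaf       = 2
  parityDigit (node _ _) = 1

  spine-digit : ∀ a x → spine (run digitF (a ∷ x ∷ [])) ≡ parityDigit x + (spine a + spine a)
  spine-digit a leaf       = cong (2 +_) (spine-app a a)
  spine-digit a (node _ _) = cong suc (spine-app a a)

  digit : ℕᵇ → ℕ
  digit ℕᵇ.zero  = 0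
  digit 2[1+ b ] = 2
  digit 1+[2 b ] = 1

  tailᵇ : ℕᵇ → ℕᵇ
  tailᵇ ℕᵇ.zero  = ℕᵇ.zero
  tailᵇ 2[1+ b ] = b
  tailᵇ 1+[2 b ] = b

  toℕ-digit : ∀ b → toℕ b ≡ digit b + (toℕ (tailᵇ b) + toℕ (tailᵇ b))
  toℕ-digit ℕᵇ.zero  = refl
  toℕ-digit 2[1+ b ] = lem (toℕ b)
    where
    lem : ∀ n → 2 * suc n ≡ 2 + (n + n)
    lem = solve-∀
  toℕ-digit 1+[2 b ] = lem (toℕ b)
    where
    lem : ∀ n → suc (2 * n) ≡ 1 + (n + n)
    lem = solve-∀

  unaryStep : Tree → Tree → Tree
  unaryStep a x = run digitF (a ∷ x ∷ [])

  tail≤ : ∀ b → toℕ (tailᵇ b) ≤ toℕ b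
  tail≤ b = ≤-trans (≤-trans (m≤m+n _ _) (m≤n+m _ (digit b))) (≤-reflexive (sym (toℕ-digit b)))

  -- All intermediate values are at most the final one, so clipping at the length of `c` never takes
  -- effect.
  spine-unaryC : ∀ b c → toℕ b ≤ spine c → spine (run unaryC (codeℕᵇ b ∷ c ∷ [])) ≡ toℕ b
  spine-unaryC b c b≤ = trans (cong spine (fold-rev step leaf (codeℕᵇ b) leaf)) (go b b≤)
    where
    step : Tree → Tree → Tree
    step a x = run clipF (run digitF (a ∷ x ∷ []) ∷ c ∷ [])
    advance : ∀ b x → toℕ b ≤ spine c → spine (foldr′ step leaf (codeℕᵇ (tailᵇ b))) ≡ toℕ (tailᵇ b) → parityDigit x ≡ digit b →
           spine (step (foldr′ step leaf (codeℕᵇ (tailᵇ b))) x) ≡ toℕ b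
    advance b x b≤ IH d≡ = begin
      spine (step r x)                              ≡⟨ cong spine (run-clip (run digitF (r ∷ x ∷ [])) c) ⟩
      spine (un (spine c ⊓ spine (run digitF (r ∷ x ∷ [])))) ≡⟨ spine-un _ ⟩
      spine c ⊓ spine (run digitF (r ∷ x ∷ []))     ≡⟨ cong (spine c ⊓_) (trans (spine-digit r x) (trans (cong₂ _+_ d≡ (cong₂ _+_ IH IH)) (sym (toℕ-digit b)))) ⟩
      spine c ⊓ toℕ b                               ≡⟨ m≥n⇒m⊓n≡n b≤ ⟩
      toℕ b ∎
      where
      open ≡-Reasoning
      r = foldr′ step leaf (codeℕᵇ (tailᵇ b))
    go : ∀ b → toℕ b ≤ spine c → spine (foldr′ step leaf (codeℕᵇ b)) ≡ toℕ b
    go ℕᵇ.zero      b≤ = refl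
    go b@(2[1+ b′ ]) b≤ = advance b leaf b≤ (go b′ (≤-trans (tail≤ b) b≤)) refl
    go b@(1+[2 b′ ]) b≤ = advance b (node leaf leaf) b≤ (go b′ (≤-trans (tail≤ b) b≤)) refl

  half-<ᵇ : ∀ h z → (suc (h + h) <ᵇ z) ≡ (h <ᵇ ⌊ z /2⌋)
  half-<ᵇ h zero = refl
  half-<ᵇ h (suc zero) = refl
  half-<ᵇ zero (suc (suc z)) = refl
  half-<ᵇ (suc h) (suc (suc z)) rewrite +-suc h h = half-<ᵇ h z

  spine-half-from : ∀ z m c → m ≤ ⌊ spine z /2⌋ →
    fold (λ a _ → iteT (run subF (z ∷ node leaf (run appF (a ∷ a ∷ [])) ∷ [])) (node leaf a) a) (un m) c ≡ un ((m + spine c) ⊓ ⌊ spine z /2⌋)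
  spine-half-from z m leaf m≤ = cong un (sym (trans (cong (_⊓ ⌊ spine z /2⌋) (+-identityʳ m)) (m≤n⇒m⊓n≡m m≤)))
  spine-half-from z m (node x c) m≤
    rewrite iteT-if (run subF (z ∷ node leaf (run appF (un m ∷ un m ∷ [])) ∷ [])) (node leaf (un m)) (un m)
          | truth-sub z (node leaf (run appF (un m ∷ un m ∷ []))) | spine-app (un m) (un m) | spine-un m | half-<ᵇ m (spine z)
    with m <ᵇ ⌊ spine z /2⌋ in eq | ⊓-step m (spine c) ⌊ spine z /2⌋
  ... | true  | st = trans (spine-half-from z (suc m) c (<ᵇ⇒< m ⌊ spine z /2⌋ (T-true eq))) (cong un st)
  ... | false | st = trans (spine-half-from z m c m≤) (cong un st)

  run-half : ∀ z c → ⌊ spine z /2⌋ ≤ spine c → run halfF (z ∷ c ∷ []) ≡ un ⌊ spine z /2⌋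
  run-half z c ≤c = trans (spine-half-from z 0 c z≤n) (cong un (m≥n⇒m⊓n≡n ≤c))

-- Correctness of the comparison of products of unary and binary numbers.

module Leq where
  open Machine
  open Terms
  open Numbers
  open import Defs hiding (_^_; eval; if_then_else_)
  open import Data.Bool.Base using (Bool; true; false; if_then_else_)
  open import Data.Nat.Base
  open import Data.Nat.Properties
  open import Data.Nat.Binary.Base as ℕᵇ using (ℕᵇ; 2[1+_]; 1+[2_]; toℕ)
  open import Data.Product.Base using (_×_; _,_; proj₁; proj₂)
  open import Data.Vec.Base using ([]; _∷_)
  open import Function.Base using (_∘_)
  open import Relation.Binary.PropositionalEquality using (_≡_; refl; sym; trans; cong; cong₂; subst; subst₂; module ≡-Reasoning)
  open import Data.Nat.Tactic.RingSolver using (solve-∀)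

  bit : Bool → ℕ
  bit b = if b then 1 else 0

  tailsᵇ : ℕ → ℕᵇ → ℕᵇ
  tailsᵇ zero    x = x
  tailsᵇ (suc j) x = tailᵇ (tailsᵇ j x)

  right-code : ∀ x → right (codeℕᵇ x) ≡ codeℕᵇ (tailᵇ x)
  right-code ℕᵇ.zero  = refl
  right-code 2[1+ x ] = refl
  right-code 1+[2 x ] = refl

  rights-code : ∀ j x → rights j (codeℕᵇ x) ≡ codeℕᵇ (tailsᵇ j x)
  rights-code zero    x = refl
  rights-code (suc j) x = trans (cong right (rights-code j x)) (right-code (tailsᵇ j x))

  spine-zero : ∀ x → spine (codeℕᵇ x) ≡ 0 → toℕ x ≡ 0
  spine-zero ℕᵇ.zero  eq = refl

  tails-zero : ∀ j x → spine (codeℕᵇ x) ≤ j → toℕ (tailsᵇ j x) ≡ 0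
  tails-zero j x ≤j = spine-zero (tailsᵇ j x) (trans (cong spine (sym (rights-code j x)))
    (trans (spine-rights j (codeℕᵇ x)) (m≤n⇒m∸n≡0 ≤j)))

  spine-carry : ∀ x a e → spine (run carryF (codeℕᵇ x ∷ a ∷ e ∷ [])) ≡ digit x * spine a + spine e
  spine-carry ℕᵇ.zero  a e = refl
  spine-carry 2[1+ x ] a e = trans (spine-app a _) (trans (cong (spine a +_) (spine-app a e)) (lem (spine a) (spine e)))
    where
    lem : ∀ a e → a + (a + e) ≡ 2 * a + e
    lem = solve-∀
  spine-carry 1+[2 x ] a e = trans (spine-app a e) (cong (_+ spine e) (sym (+-identityʳ (spine a))))

  odd : ℕ → Bool
  odd n = (⌊ n /2⌋ + ⌊ n /2⌋) <ᵇ n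

  bit-odd : ∀ n → n ≡ bit (odd n) + (⌊ n /2⌋ + ⌊ n /2⌋)
  bit-odd zero = refl
  bit-odd (suc zero) = refl
  bit-odd (suc (suc n)) rewrite +-suc ⌊ n /2⌋ ⌊ n /2⌋ = trans (cong (suc ∘ suc) (bit-odd n)) (lem (bit (odd n)) (⌊ n /2⌋ + ⌊ n /2⌋))
    where
    lem : ∀ b m → 2 + (b + m) ≡ b + (2 + m)
    lem = solve-∀

  rounding : Bool → Bool → ℕ → ℕ
  rounding o o′ h = if o then (if o′ then h else suc h) else h

  run-round : ∀ e f h g → h ≡ un ⌊ spine e /2⌋ → g ≡ un ⌊ spine f /2⌋ →
    spine (run roundF (e ∷ f ∷ h ∷ g ∷ [])) ≡ rounding (odd (spine e)) (odd (spine f)) ⌊ spine e /2⌋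
  run-round e f h g refl refl
    rewrite iteT-if (run subF (f ∷ run appF (g ∷ g ∷ []) ∷ [])) h (node leaf h)
          | iteT-if (run subF (e ∷ run appF (h ∷ h ∷ []) ∷ [])) (if truth (run subF (f ∷ run appF (g ∷ g ∷ []) ∷ [])) then h else node leaf h) h
          | truth-sub e (run appF (h ∷ h ∷ [])) | truth-sub f (run appF (g ∷ g ∷ []))
          | spine-app h h | spine-app g g | spine-un ⌊ spine e /2⌋ | spine-un ⌊ spine f /2⌋
    with odd (spine e) | odd (spine f)
  ... | true  | true  = spine-un ⌊ spine e /2⌋
  ... | true  | false = cong suc (spine-un ⌊ spine e /2⌋)
  ... | false | _     = spine-un ⌊ spine e /2⌋

  double-≤ : ∀ {u w} → u + u ≤ suc (w + w) → u ≤ w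
  double-≤ {u} {w} p = ≮⇒≥ λ w<u → <⇒≱ (≤-trans (≤-reflexive (cong suc (sym (+-suc w w)))) (+-mono-≤ w<u w<u)) p

  round-≤ : ∀ o o′ {u w} → (bit o + (u + u) ≤ bit o′ + (w + w) → rounding o o′ u ≤ w)
                         × (rounding o o′ u ≤ w → bit o + (u + u) ≤ bit o′ + (w + w))
  round-≤ true  true  = (λ p → double-≤ (m≤n⇒m≤1+n (s≤s⁻¹ p))) , (λ q → s≤s (+-mono-≤ q q))
  round-≤ true  false {u} {w} = (λ p → double-≤ (≤-trans (≤-reflexive (cong suc (+-suc u u))) (s≤s p))) ,
    (λ q → ≤-trans (n≤1+n _) (≤-trans (≤-reflexive (cong suc (sym (+-suc u u)))) (+-mono-≤ q q)))
  round-≤ false true  = double-≤ , (λ q → m≤n⇒m≤1+n (+-mono-≤ q q))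
  round-≤ false false = (λ p → double-≤ (m≤n⇒m≤1+n p)) , (λ q → +-mono-≤ q q)

  rounding-+ : ∀ o o′ p u → rounding o o′ (p + u) ≡ p + rounding o o′ u
  rounding-+ true  true  p u = refl
  rounding-+ true  false p u = sym (+-suc p u)
  rounding-+ false o′    p u = refl

  rounding≤ : ∀ o o′ u → rounding o o′ u ≤ suc u
  rounding≤ true  true  u = n≤1+n u
  rounding≤ true  false u = ≤-refl
  rounding≤ false o′    u = n≤1+n u

  -- Write e = o + 2u and f = o′ + 2w with parities o and o′. Replacing e and f by u and w in the
  -- halved condition is an equivalence except when e is odd and f is even, and in that case u has
  -- to be raised by 1.
  halving : ∀ P Q e f → (P + P + e ≤ᵇ Q + Q + f) ≡ (P + rounding (odd e) (odd f) ⌊ e /2⌋ ≤ᵇ Q + ⌊ f /2⌋)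
  halving P Q e f = begin
    (P + P + e ≤ᵇ Q + Q + f)
      ≡⟨ cong₂ _≤ᵇ_ (split P e) (split Q f) ⟩
    (bit (odd e) + ((P + ⌊ e /2⌋) + (P + ⌊ e /2⌋)) ≤ᵇ bit (odd f) + ((Q + ⌊ f /2⌋) + (Q + ⌊ f /2⌋)))
      ≡⟨ ≤ᵇ-ext (proj₁ (round-≤ (odd e) (odd f))) (proj₂ (round-≤ (odd e) (odd f))) ⟩
    (rounding (odd e) (odd f) (P + ⌊ e /2⌋) ≤ᵇ Q + ⌊ f /2⌋)
      ≡⟨ cong (_≤ᵇ Q + ⌊ f /2⌋) (rounding-+ (odd e) (odd f) P ⌊ e /2⌋) ⟩
    (P + rounding (odd e) (odd f) ⌊ e /2⌋ ≤ᵇ Q + ⌊ f /2⌋) ∎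
    where
    open ≡-Reasoning
    split : ∀ P e → P + P + e ≡ bit (odd e) + ((P + ⌊ e /2⌋) + (P + ⌊ e /2⌋))
    split P e = trans (cong (P + P +_) (bit-odd e)) (lem P (bit (odd e)) ⌊ e /2⌋)
      where
      lem : ∀ P b h → P + P + (b + (h + h)) ≡ b + ((P + h) + (P + h))
      lem = solve-∀

  module _ (a b : Tree) (x y : ℕᵇ) where
    private
      m = spine a
      n = spine b

    room : ℕ → ℕ
    room m = 2 + (m + m)

    -- 2m + 2 is a stable bound for a carry: adding at most two copies of m and halving gives at
    -- most 2m + 1, which leaves 1 for rounding up.
    halves : ∀ d m e → d ≤ 2 → e ≤ room m → ⌊ d * m + e /2⌋ ≤ suc (m + m)
    halves d m e d≤ e≤ = ≤-trans (⌊n/2⌋-mono (≤-trans (+-mono-≤ (*-monoˡ-≤ m d≤) e≤) (≤-reflexive (lem m))))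
      (≤-reflexive (sym (n≡⌊n+n/2⌋ (suc (m + m)))))
      where
      lem : ∀ m → 2 * m + (2 + (m + m)) ≡ suc (m + m) + suc (m + m)
      lem = solve-∀

    digit≤2 : ∀ x → digit x ≤ 2
    digit≤2 ℕᵇ.zero  = z≤n
    digit≤2 2[1+ x ] = ≤-refl
    digit≤2 1+[2 x ] = s≤s z≤n

    -- The loop invariant: the digits still to be processed, together with the carries, decide the
    -- original comparison.
    Holds≤ : Tree → Set
    Holds≤ s = spine (left (right s)) ≤ room m × spine (right (right s)) ≤ room n ×
      (m * toℕ (tailsᵇ (spine (left s)) x) + spine (left (right s)) ≤ᵇ n * toℕ (tailsᵇ (spine (left s)) y) + spine (right (right s)))
        ≡ (m * toℕ x ≤ᵇ n * toℕ y)

    leqBody : Tree → Tree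
    leqBody s = run leqStep (s ∷ a ∷ codeℕᵇ x ∷ b ∷ codeℕᵇ y ∷ [])

    run-leqStep : ∀ s → Holds≤ s → Holds≤ (leqBody s) × spine (left (leqBody s)) ≡ suc (spine (left s))
    run-leqStep s (e≤ , f≤ , eq) =
      (subst (_≤ room m) (sym E′≡) (≤-trans (rounding≤ (odd e₁) (odd f₁) ⌊ e₁ /2⌋) (s≤s e₁≤)) ,
       subst (_≤ room n) (sym F′≡) (≤-trans f₁≤ (n≤1+n _)) ,
       trans (cong₂ (λ u v → m * toℕ (tailᵇ xj) + u ≤ᵇ n * toℕ (tailᵇ yj) + v) E′≡ F′≡)
         (trans (sym (halving (m * toℕ (tailᵇ xj)) (n * toℕ (tailᵇ yj)) e₁ f₁))
           (trans (sym (cong₂ _≤ᵇ_ (expand m xj (spine (left (right s)))) (expand n yj (spine (right (right s)))))) eq))) ,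
      refl
      where
      j = spine (left s)
      xj = tailsᵇ j x
      yj = tailsᵇ j y
      e₁ = digit xj * m + spine (left (right s))
      f₁ = digit yj * n + spine (right (right s))
      e₁≤ = halves (digit xj) m (spine (left (right s))) (digit≤2 xj) e≤
      f₁≤ = halves (digit yj) n (spine (right (right s))) (digit≤2 yj) f≤
      E₁ = run carryF (run subF (codeℕᵇ x ∷ left s ∷ []) ∷ a ∷ left (right s) ∷ [])
      F₁ = run carryF (run subF (codeℕᵇ y ∷ left s ∷ []) ∷ b ∷ right (right s) ∷ [])
      drop : ∀ x → run subF (codeℕᵇ x ∷ left s ∷ []) ≡ codeℕᵇ (tailsᵇ j x)
      drop x = trans (run-sub (codeℕᵇ x) (left s)) (rights-code j x)
      E₁≡ : spine E₁ ≡ e₁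
      E₁≡ = trans (cong (λ t → spine (run carryF (t ∷ a ∷ left (right s) ∷ []))) (drop x)) (spine-carry xj a (left (right s)))
      F₁≡ : spine F₁ ≡ f₁
      F₁≡ = trans (cong (λ t → spine (run carryF (t ∷ b ∷ right (right s) ∷ []))) (drop y)) (spine-carry yj b (right (right s)))
      hE = run halfF (E₁ ∷ node leaf (run appF (a ∷ a ∷ [])) ∷ [])
      hF = run halfF (F₁ ∷ node leaf (run appF (b ∷ b ∷ [])) ∷ [])
      hE≡ : hE ≡ un ⌊ spine E₁ /2⌋
      hE≡ = run-half E₁ (node leaf (run appF (a ∷ a ∷ []))) (subst₂ (λ u v → ⌊ u /2⌋ ≤ suc v) (sym E₁≡) (sym (spine-app a a)) e₁≤)
      hF≡ : hF ≡ un ⌊ spine F₁ /2⌋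
      hF≡ = run-half F₁ (node leaf (run appF (b ∷ b ∷ []))) (subst₂ (λ u v → ⌊ u /2⌋ ≤ suc v) (sym F₁≡) (sym (spine-app b b)) f₁≤)
      E′≡ : spine (left (right (leqBody s))) ≡ rounding (odd e₁) (odd f₁) ⌊ e₁ /2⌋
      E′≡ = trans (run-round E₁ F₁ hE hF hE≡ hF≡) (cong₂ (λ u v → rounding (odd u) (odd v) ⌊ u /2⌋) E₁≡ F₁≡)
      F′≡ : spine (right (right (leqBody s))) ≡ ⌊ f₁ /2⌋
      F′≡ = trans (cong spine hF≡) (trans (spine-un ⌊ spine F₁ /2⌋) (cong ⌊_/2⌋ F₁≡))
      expand : ∀ m z e → m * toℕ z + e ≡ m * toℕ (tailᵇ z) + m * toℕ (tailᵇ z) + (digit z * m + e)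
      expand m z e = trans (cong (λ u → m * u + e) (toℕ-digit z)) (lem m (digit z) (toℕ (tailᵇ z)) e)
        where
        lem : ∀ m d t e → m * (d + (t + t)) + e ≡ m * t + m * t + (d * m + e)
        lem = solve-∀

    leqRuns : ∀ c s → Holds≤ s → let s′ = fold (λ s _ → leqBody s) s c in
              Holds≤ s′ × spine (left s′) ≡ spine c + spine (left s)
    leqRuns leaf       s h = h , refl
    leqRuns (node _ c) s h =
      let h₁ , eq₁ = run-leqStep s h
          h₂ , eq₂ = leqRuns c (leqBody s) h₁
      in h₂ , trans eq₂ (trans (cong (spine c +_) eq₁) (+-suc (spine c) (spine (left s))))

    run-leq : run leqF (a ∷ codeℕᵇ x ∷ b ∷ codeℕᵇ y ∷ []) ≡ codeBool (spine a * toℕ x ≤ᵇ spine b * toℕ y)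
    run-leq = begin
      iteT (run subF (E ∷ F ∷ [])) leaf (node leaf leaf)
        ≡⟨ iteT-if (run subF (E ∷ F ∷ [])) leaf (node leaf leaf) ⟩
      (if truth (run subF (E ∷ F ∷ [])) then leaf else node leaf leaf)
        ≡⟨ cong (λ t → if t then leaf else node leaf leaf) (truth-sub E F) ⟩
      (if spine F <ᵇ spine E then leaf else node leaf leaf)
        ≡⟨ ≤ᵇ-not (spine E) (spine F) ⟩
      codeBool (spine E ≤ᵇ spine F)
        ≡⟨ cong codeBool (cong₂ _≤ᵇ_ (zeroed m x (spine E) x≤) (zeroed n y (spine F) y≤)) ⟨
      codeBool (m * toℕ (tailsᵇ j x) + spine E ≤ᵇ n * toℕ (tailsᵇ j y) + spine F)
        ≡⟨ cong codeBool (proj₂ (proj₂ (proj₁ runs))) ⟩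
      codeBool (m * toℕ x ≤ᵇ n * toℕ y) ∎
      where
      open ≡-Reasoning
      -- One round for each digit of x and of y, so both are exhausted at the end and only the
      -- carries remain.
      clock = run appF (codeℕᵇ x ∷ codeℕᵇ y ∷ [])
      s′ = fold (λ s _ → leqBody s) leaf clock
      E = left (right s′)
      F = right (right s′)
      j = spine (left s′)
      runs : Holds≤ s′ × spine (left s′) ≡ spine clock + 0
      runs = leqRuns clock leaf (z≤n , z≤n , cong₂ _≤ᵇ_ (+-identityʳ (m * toℕ x)) (+-identityʳ (n * toℕ y)))
      j≡ : j ≡ spine (codeℕᵇ x) + spine (codeℕᵇ y)
      j≡ = trans (proj₂ runs) (trans (+-identityʳ _) (spine-app (codeℕᵇ x) (codeℕᵇ y)))
      x≤ : spine (codeℕᵇ x) ≤ j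
      x≤ = subst (spine (codeℕᵇ x) ≤_) (sym j≡) (m≤m+n _ _)
      y≤ : spine (codeℕᵇ y) ≤ j
      y≤ = subst (spine (codeℕᵇ y) ≤_) (sym j≡) (m≤n+m _ _)
      zeroed : ∀ m z e → spine (codeℕᵇ z) ≤ j → m * toℕ (tailsᵇ j z) + e ≡ e
      zeroed m z e z≤ = trans (cong (λ u → m * u + e) (tails-zero j z z≤)) (cong (_+ e) (*-zeroʳ m))
      ≤ᵇ-not : ∀ e f → (if f <ᵇ e then leaf else node leaf leaf) ≡ codeBool (e ≤ᵇ f)
      ≤ᵇ-not zero    f = refl
      ≤ᵇ-not (suc e) zero = refl
      ≤ᵇ-not (suc e) (suc f) = trans (≤ᵇ-not e f) (cong codeBool (lem e f))
        where
        lem : ∀ e f → (e ≤ᵇ f) ≡ (e <ᵇ suc f)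
        lem zero    f = refl
        lem (suc e) f = refl

-- Correctness of the operations on assignments, constraints and values.

module Values where
  open Machine
  open Terms
  open Numbers
  open Leq
  open import Defs hiding (_^_; eval; if_then_else_)
  open import Data.Bool.Base using (Bool; true; false; if_then_else_)
  open import Data.Fin.Base as Fin using (Fin; zero; suc; toℕ)
  open import Data.Fin.Properties using (toℕ<n)
  open import Data.List.Base as List using (List; []; _∷_; [_]; _++_; foldl; length; filterᵇ)
  open import Data.List.Membership.Propositional using (_∈_)
  open import Data.List.Membership.Propositional.Properties using (∈-map⁺; ∈-++⁺ˡ; ∈-++⁺ʳ; ∈-cartesianProductWith⁺)
  open import Data.List.Relation.Unary.Any using (here; there)
  open import Data.Nat.Base
  open import Data.Nat.Properties
  open import Data.Nat.Binary.Base using (fromℕ)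
  open import Data.Nat.Binary.Properties using (toℕ-fromℕ)
  open import Data.Sign.Base using (Sign) renaming (+ to ⊕; - to ⊖)
  open import Data.Vec.Base as Vec using (Vec; []; _∷_; lookup; tabulate)
  open import Function.Base using (_∘_)
  open import Relation.Binary.PropositionalEquality using (_≡_; refl; sym; trans; cong; cong₂; subst)

  codeFin : ∀ {n} → Fin n → Tree
  codeFin i = un (toℕ i)

  -- Decreasing, so that a left fold which conses one entry per index yields the entries in
  -- increasing order.
  idxs : ∀ n → List (Fin n)
  idxs zero    = []
  idxs (suc n) = List.map suc (idxs n) ++ [ zero ]

  ∈-idxs : ∀ {n} (i : Fin n) → i ∈ idxs n
  ∈-idxs {suc n} zero    = ∈-++⁺ʳ (List.map suc (idxs n)) (here refl)
  ∈-idxs {suc n} (suc i) = ∈-++⁺ˡ (∈-map⁺ suc (∈-idxs i))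

  codeIdx : ℕ → Tree
  codeIdx n = codeList codeFin (idxs n)

  codeSigns : ∀ {n} → Vec Sign n → Tree
  codeSigns = codeVec codeSign

  _≡ᶠ_ : ∀ {n} → Fin n → Fin n → Bool
  i ≡ᶠ j = toℕ i ≡ᵇ toℕ j

  sw : ∀ {n} → Fin n → Fin n → Fin n → Fin n
  sw a b i = if i ≡ᶠ a then b else (if i ≡ᶠ b then a else i)

  swap : ∀ {n} → Fin n → Fin n → Assignment n → Assignment n
  swap a b α = tabulate (λ i → lookup α (sw a b i))

  #⊖ #⊕ : ∀ {n} → Vec Sign n → ℕ
  #⊖ []      = 0
  #⊖ (⊖ ∷ α) = suc (#⊖ α)
  #⊖ (⊕ ∷ α) = #⊖ α
  #⊕ []      = 0
  #⊕ (⊖ ∷ α) = #⊕ α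
  #⊕ (⊕ ∷ α) = suc (#⊕ α)

  #⊖≤ : ∀ {n} (α : Vec Sign n) → #⊖ α ≤ n
  #⊖≤ []      = z≤n
  #⊖≤ (⊖ ∷ α) = s≤s (#⊖≤ α)
  #⊖≤ (⊕ ∷ α) = m≤n⇒m≤1+n (#⊖≤ α)

  fold-list : ∀ {A B : Set} (c : A → Tree) (cB : B → Tree) {g : Tree → Tree → Tree} (h : B → A → B) →
              (∀ b a → g (cB b) (c a) ≡ cB (h b a)) → ∀ b xs → fold g (cB b) (codeList c xs) ≡ cB (foldl h b xs)
  fold-list c cB h e b []       = refl
  fold-list c cB {g} h e b (x ∷ xs) = trans (cong (λ t → fold g t (codeList c xs)) (e b x)) (fold-list c cB h e (h b x) xs)

  -- The recursion behind all folds over the indices: index zero comes last, and before it the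
  -- smaller index list is folded with every index raised by one.
  fold-shift : ∀ g a m → fold g a (codeIdx (suc m)) ≡ g (fold (λ a x → g a (node leaf x)) a (codeIdx m)) leaf
  fold-shift g a m = go a (idxs m)
    where
    go : ∀ a xs → fold g a (codeList codeFin (List.map suc xs ++ [ zero ])) ≡ g (fold (λ a x → g a (node leaf x)) a (codeList codeFin xs)) leaf
    go a []       = refl
    go a (x ∷ xs) = go (g a (node leaf (codeFin x))) xs

  fold-tab : ∀ {A : Set} n (F : Tree → Tree) (c : A → Tree) (f : Fin n → A) → (∀ i → F (codeFin i) ≡ c (f i)) →
             fold (λ a x → node (F x) a) leaf (codeIdx n) ≡ codeVec c (tabulate f)
  fold-tab zero    F c f e = refl
  fold-tab (suc n) F c f e = trans (fold-shift (λ a x → node (F x) a) leaf n)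
    (cong₂ node (e zero) (fold-tab n (F ∘ node leaf) c (f ∘ suc) (e ∘ suc)))

  lift : Tree → Tree
  lift leaf       = node leaf leaf
  lift (node x l) = node (node leaf x) (lift l)

  idx-lift : ∀ {m} (xs : List (Fin m)) → codeList codeFin (List.map suc xs ++ [ zero ]) ≡ lift (codeList codeFin xs)
  idx-lift []       = refl
  idx-lift (x ∷ xs) = cong (node (node leaf (codeFin x))) (idx-lift xs)

  idx-top : ∀ m → codeIdx (suc m) ≡ node (un m) (codeIdx m)
  idx-top zero    = refl
  idx-top (suc m) = trans (idx-lift (idxs (suc m))) (trans (cong lift (idx-top m)) (cong (node (un (suc m))) (sym (idx-lift (idxs m)))))

  spine-list : ∀ {A : Set} (c : A → Tree) xs → spine (codeList c xs) ≡ length xs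
  spine-list c []       = refl
  spine-list c (x ∷ xs) = cong suc (spine-list c xs)

  spine-idx : ∀ m → spine (codeIdx m) ≡ m
  spine-idx zero    = refl
  spine-idx (suc m) = trans (cong spine (idx-top m)) (cong suc (spine-idx m))

  length-idxs : ∀ n → length (idxs n) ≡ n
  length-idxs n = trans (sym (spine-list codeFin (idxs n))) (spine-idx n)

  run-idx : ∀ N → run idxF (N ∷ []) ≡ codeIdx (spine N)
  run-idx N = go 0 N ≤-refl
    where
    go : ∀ m c → m + spine c ≤ spine N →
         fold (λ a _ → node (run clipF (a ∷ N ∷ [])) a) (codeIdx m) c ≡ codeIdx (m + spine c)
    go m leaf       le = cong codeIdx (sym (+-identityʳ m))
    go m (node x c) le = trans (cong (λ t → fold (λ a _ → node (run clipF (a ∷ N ∷ [])) a) t c) top)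
      (trans (go (suc m) c le′) (cong codeIdx (sym (+-suc m (spine c)))))
      where
      le′ : suc m + spine c ≤ spine N
      le′ = subst (_≤ spine N) (+-suc m (spine c)) le
      top : node (run clipF (codeIdx m ∷ N ∷ [])) (codeIdx m) ≡ codeIdx (suc m)
      top = trans (cong (λ t → node t (codeIdx m)) (trans (run-clip (codeIdx m) N)
        (cong un (trans (cong (spine N ⊓_) (spine-idx m)) (m≥n⇒m⊓n≡n (≤-trans (n≤1+n m) (≤-trans (m≤m+n (suc m) (spine c)) le′)))))))
        (sym (idx-top m))

  left-rights : ∀ {A : Set} (c : A → Tree) {n} (α : Vec A n) i → left (rights (toℕ i) (codeVec c α)) ≡ c (lookup α i)
  left-rights c (x ∷ α) zero    = refl
  left-rights c (x ∷ α) (suc i) = trans (cong left (rights-node (toℕ i) (c x) (codeVec c α))) (left-rights c α i)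

  run-get : ∀ {A : Set} (c : A → Tree) {n} (α : Vec A n) i {t} → spine t ≡ toℕ i → run getF (codeVec c α ∷ t ∷ []) ≡ c (lookup α i)
  run-get c α i {t} eq = trans (cong left (run-sub (codeVec c α) t)) (trans (cong (λ j → left (rights j (codeVec c α))) eq) (left-rights c α i))

  eqSign : Sign → Sign → Bool
  eqSign ⊖ ⊖ = true
  eqSign ⊖ ⊕ = false
  eqSign ⊕ ⊖ = false
  eqSign ⊕ ⊕ = true

  eqSigns : ∀ {n} → Vec Sign n → Vec Sign n → Bool
  eqSigns []      []      = true
  eqSigns (s ∷ σ) (t ∷ τ) = if eqSign s t then eqSigns σ τ else false

  run-eqbit : ∀ s t → run eqbitF (codeSign s ∷ codeSign t ∷ []) ≡ codeBool (eqSign s t)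
  run-eqbit ⊖ ⊖ = refl
  run-eqbit ⊖ ⊕ = refl
  run-eqbit ⊕ ⊖ = refl
  run-eqbit ⊕ ⊕ = refl

  iteT-codeBool : ∀ b x y → iteT (codeBool b) x y ≡ (if b then x else y)
  iteT-codeBool true  x y = refl
  iteT-codeBool false x y = refl

  eqSign-≡ : ∀ s t → eqSign s t ≡ true → s ≡ t
  eqSign-≡ ⊖ ⊖ _ = refl
  eqSign-≡ ⊕ ⊕ _ = refl

  eqSigns-≡ : ∀ {n} (σ τ : Vec Sign n) → eqSigns σ τ ≡ true → σ ≡ τ
  eqSigns-≡ []      []      _  = refl
  eqSigns-≡ (s ∷ σ) (t ∷ τ) eq with eqSign s t in e
  ... | true = cong₂ _∷_ (eqSign-≡ s t e) (eqSigns-≡ σ τ eq)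

  eqSigns-refl : ∀ {n} (σ : Vec Sign n) → eqSigns σ σ ≡ true
  eqSigns-refl []      = refl
  eqSigns-refl (⊖ ∷ σ) = eqSigns-refl σ
  eqSigns-refl (⊕ ∷ σ) = eqSigns-refl σ

  ∈-vectors : ∀ {n} (σ : Vec Sign n) → σ ∈ vectors signs n
  ∈-vectors []      = here refl
  ∈-vectors (s ∷ σ) = ∈-cartesianProductWith⁺ _∷_ (∈-signs s) (∈-vectors σ)
    where
    ∈-signs : ∀ s → s ∈ signs
    ∈-signs ⊖ = here refl
    ∈-signs ⊕ = there (here refl)

  anyᵇ : ∀ {A : Set} → (A → Bool) → Bool → List A → Bool
  anyᵇ p = foldl (λ b x → if b then b else p x)

  anyᵇ-true : ∀ {A : Set} (p : A → Bool) xs → anyᵇ p true xs ≡ true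
  anyᵇ-true p []       = refl
  anyᵇ-true p (x ∷ xs) = anyᵇ-true p xs

  -- A predicate reaches the program as the list of its members. Searching that list decides it
  -- because the list of all sign vectors contains `v`.
  any-filter : ∀ {d} (P : Vec Sign d → Bool) v xs → v ∈ xs → anyᵇ (λ q → eqSigns q v) false (filterᵇ P xs) ≡ P v
  any-filter P v xs v∈ with P v in Pv
  ... | true  = found xs v∈
    where
    found : ∀ xs → v ∈ xs → anyᵇ (λ q → eqSigns q v) false (filterᵇ P xs) ≡ true
    found (x ∷ xs) (here refl) rewrite Pv | eqSigns-refl x = anyᵇ-true (λ q → eqSigns q x) (filterᵇ P xs)
    found (x ∷ xs) (there v∈) with P x
    ... | false = found xs v∈
    ... | true with eqSigns x v
    ...   | true  = anyᵇ-true (λ q → eqSigns q v) (filterᵇ P xs)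
    ...   | false = found xs v∈
  ... | false = missing xs
    where
    missing : ∀ xs → anyᵇ (λ q → eqSigns q v) false (filterᵇ P xs) ≡ false
    missing [] = refl
    missing (x ∷ xs) with P x in Px
    ... | false = missing xs
    ... | true with eqSigns x v in e
    ...   | false = missing xs
    ...   | true with refl ← eqSigns-≡ x v e with () ← trans (sym Px) Pv

  ∈ᵇ : ∀ {n} → Fin n → List (Fin n) → Bool
  ∈ᵇ i = foldl (λ b h → if h ≡ᶠ i then true else b) false

  run-mem : ∀ {n} (H : List (Fin n)) i → run memF (codeList codeFin H ∷ codeFin i ∷ []) ≡ codeBool (∈ᵇ i H)
  run-mem H i = fold-list codeFin codeBool _ step false H
    where
    step : ∀ b h → iteT (run eqlenF (codeFin h ∷ codeFin i ∷ [])) (node leaf leaf) (codeBool b) ≡ codeBool (if h ≡ᶠ i then true else b)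
    step b h rewrite run-eqlen (codeFin h) (codeFin i) | spine-un (toℕ h) | spine-un (toℕ i) with h ≡ᶠ i
    ... | true  = refl
    ... | false = refl

  run-swap : ∀ {n} (α : Assignment n) i j → run swapF (codeSigns α ∷ codeFin i ∷ codeFin j ∷ codeIdx n ∷ []) ≡ codeSigns (swap i j α)
  run-swap {n} α i j = fold-tab n F codeSign (λ k → lookup α (sw i j k))
    (λ k → trans (cong (λ t → run getF (codeSigns α ∷ t ∷ [])) (sel k)) (run-get codeSign α (sw i j k) (spine-un (toℕ (sw i j k)))))
    where
    S F : Tree → Tree
    S x = iteT (run eqlenF (x ∷ codeFin i ∷ [])) (codeFin j) (iteT (run eqlenF (x ∷ codeFin j ∷ [])) (codeFin i) x)
    F x = run getF (codeSigns α ∷ S x ∷ [])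
    sel : ∀ k → S (codeFin k) ≡ codeFin (sw i j k)
    sel k rewrite run-eqlen (codeFin k) (codeFin i) | run-eqlen (codeFin k) (codeFin j)
                | spine-un (toℕ k) | spine-un (toℕ i) | spine-un (toℕ j) with k ≡ᶠ i
    ... | true = refl
    ... | false with k ≡ᶠ j
    ...   | true  = refl
    ...   | false = refl

  spine-plus : ∀ {n} (α : Vec Sign n) → spine (run plusF (codeSigns α ∷ [])) ≡ #⊕ α
  spine-plus α = trans (go leaf α) (+-identityʳ (#⊕ α))
    where
    go : ∀ {n} a (α : Vec Sign n) → spine (fold (λ a x → iteT x (node leaf a) a) a (codeSigns α)) ≡ #⊕ α + spine a
    go a []      = refl
    go a (⊖ ∷ α) = go a α
    go a (⊕ ∷ α) = trans (go (node leaf a) α) (+-suc (#⊕ α) (spine a))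

  run-minus : ∀ {n} (α : Vec Sign n) → run minusF (codeSigns α ∷ []) ≡ un (#⊖ α)
  run-minus α = trans (go 0 α) (cong un (+-identityʳ (#⊖ α)))
    where
    go : ∀ {n} m (α : Vec Sign n) → fold (λ a x → iteT x a (node leaf a)) (un m) (codeSigns α) ≡ un (#⊖ α + m)
    go m []      = refl
    go m (⊕ ∷ α) = go m α
    go m (⊖ ∷ α) = trans (go (suc m) α) (cong un (+-suc (#⊖ α) m))

  -- The input of size n in unary is any tree N whose spine has length n.
  module _ {n} (N : Tree) (N≡ : spine N ≡ n) where

    codeVar : Fin n → Tree
    codeVar i = codeℕ (toℕ i)

    get-var : ∀ (α : Assignment n) i →
      run getF (codeSigns α ∷ run unaryC (codeVar i ∷ N ∷ []) ∷ []) ≡ codeSign (lookup α i)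
    get-var α i = run-get codeSign α i (trans (spine-unaryC (fromℕ (toℕ i)) N le) (toℕ-fromℕ (toℕ i)))
      where
      le = subst (_≤ spine N) (sym (toℕ-fromℕ (toℕ i))) (subst (toℕ i ≤_) (sym N≡) (<⇒≤ (toℕ<n i)))

    matchBody : Assignment n → Tree → Tree → Tree
    matchBody α s v = run matchStep (s ∷ v ∷ codeSigns α ∷ N ∷ [])

    match-false : ∀ α {d} (vs : Vec (Fin n) d) → fold (matchBody α) (node leaf leaf) (codeVec codeVar vs) ≡ node leaf leaf
    match-false α []       = refl
    match-false α (v ∷ vs) = match-false α vs

    match-run : ∀ α {d} (vs : Vec (Fin n) d) (q : Vec Sign d) →
      left (fold (matchBody α) (node (node leaf leaf) (codeSigns q)) (codeVec codeVar vs)) ≡ codeBool (eqSigns q (Vec.map (lookup α) vs))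
    match-run α []       []      = refl
    match-run α (v ∷ vs) (s ∷ q) = trans (cong (λ t → left (fold (matchBody α) t (codeVec codeVar vs))) body≡) (rest (eqSign s (lookup α v)) refl)
      where
      body≡ : matchBody α (node (node leaf leaf) (codeSigns (s ∷ q))) (codeVar v)
           ≡ (if eqSign s (lookup α v) then node (node leaf leaf) (codeSigns q) else node leaf leaf)
      body≡ = trans (cong (λ t → iteT (run eqbitF (codeSign s ∷ t ∷ [])) (node (node leaf leaf) (codeSigns q)) (node leaf leaf)) (get-var α v))
        (trans (cong (λ t → iteT t (node (node leaf leaf) (codeSigns q)) (node leaf leaf)) (run-eqbit s (lookup α v)))
               (iteT-codeBool (eqSign s (lookup α v)) _ _))
      rest : ∀ b → eqSign s (lookup α v) ≡ b →
        left (fold (matchBody α) (if b then node (node leaf leaf) (codeSigns q) else node leaf leaf) (codeVec codeVar vs))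
        ≡ codeBool (if b then eqSigns q (Vec.map (lookup α) vs) else false)
      rest true  _ = match-run α vs q
      rest false _ = cong left (match-false α vs)

    run-sat : ∀ {d} (α : Assignment n) (c : Constraint d n) →
              run satF (codeConstraint c ∷ codeSigns α ∷ N ∷ []) ≡ codeBool (satisfies α c)
    run-sat {d} α c = trans (fold-list codeSigns codeBool _ step false (filterᵇ (predicate c) (vectors signs d)))
      (cong codeBool (any-filter (predicate c) v (vectors signs d) (∈-vectors v)))
      where
      v = Vec.map (lookup α) (vars c)
      step : ∀ b q → iteT (codeBool b) (codeBool b) (left (fold (matchBody α) (node (node leaf leaf) (codeSigns q)) (codeVec codeVar (vars c))))
           ≡ codeBool (if b then b else eqSigns q v)
      step true  q = refl
      step false q = match-run α (vars c) q

    spine-val : ∀ {d} (α : Assignment n) (I : CSP d n) →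
                spine (run valF (codeList codeConstraint I ∷ codeSigns α ∷ N ∷ [])) ≡ val I α
    spine-val {d} α I = trans (go leaf I) (+-identityʳ (val I α))
      where
      go : ∀ a (I : CSP d n) → spine (fold (λ a c → iteT (run satF (c ∷ codeSigns α ∷ N ∷ [])) (node leaf a) a) a (codeList codeConstraint I))
                   ≡ val I α + spine a
      go a []      = refl
      go a (c ∷ I) rewrite run-sat α c with satisfies α c
      ... | false = go a I
      ... | true  = trans (go (node leaf a) I) (+-suc (val I α) (spine a))

-- The algorithm on mathematical objects, and its agreement with the terms.

module Algorithm where
  open Machine
  open Terms
  open Numbers
  open Leq
  open Values
  open import Defs hiding (_^_; eval; if_then_else_)
  open import Data.Bool.Base using (Bool; true; false; T; if_then_else_)
  open import Data.Fin.Base as Fin using (Fin; zero; suc; toℕ)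
  open import Data.Integer.Base as ℤ using (+_; -[1+_])
  open import Data.List.Base as List using (List; []; _∷_; [_]; foldl; length)
  open import Data.Nat.Base
  open import Data.Nat.Properties
  open import Data.Nat.Binary.Base using (fromℕ)
  open import Data.Nat.Binary.Properties using (toℕ-fromℕ)
  open import Data.Product.Base using (_×_; _,_; proj₁; proj₂)
  open import Data.Rational.Base as ℚ using (ℚ; ½; 1ℚ; ↥_; ↧ₙ_)
  open import Data.Sign.Base using (Sign) renaming (+ to ⊕; - to ⊖)
  open import Data.Vec.Base as Vec using (Vec; []; _∷_; lookup; tabulate)
  open import Data.Vec.Properties using (lookup∘tabulate)
  open import Relation.Binary.PropositionalEquality using (_≡_; refl; sym; trans; cong; cong₂; module ≡-Reasoning)

  codePoints : ∀ {n} → List (Assignment n) → Tree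
  codePoints = codeList codeSigns

  codeFins : ∀ {n} → List (Fin n) → Tree
  codeFins = codeList codeFin

  expand : ∀ {n} → List (Assignment n) → List (Assignment n)
  expand {n} = foldl (λ acc y → foldl (λ acc i → foldl (λ acc j → swap i j y ∷ acc) acc (idxs n)) acc (idxs n)) []

  run-expand : ∀ {n} (L : List (Assignment n)) → run ballStep (codePoints L ∷ codeIdx n ∷ []) ≡ codePoints (expand L)
  run-expand {n} = fold-list codeSigns codePoints _
    (λ acc y → fold-list codeFin codePoints _
      (λ acc i → fold-list codeFin codePoints _
        (λ acc j → cong (λ t → node t (codePoints acc)) (run-swap y i j))
        acc (idxs n))
      acc (idxs n)) []

  iterate : ∀ {A : Set} → (A → A) → ℕ → A → A
  iterate f zero    a = a
  iterate f (suc m) a = iterate f m (f a)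

  pair-step : ∀ {d n} → CSP d n → Assignment n → List (Fin n) → Fin n → Fin n → List (Fin n)
  pair-step I y H i j = if ∈ᵇ i H then H else (if ∈ᵇ j H then H else
    (if val I y ≡ᵇ val I (swap i j y) then H else (i ∷ j ∷ H)))

  matching : ∀ {d n} → CSP d n → List (Assignment n) → List (Fin n)
  matching {n = n} I = foldl (λ H y → foldl (λ H i → foldl (λ H j → pair-step I y H i j) H (idxs n)) H (idxs n)) []

  -- Descent from a set S of variables exchanges each ⊖ in S with a ⊕ outside, so it needs at least
  -- as many of the latter. A set of at most #⊕ members guarantees this at every point of the slice.
  -- For a larger H the polynomial in all variables serves, which is exact everywhere.
  choose : ∀ {n} → Assignment n → List (Fin n) → List (Fin n)
  choose {n} β H = if #⊕ β <ᵇ length H then idxs n else H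

  codeCSP : ∀ {d n} → CSP d n → Tree
  codeCSP = codeList codeConstraint

  if-code : ∀ {A : Set} (c : A → Tree) b x y → iteT (codeBool b) (c x) (c y) ≡ c (if b then x else y)
  if-code c true  x y = refl
  if-code c false x y = refl

  module _ {d n} (I : CSP d n) (N : Tree) (N≡ : spine N ≡ n) where

    run-pair-step : ∀ y H i j → run pairStep (codeFins H ∷ codeFin j ∷ codeFin i ∷ codeSigns y ∷ codeIdx n ∷ codeCSP I ∷ N ∷ [])
                    ≡ codeFins (pair-step I y H i j)
    run-pair-step y H i j = begin
      iteT (run memF (codeFins H ∷ codeFin i ∷ [])) (codeFins H)
        (iteT (run memF (codeFins H ∷ codeFin j ∷ [])) (codeFins H)
          (iteT (run eqlenF (V₁ ∷ V₂ ∷ [])) (codeFins H) (codeFins (i ∷ j ∷ H))))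
        ≡⟨ cong₂ (λ s t → iteT s (codeFins H) (iteT t (codeFins H) (iteT (run eqlenF (V₁ ∷ V₂ ∷ [])) (codeFins H) (codeFins (i ∷ j ∷ H)))))
             (run-mem H i) (run-mem H j) ⟩
      iteT (codeBool (∈ᵇ i H)) (codeFins H) (iteT (codeBool (∈ᵇ j H)) (codeFins H) (iteT (run eqlenF (V₁ ∷ V₂ ∷ [])) (codeFins H) (codeFins (i ∷ j ∷ H))))
        ≡⟨ cong (λ s → iteT (codeBool (∈ᵇ i H)) (codeFins H) (iteT (codeBool (∈ᵇ j H)) (codeFins H) (iteT s (codeFins H) (codeFins (i ∷ j ∷ H))))) eq ⟩
      iteT (codeBool (∈ᵇ i H)) (codeFins H) (iteT (codeBool (∈ᵇ j H)) (codeFins H) (iteT (codeBool (val I y ≡ᵇ val I (swap i j y))) (codeFins H) (codeFins (i ∷ j ∷ H))))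
        ≡⟨ cong (iteT (codeBool (∈ᵇ i H)) (codeFins H)) (trans (cong (iteT (codeBool (∈ᵇ j H)) (codeFins H))
             (if-code codeFins (val I y ≡ᵇ val I (swap i j y)) H (i ∷ j ∷ H))) (if-code codeFins (∈ᵇ j H) H _)) ⟩
      iteT (codeBool (∈ᵇ i H)) (codeFins H) (codeFins (if ∈ᵇ j H then H else (if val I y ≡ᵇ val I (swap i j y) then H else (i ∷ j ∷ H))))
        ≡⟨ if-code codeFins (∈ᵇ i H) H _ ⟩
      codeFins (pair-step I y H i j) ∎
      where
      open ≡-Reasoning
      V₁ V₂ : Tree
      V₁ = run valF (codeCSP I ∷ codeSigns y ∷ N ∷ [])
      V₂ = run valF (codeCSP I ∷ run swapF (codeSigns y ∷ codeFin i ∷ codeFin j ∷ codeIdx n ∷ []) ∷ N ∷ [])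
      eq : run eqlenF (V₁ ∷ V₂ ∷ []) ≡ codeBool (val I y ≡ᵇ val I (swap i j y))
      eq = trans (run-eqlen V₁ V₂) (cong codeBool (cong₂ _≡ᵇ_ (spine-val N N≡ y I)
        (trans (cong (λ t → spine (run valF (codeCSP I ∷ t ∷ N ∷ []))) (run-swap y i j)) (spine-val N N≡ (swap i j y) I))))

    run-matching : ∀ L → run matchingF (codePoints L ∷ codeIdx n ∷ codeCSP I ∷ N ∷ []) ≡ codeFins (matching I L)
    run-matching = fold-list codeSigns codeFins _
      (λ H y → fold-list codeFin codeFins _ (λ H i → fold-list codeFin codeFins _ (λ H j → run-pair-step y H i j) H (idxs n)) H (idxs n)) []

    run-chosen : ∀ L β → run chosenF (codePoints L ∷ codeSigns β ∷ codeIdx n ∷ N ∷ codeCSP I ∷ []) ≡ codeFins (choose β (matching I L))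
    run-chosen L β = begin
      run chooseF (run matchingF (codePoints L ∷ codeIdx n ∷ codeCSP I ∷ N ∷ []) ∷ codeIdx n ∷ codeSigns β ∷ [])
        ≡⟨ cong (λ t → run chooseF (t ∷ codeIdx n ∷ codeSigns β ∷ [])) (run-matching L) ⟩
      iteT (run subF (codeFins H ∷ run plusF (codeSigns β ∷ []) ∷ [])) (codeFins (idxs n)) (codeFins H)
        ≡⟨ iteT-if (run subF (codeFins H ∷ run plusF (codeSigns β ∷ []) ∷ [])) _ _ ⟩
      (if truth (run subF (codeFins H ∷ run plusF (codeSigns β ∷ []) ∷ [])) then codeFins (idxs n) else codeFins H)
        ≡⟨ cong (λ b → if b then codeFins (idxs n) else codeFins H) (trans (truth-sub (codeFins H) (run plusF (codeSigns β ∷ [])))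
             (cong₂ _<ᵇ_ (spine-plus β) (spine-list codeFin H))) ⟩
      (if #⊕ β <ᵇ length H then codeFins (idxs n) else codeFins H)
        ≡⟨ if-float codeFins (#⊕ β <ᵇ length H) ⟩
      codeFins (choose β H) ∎
      where
      open ≡-Reasoning
      H = matching I L
      if-float : ∀ {A : Set} (c : A → Tree) b {x y} → (if b then c x else c y) ≡ c (if b then x else y)
      if-float c true  = refl
      if-float c false = refl

  mask : ∀ {n} → List (Fin n) → Vec Bool n
  mask H = tabulate (λ i → ∈ᵇ i H)

  run-mask : ∀ {n} (H : List (Fin n)) → run maskF (codeFins H ∷ codeIdx n ∷ []) ≡ codeVec codeBool (mask H)
  run-mask {n} H = fold-tab n (λ x → run memF (codeFins H ∷ x ∷ [])) codeBool (λ i → ∈ᵇ i H) (run-mem H)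

  certifies : ℚ → ℕ → ℕ → Bool
  certifies t m A with ↥ t
  ... | -[1+ _ ] = true
  ... | + u      = A * u ≤ᵇ m * ↧ₙ t

  run-certify : ∀ t {n} (H : List (Fin n)) A → run certifyF (codeℚ t ∷ codeFins H ∷ un A ∷ []) ≡ codeBool (certifies t (length H) A)
  run-certify t H A with ↥ t
  ... | -[1+ _ ] = refl
  ... | + u      = trans (run-leq (un A) (codeFins H) (fromℕ u) (fromℕ (↧ₙ t)))
    (cong codeBool (cong₂ _≤ᵇ_ (cong₂ _*_ (spine-un A) (toℕ-fromℕ u)) (cong₂ _*_ (spine-list codeFin H) (toℕ-fromℕ (↧ₙ t)))))

  -- For p = u / v the first pn entries are ⊖ and the others ⊕.
  base : ∀ n → (u v : ℕ) → Assignment n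
  base n u v = tabulate (λ i → if suc (toℕ i) * v ≤ᵇ n * u then ⊖ else ⊕)

  run-beta : ∀ {n} N → spine N ≡ n → ∀ u v → run betaF (codeIdx n ∷ N ∷ codeℕ u ∷ codeℕ v ∷ []) ≡ codeSigns (base n u v)
  run-beta {n} N N≡ u v = fold-tab n _ codeSign _ λ i →
    trans (cong (λ t → iteT t leaf (node leaf leaf))
      (trans (run-leq (node leaf (codeFin i)) N (fromℕ v) (fromℕ u))
        (cong codeBool (cong₂ _≤ᵇ_ (cong₂ _*_ (cong suc (spine-un (toℕ i))) (toℕ-fromℕ v)) (cong₂ _*_ N≡ (toℕ-fromℕ u))))))
      (if-code codeSign (suc (toℕ i) * v ≤ᵇ n * u) ⊖ ⊕)

  -- An entry: remaining degree and coefficient, evaluation point, and monomial.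
  Entry : ℕ → Set
  Entry m = (ℕ × ℚ) × Vec Sign m × Vec Bool m

  -- The Newton step g(⊕) + (1 - x)/2 · (g(⊖) - g(⊕)), multiplied out. The four terms with
  -- coefficient ±a/2 spend one degree; the last one keeps the value at ⊕ with the degree untouched.
  -- Without a degree left, or for a variable outside the set, only that last term remains.
  extend : ∀ {m} → Bool → List (Entry (suc m)) → Entry m → List (Entry (suc m))
  extend true out ((suc b , a) , B , T) =
    ((b , ½ ℚ.* a) , ⊖ ∷ B , false ∷ T) ∷ ((b , ℚ.- (½ ℚ.* a)) , ⊖ ∷ B , true ∷ T) ∷
    ((b , ℚ.- (½ ℚ.* a)) , ⊕ ∷ B , false ∷ T) ∷ ((b , ½ ℚ.* a) , ⊕ ∷ B , true ∷ T) ∷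
    ((suc b , a) , ⊕ ∷ B , false ∷ T) ∷ out
  extend _ out (q , B , T) = (q , ⊕ ∷ B , false ∷ T) ∷ out

  entries : ∀ {n} → ℕ → Vec Bool n → List (Entry n)
  entries d []      = [ (d , 1ℚ) , [] , [] ]
  entries d (s ∷ S) = foldl (extend s) [] (entries d S)

  -- The program does no rational arithmetic: all coefficients that can arise by halving and
  -- negating at most b times are supplied as a tree, and an entry descends in it.
  coeffs : ℕ → ℚ → Tree
  coeffs zero    a = node (codeℚ a) leaf
  coeffs (suc b) a = node (codeℚ a) (node (coeffs b (½ ℚ.* a)) (coeffs b (ℚ.- (½ ℚ.* a))))

  left-coeffs : ∀ b a → left (coeffs b a) ≡ codeℚ a
  left-coeffs zero    a = refl
  left-coeffs (suc b) a = refl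

  codeEntry : ∀ {m} → Entry m → Tree
  codeEntry ((b , a) , B , T) = node (coeffs b a) (node (codeSigns B) (codeVec codeBool T))

  codeEntries : ∀ {m} → List (Entry m) → Tree
  codeEntries = codeList codeEntry

  run-entryStep : ∀ {m} s (L : List (Entry m)) → run entryStep (codeEntries L ∷ codeBool s ∷ []) ≡ codeEntries (foldl (extend s) [] L)
  run-entryStep s L = fold-list codeEntry codeEntries (extend s) (step s) [] L
    where
    step : ∀ {m} s (out : List (Entry (suc m))) e →
      (λ a x → run entryStepBody (a ∷ x ∷ codeEntries L ∷ codeBool s ∷ [])) (codeEntries out) (codeEntry e) ≡ codeEntries (extend s out e)
    step true  out ((suc b , a) , B , T) = refl
    step true  out ((zero  , a) , B , T) = refl
    step false out ((suc b , a) , B , T) = refl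
    step false out ((zero  , a) , B , T) = refl

  fold-entries : ∀ {n} d (S : Vec Bool n) g → (∀ {m} (L : List (Entry m)) i → g (codeEntries L) (codeFin i) ≡ codeEntries (foldl (extend (lookup S i)) [] L)) →
    fold g (codeEntries ([ ((d , 1ℚ) , [] , []) ])) (codeIdx n) ≡ codeEntries (entries d S)
  fold-entries d []      g h = refl
  fold-entries {suc n} d (s ∷ S) g h = trans (fold-shift g _ n)
    (trans (cong (λ t → g t leaf) (fold-entries d S (λ a x → g a (node leaf x)) (λ L i → h L (suc i)))) (h (entries d S) zero))

  run-entryLoop : ∀ {m n} (H : List (Fin n)) (L : List (Entry m)) i →
    run entryLoop (codeEntries L ∷ codeFin i ∷ codeFins H ∷ []) ≡ codeEntries (foldl (extend (lookup (mask H) i)) [] L)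
  run-entryLoop H L i =
    trans (cong (λ t → run entryStep (codeEntries L ∷ t ∷ [])) (trans (run-mem H i) (cong codeBool (sym (lookup∘tabulate (λ i → ∈ᵇ i H) i)))))
          (run-entryStep (lookup (mask H) i) L)

  run-entries : ∀ {n} d (H : List (Fin n)) →
    fold (λ a x → run entryLoop (a ∷ x ∷ codeFins H ∷ [])) (codeEntries ([ ((d , 1ℚ) , [] , []) ])) (codeIdx n) ≡ codeEntries (entries d (mask H))
  run-entries {n} d H = fold-entries d (mask H) _ (run-entryLoop H)

  fill-step : ∀ {m} → Bool → Sign → ℕ × Vec Sign m → ℕ × Vec Sign (suc m)
  fill-step true  b (q , z)     = q , b ∷ z
  fill-step false b (zero , z)  = zero , ⊕ ∷ z
  fill-step false b (suc q , z) = q , ⊖ ∷ z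

  fill : ∀ {n} → Vec Bool n → Vec Sign n → ℕ → ℕ × Vec Sign n
  fill []      []      q = q , []
  fill (s ∷ S) (b ∷ B) q = fill-step s b (fill S B q)

  -- The point which agrees with B on S and whose first entries outside S make the number of ⊖ equal to k.
  complete : ∀ {n} → ℕ → Vec Bool n → Vec Sign n → Vec Sign n
  complete k S B = proj₂ (fill S B (k ∸ #⊖ B))

  codeFill : ∀ {m} → ℕ × Vec Sign m → Tree
  codeFill (q , z) = node (un q) (codeSigns z)

  fill-step≤ : ∀ {m} s b (f : ℕ × Vec Sign m) → proj₁ (fill-step s b f) ≤ proj₁ f
  fill-step≤ true  b (q , z)     = ≤-refl
  fill-step≤ false b (zero , z)  = ≤-refl
  fill-step≤ false b (suc q , z) = n≤1+n q

  fill≤ : ∀ {n} (S : Vec Bool n) B q → proj₁ (fill S B q) ≤ q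
  fill≤ []      []      q = ≤-refl
  fill≤ (s ∷ S) (b ∷ B) q = ≤-trans (fill-step≤ s b (fill S B q)) (fill≤ S B q)

  fold-fill : ∀ {n} M (S : Vec Bool n) B g q → q ≤ M →
    (∀ {m} (f : ℕ × Vec Sign m) i → proj₁ f ≤ M → g (codeFill f) (codeFin i) ≡ codeFill (fill-step (lookup S i) (lookup B i) f)) →
    fold g (node (un q) leaf) (codeIdx n) ≡ codeFill (fill S B q)
  fold-fill M []      []      g q q≤ h = refl
  fold-fill {suc n} M (s ∷ S) (b ∷ B) g q q≤ h = trans (fold-shift g _ n)
    (trans (cong (λ t → g t leaf) (fold-fill M S B (λ a x → g a (node leaf x)) q q≤ (λ f i → h f (suc i))))
           (h (fill S B q) zero (≤-trans (fill≤ S B q) q≤)))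

  rights-un : ∀ j k → rights j (un k) ≡ un (k ∸ j)
  rights-un zero    k = refl
  rights-un (suc j) k = trans (cong right (rights-un j k)) (trans (lem (k ∸ j)) (cong un (pred[m∸n]≡m∸[1+n] k j)))
    where
    lem : ∀ m → right (un m) ≡ un (pred m)
    lem zero    = refl
    lem (suc m) = refl

  codeTerm : ∀ {n} → Term n → Tree
  codeTerm (a , S) = node (codeℚ a) (codeVec codeBool S)

  codePoly : ∀ {n} → Poly n → Tree
  codePoly = codeList codeTerm

  outputs : ∀ {d n} → CSP d n → ℕ → Vec Bool n → List (Entry n) → Poly n
  outputs I k S = foldl (λ g ((_ , a) , B , T) → foldl (λ g c → if satisfies (complete k S B) c then (a , T) ∷ g else g) g I) []

  code-kernel : ∀ {n} S (g : Poly n) → codeOutput (kernel S g) ≡ node (codeVec codeBool S) (codePoly g)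
  code-kernel S g = cong (node (codeVec codeBool S)) (go g)
    where
    go : ∀ g → right (codeOutput (kernel S g)) ≡ codePoly g
    go []      = refl
    go (x ∷ g) = cong (node (codeTerm x)) (go g)

  algorithm : ∀ {d n} → ℕ → CSP d n → ℚ → (u v : ℕ) → Output n
  algorithm {d} {n} A I t u v =
    let β = base n u v
        H = choose β (matching I (iterate expand d (β ∷ [])))
    in if certifies t (length H) A then OPT≥AVG+t
       else kernel (mask H) (outputs I (#⊖ β) (mask H) (entries d (mask H)))

  module _ {n} (N : Tree) (N≡ : spine N ≡ n) where

    run-fill-step : ∀ {m} (H : List (Fin n)) (B : Vec Sign n) (f : ℕ × Vec Sign m) i → proj₁ f ≤ n →
      run fillStep (codeFill f ∷ codeFin i ∷ codeSigns B ∷ codeFins H ∷ N ∷ []) ≡ codeFill (fill-step (lookup (mask H) i) (lookup B i) f)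
    run-fill-step H B f@(q , z) i q≤ = trans
      (cong₂ (λ s t → iteT s (node (run clipF (un q ∷ N ∷ [])) (node t (codeSigns z)))
        (iteT (un q) (node (run clipF (right (un q) ∷ N ∷ [])) (node leaf (codeSigns z))) (node leaf (node (node leaf leaf) (codeSigns z)))))
        (trans (run-mem H i) (cong codeBool (sym (lookup∘tabulate (λ i → ∈ᵇ i H) i)))) (run-get codeSign B i (spine-un (toℕ i))))
      (cases (lookup (mask H) i) q q≤)
      where
      clip-un : ∀ q → q ≤ n → run clipF (un q ∷ N ∷ []) ≡ un q
      clip-un q q≤ = trans (run-clip (un q) N) (cong un (trans (cong₂ _⊓_ N≡ (spine-un q)) (m≥n⇒m⊓n≡n q≤)))
      cases : ∀ s q → q ≤ n → iteT (codeBool s) (node (run clipF (un q ∷ N ∷ [])) (node (codeSign (lookup B i)) (codeSigns z)))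
        (iteT (un q) (node (run clipF (right (un q) ∷ N ∷ [])) (node leaf (codeSigns z))) (node leaf (node (node leaf leaf) (codeSigns z))))
        ≡ codeFill (fill-step s (lookup B i) (q , z))
      cases true  q       q≤ = cong (λ t → node t (node (codeSign (lookup B i)) (codeSigns z))) (clip-un q q≤)
      cases false zero    q≤ = refl
      cases false (suc q) q≤ = cong (λ t → node t (node leaf (codeSigns z))) (clip-un q (≤-trans (n≤1+n q) q≤))

    run-ext : ∀ (H : List (Fin n)) B k → k ≤ n →
      run extF (codeSigns B ∷ codeFins H ∷ codeIdx n ∷ un k ∷ N ∷ []) ≡ codeSigns (complete k (mask H) B)
    run-ext H B k k≤ = cong right (trans
      (cong (λ t → fold (λ a x → run fillStep (a ∷ x ∷ codeSigns B ∷ codeFins H ∷ N ∷ [])) (node t leaf) (codeIdx n)) need)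
      (fold-fill n (mask H) B _ (k ∸ #⊖ B) (≤-trans (m∸n≤m k (#⊖ B)) k≤) (run-fill-step H B)))
      where
      need : run subF (un k ∷ run minusF (codeSigns B ∷ []) ∷ []) ≡ un (k ∸ #⊖ B)
      need = trans (run-sub (un k) (run minusF (codeSigns B ∷ []))) (trans (rights-un (spine (run minusF (codeSigns B ∷ []))) k)
        (cong (λ j → un (k ∸ j)) (trans (cong spine (run-minus B)) (spine-un (#⊖ B)))))

    run-output : ∀ {d} (I : CSP d n) (H : List (Fin n)) k → k ≤ n → ∀ L →
      run outputF (codeEntries L ∷ codeFins H ∷ codeIdx n ∷ un k ∷ N ∷ codeCSP I ∷ []) ≡ codePoly (outputs I k (mask H) L)
    run-output {d} I H k k≤ L = fold-list codeEntry codePoly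
      (λ g ((_ , a) , B , T) → foldl (λ g c → if satisfies (complete k (mask H) B) c then (a , T) ∷ g else g) g I) step [] L
      where
      loopC : Tree → Tree → Tree → Tree → Tree
      loopC y q T g = fold (λ acc c → iteT (run satF (c ∷ y ∷ N ∷ [])) (node (node q T) acc) acc) g (codeCSP I)
      step : ∀ g (e : Entry n) → loopC (run extF (left (right (codeEntry e)) ∷ codeFins H ∷ codeIdx n ∷ un k ∷ N ∷ []))
                           (left (left (codeEntry e))) (right (right (codeEntry e))) (codePoly g)
        ≡ codePoly (foldl (λ g c → if satisfies (complete k (mask H) (proj₁ (proj₂ e))) c then (proj₂ (proj₁ e) , proj₂ (proj₂ e)) ∷ g else g) g I)
      step g ((b , a) , B , T) = trans
        (cong₂ (λ y q → loopC y q (codeVec codeBool T) (codePoly g)) (run-ext H B k k≤) (left-coeffs b a))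
        (fold-list codeConstraint codePoly (λ g c → if satisfies (complete k (mask H) B) c then (a , T) ∷ g else g)
          (λ g c → trans (cong (λ t → iteT t (codePoly ((a , T) ∷ g)) (codePoly g)) (run-sat N N≡ (complete k (mask H) B) c))
                         (if-code codePoly (satisfies (complete k (mask H) B) c) ((a , T) ∷ g) g)) g I)

    run-answer : ∀ {d} (I : CSP d n) (H : List (Fin n)) (β : Assignment n) → #⊖ β ≤ n → ∀ L →
      run answerF (codeEntries L ∷ codeFins H ∷ codeIdx n ∷ codeSigns β ∷ N ∷ codeCSP I ∷ [])
      ≡ node (codeVec codeBool (mask H)) (codePoly (outputs I (#⊖ β) (mask H) L))
    run-answer I H β k≤ L = cong₂ node (run-mask H)
      (trans (cong (λ t → run outputF (codeEntries L ∷ codeFins H ∷ codeIdx n ∷ t ∷ N ∷ codeCSP I ∷ [])) (run-minus β))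
             (run-output I H (#⊖ β) k≤ L))

-- Bounds for the three loops of `main` whose accumulators grow by a factor in each round.

module Running where
  open Machine
  open Growth
  open Terms
  open Numbers

  open Values
  open Algorithm
  open import Defs hiding (_^_; eval; if_then_else_)
  open import Data.Bool.Base using (Bool; true; false; T; if_then_else_)
  open import Data.Fin.Base as Fin using (Fin; zero; suc; toℕ)
  open import Data.Integer.Base as ℤ using (+_)
  open import Data.List.Base as List using (List; []; _∷_; [_]; foldl; length)
  open import Data.List.Relation.Unary.All as All using (All; []; _∷_)
  open import Data.Nat.Base
  open import Data.Nat.Properties
  open import Data.Nat.Binary.Base as ℕᵇ using (ℕᵇ; 2[1+_]; 1+[2_]; fromℕ)
  open import Data.Nat.Binary.Properties using (toℕ-fromℕ)
  open import Data.Product.Base using (_×_; _,_; Σ-syntax; proj₁; proj₂)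
  open import Data.Rational.Base as ℚ using (ℚ; ½; 1ℚ; ↥_; ↧ₙ_)
  open import Data.Sign.Base using (Sign) renaming (+ to ⊕; - to ⊖)
  open import Data.Unit.Base using (tt)
  open import Data.Vec.Base as Vec using (Vec; []; _∷_; lookup)
  open import Relation.Binary.PropositionalEquality using (_≡_; refl; sym; trans; cong; subst)
  open import Data.Nat.Tactic.RingSolver using (solve-∀)

  acc-mono : ∀ {g B B′ a l} → B ≤ B′ → AccB g B a l → AccB g B′ a l
  acc-mono B≤ (done p)   = done (≤-trans p B≤)
  acc-mono B≤ (next p A) = next (≤-trans p B≤) (acc-mono B≤ A)

  size-un : ∀ m → size (un m) ≡ suc (m + m)
  size-un zero    = refl
  size-un (suc m) = cong suc (trans (cong suc (size-un m)) (cong suc (sym (+-suc m m))))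

  run-app : ∀ a z → run appF (un a ∷ un z ∷ []) ≡ un (a + z)
  run-app zero    z = refl
  run-app (suc a) z = trans (run-app a (suc z)) (cong un (+-suc a z))

  unary-exact : ∀ b → foldr′ unaryStep leaf (codeℕᵇ b) ≡ un (ℕᵇ.toℕ b)
  unary-exact ℕᵇ.zero  = refl
  unary-exact 2[1+ b ] rewrite unary-exact b = cong (node leaf) (trans (cong (node leaf) (run-app (ℕᵇ.toℕ b) (ℕᵇ.toℕ b))) (cong un (lem (ℕᵇ.toℕ b))))
    where
    lem : ∀ m → suc (m + m) ≡ m + suc (m + 0)
    lem = solve-∀
  unary-exact 1+[2 b ] rewrite unary-exact b = cong (node leaf) (trans (run-app (ℕᵇ.toℕ b) (ℕᵇ.toℕ b)) (cong un (cong (λ m → ℕᵇ.toℕ b + m) (sym (+-identityʳ (ℕᵇ.toℕ b))))))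

  -- The digits are read from the most significant one on, so the accumulators are the values of
  -- successive tails of `b`, none of which exceeds `b`.
  acc-rev : ∀ b B r → size (un (ℕᵇ.toℕ b)) ≤ B → AccB unaryStep B (foldr′ unaryStep leaf (codeℕᵇ b)) r →
            AccB unaryStep B leaf (fold (λ acc x → node x acc) r (codeℕᵇ b))
  smaller : ∀ b {B} → size (un (ℕᵇ.toℕ b)) ≤ B → size (un (ℕᵇ.toℕ (tailᵇ b))) ≤ B
  smaller b le = ≤-trans (≤-reflexive (size-un _)) (≤-trans (s≤s (+-mono-≤ (tail≤ b) (tail≤ b))) (≤-trans (≤-reflexive (sym (size-un _))) le))
  acc-rev ℕᵇ.zero      B r le A = A
  acc-rev b@(2[1+ b′ ]) B r le A = acc-rev b′ B (node leaf r) (smaller b le) (next (subst (λ t → size t ≤ B) (sym (unary-exact b′)) (smaller b le)) A)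
  acc-rev b@(1+[2 b′ ]) B r le A = acc-rev b′ B (node (node leaf leaf) r) (smaller b le) (next (subst (λ t → size t ≤ B) (sym (unary-exact b′)) (smaller b le)) A)

  acc-unary : ∀ n {B} → suc (n + n) ≤ B → AccB unaryStep B leaf (run revF (codeℕ n ∷ []))
  acc-unary n {B} le = acc-rev (fromℕ n) B leaf s≤ (done (subst (λ t → size t ≤ B) (sym (unary-exact (fromℕ n))) s≤))
    where
    s≤ : size (un (ℕᵇ.toℕ (fromℕ n))) ≤ B
    s≤ = ≤-trans (≤-reflexive (trans (size-un _) (cong (λ m → suc (m + m)) (toℕ-fromℕ n)))) le

  size-signs : ∀ {n} (α : Vec Sign n) → size (codeSigns α) ≤ 1 + 4 * n
  size-signs []      = ≤-refl
  size-signs {suc n} (s ∷ α) = ≤-trans (s≤s (+-mono-≤ (sign≤ s) (size-signs α))) (≤-reflexive (lem n))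
    where
    sign≤ : ∀ s → size (codeSign s) ≤ 3
    sign≤ ⊖ = s≤s z≤n
    sign≤ ⊕ = ≤-refl
    lem : ∀ n → suc (3 + (1 + 4 * n)) ≡ 1 + 4 * suc n
    lem = solve-∀

  size-bools : ∀ {n} (S : Vec Bool n) → size (codeVec codeBool S) ≤ 1 + 4 * n
  size-bools []      = ≤-refl
  size-bools {suc n} (s ∷ S) = ≤-trans (s≤s (+-mono-≤ (bool≤ s) (size-bools S))) (≤-reflexive (lem n))
    where
    bool≤ : ∀ s → size (codeBool s) ≤ 3
    bool≤ false = s≤s z≤n
    bool≤ true  = ≤-refl
    lem : ∀ n → suc (3 + (1 + 4 * n)) ≡ 1 + 4 * suc n
    lem = solve-∀

  size-list : ∀ {A : Set} (c : A → Tree) {B} xs → All (λ x → size (c x) ≤ B) xs → size (codeList c xs) ≤ 1 + length xs * suc B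
  size-list c []       []       = ≤-refl
  size-list c {B} (x ∷ xs) (p ∷ ps) = ≤-trans (s≤s (+-mono-≤ p (size-list c xs ps))) (≤-reflexive (lem B (length xs * suc B)))
    where
    lem : ∀ b m → suc (b + (1 + m)) ≡ 1 + (suc b + m)
    lem = solve-∀

  size-points : ∀ {n} (L : List (Assignment n)) → size (codePoints L) ≤ 1 + length L * (2 + 4 * n)
  size-points L = size-list codeSigns L (All.universal (λ α → size-signs α) L)

  length-foldl : ∀ {A B : Set} (g : List B → A → List B) c → (∀ acc a → length (g acc a) ≡ c + length acc) →
                 ∀ acc xs → length (foldl g acc xs) ≡ length xs * c + length acc
  length-foldl g c h acc []       = refl
  length-foldl g c h acc (x ∷ xs) = trans (length-foldl g c h (g acc x) xs)
    (trans (cong (λ m → length xs * c + m) (h acc x)) (lem (length xs * c) c (length acc)))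
    where
    lem : ∀ m c a → m + (c + a) ≡ c + m + a
    lem = solve-∀

  length-expand : ∀ {n} (L : List (Assignment n)) → length (expand L) ≡ length L * (n * n)
  length-expand {n} L = trans (length-foldl _ (n * n)
      (λ acc y → trans (length-foldl _ n (λ acc i → trans (length-foldl _ 1 (λ acc j → refl) acc (idxs n))
          (cong (_+ length acc) (trans (*-identityʳ _) (length-idxs n)))) acc (idxs n))
        (cong (λ m → m * n + length acc) (length-idxs n))) [] L)
    (+-identityʳ _)

  -- A round multiplies the number of points by n²; `suc (n * n)` is used instead so that its powers
  -- are positive even for n = 0.
  ballSize : ℕ → ℕ → ℕ
  ballSize n d = 1 + suc (n * n) ^ d * (2 + 4 * n)

  acc-ball : ∀ {n} d {B} → ballSize n d ≤ B → ∀ (β : Assignment n) {f} → (∀ L x → f (codePoints L) x ≡ codePoints (expand L)) →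
             AccB f B (codePoints [ β ]) (un d) × fold f (codePoints [ β ]) (un d) ≡ codePoints (iterate expand d [ β ])
  acc-ball {n} d {B} B≥ β {f} h = go d [ β ] (≤-reflexive (lem (suc (n * n) ^ d)))
    where
    lem : ∀ m → 1 * m ≡ m
    lem = solve-∀
    fits : ∀ d′ (L : List (Assignment n)) → length L * suc (n * n) ^ d′ ≤ suc (n * n) ^ d → size (codePoints L) ≤ B
    fits d′ L le = ≤-trans (size-points L) (≤-trans (s≤s (*-monoˡ-≤ (2 + 4 * n) (≤-trans (m≤m*n (length L) (suc (n * n) ^ d′) ⦃ m^n≢0 (suc (n * n)) d′ ⦄) le))) B≥)
    go : ∀ d′ (L : List (Assignment n)) → length L * suc (n * n) ^ d′ ≤ suc (n * n) ^ d →
         AccB f B (codePoints L) (un d′) × fold f (codePoints L) (un d′) ≡ codePoints (iterate expand d′ L)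
    go zero     L le = done (fits 0 L le) , refl
    go (suc d′) L le with go d′ (expand L) le′
      where
      le′ : length (expand L) * suc (n * n) ^ d′ ≤ suc (n * n) ^ d
      le′ = ≤-trans (*-monoˡ-≤ (suc (n * n) ^ d′) (≤-trans (≤-reflexive (length-expand L)) (*-monoʳ-≤ (length L) (n≤1+n (n * n)))))
              (≤-trans (≤-reflexive (*-assoc (length L) (suc (n * n)) (suc (n * n) ^ d′))) le)
    ... | A , eq = next (fits (suc d′) L le) (subst (λ t → AccB f B t (un d′)) (sym (h L leaf)) A) ,
                   trans (cong (λ t → fold f t (un d′)) (h L leaf)) eq

  -- An entry with remaining degree b is charged (1 + 4r)^b, a bound for the number of its
  -- descendants after r more variables. One variable produces four entries of degree b - 1 and one
  -- of degree b, and (4 + 1 + 4r) (1 + 4r)^(b - 1) ≤ (1 + 4 (r + 1))^b, so the charge with r + 1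
  -- variables ahead pays for all of them.
  potential : ∀ {m} → ℕ → List (Entry m) → ℕ
  potential r []                    = 0
  potential r (((b , a) , B , T) ∷ L) = suc (4 * r) ^ b + potential r L

  length≤potential : ∀ {m} r (L : List (Entry m)) → length L ≤ potential r L
  length≤potential r []      = z≤n
  length≤potential r (((b , a) , B , T) ∷ L) = +-mono-≤ (m^n>0 (suc (4 * r)) b) (length≤potential r L)

  potential-extend : ∀ {m} r s (out : List (Entry (suc m))) e → potential r (extend s out e) ≤ potential (suc r) [ e ] + potential r out
  potential-extend r true out ((suc b , a) , B , T) = ≤-trans (≤-reflexive (lem (suc (4 * r)) (suc (4 * r) ^ b) (potential r out)))
    (+-monoˡ-≤ (potential r out) (≤-trans (*-mono-≤ (≤-reflexive (lem₂ r)) (^-monoˡ-≤ b (s≤s (*-monoʳ-≤ 4 (n≤1+n r))))) (≤-reflexive (sym (+-identityʳ _)))))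
    where
    lem : ∀ x y p → y + (y + (y + (y + (x * y + p)))) ≡ (4 + x) * y + p
    lem = solve-∀
    lem₂ : ∀ r → 4 + suc (4 * r) ≡ suc (4 * suc r)
    lem₂ = solve-∀
  potential-extend r true out ((zero , a) , B , T) = ≤-refl
  potential-extend r false out ((b , a) , B , T) =
    +-monoˡ-≤ (potential r out) (≤-trans (^-monoˡ-≤ b (s≤s (*-monoʳ-≤ 4 (n≤1+n r)))) (≤-reflexive (sym (+-identityʳ _))))

  potential-foldl : ∀ {m} r s (out : List (Entry (suc m))) L → potential r (foldl (extend s) out L) ≤ potential (suc r) L + potential r out
  potential-foldl r s out []      = ≤-refl
  potential-foldl r s out (e ∷ L) = ≤-trans (potential-foldl r s (extend s out e) L)
    (≤-trans (+-monoʳ-≤ (potential (suc r) L) (potential-extend r s out e)) (≤-reflexive (lem (potential (suc r) L) _ (potential r out))))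
    where
    lem : ∀ l e o → l + (e + 0 + o) ≡ e + l + o
    lem = solve-∀

  potential-entries : ∀ {n} d r (S : Vec Bool n) → potential r (entries d S) ≤ suc (4 * (n + r)) ^ d
  potential-entries d r []      = ≤-reflexive (+-identityʳ _)
  potential-entries {suc n} d r (s ∷ S) = ≤-trans (potential-foldl r s [] (entries d S))
    (≤-trans (≤-reflexive (+-identityʳ _)) (≤-trans (potential-entries d (suc r) S) (≤-reflexive (cong (λ m → suc (4 * m) ^ d) (+-suc n r)))))

  SmallCoeffs : ∀ {m} → ℕ → Entry m → Set
  SmallCoeffs c ((b , a) , B , T) = size (coeffs b a) ≤ c

  small-foldl : ∀ {m} c s (out : List (Entry (suc m))) L → All (SmallCoeffs c) out → All (SmallCoeffs c) L → All (SmallCoeffs c) (foldl (extend s) out L)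
  small-foldl c s out []      o []       = o
  small-foldl c s out (e ∷ L) o (p ∷ ps) = small-foldl c s (extend s out e) L (one s e p) ps
    where
    one : ∀ s e → SmallCoeffs c e → All (SmallCoeffs c) (extend s out e)
    one true ((suc b , a) , B , T) p = l ∷ r ∷ r ∷ l ∷ p ∷ o
      where
      x = size (coeffs b (½ ℚ.* a))
      y = size (coeffs b (ℚ.- (½ ℚ.* a)))
      xy : suc (x + y) ≤ c
      xy = ≤-trans (≤-trans (m≤n+m _ (size (codeℚ a))) (n≤1+n _)) p
      l : x ≤ c
      l = ≤-trans (≤-trans (m≤m+n x y) (n≤1+n _)) xy
      r : y ≤ c
      r = ≤-trans (≤-trans (m≤n+m y x) (n≤1+n _)) xy
    one true  ((zero , a) , B , T)  p = p ∷ o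
    one false ((b , a) , B , T) p = p ∷ o

  small-entries : ∀ {n} d (S : Vec Bool n) → All (SmallCoeffs (size (coeffs d 1ℚ))) (entries d S)
  small-entries d []      = ≤-refl ∷ []
  small-entries d (s ∷ S) = small-foldl _ s [] (entries d S) [] (small-entries d S)

  entriesSize : ℕ → ℕ → ℕ
  entriesSize n d = 1 + suc (4 * n) ^ d * (5 + size (coeffs d 1ℚ) + 8 * n)

  size-entries : ∀ {m n} d (S : Vec Bool m) → m ≤ n → size (codeEntries (entries d S)) ≤ entriesSize n d
  size-entries {m} {n} d S m≤n = ≤-trans (size-list codeEntry (entries d S) (All.map (λ {e} → entry≤ {e}) (small-entries d S)))
    (s≤s (*-mono-≤ (≤-trans (length≤potential 0 (entries d S)) (≤-trans (potential-entries d 0 S)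
      (^-monoˡ-≤ d (s≤s (*-monoʳ-≤ 4 (≤-trans (≤-reflexive (+-identityʳ m)) m≤n)))))) ≤-refl))
    where
    c = size (coeffs d 1ℚ)
    lem : ∀ c n → suc (c + suc ((1 + 4 * n) + (1 + 4 * n))) ≡ 4 + c + 8 * n
    lem = solve-∀
    entry≤ : ∀ {e : Entry m} → SmallCoeffs c e → size (codeEntry e) ≤ 4 + c + 8 * n
    entry≤ {(b , a) , B , T} p = ≤-trans (s≤s (+-mono-≤ p (s≤s (+-mono-≤ (size-signs B) (size-bools T)))))
      (≤-trans (≤-reflexive (lem c m)) (+-monoʳ-≤ (4 + c) (*-monoʳ-≤ 8 m≤n)))

  acc-last : ∀ {g B a} m → AccB (λ a x → g a (node leaf x)) B a (codeIdx m) →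
    size (g (fold (λ a x → g a (node leaf x)) a (codeIdx m)) leaf) ≤ B → AccB g B a (codeIdx (suc m))
  acc-last {g} {B} m A le = go _ (idxs m) A le
    where
    go : ∀ a (xs : List (Fin m)) → AccB (λ a x → g a (node leaf x)) B a (codeList codeFin xs) →
         size (g (fold (λ a x → g a (node leaf x)) a (codeList codeFin xs)) leaf) ≤ B → AccB g B a (codeList codeFin (List.map suc xs List.++ [ zero ]))
    go a []       (done p)   le = next p (done le)
    go a (x ∷ xs) (next p A) le = next p (go _ xs A le)

  acc-entries : ∀ {n N} d (S : Vec Bool n) g → n ≤ N →
    (∀ {m} (L : List (Entry m)) i → g (codeEntries L) (codeFin i) ≡ codeEntries (foldl (extend (lookup S i)) [] L)) →
    AccB g (entriesSize N d) (codeEntries ([ ((d , 1ℚ) , [] , []) ])) (codeIdx n)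
  acc-entries d [] g n≤ h = done (size-entries d [] n≤)
  acc-entries {suc n} {N} d (s ∷ S) g n≤ h = acc-last n
    (acc-entries d S (λ a x → g a (node leaf x)) (≤-trans (n≤1+n n) n≤) (λ L i → h L (suc i)))
    (subst (λ t → size t ≤ entriesSize N d)
      (trans (sym (h (entries d S) zero)) (cong (λ t → g t leaf) (sym (fold-entries d S (λ a x → g a (node leaf x)) (λ L i → h L (suc i))))))
      (size-entries d (s ∷ S) n≤))

  -- The counterpart of `Timed` for a single environment and a known value, for terms whose size is
  -- under control only on meaningful inputs.
  record Does {k} (e : Tm k) (ρ : Vec Tree k) (V : ℕ) (T S : Pol) (v : Tree) : Set where
    constructor does-by
    field
      steps : Exec e ρ V (⟪ T ⟫ V)
      value : run e ρ ≡ v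
      space : size v ≤ ⟪ S ⟫ V
  open Does

  does-timed : ∀ {k} {e : Tm k} (t : Timed e) {ρ V v} → Bd V ρ → run e ρ ≡ v → Does e ρ V (timeP t) (sizeP t) v
  does-timed t B refl = does-by (exec t _ _ B) refl (sized t _ _ B)

  bindT : (T S T′ S′ : Pol) → Pol
  bindT T S T′ S′ = T ⊞ (T′ ⊙ (con 1 ⊞ (S ⊞ X)) ⊞ con 20 ⊠ (con 2 ⊞ S ⊞ S′ ⊙ (con 1 ⊞ (S ⊞ X)) ⊞ X))

  does-bind : ∀ {k} {e : Tm k} {b ρ V T S T′ S′ c v} → Does e ρ V T S c → Does b (c ∷ ρ) (suc (⟪ S ⟫ V + V)) T′ S′ v →
              Does (bind e b) ρ V (bindT T S T′ S′) (S′ ⊙ (con 1 ⊞ (S ⊞ X))) v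
  does-bind {e = e} {b} {ρ} {V} {T} {S} {T′} {S′} (does-by E refl s≤) (does-by E′ refl s′≤) = does-by
    (exec-mono {e = bind e b} ≤-refl (+-monoʳ-≤ (⟪ T ⟫ V) (+-monoʳ-≤ (⟪ T′ ⟫ (suc (⟪ S ⟫ V + V))) (*-monoʳ-≤ 20 (+-monoˡ-≤ V (+-mono-≤ (+-monoʳ-≤ 2 s≤) s′≤)))))
      (exec-bind {e = e} {b} E (exec-mono {e = b} (s≤s (+-monoˡ-≤ V s≤)) ≤-refl E′))) refl s′≤

  does-ifn : ∀ {k} {c a b : Tm k} {ρ V T S T′ S′ x va vb} (t : Timed c) → Bd V ρ → run c ρ ≡ codeBool x →
    Does a ρ V T S va → Does b ρ V T′ S′ vb →
    Does (ifn c a b) ρ V (timeP t ⊞ con 20 ⊠ (con 1 ⊞ (sizeP t ⊞ X)) ⊞ (con 1 ⊞ (T ⊞ T′))) (S ⊞ S′) (if x then va else vb)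
  does-ifn {c = c} {a} {b} {ρ} {V} {x = x} {va} {vb} t B eq (does-by Ea refl sa) (does-by Eb refl sb) = does-by
    (exec-mono {e = ifn c a b} ≤-refl (+-monoˡ-≤ _ (+-monoʳ-≤ (⟪ timeP t ⟫ V) (*-monoʳ-≤ 20 (s≤s (+-monoˡ-≤ V (sized t V ρ B))))))
      (exec-ifn {c = c} {a} {b} (exec t V ρ B) Ea Eb))
    val≡ (subst (λ v → size v ≤ _) val≡ (size-iteT (run c ρ) va vb (≤-trans sa (m≤m+n _ _)) (≤-trans sb (m≤n+m _ _))))
    where
    val≡ : iteT (run c ρ) va vb ≡ (if x then va else vb)
    val≡ = trans (cong (λ t → iteT t va vb) eq) (iteT-codeBool x va vb)

  does-loop : ∀ {k} {l i : Tm k} {b} (tₗ : Timed l) (tᵢ : Timed i) (tb : Timed b) {V ρ v} → Bd V ρ →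
    AccB (λ a x → run b (a ∷ x ∷ ρ)) V (run i ρ) (run l ρ) → run (loop l i b) ρ ≡ v →
    Does (loop l i b) ρ V (loopT (timeP tₗ) (timeP tᵢ) (timeP tb) (sizeP tᵢ) (sizeP tₗ) X) X v
  does-loop {l = l} {i} {b} tₗ tᵢ tb B A refl = does-by (loop-exec {l = l} {i} {b} tₗ tᵢ tb X _ _ B A) refl (acc-result A)

  grow : ∀ {k} {e : Tm k} {ρ V T S v} → Does e ρ V T S v → Bd V ρ → Bd (suc (⟪ S ⟫ V + V)) (v ∷ ρ)
  grow {V = V} {S = S} D B = bd-∷ (≤-trans (space D) (≤-trans (m≤m+n _ V) (n≤1+n _)))
                                 (bd-mono (≤-trans (m≤n+m V (⟪ S ⟫ V)) (n≤1+n _)) B)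

  -- The continuation sees only an upper bound for the enlarged environment, so bounds do not pile up in nested bindings.
  does-step : ∀ {k} {e : Tm k} {b ρ V T S T′ S′ c v} → Bd V ρ → Does e ρ V T S c →
              (∀ V′ → V ≤ V′ → Bd V′ (c ∷ ρ) → Does b (c ∷ ρ) V′ T′ S′ v) → Does (bind e b) ρ V (bindT T S T′ S′) (S′ ⊙ (con 1 ⊞ (S ⊞ X))) v
  does-step {V = V} {S = S} B D rest = does-bind D (rest (suc (⟪ S ⟫ V + V)) (≤-trans (m≤n+m V (⟪ S ⟫ V)) (n≤1+n _)) (grow D B))

  -- Everything that depends on d and on p₀ is passed as data, so the term `main`, and with it the
  -- degree of its time bound, is the same for all of them.
  literals : ℕ → ℕ → Tree
  literals d A = node (un d) (node (un A) (coeffs d 1ℚ))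

  record Fits (n d A Y : ℕ) (inp : Tree) : Set where
    constructor fits-by
    field
      input≤   : size inp ≤ Y
      lits≤    : size (literals d A) ≤ Y
      unary≤   : suc (n + n) ≤ Y
      ball≤    : ballSize n d ≤ Y
      entries≤ : entriesSize n d ≤ Y
  open Fits

  does-main : Σ[ T ∈ Pol ] Σ[ S ∈ Pol ] (∀ {d n} A (I : CSP d n) t p u → ↥ p ≡ + u → ∀ Y → Fits n d A Y (codeInput I t p) →
    Does main (codeInput I t p ∷ literals d A ∷ []) Y T S (codeOutput (algorithm A I t u (↧ₙ p))))
  -- Both polynomials are determined by the composition below. `Y` dominates the input, the
  -- constants and the three accumulator bounds, so each of the three special loops can use the
  -- current space bound for its accumulator.
  does-main = _ , _ , λ {d} {n} A I t p u p≡ Y fits →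
    let β  = base n u (↧ₙ p)
        L  = iterate expand d (β ∷ [])
        H  = choose β (matching I L)
        N  = un n
        N≡ = spine-un n
    in subst (Does main _ Y _ _) (out≡ (certifies t (length H) A) (mask H) (outputs I (#⊖ β) (mask H) (entries d (mask H))))
       (does-step (bd-∷ (input≤ fits) (bd-∷ (lits≤ fits) (bd λ ())))
         (does-loop {l = call1 revF (fst (fst v0))} {lf} {at (i0 ∷ i1 ∷ []) digitF} (timedOf _ tt) (timedOf _ tt) (timedOf _ tt)
           (bd-∷ (input≤ fits) (bd-∷ (lits≤ fits) (bd λ ()))) (acc-unary n (unary≤ fits))
           (trans (fold-rev unaryStep leaf (codeℕ n) leaf) (trans (unary-exact (fromℕ n)) (cong un (toℕ-fromℕ n)))))
       λ V₁ Y≤V₁ B₁ → does-step B₁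
         (does-timed (timedOf (call1 idxF v0) tt) B₁ (trans (run-idx N) (cong codeIdx N≡)))
       λ V₂ V₁≤V₂ B₂ → does-step B₂
         (does-timed (timedOf (call4 betaF v0 v1 (snd (fst (snd (snd v2)))) (snd (snd (snd v2)))) tt) B₂
           (trans (cong (λ q → run betaF (codeIdx n ∷ N ∷ right (codeℤ q) ∷ codeℕ (↧ₙ p) ∷ [])) p≡) (run-beta N N≡ u (↧ₙ p))))
       λ V₃ V₂≤V₃ B₃ →
         let Y≤V₃ = ≤-trans Y≤V₁ (≤-trans V₁≤V₂ V₂≤V₃)
             ball = acc-ball d (≤-trans (ball≤ fits) Y≤V₃) β (λ L x → run-expand L)
         in does-step B₃
         (does-loop {l = fst v4} {v0 ▹ lf} {at (i0 ∷ i3 ∷ []) ballStep} (timedOf _ tt) (timedOf _ tt) (timedOf _ tt) B₃ (proj₁ ball) (proj₂ ball))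
       λ V₄ V₃≤V₄ B₄ → does-step B₄
         (does-timed (timedOf (bind (snd (fst v4)) (at (i1 ∷ i2 ∷ i3 ∷ i4 ∷ i0 ∷ []) chosenF)) tt) B₄ (run-chosen I N N≡ L β))
       λ V₅ V₄≤V₅ B₅ → does-ifn (timedOf (call3 certifyF (fst (snd v5)) v0 (fst (snd v6))) tt) B₅ (run-certify t H A)
         (does-timed (timedOf lf tt) B₅ refl)
         (does-step B₅
           (does-loop {l = v3} {(snd (snd v6) ▹ (lf ▹ lf)) ▹ lf} {at (i0 ∷ i1 ∷ i2 ∷ []) entryLoop} (timedOf _ tt) (timedOf _ tt) (timedOf _ tt) B₅
             (acc-mono (≤-trans (entries≤ fits) (≤-trans Y≤V₃ (≤-trans V₃≤V₄ V₄≤V₅)))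
               (acc-entries d (mask H) _ ≤-refl (λ L i → run-entryLoop H L i)))
             (run-entries d H))
         λ V₆ V₅≤V₆ B₆ → does-timed (timedOf (bind (snd (fst v6)) (at (i1 ∷ i2 ∷ i5 ∷ i4 ∷ i6 ∷ i0 ∷ []) answerF)) tt) B₆
           (run-answer N N≡ I H β (#⊖≤ β) (entries d (mask H)))))
    where
    out≡ : ∀ {n} b S (g : Poly n) → (if b then leaf else node (codeVec codeBool S) (codePoly g)) ≡ codeOutput (if b then OPT≥AVG+t else kernel S g)
    out≡ true  S g = refl
    out≡ false S g = sym (code-kernel S g)

-- The program and its running time.

module TimedProgram where
  open Machine
  open Growth
  open Terms
  open Numbers
  open Values
  open Algorithm
  open Running
  open import Defs hiding (_^_; eval; if_then_else_)
  open import Data.Fin.Base as Fin using (zero; suc; toℕ)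
  open import Data.Integer.Base as ℤ using (+_)
  open import Data.Nat.Base
  open import Data.Nat.Properties
  open import Data.Product.Base using (_×_; _,_; Σ-syntax)
  open import Data.Rational.Base as ℚ using (1ℚ; ↥_; ↧ₙ_)
  open import Data.Vec.Base as Vec using ([]; _∷_)
  open import Relation.Nullary.Decidable.Core using (yes; no)
  open import Relation.Binary.PropositionalEquality using (_≡_; refl; sym; trans; cong; cong₂; subst)
  open import Data.Nat.Tactic.RingSolver using (solve-∀)

  literalE : Tree → Expr 1
  literalE leaf       = nil
  literalE (node a b) = cons (literalE a) (literalE b)

  literalE-value : ∀ t s → ⟦ ⌜ literalE t ⌝ ⟧ s ≡ t
  literalE-value leaf       s = refl
  literalE-value (node a b) s = cong₂ node (literalE-value a s) (literalE-value b s)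

  startE : ℕ → ℕ → Expr 1
  startE d A = cons (tls 0) (cons (literalE (literals d A)) nil)

  programOf : Tm 2 → ℕ → ℕ → Program
  programOf e d A = record
    { extra = 1
    ; body  = r0 := ⌜ startE d A ⌝ ⨾ comp toℕ e ⨾ r0 := ⌜ hd (tls 0) ⌝
    }

  program : ℕ → ℕ → Program
  program = programOf main

  module _ (n d M : ℕ) (1≤d : 1 ≤ d) (1≤M : 1 ≤ M) (n^d≤M : n ^ d ≤ M) where

    n≤M : n ≤ M
    n≤M = ≤-trans (go n d 1≤d) n^d≤M
      where
      go : ∀ n d → 1 ≤ d → n ≤ n ^ d
      go zero    d       _ = z≤n
      go (suc n) (suc d) _ = ≤-trans (≤-reflexive (sym (*-identityʳ (suc n)))) (*-monoʳ-≤ (suc n) (1≤^ (suc n) d (s≤s z≤n)))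

    affine≤ : ∀ a b → a + b * n ≤ (a + b) * M
    affine≤ a b = ≤-trans (+-mono-≤ (≤-trans (≤-reflexive (sym (*-identityʳ a))) (*-monoʳ-≤ a 1≤M)) (*-monoʳ-≤ b n≤M))
                          (≤-reflexive (sym (*-distribʳ-+ M a b)))

    square^≤ : suc (n * n) ^ d ≤ 2 ^ d * (M * M)
    square^≤ with n ≟ 0
    ... | yes refl = ≤-trans (≤-reflexive (^-zeroˡ d)) (*-mono-≤ (1≤^ 2 d (s≤s z≤n)) (*-mono-≤ 1≤M 1≤M))
    ... | no n≢0 = ≤-trans (^-monoˡ-≤ d (+-monoˡ-≤ (n * n) (*-mono-≤ 1≤n 1≤n)))
        (≤-trans (≤-reflexive (trans (cong (_^ d) (lem (n * n))) (trans (^-distribʳ-* 2 (n * n) d) (cong (2 ^ d *_) (^-distribʳ-* n n d)))))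
                 (*-monoʳ-≤ (2 ^ d) (*-mono-≤ n^d≤M n^d≤M)))
      where
      1≤n = n≢0⇒n>0 n≢0
      lem : ∀ m → m + m ≡ 2 * m
      lem = solve-∀

    linear^≤ : suc (4 * n) ^ d ≤ 5 ^ d * M
    linear^≤ with n ≟ 0
    ... | yes refl = ≤-trans (≤-reflexive (^-zeroˡ d)) (*-mono-≤ (1≤^ 5 d (s≤s z≤n)) 1≤M)
    ... | no n≢0 = ≤-trans (^-monoˡ-≤ d (+-monoˡ-≤ (4 * n) (n≢0⇒n>0 n≢0)))
        (≤-trans (≤-reflexive (^-distribʳ-* 5 n d)) (*-monoʳ-≤ (5 ^ d) n^d≤M))

    M≤M³ : M ≤ M ^ 3
    M≤M³ = ≤-trans (≤-reflexive (sym (*-identityʳ M))) (*-monoʳ-≤ M (1≤^ M 2 1≤M))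

    1≤M³ : 1 ≤ M ^ 3
    1≤M³ = 1≤^ M 3 1≤M

    κ : ℕ → ℕ
    κ A = ((4 + size (literals d A)) + 3) + ((1 + 2 ^ d * 6) + (1 + 5 ^ d * (13 + size (coeffs d 1ℚ))))

    -- The exponent 3 comes from the ball: the bound for its number of points is at most a multiple
    -- of M², and each point has size linear in n ≤ M.
    space-bound : ∀ A s → s ≤ M →
      ((3 + s + size (literals d A)) + suc (n + n)) + (ballSize n d + entriesSize n d) ≤ κ A * M ^ 3
    space-bound A s s≤ = ≤-trans
      (+-mono-≤ (+-mono-≤ t₁ t₂) (+-mono-≤ t₃ t₄))
      (≤-reflexive (lem (4 + size (literals d A)) 3 (1 + 2 ^ d * 6) (1 + 5 ^ d * (13 + size (coeffs d 1ℚ))) (M ^ 3)))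
      where
      lem : ∀ a b c e m → a * m + b * m + (c * m + e * m) ≡ ((a + b) + (c + e)) * m
      lem = solve-∀
      t₁ : 3 + s + size (literals d A) ≤ (4 + size (literals d A)) * M ^ 3
      t₁ = ≤-trans (≤-trans (+-mono-≤ (+-mono-≤ (*-monoʳ-≤ 3 1≤M) s≤) (≤-trans (≤-reflexive (sym (*-identityʳ _))) (*-monoʳ-≤ (size (literals d A)) 1≤M)))
        (≤-reflexive (lem′ M (size (literals d A))))) (*-monoʳ-≤ (4 + size (literals d A)) M≤M³)
        where
        lem′ : ∀ m l → 3 * m + m + l * m ≡ (4 + l) * m
        lem′ = solve-∀
      t₂ : suc (n + n) ≤ 3 * M ^ 3
      t₂ = ≤-trans (≤-trans (≤-reflexive (lem′ n)) (affine≤ 1 2)) (*-monoʳ-≤ 3 M≤M³)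
        where
        lem′ : ∀ n → suc (n + n) ≡ 1 + 2 * n
        lem′ = solve-∀
      t₃ : ballSize n d ≤ (1 + 2 ^ d * 6) * M ^ 3
      t₃ = ≤-trans (+-mono-≤ 1≤M³ (*-mono-≤ square^≤ (affine≤ 2 4))) (≤-reflexive (lem′ M (2 ^ d)))
        where
        lem′ : ∀ m t → m * (m * (m * 1)) + t * (m * m) * (6 * m) ≡ (1 + t * 6) * (m * (m * (m * 1)))
        lem′ = solve-∀
      t₄ : entriesSize n d ≤ (1 + 5 ^ d * (13 + size (coeffs d 1ℚ))) * M ^ 3
      t₄ = ≤-trans (+-mono-≤ 1≤M³ (≤-trans (*-mono-≤ linear^≤ (affine≤ (5 + size (coeffs d 1ℚ)) 8))
             (≤-trans (≤-reflexive (lem″ M (5 ^ d) (size (coeffs d 1ℚ)))) (*-monoʳ-≤ (5 ^ d * (13 + size (coeffs d 1ℚ))) M²≤M³))))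
           (≤-reflexive (lem′ (M ^ 3) (5 ^ d * (13 + size (coeffs d 1ℚ)))))
        where
        lem′ : ∀ m t → m + t * m ≡ (1 + t) * m
        lem′ = solve-∀
        lem″ : ∀ m t c → t * m * ((5 + c + 8) * m) ≡ t * (13 + c) * (m * m)
        lem″ = solve-∀
        M²≤M³ : M * M ≤ M ^ 3
        M²≤M³ = *-monoʳ-≤ M (≤-trans (≤-reflexive (sym (*-identityʳ M))) (*-monoʳ-≤ M (≤-trans 1≤M (≤-reflexive (sym (*-identityʳ M))))))

  time-program : (f : Tm 2) → Σ[ T ∈ Pol ] Σ[ S ∈ Pol ] (∀ {d n} A (I : CSP d n) t p u → ↥ p ≡ + u → ∀ Y → Fits n d A Y (codeInput I t p) →
      Does f (codeInput I t p ∷ literals d A ∷ []) Y T S (codeOutput (algorithm A I t u (↧ₙ p)))) →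
    Σ[ c ∈ ℕ ] (∀ d → 1 ≤ d → ∀ A → Σ[ K ∈ ℕ ] (∀ {n} (I : CSP d n) t p u → ↥ p ≡ + u →
      Σ[ τ ∈ ℕ ] (programOf f d A on codeInput I t p outputs codeOutput (algorithm A I t u (↧ₙ p)) inTime τ
                 × τ ≤ timeBound c K d n (codeInput I t p))))
  -- The factor 3 is the power of M in `space-bound`, and e is one more than the degree of the time
  -- polynomial. Both are fixed before d and A, which enter only the constant.
  time-program f (T , S , does) = 3 * e , λ d 1≤d A → let c = suc (costW (startE d A)) in (c + coeff P) * (κ′ d A 1≤d) ^ e , λ {n} I t p u p≡ →
    let inp  = codeInput I t p
        out  = codeOutput (algorithm A I t u (↧ₙ p))
        lit  = literals d A
        M    = n ^ d ⊔ size inp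
        1≤M  = ≤-trans (0<size inp) (m≤n⊔m (n ^ d) (size inp))
        Y    = ((3 + size inp + size lit) + suc (n + n)) + (ballSize n d + entriesSize n d)
        Y≤   = space-bound n d M 1≤d 1≤M (m≤m⊔n (n ^ d) (size inp)) A (size inp) (m≤n⊔m (n ^ d) (size inp))
        a≤   = ≤-trans (m≤m+n (3 + size inp + size lit) (suc (n + n))) (m≤m+n _ (ballSize n d + entriesSize n d))
        inp≤ = ≤-trans (m≤n+m (size inp) 3) (≤-trans (m≤m+n _ (size lit)) a≤)
        lit≤ = ≤-trans (m≤n+m (size lit) (3 + size inp)) a≤
        D    = does A I t p u p≡ Y (fits-by inp≤ lit≤
                 (≤-trans (m≤n+m _ (3 + size inp + size lit)) (m≤m+n _ (ballSize n d + entriesSize n d)))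
                 (≤-trans (m≤m+n _ (entriesSize n d)) (m≤n+m _ ((3 + size inp + size lit) + suc (n + n))))
                 (≤-trans (m≤n+m _ (ballSize n d)) (m≤n+m _ ((3 + size inp + size lit) + suc (n + n)))))
        s    = node inp (node lit leaf)
        s≤   = ≤-trans (≤-reflexive (lem₁ (size inp) (size lit))) a≤
        r′ , τ , τ≤ , R = Does.steps D toℕ s leaf (holds (λ { zero → refl ; (suc zero) → refl }) (λ { zero → z≤n ; (suc zero) → s≤s z≤n })) s≤
        R′   = subst (λ v → comp toℕ f ⊢ s ∷ leaf ∷ [] ⇓ node v s ∷ r′ ∷ [] [ τ ]) (Does.value D) R
        st≤  : size (node out s) ≤ suc (⟪ S ⟫ Y + Y)
        st≤  = s≤s (+-mono-≤ (Does.space D) s≤)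
    in _ , (r′ ∷ [] , compose (subst (λ v → r0 := ⌜ startE d A ⌝ ⊢ inp ∷ leaf ∷ [] ⇓ node inp (node v leaf) ∷ leaf ∷ [] [ suc (cost ⌜ startE d A ⌝ (inp ∷ leaf ∷ [])) ]) (literalE-value lit _) assign)
                              (compose R′ assign)) ,
       ≤-trans (+-mono-≤ (assign-bound inp leaf Y inp≤ (startE d A) {c} ≤-refl)
                         (+-mono-≤ τ≤ (assign-bound (node out s) r′ _ st≤ (hd (tls 0)) {4} (≤-by refl))))
       (≤-trans (+-monoʳ-≤ (c * Y) (⟪⟫-bound P Y (≤-trans (0<size inp) inp≤)))
       (≤-trans (combine c Y (≤-trans (0<size inp) inp≤))
       (≤-trans (*-monoʳ-≤ (c + coeff P) (^-monoˡ-≤ e Y≤)) (≤-reflexive (lem₂ (c + coeff P) (κ n d M 1≤d 1≤M (m≤m⊔n (n ^ d) (size inp)) A) M)))))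
    where
    P = T ⊞ con 4 ⊠ (con 1 ⊞ (S ⊞ X))
    e = suc (degree P)
    κ′ : ∀ d (A : ℕ) → 1 ≤ d → ℕ
    κ′ d A 1≤d = ((4 + size (literals d A)) + 3) + ((1 + 2 ^ d * 6) + (1 + 5 ^ d * (13 + size (coeffs d 1ℚ))))
    lem₁ : ∀ i l → suc (i + suc (l + 1)) ≡ 3 + i + l
    lem₁ = solve-∀
    combine : ∀ c Y → 1 ≤ Y → c * Y + coeff P * Y ^ degree P ≤ (c + coeff P) * Y ^ e
    combine c Y 1≤Y = ≤-trans (+-mono-≤
        (*-monoʳ-≤ c (≤-trans (≤-reflexive (sym (*-identityʳ Y))) (*-monoʳ-≤ Y (1≤^ Y (degree P) 1≤Y))))
        (*-monoʳ-≤ (coeff P) (≤-trans (≤-reflexive (sym (*-identityˡ _))) (*-monoˡ-≤ (Y ^ degree P) 1≤Y))))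
      (≤-reflexive (sym (*-distribʳ-+ (Y ^ e) c (coeff P))))
    lem₂ : ∀ a k M → a * (k * M ^ 3) ^ e ≡ a * k ^ e * M ^ (3 * e)
    lem₂ a k M = trans (cong (a *_) (trans (^-distribʳ-* k (M ^ 3) e) (cong (k ^ e *_) (^-*-assoc M 3 e)))) (sym (*-assoc a (k ^ e) _))

  timed-program : Σ[ c ∈ ℕ ] (∀ d → 1 ≤ d → ∀ A → Σ[ K ∈ ℕ ] (∀ {n} (I : CSP d n) t p u → ↥ p ≡ + u →
    Σ[ τ ∈ ℕ ] (program d A on codeInput I t p outputs codeOutput (algorithm A I t u (↧ₙ p)) inTime τ
               × τ ≤ timeBound c K d n (codeInput I t p))))
  timed-program = time-program main does-main

-- Finite sums and their reindexing by involutions.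

module Sums where
  open import Algebra.Structures using (IsCommutativeMonoid)
  open import Data.Integer.Base as ℤ using (ℤ)
  import Data.Integer.Properties as ℤ
  open import Data.List.Base using (List; []; _∷_; map; _++_)
  open import Data.List.Membership.Propositional using (_∈_)
  open import Data.List.Membership.Propositional.Properties using (∈-map⁺)
  open import Data.List.Membership.Propositional.Properties.WithK using (unique∧set⇒bag)
  open import Data.List.Relation.Binary.BagAndSetEquality using (∼bag⇒↭)
  open import Data.List.Relation.Binary.Permutation.Propositional using (_↭_; refl; prep; swap; trans)
  open import Data.List.Relation.Unary.Unique.Propositional using (Unique)
  import Data.List.Relation.Unary.Unique.Propositional.Properties as Unique
  open import Data.Nat.Base as ℕ using (ℕ)
  import Data.Nat.Properties as ℕ
  open import Function.Base using (_∘_)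
  open import Function.Bundles using (mk⇔)
  open import Relation.Binary.PropositionalEquality as ≡ using (_≡_; sym; cong; cong₂; subst; module ≡-Reasoning)

  -- Both lists are free of repetitions and contain every element, hence they agree as bags.
  involution-↭ : ∀ {A : Set} {xs : List A} (f : A → A) → Unique xs → (∀ x → x ∈ xs) → (∀ x → f (f x) ≡ x) → map f xs ↭ xs
  involution-↭ {xs = xs} f u complete invol = ∼bag⇒↭ (unique∧set⇒bag (Unique.map⁺ injective u) u λ {x} →
    mk⇔ (λ _ → complete x) (λ _ → subst (_∈ map f xs) (invol x) (∈-map⁺ f (complete (f x)))))
    where
    injective : ∀ {x y} → f x ≡ f y → x ≡ y
    injective {x} {y} eq = ≡.trans (sym (invol x)) (≡.trans (cong f eq) (invol y))

  module ListSum {M : Set} {_+_ : M → M → M} {0# : M} (isCM : IsCommutativeMonoid _≡_ _+_ 0#) where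
    open IsCommutativeMonoid isCM using (assoc; comm; identityˡ; identityʳ)

    ∑ : ∀ {A : Set} → List A → (A → M) → M
    ∑ []       h = 0#
    ∑ (x ∷ xs) h = h x + ∑ xs h

    +-exchange : ∀ a b c d → (a + b) + (c + d) ≡ (a + c) + (b + d)
    +-exchange a b c d = begin
      (a + b) + (c + d) ≡⟨ assoc a b (c + d) ⟩
      a + (b + (c + d)) ≡⟨ cong (a +_) (assoc b c d) ⟨
      a + ((b + c) + d) ≡⟨ cong (λ z → a + (z + d)) (comm b c) ⟩
      a + ((c + b) + d) ≡⟨ cong (a +_) (assoc c b d) ⟩
      a + (c + (b + d)) ≡⟨ assoc a c (b + d) ⟨
      (a + c) + (b + d) ∎
      where open ≡-Reasoning

    ∑-cong : ∀ {A : Set} (xs : List A) {g h : A → M} → (∀ x → g x ≡ h x) → ∑ xs g ≡ ∑ xs h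
    ∑-cong []       e = ≡.refl
    ∑-cong (x ∷ xs) e = cong₂ _+_ (e x) (∑-cong xs e)

    ∑-0 : ∀ {A : Set} (xs : List A) → ∑ xs (λ _ → 0#) ≡ 0#
    ∑-0 []       = ≡.refl
    ∑-0 (x ∷ xs) = ≡.trans (identityˡ _) (∑-0 xs)

    ∑-+ : ∀ {A : Set} (xs : List A) (g h : A → M) → ∑ xs (λ x → g x + h x) ≡ ∑ xs g + ∑ xs h
    ∑-+ []       g h = sym (identityˡ 0#)
    ∑-+ (x ∷ xs) g h = ≡.trans (cong ((g x + h x) +_) (∑-+ xs g h)) (+-exchange (g x) (h x) _ _)

    ∑-comm : ∀ {A B : Set} (xs : List A) (ys : List B) (h : A → B → M) →
             ∑ xs (λ x → ∑ ys (h x)) ≡ ∑ ys (λ y → ∑ xs (λ x → h x y))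
    ∑-comm []       ys h = sym (∑-0 ys)
    ∑-comm (x ∷ xs) ys h = ≡.trans (cong (∑ ys (h x) +_) (∑-comm xs ys h)) (sym (∑-+ ys (h x) _))

    ∑-map : ∀ {A B : Set} (f : A → B) xs (h : B → M) → ∑ (map f xs) h ≡ ∑ xs (h ∘ f)
    ∑-map f []       h = ≡.refl
    ∑-map f (x ∷ xs) h = cong (h (f x) +_) (∑-map f xs h)

    ∑-++ : ∀ {A : Set} (xs ys : List A) (h : A → M) → ∑ (xs ++ ys) h ≡ ∑ xs h + ∑ ys h
    ∑-++ []       ys h = sym (identityˡ _)
    ∑-++ (x ∷ xs) ys h = ≡.trans (cong (h x +_) (∑-++ xs ys h)) (sym (assoc (h x) _ _))

    ∑-↭ : ∀ {A : Set} {xs ys : List A} (h : A → M) → xs ↭ ys → ∑ xs h ≡ ∑ ys h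
    ∑-↭ h refl         = ≡.refl
    ∑-↭ h (prep x p)   = cong (h x +_) (∑-↭ h p)
    ∑-↭ h (swap x y p) = ≡.trans (sym (assoc (h x) (h y) _)) (≡.trans (cong₂ _+_ (comm (h x) (h y)) (∑-↭ h p)) (assoc (h y) (h x) _))
    ∑-↭ h (trans p q)  = ≡.trans (∑-↭ h p) (∑-↭ h q)

    ∑-involution : ∀ {A : Set} {xs : List A} (f : A → A) → Unique xs → (∀ x → x ∈ xs) → (∀ x → f (f x) ≡ x) →
                   ∀ h → ∑ xs (h ∘ f) ≡ ∑ xs h
    ∑-involution {xs = xs} f u c i h = ≡.trans (sym (∑-map f xs h)) (∑-↭ h (involution-↭ f u c i))

  module ℕΣ = ListSum ℕ.+-0-isCommutativeMonoid
  module ℤΣ = ListSum ℤ.+-0-isCommutativeMonoid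

  module _ {A : Set} where
    ℕ-∑-mono : ∀ (xs : List A) {g h : A → ℕ} → (∀ x → g x ℕ.≤ h x) → ℕΣ.∑ xs g ℕ.≤ ℕΣ.∑ xs h
    ℕ-∑-mono []       e = ℕ.z≤n
    ℕ-∑-mono (x ∷ xs) e = ℕ.+-mono-≤ (e x) (ℕ-∑-mono xs e)

    ℤ-∑-mono : ∀ (xs : List A) {g h : A → ℤ} → (∀ x → g x ℤ.≤ h x) → ℤΣ.∑ xs g ℤ.≤ ℤΣ.∑ xs h
    ℤ-∑-mono []       e = ℤ.≤-refl
    ℤ-∑-mono (x ∷ xs) e = ℤ.+-mono-≤ (e x) (ℤ-∑-mono xs e)

    ℕ-∑-* : ∀ c (xs : List A) (h : A → ℕ) → ℕΣ.∑ xs (λ x → c ℕ.* h x) ≡ c ℕ.* ℕΣ.∑ xs h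
    ℕ-∑-* c []       h = sym (ℕ.*-zeroʳ c)
    ℕ-∑-* c (x ∷ xs) h = ≡.trans (cong (c ℕ.* h x ℕ.+_) (ℕ-∑-* c xs h)) (sym (ℕ.*-distribˡ-+ c (h x) _))

    ℤ-∑-* : ∀ c (xs : List A) (h : A → ℤ) → ℤΣ.∑ xs (λ x → c ℤ.* h x) ≡ c ℤ.* ℤΣ.∑ xs h
    ℤ-∑-* c []       h = sym (ℤ.*-zeroʳ c)
    ℤ-∑-* c (x ∷ xs) h = ≡.trans (cong (λ z → (c ℤ.* h x) ℤ.+ z) (ℤ-∑-* c xs h)) (sym (ℤ.*-distribˡ-+ c (h x) _))

    ∑-pos : ∀ (xs : List A) (h : A → ℕ) → ℤΣ.∑ xs (λ x → ℤ.+ h x) ≡ ℤ.+ ℕΣ.∑ xs h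
    ∑-pos []       h = ≡.refl
    ∑-pos (x ∷ xs) h = cong (ℤ._+_ (ℤ.+ h x)) (∑-pos xs h)

-- Swaps of two variables and the number of ⊖ in a set.

module Swaps where
  open Values using (_≡ᶠ_; sw; swap; #⊖; #⊕; idxs; ∈-idxs)
  open Sums
  open import Defs using (Assignment; vectors; signs)
  open import Data.Bool.Base using (Bool; true; false; if_then_else_; _∧_; not; T)
  open import Data.Bool.Properties using (T?)
  open import Data.Empty using (⊥; ⊥-elim)
  open import Data.Fin.Base using (Fin; zero; suc; toℕ)
  open import Data.Fin.Properties using (toℕ-injective; _≟_; suc-injective)
  open import Data.List.Base as List using (List; []; _∷_; [_]; length)
  open import Data.List.Membership.Propositional using (_∈_)
  open import Data.List.Membership.Propositional.Properties using (∈-map⁻)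
  open import Data.List.Relation.Unary.All as All using (All; []; _∷_)
  open import Data.List.Relation.Unary.Any using (here; there)
  open import Data.List.Relation.Unary.AllPairs using ([]; _∷_)
  open import Data.List.Relation.Unary.Unique.Propositional using (Unique)
  import Data.List.Relation.Unary.Unique.Propositional.Properties as Unique
  open import Data.Nat.Base as ℕ using (ℕ; zero; suc; _+_; _≤_; z≤n; s≤s; _≡ᵇ_)
  import Data.Nat.Properties as ℕ
  open import Data.Product.Base using (_×_; _,_)
  open import Data.Sign.Base using (Sign) renaming (+ to ⊕; - to ⊖)
  open import Data.Unit.Base using (tt)
  open import Data.Vec.Base as Vec using ([]; _∷_; lookup)
  open import Data.Vec.Properties using (lookup∘tabulate; tabulate∘lookup; tabulate-cong; ∷-injective)
  open import Function.Base using (_∘_)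
  open import Relation.Binary.PropositionalEquality using (_≡_; _≢_; refl; sym; trans; cong; cong₂; subst; ≢-sym)
  open import Relation.Nullary.Decidable.Core using (yes; no)
  open import Data.Nat.Tactic.RingSolver using (solve-∀)

  private
    variable
      n : ℕ

  ≡ᶠ-refl : ∀ (i : Fin n) → (i ≡ᶠ i) ≡ true
  ≡ᶠ-refl i = go (toℕ i)
    where
    go : ∀ m → (m ≡ᵇ m) ≡ true
    go zero    = refl
    go (suc m) = go m

  ≡ᶠ-≡ : ∀ (i j : Fin n) → (i ≡ᶠ j) ≡ true → i ≡ j
  ≡ᶠ-≡ i j eq = toℕ-injective (ℕ.≡ᵇ⇒≡ (toℕ i) (toℕ j) (subst T (sym eq) tt))

  ≡ᶠ-≢ : ∀ {i j : Fin n} → i ≢ j → (i ≡ᶠ j) ≡ false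
  ≡ᶠ-≢ {i = i} {j} i≢j with i ≡ᶠ j in eq
  ... | true  = ⊥-elim (i≢j (≡ᶠ-≡ i j eq))
  ... | false = refl

  sw-left : ∀ (a b : Fin n) → sw a b a ≡ b
  sw-left a b rewrite ≡ᶠ-refl a = refl

  sw-right : ∀ (a b : Fin n) → sw a b b ≡ a
  sw-right a b with b ≟ a
  ... | yes refl = sw-left a b
  ... | no b≢a rewrite ≡ᶠ-≢ b≢a | ≡ᶠ-refl b = refl

  sw-other : ∀ (a b : Fin n) {i} → i ≢ a → i ≢ b → sw a b i ≡ i
  sw-other a b i≢a i≢b rewrite ≡ᶠ-≢ i≢a | ≡ᶠ-≢ i≢b = refl

  sw-involutive : ∀ (a b i : Fin n) → sw a b (sw a b i) ≡ i
  sw-involutive a b i with i ≟ a | i ≟ b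
  ... | yes refl | _        = trans (cong (sw i b) (sw-left i b)) (sw-right i b)
  ... | no _     | yes refl = trans (cong (sw a i) (sw-right a i)) (sw-left a i)
  ... | no i≢a   | no i≢b   = trans (cong (sw a b) (sw-other a b i≢a i≢b)) (sw-other a b i≢a i≢b)

  sw-comm : ∀ {a b c d : Fin n} → a ≢ c → a ≢ d → b ≢ c → b ≢ d → ∀ i → sw a b (sw c d i) ≡ sw c d (sw a b i)
  sw-comm {a = a} {b} {c} {d} a≢c a≢d b≢c b≢d i with i ≟ a | i ≟ b | i ≟ c | i ≟ d
  ... | yes refl | _ | _ | _ = trans (cong (sw i b) (sw-other c d a≢c a≢d))
    (trans (sw-left i b) (sym (trans (cong (sw c d) (sw-left i b)) (sw-other c d b≢c b≢d))))
  ... | no _ | yes refl | _ | _ = trans (cong (sw a i) (sw-other c d b≢c b≢d))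
    (trans (sw-right a i) (sym (trans (cong (sw c d) (sw-right a i)) (sw-other c d a≢c a≢d))))
  ... | no i≢a | no i≢b | yes refl | _ = trans (cong (sw a b) (sw-left i d))
    (trans (sw-other a b (≢-sym a≢d) (≢-sym b≢d)) (sym (trans (cong (sw i d) (sw-other a b i≢a i≢b)) (sw-left i d))))
  ... | no i≢a | no i≢b | no _ | yes refl = trans (cong (sw a b) (sw-right c i))
    (trans (sw-other a b (≢-sym a≢c) (≢-sym b≢c)) (sym (trans (cong (sw c i) (sw-other a b i≢a i≢b)) (sw-right c i))))
  ... | no i≢a | no i≢b | no i≢c | no i≢d = trans (cong (sw a b) (sw-other c d i≢c i≢d)) (trans (sw-other a b i≢a i≢b)
    (sym (trans (cong (sw c d) (sw-other a b i≢a i≢b)) (sw-other c d i≢c i≢d))))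

  lookup-swap : ∀ a b (y : Assignment n) i → lookup (swap a b y) i ≡ lookup y (sw a b i)
  lookup-swap a b y i = lookup∘tabulate (λ i → lookup y (sw a b i)) i

  lookup-ext : ∀ {y z : Assignment n} → (∀ i → lookup y i ≡ lookup z i) → y ≡ z
  lookup-ext {y = y} {z} e = trans (sym (tabulate∘lookup y)) (trans (tabulate-cong e) (tabulate∘lookup z))

  swap-involutive : ∀ a b (y : Assignment n) → swap a b (swap a b y) ≡ y
  swap-involutive a b y = lookup-ext λ i → trans (lookup-swap a b (swap a b y) i)
    (trans (lookup-swap a b y (sw a b i)) (cong (lookup y) (sw-involutive a b i)))

  swap-comm : ∀ {a b c d : Fin n} → a ≢ c → a ≢ d → b ≢ c → b ≢ d → ∀ y → swap a b (swap c d y) ≡ swap c d (swap a b y)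
  swap-comm {a = a} {b} {c} {d} a≢c a≢d b≢c b≢d y = lookup-ext λ i →
    trans (lookup-swap a b (swap c d y) i) (trans (lookup-swap c d y (sw a b i))
    (trans (cong (lookup y) (sym (sw-comm a≢c a≢d b≢c b≢d i)))
    (sym (trans (lookup-swap c d (swap a b y) i) (lookup-swap a b y (sw c d i))))))

  swap-id : ∀ {a b} (y : Assignment n) → lookup y a ≡ lookup y b → swap a b y ≡ y
  swap-id {a = a} {b} y eq = lookup-ext λ i → trans (lookup-swap a b y i) (h i)
    where
    h : ∀ i → lookup y (sw a b i) ≡ lookup y i
    h i with i ≟ a | i ≟ b
    ... | yes refl | _        = trans (cong (lookup y) (sw-left i b)) (sym eq)
    ... | no _     | yes refl = trans (cong (lookup y) (sw-right a i)) eq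
    ... | no i≢a   | no i≢b   = cong (lookup y) (sw-other a b i≢a i≢b)

  swap-left : ∀ a b (y : Assignment n) → lookup (swap a b y) a ≡ lookup y b
  swap-left a b y = trans (lookup-swap a b y a) (cong (lookup y) (sw-left a b))

  swap-right : ∀ a b (y : Assignment n) → lookup (swap a b y) b ≡ lookup y a
  swap-right a b y = trans (lookup-swap a b y b) (cong (lookup y) (sw-right a b))

  swap-other : ∀ {a b} (y : Assignment n) {i} → i ≢ a → i ≢ b → lookup (swap a b y) i ≡ lookup y i
  swap-other {a = a} {b} y i≢a i≢b = trans (lookup-swap a b y _) (cong (lookup y) (sw-other a b i≢a i≢b))

  unique-idxs : ∀ n → Unique (idxs n)
  unique-idxs zero    = []
  unique-idxs (suc n) = Unique.++⁺ (Unique.map⁺ suc-injective (unique-idxs n)) ([] ∷ []) disjoint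
    where
    disjoint : ∀ {i} → i ∈ List.map suc (idxs n) × i ∈ [ zero ] → ⊥
    disjoint (z∈ , here refl) with _ , _ , () ← ∈-map⁻ suc z∈

  unique-vectors : ∀ n → Unique (vectors signs n)
  unique-vectors zero    = [] ∷ []
  unique-vectors (suc n) = Unique.cartesianProductWith⁺ _∷_ ∷-injective (((λ ()) ∷ []) ∷ ([] ∷ [])) (unique-vectors n)

  module _ {n : ℕ} where
    open ℕΣ using (∑; ∑-cong; ∑-involution)

    ∑ᶠ : (Fin n → ℕ) → ℕ
    ∑ᶠ = ∑ (idxs n)

    ∑ᶠ-sw : ∀ a b h → ∑ᶠ (h ∘ sw a b) ≡ ∑ᶠ h
    ∑ᶠ-sw a b = ∑-involution (sw a b) (unique-idxs n) ∈-idxs (sw-involutive a b)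

  ∑ᶠ-suc : ∀ (h : Fin (suc n) → ℕ) → ∑ᶠ h ≡ ∑ᶠ (h ∘ suc) + h zero
  ∑ᶠ-suc {n} h = trans (ℕΣ.∑-++ (List.map suc (idxs n)) [ zero ] h)
    (cong₂ _+_ (ℕΣ.∑-map suc (idxs n) h) (ℕ.+-identityʳ (h zero)))

  bool : Bool → ℕ
  bool b = if b then 1 else 0

  bool≤1 : ∀ b → bool b ≤ 1
  bool≤1 false = z≤n
  bool≤1 true  = s≤s z≤n

  is⊖ is⊕ : Sign → Bool
  is⊖ ⊖ = true
  is⊖ ⊕ = false
  is⊕ ⊖ = false
  is⊕ ⊕ = true

  #⊖-sum : ∀ (y : Assignment n) → #⊖ y ≡ ∑ᶠ (λ i → bool (is⊖ (lookup y i)))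
  #⊖-sum []      = refl
  #⊖-sum (⊖ ∷ y) = sym (trans (∑ᶠ-suc (λ i → bool (is⊖ (lookup (⊖ ∷ y) i)))) (trans (ℕ.+-comm _ 1) (cong suc (sym (#⊖-sum y)))))
  #⊖-sum (⊕ ∷ y) = sym (trans (∑ᶠ-suc (λ i → bool (is⊖ (lookup (⊕ ∷ y) i)))) (trans (ℕ.+-identityʳ _) (sym (#⊖-sum y))))

  #⊕-sum : ∀ (y : Assignment n) → #⊕ y ≡ ∑ᶠ (λ i → bool (is⊕ (lookup y i)))
  #⊕-sum []      = refl
  #⊕-sum (⊕ ∷ y) = sym (trans (∑ᶠ-suc (λ i → bool (is⊕ (lookup (⊕ ∷ y) i)))) (trans (ℕ.+-comm _ 1) (cong suc (sym (#⊕-sum y)))))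
  #⊕-sum (⊖ ∷ y) = sym (trans (∑ᶠ-suc (λ i → bool (is⊕ (lookup (⊖ ∷ y) i)))) (trans (ℕ.+-identityʳ _) (sym (#⊕-sum y))))

  #⊖-swap : ∀ a b (y : Assignment n) → #⊖ (swap a b y) ≡ #⊖ y
  #⊖-swap {n} a b y = trans (#⊖-sum (swap a b y)) (trans (ℕΣ.∑-cong (idxs n) (λ i → cong (bool ∘ is⊖) (lookup-swap a b y i)))
    (trans (∑ᶠ-sw a b (λ i → bool (is⊖ (lookup y i)))) (sym (#⊖-sum y))))

  #⊖+#⊕ : ∀ (y : Assignment n) → #⊖ y + #⊕ y ≡ n
  #⊖+#⊕ []      = refl
  #⊖+#⊕ (⊖ ∷ y) = cong suc (#⊖+#⊕ y)
  #⊖+#⊕ (⊕ ∷ y) = trans (ℕ.+-suc (#⊖ y) (#⊕ y)) (cong suc (#⊖+#⊕ y))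

  -- The number of ⊖ of y inside S, and of ⊕ outside S.
  inside outside : (Fin n → Bool) → Assignment n → ℕ
  inside  S y = ∑ᶠ (λ i → bool (S i ∧ is⊖ (lookup y i)))
  outside S y = ∑ᶠ (λ i → bool (not (S i) ∧ is⊕ (lookup y i)))

  inside-outside : ∀ (S : Fin n → Bool) y → inside S y + #⊕ y ≡ outside S y + ∑ᶠ (bool ∘ S)
  inside-outside {n} S y = trans (cong (inside S y +_) e₂) (trans (lem (inside S y) (outside S y) both) (cong (outside S y +_) e₁))
    where
    both = ∑ᶠ (λ i → bool (S i ∧ is⊕ (lookup y i)))
    lem : ∀ a b c → a + (b + c) ≡ b + (a + c)
    lem = solve-∀
    e₁ : inside S y + both ≡ ∑ᶠ (bool ∘ S)
    e₁ = trans (sym (ℕΣ.∑-+ (idxs n) _ _)) (ℕΣ.∑-cong (idxs n) (λ i → h (S i) (lookup y i)))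
      where
      h : ∀ s x → bool (s ∧ is⊖ x) + bool (s ∧ is⊕ x) ≡ bool s
      h false x = refl
      h true  ⊖ = refl
      h true  ⊕ = refl
    e₂ : #⊕ y ≡ outside S y + both
    e₂ = trans (#⊕-sum y) (trans (ℕΣ.∑-cong (idxs n) (λ i → h (S i) (lookup y i))) (ℕΣ.∑-+ (idxs n) _ _))
      where
      h : ∀ s x → bool (is⊕ x) ≡ bool (not s ∧ is⊕ x) + bool (s ∧ is⊕ x)
      h false ⊖ = refl
      h false ⊕ = refl
      h true  ⊖ = refl
      h true  ⊕ = refl

  inside≤outside : ∀ (S : Fin n → Bool) y → ∑ᶠ (bool ∘ S) ≤ #⊕ y → inside S y ≤ outside S y
  inside≤outside S y S≤ = ℕ.+-cancelʳ-≤ (#⊕ y) _ _ (ℕ.≤-trans (ℕ.≤-reflexive (inside-outside S y)) (ℕ.+-monoʳ-≤ (outside S y) S≤))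

  point : Fin n → Fin n → ℕ
  point a i = bool (i ≡ᶠ a)

  ∑-point : ∀ (a : Fin n) → ∑ᶠ (point a) ≡ 1
  ∑-point {suc n} zero = trans (∑ᶠ-suc {n} (point zero)) (cong (_+ 1) (ℕΣ.∑-0 (idxs n)))
  ∑-point {suc n} (suc a) = trans (∑ᶠ-suc {n} (point (suc a))) (trans (ℕ.+-identityʳ _) (∑-point a))

  -- Instead of y the set is permuted. Among the places where y has ⊖, the permuted set differs from
  -- S only at a, which lies in S but not in its image.
  inside-swap : ∀ (S : Fin n → Bool) y {a b} → S a ≡ true → lookup y a ≡ ⊖ → S b ≡ false → lookup y b ≡ ⊕ →
                suc (inside S (swap a b y)) ≡ inside S y
  inside-swap {n} S y {a} {b} Sa ya Sb yb = sym (trans (ℕΣ.∑-cong (idxs n) pointwise)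
    (trans (ℕΣ.∑-+ (idxs n) (point a) (φ (sw a b))) (cong₂ _+_ (∑-point a) re)))
    where
    φ : (Fin n → Fin n) → Fin n → ℕ
    φ τ i = bool (S (τ i) ∧ is⊖ (lookup y i))
    pointwise : ∀ i → bool (S i ∧ is⊖ (lookup y i)) ≡ point a i + φ (sw a b) i
    pointwise i with i ≟ a | i ≟ b
    ... | yes refl | _ rewrite ≡ᶠ-refl i | Sa | ya | Sb = refl
    ... | no i≢a | yes refl rewrite ≡ᶠ-≢ i≢a | ≡ᶠ-refl i | Sb | yb | Sa = refl
    ... | no i≢a | no i≢b rewrite ≡ᶠ-≢ i≢a | ≡ᶠ-≢ i≢b = refl
    re : ∑ᶠ (φ (sw a b)) ≡ inside S (swap a b y)
    re = trans (sym (∑ᶠ-sw a b (φ (sw a b)))) (ℕΣ.∑-cong (idxs n) λ i →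
      cong₂ (λ j x → bool (S j ∧ is⊖ x)) (sw-involutive a b i) (sym (lookup-swap a b y i)))

  select : (Fin n → Bool) → List (Fin n)
  select {n} φ = List.filterᵇ φ (idxs n)

  length-select : ∀ (φ : Fin n → Bool) → length (select φ) ≡ ∑ᶠ (bool ∘ φ)
  length-select {n} φ = go (idxs n)
    where
    go : ∀ xs → length (List.filterᵇ φ xs) ≡ ℕΣ.∑ xs (bool ∘ φ)
    go []       = refl
    go (x ∷ xs) with φ x
    ... | false = go xs
    ... | true  = cong suc (go xs)

  all-select : ∀ (φ : Fin n → Bool) → All (λ i → φ i ≡ true) (select φ)
  all-select {n} φ = go (idxs n)
    where
    go : ∀ xs → All (λ i → φ i ≡ true) (List.filterᵇ φ xs)
    go []       = []
    go (x ∷ xs) with φ x in eq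
    ... | false = go xs
    ... | true  = eq ∷ go xs

  ∈-select : ∀ (φ : Fin n → Bool) {i} → φ i ≡ true → i ∈ select φ
  ∈-select {n} φ {i} φi = go (idxs n) (∈-idxs i)
    where
    go : ∀ xs → i ∈ xs → i ∈ List.filterᵇ φ xs
    go (x ∷ xs) (here refl) rewrite φi = here refl
    go (x ∷ xs) (there i∈) with φ x
    ... | false = go xs i∈
    ... | true  = there (go xs i∈)

  unique-select : ∀ (φ : Fin n → Bool) → Unique (select φ)
  unique-select {n} φ = Unique.filter⁺ (T? ∘ φ) (unique-idxs n)

  none : ∀ (φ : Fin n → Bool) → ∑ᶠ (bool ∘ φ) ≡ 0 → ∀ i → φ i ≡ false
  none φ eq i with φ i in φi
  ... | false = refl
  ... | true with select φ | length-select φ | ∈-select φ φi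
  ...   | []    | _  | ()
  ...   | x ∷ _ | e  | _ with () ← trans e eq

-- Iterated differences along disjoint swaps, and functions of bounded degree.

module Differences where
  open Values using (sw; swap; #⊖; #⊕)
  open Sums
  open Swaps
  open import Defs using (Assignment)
  open import Data.Bool.Base using (Bool; true; false; _∧_; not)
  open import Data.Empty using (⊥-elim)
  open import Data.Fin.Base using (Fin; suc)
  open import Data.Fin.Properties using (_≟_)
  open import Data.List.Base as List using (List; []; _∷_; _++_; length)
  open import Data.List.Membership.Propositional using (_∈_; _∉_)
  open import Data.List.Membership.Propositional.Properties using (∈-∃++; ∈-++⁺ˡ; ∈-++⁺ʳ; ∈-++⁻)
  open import Data.List.Relation.Unary.All as All using (All; []; _∷_)
  open import Data.List.Relation.Unary.Any using (here; there)
  open import Data.List.Relation.Unary.AllPairs using ([]; _∷_)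
  open import Data.List.Relation.Unary.Unique.Propositional using (Unique)
  open import Data.Nat.Base as ℕ using (ℕ; suc; _≤_; _<_; z≤n; s≤s; s≤s⁻¹)
  import Data.Nat.Properties as ℕ
  open import Data.Nat.Induction using (<-wellFounded)
  open import Induction.WellFounded using (Acc; acc)
  open import Data.Product.Base using (_×_; _,_; proj₁; proj₂; Σ-syntax; ∃-syntax)
  open import Data.Sign.Base using () renaming (+ to ⊕; - to ⊖)
  open import Data.Sum.Base using (_⊎_; inj₁; inj₂)
  open import Data.Vec.Base using (lookup)
  open import Function.Base using (_∘_)
  open import Relation.Binary.PropositionalEquality using (_≡_; _≢_; refl; sym; trans; cong; cong₂; subst; ≢-sym)
  open import Relation.Nullary.Decidable.Core using (yes; no)
  open import Relation.Nullary.Negation.Core using (¬_)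

  Pair : ℕ → Set
  Pair n = Fin n × Fin n

  pts : ∀ {n} → List (Pair n) → List (Fin n)
  pts []            = []
  pts ((a , b) ∷ P) = a ∷ b ∷ pts P

  ∈-pts : ∀ {n a b} {P : List (Pair n)} → (a , b) ∈ P → a ∈ pts P × b ∈ pts P
  ∈-pts (here refl) = here refl , there (here refl)
  ∈-pts (there p)   = let a∈ , b∈ = ∈-pts p in there (there a∈) , there (there b∈)

  length-pts : ∀ {n} (P : List (Pair n)) → length (pts P) ≡ length P ℕ.+ length P
  length-pts []      = refl
  length-pts (_ ∷ P) = cong suc (trans (cong suc (length-pts P)) (sym (ℕ.+-suc (length P) (length P))))

  ∉-unique : ∀ {A : Set} {x y : A} {xs} → All (x ≢_) xs → y ∈ xs → x ≢ y
  ∉-unique ps y∈ = All.lookup ps y∈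

  ∈-remove : ∀ {A : Set} {x y : A} xs ys → y ∈ xs ++ x ∷ ys → x ≢ y → y ∈ xs ++ ys
  ∈-remove xs ys y∈ x≢y with ∈-++⁻ xs y∈
  ... | inj₁ y∈xs         = ∈-++⁺ˡ y∈xs
  ... | inj₂ (here y≡x)   = ⊥-elim (x≢y (sym y≡x))
  ... | inj₂ (there y∈ys) = ∈-++⁺ʳ xs y∈ys

  length-remove : ∀ {A : Set} {x : A} xs ys → length (xs ++ x ∷ ys) ≡ suc (length (xs ++ ys))
  length-remove []       ys = refl
  length-remove (_ ∷ xs) ys = cong suc (length-remove xs ys)

  -- A point of X that meets the first pair can be removed: by disjointness the other pairs are
  -- still met by the rest of X.
  hitting : ∀ {n} (P : List (Pair n)) X → Unique (pts P) → (∀ {a b} → (a , b) ∈ P → a ∈ X ⊎ b ∈ X) → length P ≤ length X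
  hitting []            X u h = z≤n
  hitting ((a , b) ∷ P) X ((a≢b ∷ a≢) ∷ b≢ ∷ u) h with h (here refl)
  ... | inj₁ a∈ with xs , ys , refl ← ∈-∃++ a∈ = ℕ.≤-trans (s≤s (hitting P (xs ++ ys) u rest)) (ℕ.≤-reflexive (sym (length-remove xs ys)))
    where
    rest : ∀ {c d} → (c , d) ∈ P → c ∈ xs ++ ys ⊎ d ∈ xs ++ ys
    rest cd∈ with h (there cd∈)
    ... | inj₁ c∈ = inj₁ (∈-remove xs ys c∈ (∉-unique a≢ (proj₁ (∈-pts cd∈))))
    ... | inj₂ d∈ = inj₂ (∈-remove xs ys d∈ (∉-unique a≢ (proj₂ (∈-pts cd∈))))
  ... | inj₂ b∈ with xs , ys , refl ← ∈-∃++ b∈ = ℕ.≤-trans (s≤s (hitting P (xs ++ ys) u rest)) (ℕ.≤-reflexive (sym (length-remove xs ys)))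
    where
    rest : ∀ {c d} → (c , d) ∈ P → c ∈ xs ++ ys ⊎ d ∈ xs ++ ys
    rest cd∈ with h (there cd∈)
    ... | inj₁ c∈ = inj₁ (∈-remove xs ys c∈ (∉-unique b≢ (proj₁ (∈-pts cd∈))))
    ... | inj₂ d∈ = inj₂ (∈-remove xs ys d∈ (∉-unique b≢ (proj₂ (∈-pts cd∈))))

  module _ {n : ℕ} where
    open import Data.List.Membership.DecPropositional (_≟_ {n}) using (_∈?_)

    unhit : ∀ (P : List (Pair n)) X → Unique (pts P) → length X < length P → ∃[ a ] ∃[ b ] ((a , b) ∈ P × a ∉ X × b ∉ X)
    unhit P X u X<P with go P
      where
      go : ∀ Q → (∃[ a ] ∃[ b ] ((a , b) ∈ Q × a ∉ X × b ∉ X)) ⊎ (∀ {a b} → (a , b) ∈ Q → a ∈ X ⊎ b ∈ X)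
      go [] = inj₂ λ ()
      go ((a , b) ∷ Q) with a ∈? X | b ∈? X | go Q
      ... | no a∉  | no b∉  | _ = inj₁ (a , b , here refl , a∉ , b∉)
      ... | _      | _      | inj₁ (c , d , cd∈ , c∉ , d∉) = inj₁ (c , d , there cd∈ , c∉ , d∉)
      ... | yes a∈ | _      | inj₂ h = inj₂ λ { (here refl) → inj₁ a∈ ; (there p) → h p }
      ... | no _   | yes b∈ | inj₂ h = inj₂ λ { (here refl) → inj₂ b∈ ; (there p) → h p }
    ... | inj₁ found = found
    ... | inj₂ h     = ⊥-elim (ℕ.<⇒≱ X<P (hitting P X u h))

  Invariant : ∀ {n} {B : Set} → (Assignment n → B) → Fin n → Fin n → Set
  Invariant h a b = ∀ y → h (swap a b y) ≡ h y

  Local : ∀ {n} {B : Set} → List (Fin n) → (Assignment n → B) → Set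
  Local X h = ∀ y z → (∀ i → i ∈ X → lookup y i ≡ lookup z i) → h y ≡ h z

  local-invariant : ∀ {n} {B : Set} {X : List (Fin n)} {h : Assignment n → B} → Local X h → ∀ {a b} → a ∉ X → b ∉ X → Invariant h a b
  local-invariant L a∉ b∉ y = L _ _ λ i i∈ → swap-other y (λ { refl → a∉ i∈ }) (λ { refl → b∉ i∈ })

  local-swap : ∀ {n} {B : Set} {X : List (Fin n)} {h : Assignment n → B} a b → Local X h → Local (List.map (sw a b) X) (h ∘ swap a b)
  local-swap a b L y z e = L _ _ λ i i∈ → trans (lookup-swap a b y i) (trans (e (sw a b i) (∈-map⁺ (sw a b) i∈)) (sym (lookup-swap a b z i)))
    where open import Data.List.Membership.Propositional.Properties using (∈-map⁺)

  -- Swapping such a pair moves one ⊖ out of S.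
  Red : ∀ {n} → (Fin n → Bool) → Assignment n → Pair n → Set
  Red S y (a , b) = (S a ≡ true × lookup y a ≡ ⊖) × (S b ≡ false × lookup y b ≡ ⊕)

  red-swap : ∀ {n} {S : Fin n → Bool} {y a b} {P : List (Pair n)} → All (a ≢_) (pts P) → All (b ≢_) (pts P) → All (Red S y) P → All (Red S (swap a b y)) P
  red-swap {P = []} _ _ [] = []
  red-swap {S = S} {y} {P = (c , d) ∷ P} (a≢c ∷ a≢d ∷ a≢) (b≢c ∷ b≢d ∷ b≢) (((Sc , yc) , (Sd , yd)) ∷ rs) =
    ((Sc , trans (swap-other y (≢-sym a≢c) (≢-sym b≢c)) yc) , (Sd , trans (swap-other y (≢-sym a≢d) (≢-sym b≢d)) yd)) ∷ red-swap {S = S} {y} a≢ b≢ rs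

  redPairs : ∀ {n} (S : Fin n → Bool) y → inside S y ≤ outside S y →
             Σ[ P ∈ List (Pair n) ] (Unique (pts P) × All (Red S y) P × length P ≡ inside S y)
  redPairs {n} S y le = go (select φ) (select ψ) (all-select φ) (all-select ψ) (unique-select φ) (unique-select ψ)
      (length-select φ) (subst (inside S y ≤_) (sym (length-select ψ)) le)
    where
    φ ψ : Fin n → Bool
    φ i = S i ∧ is⊖ (lookup y i)
    ψ i = not (S i) ∧ is⊕ (lookup y i)
    redˡ : ∀ {a} → φ a ≡ true → S a ≡ true × lookup y a ≡ ⊖
    redˡ {a} e with S a | lookup y a
    redˡ e  | true | ⊖ = refl , refl
    redʳ : ∀ {a} → ψ a ≡ true → S a ≡ false × lookup y a ≡ ⊕
    redʳ {a} e with S a | lookup y a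
    redʳ e  | false | ⊕ = refl , refl
    go : ∀ {m} xs ys → All (λ i → φ i ≡ true) xs → All (λ i → ψ i ≡ true) ys → Unique xs → Unique ys → length xs ≡ m → m ≤ length ys →
         Σ[ P ∈ List (Pair n) ] (Unique (pts P) × All (Red S y) P × length P ≡ m)
    go xs ys φs ψs ux uy e le = List.zip xs ys , unique xs ys φs ψs ux uy , reds xs ys φs ψs , trans (len xs ys (subst (_≤ length ys) (sym e) le)) e
      where
      reds : ∀ xs ys → All (λ i → φ i ≡ true) xs → All (λ i → ψ i ≡ true) ys → All (Red S y) (List.zip xs ys)
      reds []       _        _ _ = []
      reds (_ ∷ _)  []       _ _ = []
      reds (x ∷ xs) (z ∷ zs) (p ∷ ps) (q ∷ qs) = (redˡ p , redʳ q) ∷ reds xs zs ps qs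
      len : ∀ xs ys → length xs ≤ length ys → length (List.zip xs ys) ≡ length xs
      len []       ys       _  = refl
      len (x ∷ xs) (z ∷ zs) le = cong suc (len xs zs (s≤s⁻¹ le))
      differ : ∀ {a b} → φ a ≡ true → ψ b ≡ true → a ≢ b
      differ p q refl with () ← trans (sym (proj₁ (redˡ p))) (proj₁ (redʳ q))
      fresh : ∀ {Q : Fin n → Set} {R : Fin n → Set} xs ys → All Q xs → All R ys → ∀ {c} → (∀ {i} → Q i → c ≢ i) → (∀ {i} → R i → c ≢ i) → All (c ≢_) (pts (List.zip xs ys))
      fresh []       _        _ _ f g = []
      fresh (_ ∷ _)  []       _ _ f g = []
      fresh (x ∷ xs) (z ∷ zs) (p ∷ ps) (q ∷ qs) f g = f p ∷ g q ∷ fresh xs zs ps qs f g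
      unique : ∀ xs ys → All (λ i → φ i ≡ true) xs → All (λ i → ψ i ≡ true) ys → Unique xs → Unique ys → Unique (pts (List.zip xs ys))
      unique []       _        _ _ _ _ = []
      unique (_ ∷ _)  []       _ _ _ _ = []
      unique (x ∷ xs) (z ∷ zs) (p ∷ ps) (q ∷ qs) (x≢ ∷ ux) (z≢ ∷ uz) =
        (differ p q ∷ fresh xs zs x≢ qs (λ x≢i → x≢i) (λ r → differ p r)) ∷
        fresh xs zs ps z≢ (λ r → ≢-sym (differ r q)) (λ z≢i → z≢i) ∷ unique xs zs ps qs ux uz

  module _ {n : ℕ} (z : Assignment n) where

    -- `inside (plus z) y` counts the places with ⊕ in z and ⊖ in y. For two points of one slice
    -- this is the number of swaps that separates them.
    plus : Fin n → Bool
    plus i = is⊕ (lookup z i)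

    ∑-plus : ∀ y → #⊖ y ≡ #⊖ z → ∑ᶠ (bool ∘ plus) ≡ #⊕ y
    ∑-plus y e = sym (trans (ℕ.+-cancelˡ-≡ (#⊖ z) _ _ (trans (cong (ℕ._+ #⊕ y) (sym e)) (trans (#⊖+#⊕ y) (sym (#⊖+#⊕ z))))) (#⊕-sum z))

    inside≡outside : ∀ y → #⊖ y ≡ #⊖ z → inside plus y ≡ outside plus y
    inside≡outside y e = ℕ.+-cancelʳ-≡ (#⊕ y) _ _ (trans (inside-outside plus y) (cong (outside plus y ℕ.+_) (∑-plus y e)))

    coincide : ∀ y → #⊖ y ≡ #⊖ z → inside plus y ≡ 0 → y ≡ z
    coincide y e i≡0 = lookup-ext λ i → eq (lookup y i) (lookup z i)
      (none (λ i → plus i ∧ is⊖ (lookup y i)) i≡0 i) (none (λ i → not (plus i) ∧ is⊕ (lookup y i)) (trans (sym (inside≡outside y e)) i≡0) i)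
      where
      eq : ∀ s t → is⊕ t ∧ is⊖ s ≡ false → not (is⊕ t) ∧ is⊕ s ≡ false → s ≡ t
      eq ⊖ ⊖ _ _ = refl
      eq ⊕ ⊕ _ _ = refl

  -- As long as y differs from z there are a place a with ⊖ in y and ⊕ in z, and a place b with the
  -- opposite signs. Both are outside X, so swapping them keeps the value and brings y closer to z.
  connect : ∀ {n} {B : Set} (X : Fin n → Set) (h : Assignment n → B) k →
            (∀ a b y → #⊖ y ≡ k → ¬ X a → ¬ X b → h (swap a b y) ≡ h y) →
            ∀ y z → #⊖ y ≡ k → #⊖ z ≡ k → (∀ i → X i → lookup y i ≡ lookup z i) → h y ≡ h z
  connect {n} X h k inv y z y∈ z∈ agree = go y y∈ agree (<-wellFounded _)
    where
    go : ∀ y → #⊖ y ≡ k → (∀ i → X i → lookup y i ≡ lookup z i) → Acc _<_ (inside (plus z) y) → h y ≡ h z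
    go y y∈ agree (acc rec) with redPairs (plus z) y (ℕ.≤-reflexive (inside≡outside z y (trans y∈ (sym z∈))))
    ... | [] , _ , _ , e = cong h (coincide z y (trans y∈ (sym z∈)) (sym e))
    ... | (a , b) ∷ _ , _ , ((Sa , ya) , (Sb , yb)) ∷ _ , _ = trans (sym (inv a b y y∈ (off ya Sa) (off′ yb Sb)))
            (go (swap a b y) (trans (#⊖-swap a b y) y∈) agree′ (rec (ℕ.≤-reflexive (inside-swap (plus z) y Sa ya Sb yb))))
      where
      off : lookup y a ≡ ⊖ → plus z a ≡ true → ¬ X a
      off ya Sa Xa with () ← trans (sym Sa) (cong is⊕ (trans (sym (agree a Xa)) ya))
      off′ : lookup y b ≡ ⊕ → plus z b ≡ false → ¬ X b
      off′ yb Sb Xb with () ← trans (sym Sb) (cong is⊕ (trans (sym (agree b Xb)) yb))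
      agree′ : ∀ i → X i → lookup (swap a b y) i ≡ lookup z i
      agree′ i Xi = trans (swap-other y (λ { refl → off ya Sa Xi }) (λ { refl → off′ yb Sb Xi })) (agree i Xi)

  -- Instantiated with the integers for the values of an instance and with the rationals for the
  -- kernel polynomial.
  module Diff {A : Set} (_+_ _-_ : A → A → A) (0# : A)
    (self : ∀ x → x - x ≡ 0#) (right : ∀ x → x - 0# ≡ x) (zero+ : 0# + 0# ≡ 0#)
    (add : ∀ x y z w → (x + y) - (z + w) ≡ (x - z) + (y - w))
    (minus : ∀ x y z w → (x - y) - (z - w) ≡ (x - z) - (y - w)) where

    module _ {n : ℕ} where

      Δ : List (Pair n) → (Assignment n → A) → Assignment n → A
      Δ []            h y = h y
      Δ ((a , b) ∷ P) h y = Δ P h y - Δ P h (swap a b y)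

      Δ-+ : ∀ P g h y → Δ P (λ y → g y + h y) y ≡ Δ P g y + Δ P h y
      Δ-+ []            g h y = refl
      Δ-+ ((a , b) ∷ P) g h y = trans (cong₂ _-_ (Δ-+ P g h y) (Δ-+ P g h (swap a b y))) (add _ _ _ _)

      Δ-− : ∀ P g h y → Δ P (λ y → g y - h y) y ≡ Δ P g y - Δ P h y
      Δ-− []            g h y = refl
      Δ-− ((a , b) ∷ P) g h y = trans (cong₂ _-_ (Δ-− P g h y) (Δ-− P g h (swap a b y))) (minus _ _ _ _)

      Δ-cong : ∀ P {g h : Assignment n → A} → (∀ y → g y ≡ h y) → ∀ y → Δ P g y ≡ Δ P h y
      Δ-cong []            e y = e y
      Δ-cong ((a , b) ∷ P) e y = cong₂ _-_ (Δ-cong P e y) (Δ-cong P e (swap a b y))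

      Δ-invariant : ∀ P {a b} h → All (a ≢_) (pts P) → All (b ≢_) (pts P) → Invariant h a b → Invariant (Δ P h) a b
      Δ-invariant []            h _ _ inv y = inv y
      Δ-invariant ((c , d) ∷ P) {a} {b} h (a≢c ∷ a≢d ∷ a≢) (b≢c ∷ b≢d ∷ b≢) inv y = cong₂ _-_ (Δ-invariant P h a≢ b≢ inv y)
        (trans (cong (Δ P h) (swap-comm (≢-sym a≢c) (≢-sym b≢c) (≢-sym a≢d) (≢-sym b≢d) y)) (Δ-invariant P h a≢ b≢ inv (swap c d y)))

      -- Differences along the other, disjoint pairs preserve the invariance, so the difference at
      -- `(a , b)` subtracts equal values.
      Δ-kill : ∀ P h → Unique (pts P) → ∀ {a b} → (a , b) ∈ P → Invariant h a b → ∀ y → Δ P h y ≡ 0#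
      Δ-kill ((a , b) ∷ P) h ((_ ∷ a≢) ∷ b≢ ∷ u) (here refl) inv y = trans (cong (Δ P h y -_) (Δ-invariant P h a≢ b≢ inv y)) (self _)
      Δ-kill ((c , d) ∷ P) h (_ ∷ _ ∷ u) (there ab∈) inv y = trans (cong₂ _-_ (Δ-kill P h u ab∈ inv y) (Δ-kill P h u ab∈ inv (swap c d y))) (self 0#)

      Deg≤ : ℕ → (Assignment n → A) → Set
      Deg≤ d h = ∀ P → d < length P → Unique (pts P) → ∀ y → Δ P h y ≡ 0#

      -- At most d variables cannot meet more than d disjoint pairs, and the swap of a missed pair
      -- kills the difference. Through this lemma monomials of degree d and constraints of arity d
      -- come under `Deg≤`.
      local-deg : ∀ {X h d} → Local X h → length X ≤ d → Deg≤ d h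
      local-deg {X} {h} L X≤ P d<P u y with a , b , ab∈ , a∉ , b∉ ← unhit P X u (ℕ.≤-<-trans X≤ d<P) =
        Δ-kill P h u ab∈ (local-invariant L a∉ b∉) y

      deg-+ : ∀ {d g h} → Deg≤ d g → Deg≤ d h → Deg≤ d (λ y → g y + h y)
      deg-+ {g = g} {h} Dg Dh P d< u y = trans (Δ-+ P g h y) (trans (cong₂ _+_ (Dg P d< u y) (Dh P d< u y)) zero+)

      deg-− : ∀ {d g h} → Deg≤ d g → Deg≤ d h → Deg≤ d (λ y → g y - h y)
      deg-− {g = g} {h} Dg Dh P d< u y = trans (Δ-− P g h y) (trans (cong₂ _-_ (Dg P d< u y) (Dh P d< u y)) (self 0#))

      deg-cong : ∀ {d g h} → (∀ y → g y ≡ h y) → Deg≤ d g → Deg≤ d h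
      deg-cong e D P d< u y = trans (sym (Δ-cong P e y)) (D P d< u y)

      deg-sum : ∀ {B : Set} {d} (f : B → Assignment n → A) (xs : List B) → (∀ x → x ∈ xs → Deg≤ d (f x)) →
                Deg≤ d (λ y → List.foldr (λ x s → f x y + s) 0# xs)
      deg-sum f []       D = local-deg {X = []} (λ _ _ _ → refl) z≤n
      deg-sum f (x ∷ xs) D = deg-+ (D x (here refl)) (deg-sum f xs (λ z z∈ → D z (there z∈)))

      -- A function of degree at most d vanishes on the slice as soon as it vanishes
      -- at the points with at most d entries ⊖ in S: the other points reach these by
      -- swaps which decrease the number of such entries.
      module _ (S : Fin n → Bool) (k : ℕ) where

        Δ-below : ∀ P h w M → Unique (pts P) → All (Red S w) P → #⊖ w ≡ k → inside S w < M →
                  (∀ z → #⊖ z ≡ k → inside S z < M → h z ≡ 0#) → Δ P h w ≡ 0#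
        Δ-below []            h w M _ _ w∈ w< zeros = zeros w w∈ w<
        Δ-below ((a , b) ∷ P) h w M ((_ ∷ a≢) ∷ b≢ ∷ u) (((Sa , wa) , (Sb , wb)) ∷ rs) w∈ w< zeros =
          trans (cong₂ _-_ (Δ-below P h w M u rs w∈ w< zeros)
            (Δ-below P h (swap a b w) M u (red-swap {S = S} {w} a≢ b≢ rs) (trans (#⊖-swap a b w) w∈)
              (ℕ.<-trans (ℕ.≤-reflexive (inside-swap S w Sa wa Sb wb)) w<) zeros)) (self 0#)

        -- Among the corners of the cube spanned by the swaps of P, all but w have fewer ⊖ inside S,
        -- so only the term at w survives. In `descent` P has more than d pairs, so this same
        -- difference is zero.
        Δ-top : ∀ P h w → Unique (pts P) → All (Red S w) P → #⊖ w ≡ k →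
                (∀ z → #⊖ z ≡ k → inside S z < inside S w → h z ≡ 0#) → Δ P h w ≡ h w
        Δ-top []            h w _ _ w∈ zeros = refl
        Δ-top ((a , b) ∷ P) h w ((_ ∷ a≢) ∷ b≢ ∷ u) (((Sa , wa) , (Sb , wb)) ∷ rs) w∈ zeros =
          trans (cong₂ _-_ (Δ-top P h w u rs w∈ zeros)
            (Δ-below P h (swap a b w) (inside S w) u (red-swap {S = S} {w} a≢ b≢ rs) (trans (#⊖-swap a b w) w∈)
              (ℕ.≤-reflexive (inside-swap S w Sa wa Sb wb)) zeros)) (right (h w))

        descent : ∀ {d} h → Deg≤ d h → (∀ z → #⊖ z ≡ k → ∑ᶠ (bool ∘ S) ≤ #⊕ z) →
                  (∀ z → #⊖ z ≡ k → inside S z ≤ d → h z ≡ 0#) → ∀ z → #⊖ z ≡ k → h z ≡ 0#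
        descent {d} h D room base z z∈ = go z z∈ (<-wellFounded _)
          where
          go : ∀ z → #⊖ z ≡ k → Acc _<_ (inside S z) → h z ≡ 0#
          go z z∈ (acc rec) with inside S z ℕ.≤? d
          ... | yes ≤d = base z z∈ ≤d
          ... | no ≰d with P , u , rs , len ← redPairs S z (inside≤outside S z (room z z∈)) =
            trans (sym (Δ-top P h z u rs z∈ (λ w w∈ w< → go w w∈ (rec w<))))
                  (D P (subst (d <_) (sym len) (ℕ.≰⇒> ≰d)) u z)

-- Biased densities on the slice and the gain they force.

module Gain where
  open Values using (swap; ∈-vectors)
  open Sums
  open Swaps
  open Differences
  open import Defs using (Assignment; vectors; signs)
  open import Data.Fin.Base using (Fin; zero; suc)
  open import Data.Integer.Base as ℤ using (ℤ; +_; -[1+_]; 0ℤ; 1ℤ; ∣_∣; _-_) renaming (_+_ to _+ᶻ_; _*_ to _*ᶻ_; -_ to -ᶻ_; _≤_ to _≤ᶻ_)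
  import Data.Integer.Properties as ℤ
  open import Data.Integer.Tactic.RingSolver using (solve-∀)
  open import Data.List.Base as List using (List; []; _∷_; length)
  open import Data.List.Membership.Propositional using (_∈_)
  open import Data.List.Relation.Unary.All as All using (All; []; _∷_)
  open import Data.List.Relation.Unary.Any using (here; there)
  open import Data.List.Relation.Unary.AllPairs using ([]; _∷_)
  open import Data.List.Relation.Unary.Unique.Propositional using (Unique)
  open import Data.Nat.Base as ℕ using (ℕ; zero; suc; _+_; _*_; _^_; z≤n)
  import Data.Nat.Properties as ℕ
  open import Data.Product.Base using (_×_; _,_; proj₁; proj₂)
  open import Function.Base using (_∘_)
  open import Relation.Binary.PropositionalEquality using (_≡_; _≢_; refl; sym; trans; cong; cong₂; subst; module ≡-Reasoning)

  private
    interchange₁ : ∀ x y z w → (x +ᶻ y) - (z +ᶻ w) ≡ (x - z) +ᶻ (y - w)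
    interchange₁ = solve-∀
    interchange₂ : ∀ x y z w → (x - y) - (z - w) ≡ (x - z) - (y - w)
    interchange₂ = solve-∀

  open Diff _+ᶻ_ _-_ 0ℤ ℤ.+-inverseʳ ℤ.+-identityʳ refl interchange₁ interchange₂ public

  sgn : ℤ → ℤ
  sgn (+ zero)  = 0ℤ
  sgn (+ suc _) = 1ℤ
  sgn -[1+ _ ]  = -[1+ 0 ]

  sgn-* : ∀ x → sgn x *ᶻ x ≡ + ∣ x ∣
  sgn-* (+ zero)  = refl
  sgn-* (+ suc m) = ℤ.*-identityˡ (+ suc m)
  sgn-* -[1+ m ]  = cong (+_ ∘ suc) (ℕ.+-identityʳ m)

  sgn-neg : ∀ x → sgn (-ᶻ x) ≡ -ᶻ sgn x
  sgn-neg (+ zero)  = refl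
  sgn-neg (+ suc m) = refl
  sgn-neg -[1+ m ]  = refl

  0≤1+sgn : ∀ x → 0ℤ ≤ᶻ 1ℤ +ᶻ sgn x
  0≤1+sgn (+ zero)  = ℤ.+≤+ z≤n
  0≤1+sgn (+ suc m) = ℤ.+≤+ z≤n
  0≤1+sgn -[1+ m ]  = ℤ.+≤+ z≤n

  double-zero : ∀ x → x +ᶻ x ≡ 0ℤ → x ≡ 0ℤ
  double-zero (+ zero)  eq = refl

  module _ {n : ℕ} where

    Sum : (Assignment n → ℤ) → ℤ
    Sum = ℤΣ.∑ (vectors signs n)

    Sumᴺ : (Assignment n → ℕ) → ℕ
    Sumᴺ = ℕΣ.∑ (vectors signs n)

    Sum-swap : ∀ a b h → Sum (h ∘ swap a b) ≡ Sum h
    Sum-swap a b = ℤΣ.∑-involution (swap a b) (unique-vectors n) ∈-vectors (swap-involutive a b)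

    Sumᴺ-swap : ∀ a b h → Sumᴺ (h ∘ swap a b) ≡ Sumᴺ h
    Sumᴺ-swap a b = ℕΣ.∑-involution (swap a b) (unique-vectors n) ∈-vectors (swap-involutive a b)

    Sum-cong : ∀ {g h : Assignment n → ℤ} → (∀ y → g y ≡ h y) → Sum g ≡ Sum h
    Sum-cong = ℤΣ.∑-cong (vectors signs n)

    Sumᴺ-cong : ∀ {g h : Assignment n → ℕ} → (∀ y → g y ≡ h y) → Sumᴺ g ≡ Sumᴺ h
    Sumᴺ-cong = ℕΣ.∑-cong (vectors signs n)

    Sum-+ : ∀ g h → Sum (λ y → g y +ᶻ h y) ≡ Sum g +ᶻ Sum h
    Sum-+ = ℤΣ.∑-+ (vectors signs n)

    Anti : (Assignment n → ℤ) → Fin n → Fin n → Set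
    Anti h a b = ∀ y → h (swap a b y) ≡ -ᶻ h y

    -- Reindexing by the swap shows that the sum is its own negative.
    Sum-anti : ∀ {h a b} → Anti h a b → Sum h ≡ 0ℤ
    Sum-anti {h} {a} {b} anti = double-zero (Sum h) (trans (cong (Sum h +ᶻ_) (sym (Sum-swap a b h)))
      (trans (sym (Sum-+ h (h ∘ swap a b)))
      (trans (Sum-cong (λ y → trans (cong (h y +ᶻ_) (anti y)) (ℤ.+-inverseʳ (h y)))) (ℤΣ.∑-0 (vectors signs n)))))

    Δ-anti : ∀ P f → Unique (pts P) → ∀ {a b} → (a , b) ∈ P → Anti (Δ P f) a b
    Δ-anti ((a , b) ∷ P) f u (here refl) y = trans (cong (λ z → Δ P f (swap a b y) - Δ P f z) (swap-involutive a b y)) (lem (Δ P f y) (Δ P f (swap a b y)))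
      where
      lem : ∀ x z → z - x ≡ -ᶻ (x - z)
      lem = solve-∀
    Δ-anti ((c , d) ∷ P) f ((_ ∷ c≢) ∷ d≢ ∷ u) {a} {b} (there ab∈) y =
      trans (cong₂ _-_ (Δ-anti P f u ab∈ y) (trans (cong (Δ P f) (swap-comm (c≢′ a∈) (c≢′ b∈) (d≢′ a∈) (d≢′ b∈) y)) (Δ-anti P f u ab∈ (swap c d y))))
            (lem (Δ P f y) (Δ P f (swap c d y)))
      where
      a∈ = proj₁ (∈-pts ab∈)
      b∈ = proj₂ (∈-pts ab∈)
      c≢′ : ∀ {i} → i ∈ pts P → c ≢ i
      c≢′ = ∉-unique c≢
      d≢′ : ∀ {i} → i ∈ pts P → d ≢ i
      d≢′ = ∉-unique d≢
      lem : ∀ x z → -ᶻ x - -ᶻ z ≡ -ᶻ (x - z)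
      lem = solve-∀

    -- Summation by parts: as w changes sign under each swap of P, a difference operator moved from
    -- f to w only doubles the sum.
    adjoint : ∀ P w f → (∀ {a b} → (a , b) ∈ P → Anti w a b) → Sum (λ y → w y *ᶻ Δ P f y) ≡ + (2 ^ length P) *ᶻ Sum (λ y → w y *ᶻ f y)
    adjoint []            w f anti = sym (ℤ.*-identityˡ _)
    adjoint ((a , b) ∷ P) w f anti = begin
      Sum (λ y → w y *ᶻ (g y - g (swap a b y)))      ≡⟨ Sum-cong pointwise ⟩
      Sum (λ y → wg y +ᶻ wg (swap a b y))            ≡⟨ Sum-+ wg (wg ∘ swap a b) ⟩
      Sum wg +ᶻ Sum (wg ∘ swap a b)                  ≡⟨ cong (Sum wg +ᶻ_) (Sum-swap a b wg) ⟩
      Sum wg +ᶻ Sum wg                               ≡⟨ cong₂ _+ᶻ_ IH IH ⟩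
      c *ᶻ s +ᶻ c *ᶻ s                               ≡⟨ lem c s ⟩
      (+ 2 *ᶻ c) *ᶻ s                                ≡⟨ cong (_*ᶻ s) (sym (ℤ.pos-* 2 (2 ^ length P))) ⟩
      + (2 * 2 ^ length P) *ᶻ s                      ∎
      where
      open ≡-Reasoning
      g = Δ P f
      wg : Assignment n → ℤ
      wg y = w y *ᶻ g y
      c = + (2 ^ length P)
      s = Sum (λ y → w y *ᶻ f y)
      IH : Sum wg ≡ c *ᶻ s
      IH = adjoint P w f (λ p → anti (there p))
      lem : ∀ c s → c *ᶻ s +ᶻ c *ᶻ s ≡ (+ 2 *ᶻ c) *ᶻ s
      lem = solve-∀
      lem′ : ∀ w x z → w *ᶻ (x - z) ≡ w *ᶻ x +ᶻ (-ᶻ w) *ᶻ z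
      lem′ = solve-∀
      pointwise : ∀ y → w y *ᶻ (g y - g (swap a b y)) ≡ wg y +ᶻ wg (swap a b y)
      pointwise y = trans (lem′ (w y) (g y) (g (swap a b y))) (cong (λ u → wg y +ᶻ u *ᶻ g (swap a b y)) (sym (anti (here refl) y)))

    -- The density W biases the uniform distribution on the slice in favour of the
    -- sign of Δ P f, independently for all members P of a family.
    module Density (f : Assignment n → ℤ) where

      size : List (Pair n) → ℕ
      size P = Sumᴺ (λ y → ∣ Δ P f y ∣)

      Commutes : List (Pair n) → List (Pair n) → Set
      Commutes P Q = ∀ {a b} → (a , b) ∈ P → Invariant (Δ Q f) a b

      -- Members are nonempty, since averaging out the sign of a member takes a swap that belongs to
      -- it. Mutual invariance is what makes the signs of different members independent.
      data Family : List (List (Pair n)) → Set where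
        []  : Family []
        add : ∀ {a b P F} → Unique (pts ((a , b) ∷ P)) → (∀ {Q} → Q ∈ F → Commutes ((a , b) ∷ P) Q × Commutes Q ((a , b) ∷ P)) →
              Family F → Family (((a , b) ∷ P) ∷ F)

      W : List (List (Pair n)) → Assignment n → ℤ
      W []      y = 1ℤ
      W (P ∷ F) y = (1ℤ +ᶻ sgn (Δ P f y)) *ᶻ W F y

      W-invariant : ∀ F {a b} → (∀ {Q} → Q ∈ F → Invariant (Δ Q f) a b) → Invariant (W F) a b
      W-invariant []      inv y = refl
      W-invariant (P ∷ F) inv y = cong₂ (λ x w → (1ℤ +ᶻ sgn x) *ᶻ w) (inv (here refl) y) (W-invariant F (λ q → inv (there q)) y)

      0≤W : ∀ F y → 0ℤ ≤ᶻ W F y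
      0≤W []      y = ℤ.+≤+ z≤n
      0≤W (P ∷ F) y = nonneg (0≤1+sgn (Δ P f y)) (0≤W F y)
        where
        nonneg : ∀ {x z} → 0ℤ ≤ᶻ x → 0ℤ ≤ᶻ z → 0ℤ ≤ᶻ x *ᶻ z
        nonneg {+ x} {+ z} _ _ = subst (0ℤ ≤ᶻ_) (ℤ.pos-* x z) (ℤ.+≤+ z≤n)

      split-sum : ∀ P F (g : Assignment n → ℤ) → Sum (λ y → W (P ∷ F) y *ᶻ g y) ≡ Sum (λ y → W F y *ᶻ g y) +ᶻ Sum (λ y → (sgn (Δ P f y) *ᶻ W F y) *ᶻ g y)
      split-sum P F g = trans (Sum-cong (λ y → lem (sgn (Δ P f y)) (W F y) (g y))) (Sum-+ _ _)
        where
        lem : ∀ (s w g : ℤ) → ((1ℤ +ᶻ s) *ᶻ w) *ᶻ g ≡ w *ᶻ g +ᶻ (s *ᶻ w) *ᶻ g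
        lem = solve-∀

      signed-anti : ∀ {P F a b} → Unique (pts P) → (a , b) ∈ P → (∀ {Q} → Q ∈ F → Invariant (Δ Q f) a b) →
                    Anti (λ y → sgn (Δ P f y) *ᶻ W F y) a b
      signed-anti {P} {F} u ab∈ inv y = trans (cong₂ _*ᶻ_ (trans (cong sgn (Δ-anti P f u ab∈ y)) (sgn-neg (Δ P f y))) (W-invariant F inv y))
        (sym (ℤ.neg-distribˡ-* (sgn (Δ P f y)) (W F y)))

      -- Expand the factor 1 + sgn Δ P f of the first member. The term with the sign is
      -- antisymmetric under the first pair of P, because g and the density of the other members do
      -- not change there, so it sums to zero. For g = χ this means that the density has mean 1 on
      -- the slice.
      W-mean : ∀ {F} (g : Assignment n → ℤ) → Family F → (∀ {Q} → Q ∈ F → ∀ {a b} → (a , b) ∈ Q → Invariant g a b) → Sum (λ y → W F y *ᶻ g y) ≡ Sum g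
      W-mean g []  inv = Sum-cong (λ y → ℤ.*-identityˡ (g y))
      W-mean g (add {a} {b} {P} {F} u com fam) inv = trans (split-sum ((a , b) ∷ P) F g)
        (trans (cong₂ _+ᶻ_ (W-mean g fam (λ q → inv (there q))) (Sum-anti {a = a} {b} anti)) (ℤ.+-identityʳ _))
        where
        anti : Anti (λ y → (sgn (Δ ((a , b) ∷ P) f y) *ᶻ W F y) *ᶻ g y) a b
        anti y = trans (cong₂ _*ᶻ_ (signed-anti {F = F} u (here refl) (λ q → proj₁ (com q) (here refl)) y) (inv (here refl) (here refl) y))
          (sym (ℤ.neg-distribˡ-* (sgn (Δ ((a , b) ∷ P) f y) *ᶻ W F y) (g y)))

      -- In the term with sgn Δ P f, summation by parts turns 2^r f into Δ P f, so the weighted sum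
      -- of |Δ P f| appears. The other members leave |Δ P f| unchanged, and `W-mean` removes their
      -- density.
      W-value : ∀ {F} r → Family F → All (λ P → length P ≡ r) F →
        + (2 ^ r) *ᶻ Sum (λ y → W F y *ᶻ f y) ≡ + (2 ^ r) *ᶻ Sum f +ᶻ + ℕΣ.∑ F size
      W-value r [] [] = trans (cong (+ (2 ^ r) *ᶻ_) (Sum-cong (λ y → ℤ.*-identityˡ (f y)))) (sym (ℤ.+-identityʳ _))
      W-value r (add {a} {b} {P′} {F} u com fam) (refl ∷ ls) = begin
        c *ᶻ Sum (λ y → W (P ∷ F) y *ᶻ f y)                    ≡⟨ cong (c *ᶻ_) (split-sum P F f) ⟩
        c *ᶻ (Sum (λ y → W F y *ᶻ f y) +ᶻ Sum (λ y → w y *ᶻ f y)) ≡⟨ ℤ.*-distribˡ-+ c _ _ ⟩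
        c *ᶻ Sum (λ y → W F y *ᶻ f y) +ᶻ c *ᶻ Sum (λ y → w y *ᶻ f y)
          ≡⟨ cong₂ _+ᶻ_ (W-value r fam ls) (trans (sym (adjoint P w f (λ p → signed-anti {F = F} u p (λ q → proj₁ (com q) p)))) biased) ⟩
        (c *ᶻ Sum f +ᶻ + ℕΣ.∑ F size) +ᶻ + size P               ≡⟨ ℤ.+-assoc (c *ᶻ Sum f) _ _ ⟩
        c *ᶻ Sum f +ᶻ (+ ℕΣ.∑ F size +ᶻ + size P)               ≡⟨ cong (c *ᶻ Sum f +ᶻ_) (ℤ.+-comm (+ ℕΣ.∑ F size) (+ size P)) ⟩
        c *ᶻ Sum f +ᶻ + (size P + ℕΣ.∑ F size)                  ∎
        where
        open ≡-Reasoning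
        P = (a , b) ∷ P′
        c = + (2 ^ length P)
        w : Assignment n → ℤ
        w y = sgn (Δ P f y) *ᶻ W F y
        lem : ∀ s w x → (s *ᶻ w) *ᶻ x ≡ w *ᶻ (s *ᶻ x)
        lem = solve-∀
        biased : Sum (λ y → w y *ᶻ Δ P f y) ≡ + size P
        biased = trans (Sum-cong (λ y → trans (lem (sgn (Δ P f y)) (W F y) (Δ P f y)) (cong (W F y *ᶻ_) (sgn-* (Δ P f y)))))
          (trans (W-mean (λ y → + ∣ Δ P f y ∣) fam (λ q p y → cong (+_ ∘ ∣_∣) (proj₂ (com q) p y))) (∑-pos (vectors signs n) _))

      -- The weights are nonnegative with the same total over the slice as the uniform ones, so the
      -- biased mean of f cannot exceed the maximum M.
      biased-gain : ∀ {F} r (χ : Assignment n → ℕ) M → Family F → All (λ P → length P ≡ r) F → (∀ a b → Invariant χ a b) →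
        (∀ y → f y ≤ᶻ + M *ᶻ + χ y) → + (2 ^ r) *ᶻ Sum f +ᶻ + ℕΣ.∑ F size ≤ᶻ + (2 ^ r * (M * Sumᴺ χ))
      biased-gain {F} r χ M fam ls inv f≤ = begin
        + (2 ^ r) *ᶻ Sum f +ᶻ + ℕΣ.∑ F size           ≡⟨ W-value r fam ls ⟨
        + (2 ^ r) *ᶻ Sum (λ y → W F y *ᶻ f y)         ≤⟨ ℤ.*-monoˡ-≤-nonNeg (+ (2 ^ r)) (ℤ-∑-mono (vectors signs n) (λ y → mul (W F y) (0≤W F y) (f≤ y))) ⟩
        + (2 ^ r) *ᶻ Sum (λ y → W F y *ᶻ (+ M *ᶻ + χ y)) ≡⟨ cong (+ (2 ^ r) *ᶻ_) (W-mean (λ y → + M *ᶻ + χ y) fam (λ _ {a} {b} _ y → cong (λ m → + M *ᶻ + m) (inv a b y))) ⟩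
        + (2 ^ r) *ᶻ Sum (λ y → + M *ᶻ + χ y)         ≡⟨ cong (+ (2 ^ r) *ᶻ_) (trans (ℤ-∑-* (+ M) (vectors signs n) (λ y → + χ y)) (cong (+ M *ᶻ_) (∑-pos (vectors signs n) χ))) ⟩
        + (2 ^ r) *ᶻ (+ M *ᶻ + Sumᴺ χ)                ≡⟨ cong (+ (2 ^ r) *ᶻ_) (ℤ.pos-* M (Sumᴺ χ)) ⟨
        + (2 ^ r) *ᶻ + (M * Sumᴺ χ)                   ≡⟨ ℤ.pos-* (2 ^ r) (M * Sumᴺ χ) ⟨
        + (2 ^ r * (M * Sumᴺ χ))                      ∎
        where
        open ℤ.≤-Reasoning
        mul : ∀ w {x z} → 0ℤ ≤ᶻ w → x ≤ᶻ z → w *ᶻ x ≤ᶻ w *ᶻ z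
        mul (+ w) _ x≤z = ℤ.*-monoˡ-≤-nonNeg (+ w) x≤z

-- Counting the points of the slice with prescribed signs.

module Levels where
  open Values using (_≡ᶠ_; length-idxs; swap; #⊖; #⊕; idxs)
  open Sums
  open Swaps
  open Differences
  open Gain
  open import Defs using (Assignment; vectors; signs)
  open import Data.Bool.Base using (true; false; T; if_then_else_)
  open import Data.Empty using (⊥-elim)
  open import Data.Fin.Base using (Fin; zero; suc)
  open import Data.Fin.Properties using (_≟_)
  open import Data.List.Base as List using (List; []; _∷_; length)
  open import Data.List.Membership.Propositional using (_∈_; _∉_)
  open import Data.List.Relation.Unary.All as All using (All; []; _∷_)
  open import Data.List.Relation.Unary.Any using (here; there)
  open import Data.List.Relation.Unary.AllPairs using ([]; _∷_)
  open import Data.List.Relation.Unary.Unique.Propositional using (Unique)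
  open import Data.Nat.Base using (ℕ; zero; suc; _+_; _*_; _^_; _∸_; _≤_; _<_; z≤n; s≤s; _≡ᵇ_; >-nonZero)
  open import Data.Nat.Properties hiding (_≟_)
  open import Data.Nat.Tactic.RingSolver using (solve-∀)
  open import Data.Product.Base using (_×_; _,_; proj₁)
  open import Data.Sign.Base using (Sign) renaming (+ to ⊕; - to ⊖)
  open import Data.Vec.Base using (lookup)
  open import Function.Base using (_∘_)
  open import Relation.Binary.PropositionalEquality using (_≡_; _≢_; refl; sym; trans; cong; cong₂; subst; module ≡-Reasoning)
  open import Relation.Nullary.Decidable.Core using (yes; no)

  is : Sign → Sign → ℕ
  is ⊖ x = bool (is⊖ x)
  is ⊕ x = bool (is⊕ x)

  is-≡ : ∀ s x → is s x ≢ 0 → x ≡ s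
  is-≡ ⊖ ⊖ _ = refl
  is-≡ ⊖ ⊕ h = ⊥-elim (h refl)
  is-≡ ⊕ ⊕ _ = refl
  is-≡ ⊕ ⊖ h = ⊥-elim (h refl)

  module _ {n : ℕ} where

    Spec : Set
    Spec = List (Fin n × Sign)

    positions : Spec → List (Fin n)
    positions = List.map proj₁

    match : Spec → Assignment n → ℕ
    match []            y = 1
    match ((i , s) ∷ Z) y = is s (lookup y i) * match Z y

    amount : Sign → Spec → ℕ
    amount s []             = 0
    amount s ((_ , s′) ∷ Z) = is s s′ + amount s Z

    fresh : Spec → Fin n → ℕ
    fresh []            j = 1
    fresh ((i , _) ∷ Z) j = (if j ≡ᶠ i then 0 else 1) * fresh Z j

    number : Sign → Assignment n → ℕ
    number s y = ∑ᶠ (λ j → is s (lookup y j))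

    fresh-∉ : ∀ Z {j} → j ∉ positions Z → fresh Z j ≡ 1
    fresh-∉ []            j∉ = refl
    fresh-∉ ((i , _) ∷ Z) {j} j∉ rewrite ≡ᶠ-≢ {i = j} {i} (λ { refl → j∉ (here refl) }) = trans (+-identityʳ _) (fresh-∉ Z (j∉ ∘ there))

    fresh-≢0 : ∀ Z {j} → fresh Z j ≢ 0 → j ∉ positions Z
    fresh-≢0 ((i , _) ∷ Z) {j} h (here refl) rewrite ≡ᶠ-refl j = h refl
    fresh-≢0 ((i , _) ∷ Z) {j} h (there j∈) = fresh-≢0 Z (λ eq → h (trans (cong (c *_) eq) (*-zeroʳ c))) j∈
      where c = if j ≡ᶠ i then 0 else 1

    match-∷ : ∀ i s Z y → match ((i , s) ∷ Z) y ≢ 0 → lookup y i ≡ s × match Z y ≢ 0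
    match-∷ i s Z y h = is-≡ s (lookup y i) (λ eq → h (cong (_* match Z y) eq)) , λ eq → h (trans (cong (is s (lookup y i) *_) eq) (*-zeroʳ (is s (lookup y i))))

    count-fresh : ∀ s Z y → Unique (positions Z) → match Z y ≢ 0 → ∑ᶠ (λ j → fresh Z j * is s (lookup y j)) + amount s Z ≡ number s y
    count-fresh s [] y _ _ = trans (+-identityʳ _) (ℕΣ.∑-cong (idxs n) (λ j → +-identityʳ _))
    count-fresh s ((z , s′) ∷ Z) y (z≢ ∷ u) h with yz , h′ ← match-∷ z s′ Z y h = begin
      ∑ᶠ new + (is s s′ + amount s Z)                        ≡⟨ +-assoc (∑ᶠ new) _ _ ⟨
      (∑ᶠ new + is s s′) + amount s Z                        ≡⟨ cong (λ m → (∑ᶠ new + m) + amount s Z) at-z ⟨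
      (∑ᶠ new + ∑ᶠ (λ j → is s s′ * point z j)) + amount s Z ≡⟨ cong (_+ amount s Z) (ℕΣ.∑-+ (idxs n) new _) ⟨
      ∑ᶠ (λ j → new j + is s s′ * point z j) + amount s Z    ≡⟨ cong (_+ amount s Z) (ℕΣ.∑-cong (idxs n) pointwise) ⟩
      ∑ᶠ (λ j → fresh Z j * is s (lookup y j)) + amount s Z  ≡⟨ count-fresh s Z y u h′ ⟩
      number s y                                             ∎
      where
      open ≡-Reasoning
      new : Fin n → ℕ
      new j = fresh ((z , s′) ∷ Z) j * is s (lookup y j)
      at-z : ∑ᶠ (λ j → is s s′ * point z j) ≡ is s s′
      at-z = trans (ℕ-∑-* (is s s′) (idxs n) (point z)) (trans (cong (is s s′ *_) (∑-point z)) (*-identityʳ _))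
      z∉ : z ∉ positions Z
      z∉ z∈ = ∉-unique z≢ z∈ refl
      pointwise : ∀ j → new j + is s s′ * point z j ≡ fresh Z j * is s (lookup y j)
      pointwise j with j ≟ z
      ... | yes refl rewrite ≡ᶠ-refl j | fresh-∉ Z z∉ | yz = trans (*-identityʳ (is s s′)) (sym (+-identityʳ _))
      ... | no j≢z   rewrite ≡ᶠ-≢ j≢z | *-zeroʳ (is s s′) = trans (+-identityʳ _) (cong (_* is s (lookup y j)) (+-identityʳ (fresh Z j)))

    match-swap : ∀ Z {a b} y → a ∉ positions Z → b ∉ positions Z → match Z (swap a b y) ≡ match Z y
    match-swap []            y a∉ b∉ = refl
    match-swap ((i , s) ∷ Z) y a∉ b∉ = cong₂ (λ x m → is s x * m)
      (swap-other y (λ { refl → a∉ (here refl) }) (λ { refl → b∉ (here refl) })) (match-swap Z y (a∉ ∘ there) (b∉ ∘ there))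

  module Slice {n : ℕ} (k : ℕ) where

    χ : Assignment n → ℕ
    χ y = bool (#⊖ y ≡ᵇ k)

    χ-swap : ∀ a b → Invariant χ a b
    χ-swap a b y = cong (λ m → bool (m ≡ᵇ k)) (#⊖-swap a b y)

    χ-≢0 : ∀ y → χ y ≢ 0 → #⊖ y ≡ k
    χ-≢0 y h with #⊖ y ≡ᵇ k in eq
    ... | true  = ≡ᵇ⇒≡ (#⊖ y) k (subst T (sym eq) _)

    ... | false = ⊥-elim (h refl)

    χ-slice : ∀ y → #⊖ y ≡ k → χ y ≡ 1
    χ-slice y refl = cong bool (go (#⊖ y))
      where
      go : ∀ m → (m ≡ᵇ m) ≡ true
      go zero    = refl
      go (suc m) = go m

    σ : ℕ
    σ = Sumᴺ χ

    κ : Sign → ℕ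
    κ ⊖ = k
    κ ⊕ = n ∸ k

    number-slice : ∀ s (y : Assignment n) → #⊖ y ≡ k → number s y ≡ κ s
    number-slice ⊖ y refl = sym (#⊖-sum y)
    number-slice ⊕ y refl = trans (sym (#⊕-sum y)) (trans (sym (m+n∸m≡n (#⊖ y) (#⊕ y))) (cong (_∸ #⊖ y) (#⊖+#⊕ y)))

    N : Spec → ℕ
    N Z = Sumᴺ (λ y → χ y * match Z y)

    N-[] : N [] ≡ σ
    N-[] = Sumᴺ-cong (λ y → *-identityʳ (χ y))

    N-exchange : ∀ i j s Z → i ∉ positions Z → j ∉ positions Z → N ((j , s) ∷ Z) ≡ N ((i , s) ∷ Z)
    N-exchange i j s Z i∉ j∉ = trans (sym (Sumᴺ-swap i j _)) (Sumᴺ-cong λ y →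
      cong₂ _*_ (χ-swap i j y) (cong₂ (λ x m → is s x * m) (swap-right i j y) (match-swap Z y i∉ j∉)))

    -- Double counting of the pairs (y , j) with y matching Z, y_j = s, and j a position not in Z.
    N-step : ∀ i s Z → Unique (positions Z) → i ∉ positions Z → (κ s ∸ amount s Z) * N Z ≤ n * N ((i , s) ∷ Z)
    N-step i s Z u i∉ = begin
      (κ s ∸ amount s Z) * N Z
        ≡⟨ ℕ-∑-* (κ s ∸ amount s Z) (vectors signs n) _ ⟨
      Sumᴺ (λ y → (κ s ∸ amount s Z) * (χ y * match Z y))
        ≤⟨ ℕ-∑-mono (vectors signs n) pointwise ⟩
      Sumᴺ (λ y → ∑ᶠ (λ j → fresh Z j * (χ y * match ((j , s) ∷ Z) y)))
        ≡⟨ ℕΣ.∑-comm (vectors signs n) (idxs n) _ ⟩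
      ∑ᶠ (λ j → Sumᴺ (λ y → fresh Z j * (χ y * match ((j , s) ∷ Z) y)))
        ≡⟨ ℕΣ.∑-cong (idxs n) (λ j → ℕ-∑-* (fresh Z j) (vectors signs n) _) ⟩
      ∑ᶠ (λ j → fresh Z j * N ((j , s) ∷ Z))
        ≤⟨ ℕ-∑-mono (idxs n) each ⟩
      ∑ᶠ {n} (λ _ → N ((i , s) ∷ Z))
        ≡⟨ const-sum (N ((i , s) ∷ Z)) ⟩
      n * N ((i , s) ∷ Z) ∎
      where
      open ≤-Reasoning
      const-sum : ∀ c → ∑ᶠ {n} (λ _ → c) ≡ n * c
      const-sum c = trans (go (idxs n)) (cong (_* c) (length-idxs n))
        where
        go : ∀ (xs : List (Fin n)) → ℕΣ.∑ xs (λ _ → c) ≡ length xs * c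
        go []       = refl
        go (x ∷ xs) = cong (c +_) (go xs)
      each : ∀ j → fresh Z j * N ((j , s) ∷ Z) ≤ N ((i , s) ∷ Z)
      each j with fresh Z j in eq
      ... | zero  = z≤n
      ... | suc m = ≤-trans (≤-reflexive (trans (cong (_* N ((j , s) ∷ Z)) (trans (sym eq) (fresh-∉ Z j∉))) (+-identityʳ _))) (≤-reflexive (N-exchange i j s Z i∉ j∉))
        where
        j∉ : j ∉ positions Z
        j∉ = fresh-≢0 Z (λ e → 1+n≢0 (trans (sym eq) e))
      pointwise : ∀ y → (κ s ∸ amount s Z) * (χ y * match Z y) ≤ ∑ᶠ (λ j → fresh Z j * (χ y * match ((j , s) ∷ Z) y))
      pointwise y with χ y * match Z y in eq
      ... | zero  = ≤-trans (≤-reflexive (*-zeroʳ (κ s ∸ amount s Z))) z≤n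
      ... | suc m = ≤-trans (*-monoˡ-≤ (suc m) (m≤n+o⇒m∸n≤o (κ s) (amount s Z)
            (≤-reflexive (trans (sym (number-slice s y y∈)) (trans (sym (count-fresh s Z y u mz)) (+-comm _ (amount s Z)))))))
          (≤-reflexive (trans (*-comm _ (suc m)) (trans (sym (ℕ-∑-* (suc m) (idxs n) _)) (ℕΣ.∑-cong (idxs n) λ j →
            trans (cong (_* (fresh Z j * is s (lookup y j))) (sym eq)) (lem (χ y) (match Z y) (fresh Z j) (is s (lookup y j)))))))
        where
        y∈ : #⊖ y ≡ k
        y∈ = χ-≢0 y (λ e → 1+n≢0 (trans (sym eq) (cong (_* match Z y) e)))
        mz : match Z y ≢ 0
        mz e = 1+n≢0 (trans (sym eq) (trans (cong (χ y *_) e) (*-zeroʳ (χ y))))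
        lem : ∀ c m f i → c * m * (f * i) ≡ f * (c * (i * m))
        lem = solve-∀

    spec : List (Pair n) → Spec
    spec []            = []
    spec ((a , b) ∷ P) = (a , ⊖) ∷ (b , ⊕) ∷ spec P

    positions-spec : ∀ P → positions (spec P) ≡ pts P
    positions-spec []            = refl
    positions-spec ((a , b) ∷ P) = cong (λ xs → a ∷ b ∷ xs) (positions-spec P)

    amount-spec : ∀ s P → amount s (spec P) ≡ length P
    amount-spec s []            = refl
    amount-spec ⊖ ((a , b) ∷ P) = cong suc (amount-spec ⊖ P)
    amount-spec ⊕ ((a , b) ∷ P) = cong suc (amount-spec ⊕ P)

    module _ (d ρ : ℕ) (balanced : n * n ≤ 2 * ρ * (k * (n ∸ k))) where

      -- The price of prescribing one more pair: n² / (k (n - k)) is at most 2ρ, and each of the two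
      -- factors d makes up for the signs that earlier pairs have already used.
      G₀ : ℕ
      G₀ = 2 * ρ * (d * d)

      -- c = m + (c - m) ≤ (m + 1) (c - m), because c - m is at least 1.
      proportion : ∀ {c m} → m < d → m < c → c ≤ d * (c ∸ m)
      proportion {c} {m} m<d m<c with c ∸ m | m+[n∸m]≡n (<⇒≤ m<c)
      ... | zero  | eq = ⊥-elim (<-irrefl (trans (sym (+-identityʳ m)) eq) m<c)
      ... | suc x | eq = ≤-trans (≤-reflexive (sym eq)) (≤-trans (+-monoˡ-≤ (suc x) (m≤m*n m (suc x)))
          (≤-trans (≤-reflexive (+-comm (m * suc x) (suc x))) (*-monoˡ-≤ (suc x) m<d)))

      -- Prescribing ⊕ at b costs a factor n / (n - k - |P|), and ⊖ at a then costs n / (k - |P|).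
      -- By `proportion` these are at most d n / (n - k) and d n / k.
      N-pair : ∀ a b P → Unique (pts ((a , b) ∷ P)) → length P < d → length P < k → length P < n ∸ k →
               N (spec P) ≤ G₀ * N (spec ((a , b) ∷ P))
      N-pair a b P ((a≢b ∷ a≢) ∷ b≢ ∷ u) <d <k <n∸k =
        *-cancelˡ-≤ (k * (n ∸ k)) ⦃ >-nonZero (*-mono-≤ (≤-trans (s≤s z≤n) <k) (≤-trans (s≤s z≤n) <n∸k)) ⦄ (begin
        k * (n ∸ k) * N Z          ≡⟨ *-assoc k (n ∸ k) (N Z) ⟩
        k * ((n ∸ k) * N Z)        ≤⟨ *-monoʳ-≤ k second ⟩
        k * (d * (n * N Z₁))       ≡⟨ lem₁ k d n (N Z₁) ⟩
        d * n * (k * N Z₁)         ≤⟨ *-monoʳ-≤ (d * n) first ⟩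
        d * n * (d * (n * N Z₂))   ≡⟨ lem₂ d n (N Z₂) ⟩
        d * d * N Z₂ * (n * n)     ≤⟨ *-monoʳ-≤ (d * d * N Z₂) balanced ⟩
        d * d * N Z₂ * (2 * ρ * (k * (n ∸ k))) ≡⟨ lem₃ (d * d) (N Z₂) (2 * ρ) (k * (n ∸ k)) ⟩
        k * (n ∸ k) * (G₀ * N Z₂)  ∎)
        where
        open ≤-Reasoning
        Z  = spec P
        Z₁ = (b , ⊕) ∷ Z
        Z₂ = (a , ⊖) ∷ Z₁
        pos : ∀ {x} → All (x ≢_) (pts P) → x ∉ positions Z
        pos x≢ x∈ = ∉-unique x≢ (subst (_ ∈_) (positions-spec P) x∈) refl
        uZ : Unique (positions Z)
        uZ = subst Unique (sym (positions-spec P)) u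
        uZ₁ : Unique (positions Z₁)
        uZ₁ = subst (λ xs → All (b ≢_) xs) (sym (positions-spec P)) b≢ ∷ uZ
        second : (n ∸ k) * N Z ≤ d * (n * N Z₁)
        second = ≤-trans (*-monoˡ-≤ (N Z) (proportion <d <n∸k)) (≤-trans (≤-reflexive (*-assoc d _ (N Z)))
          (*-monoʳ-≤ d (≤-trans (≤-reflexive (cong (λ m → (n ∸ k ∸ m) * N Z) (sym (amount-spec ⊕ P)))) (N-step b ⊕ Z uZ (pos b≢)))))
        first : k * N Z₁ ≤ d * (n * N Z₂)
        first = ≤-trans (*-monoˡ-≤ (N Z₁) (proportion <d <k)) (≤-trans (≤-reflexive (*-assoc d _ (N Z₁)))
          (*-monoʳ-≤ d (≤-trans (≤-reflexive (cong (λ m → (k ∸ m) * N Z₁) (sym (amount-spec ⊖ P))))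
            (N-step a ⊖ Z₁ uZ₁ λ { (here refl) → a≢b refl ; (there a∈) → pos a≢ a∈ }))))
        lem₁ : ∀ k d n x → k * (d * (n * x)) ≡ d * n * (k * x)
        lem₁ = solve-∀
        lem₂ : ∀ d n x → d * n * (d * (n * x)) ≡ d * d * x * (n * n)
        lem₂ = solve-∀
        lem₃ : ∀ d x r c → d * x * (r * c) ≡ c * (r * d * x)
        lem₃ = solve-∀

      N-spec : ∀ P → Unique (pts P) → length P ≤ d → length P ≤ k → length P ≤ n ∸ k → σ ≤ G₀ ^ length P * N (spec P)
      N-spec []            u ≤d ≤k ≤n = ≤-reflexive (sym (trans (+-identityʳ _) N-[]))
      N-spec ((a , b) ∷ P) u@(_ ∷ _ ∷ u′) ≤d ≤k ≤n = ≤-trans (N-spec P u′ (<⇒≤ ≤d) (<⇒≤ ≤k) (<⇒≤ ≤n))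
        (≤-trans (*-monoʳ-≤ (G₀ ^ length P) (N-pair a b P u ≤d ≤k ≤n))
          (≤-reflexive (trans (sym (*-assoc (G₀ ^ length P) G₀ _)) (cong (_* N (spec ((a , b) ∷ P))) (*-comm (G₀ ^ length P) G₀)))))

  module _ {n : ℕ} (k : ℕ) where
    open Slice {n} k

    Vanishes : (Assignment n → ℕ) → Fin n → Fin n → Set
    Vanishes g a b = ∀ y → lookup y a ≡ lookup y b → g y ≡ 0

    match-spec-swap : ∀ P {a b} y → All (a ≢_) (pts P) → All (b ≢_) (pts P) → match (spec P) (swap a b y) ≡ match (spec P) y
    match-spec-swap P y a≢ b≢ = match-swap (spec P) y (pos a≢) (pos b≢)
      where
      pos : ∀ {x} → All (x ≢_) (pts P) → x ∉ positions (spec P)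
      pos x≢ x∈ = ∉-unique x≢ (subst (_ ∈_) (positions-spec P) x∈) refl

    -- Where g does not vanish, the two places of each pair carry opposite signs, and exchanging
    -- them does not change g. So all 2^|P| orientations contribute equally.
    Sum-oriented : ∀ P g → Unique (pts P) → (∀ {a b} → (a , b) ∈ P → Invariant g a b) → (∀ {a b} → (a , b) ∈ P → Vanishes g a b) →
                   Sumᴺ g ≡ 2 ^ length P * Sumᴺ (λ y → g y * match (spec P) y)
    Sum-oriented []            g u inv van = trans (Sumᴺ-cong (λ y → sym (*-identityʳ (g y)))) (sym (+-identityʳ _))
    Sum-oriented ((a , b) ∷ P) g ((a≢b ∷ a≢) ∷ b≢ ∷ u) inv van =
      trans (Sum-oriented P g u (λ p → inv (there p)) (λ p → van (there p)))
      (trans (cong (2 ^ length P *_) halves) (lem (2 ^ length P) (Sumᴺ h)))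
      where
      g′ h : Assignment n → ℕ
      g′ y = g y * match (spec P) y
      h y = g y * match (spec ((a , b) ∷ P)) y
      lem : ∀ c x → c * (x + x) ≡ 2 * c * x
      lem = solve-∀
      pointwise : ∀ y → g′ y ≡ h y + h (swap a b y)
      pointwise y rewrite swap-left a b y | swap-right a b y | match-spec-swap P y a≢ b≢ | inv (here refl) y
        with lookup y a in ya | lookup y b in yb
      ... | ⊖ | ⊖ rewrite van (here refl) y (trans ya (sym yb)) = refl
      ... | ⊕ | ⊕ rewrite van (here refl) y (trans ya (sym yb)) = refl
      ... | ⊖ | ⊕ = lem′ (g y) (match (spec P) y)
        where
        lem′ : ∀ g m → g * m ≡ g * (1 * (1 * m)) + g * 0
        lem′ = solve-∀
      ... | ⊕ | ⊖ = lem′ (g y) (match (spec P) y)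
        where
        lem′ : ∀ g m → g * m ≡ g * 0 + g * (1 * (1 * m))
        lem′ = solve-∀
      halves : Sumᴺ g′ ≡ Sumᴺ h + Sumᴺ h
      halves = trans (Sumᴺ-cong pointwise) (trans (ℕΣ.∑-+ (vectors signs n) h (h ∘ swap a b)) (cong (Sumᴺ h +_) (Sumᴺ-swap a b h)))

-- Many disjoint pairs with an effect force a large OPT.

module Certificate where
  open Values using (swap; #⊖; idxs; ∈-idxs; length-idxs)
  open Sums
  open Swaps
  open Differences
  open Gain
  open Levels
  open import Defs using (Assignment; vectors; signs)
  open import Data.Empty using (⊥-elim)
  open import Data.Fin.Base using (Fin; zero; suc)
  import Data.Fin.Properties as Fin
  open import Data.Integer.Base as ℤ using (ℤ; 0ℤ; ∣_∣; _-_) renaming (_+_ to _+ᶻ_; _*_ to _*ᶻ_; -_ to -ᶻ_; _≤_ to _≤ᶻ_)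
  import Data.Integer.Properties as ℤ
  import Data.Integer.Tactic.RingSolver as ℤ-Solver
  open import Data.List.Base as List using (List; []; _∷_; _++_; length)
  open import Data.List.Membership.Propositional using (_∈_; _∉_)
  open import Data.List.Membership.Propositional.Properties using (∈-++⁺ˡ; ∈-++⁺ʳ; ∈-++⁻; ∈-∃++)
  open import Data.List.Properties using (length-++; ++-assoc)
  open import Data.List.Relation.Unary.All as All using (All; []; _∷_)
  open import Data.List.Relation.Unary.Any using (here; there)
  open import Data.List.Relation.Unary.AllPairs using ([]; _∷_)
  open import Data.List.Relation.Unary.Unique.Propositional using (Unique)
  import Data.List.Relation.Unary.Unique.Propositional.Properties as Unique
  open import Data.Nat.Base using (ℕ; zero; suc; _+_; _*_; _^_; _∸_; _≤_; _<_; z≤n; s≤s; >-nonZero)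
  open import Data.Nat.Properties
  open import Data.Nat.Tactic.RingSolver using (solve-∀)
  open import Data.Product.Base using (_×_; _,_; proj₁; proj₂; Σ-syntax; ∃-syntax)
  open import Data.Sign.Base using () renaming (+ to ⊕; - to ⊖)
  open import Data.Sum.Base using (_⊎_; inj₁; inj₂)
  open import Data.Vec.Base using (lookup)
  open import Relation.Binary.PropositionalEquality using (_≡_; _≢_; refl; sym; trans; cong; cong₂; subst; ≢-sym)
  open import Relation.Nullary.Decidable.Core using (Dec; yes; no; decidable-stable; ¬¬-excluded-middle)
  open import Relation.Nullary.Negation.Core using (¬_)

  unique-++⁻ : ∀ {A : Set} xs {ys : List A} → Unique (xs ++ ys) → Unique xs × Unique ys × (∀ {x y} → x ∈ xs → y ∈ ys → x ≢ y)
  unique-++⁻ []       u        = [] , u , λ ()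
  unique-++⁻ (x ∷ xs) (x≢ ∷ u) =
    let ux , uy , dis = unique-++⁻ xs u
    in All.tabulate (λ z∈ → ∉-unique x≢ (∈-++⁺ˡ z∈)) ∷ ux , uy ,
       λ { (here refl) y∈ → ∉-unique x≢ (∈-++⁺ʳ xs y∈) ; (there z∈) y∈ → dis z∈ y∈ }

  pair-distinct : ∀ {n} {P : List (Pair n)} {a b} → Unique (pts P) → (a , b) ∈ P → a ≢ b
  pair-distinct ((a≢b ∷ _) ∷ _) (here refl) = a≢b
  pair-distinct (_ ∷ _ ∷ u)     (there p)   = pair-distinct u p

  unique-length : ∀ {A : Set} (xs ys : List A) → Unique xs → (∀ {x} → x ∈ xs → x ∈ ys) → length xs ≤ length ys
  unique-length []       ys u        sub = z≤n
  unique-length (x ∷ xs) ys (x≢ ∷ u) sub with as , bs , refl ← ∈-∃++ (sub (here refl)) =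
    ≤-trans (s≤s (unique-length xs (as ++ bs) u (λ z∈ → ∈-remove as bs (sub (there z∈)) (∉-unique x≢ z∈))))
            (≤-reflexive (sym (length-remove as bs)))

  minus-zero : ∀ x z → x - z ≡ 0ℤ → x ≡ z
  minus-zero x z = ℤ.i-j≡0⇒i≡j x z

  module _ {n : ℕ} (k d ρ M : ℕ) (v : Assignment n → ℕ) (deg : Deg≤ d (λ y → ℤ.+ v y))
           (v≤M : ∀ y → #⊖ y ≡ k → v y ≤ M) (balanced : n * n ≤ 2 * ρ * (k * (n ∸ k))) (1≤d : 1 ≤ d) (1≤ρ : 1 ≤ ρ) where
    open Slice {n} k

    -- The factor χ confines sums over all assignments to the slice. It is invariant under swaps and
    -- therefore comes out of every difference.
    f : Assignment n → ℤ
    f y = ℤ.+ (χ y * v y)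

    Δ-χ : ∀ P y → Δ P f y ≡ ℤ.+ χ y *ᶻ Δ P (λ y → ℤ.+ v y) y
    Δ-χ []            y = ℤ.pos-* (χ y) (v y)
    Δ-χ ((a , b) ∷ P) y = trans (cong₂ _-_ (Δ-χ P y) (trans (Δ-χ P (swap a b y)) (cong (λ m → ℤ.+ m *ᶻ Δ P (λ y → ℤ.+ v y) (swap a b y)) (χ-swap a b y))))
                                (lem (ℤ.+ χ y) _ _)
      where
      lem : ∀ c x z → c *ᶻ x - c *ᶻ z ≡ c *ᶻ (x - z)
      lem = ℤ-Solver.solve-∀

    deg-f : Deg≤ d f
    deg-f P d< u y = trans (Δ-χ P y) (trans (cong (ℤ.+ χ y *ᶻ_) (deg P d< u y)) (ℤ.*-zeroʳ (ℤ.+ χ y)))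

    support : ∀ P y → Δ P f y ≢ 0ℤ → #⊖ y ≡ k
    support P y h = χ-≢0 y λ e → h (trans (Δ-χ P y) (cong (λ m → ℤ.+ m *ᶻ Δ P (λ y → ℤ.+ v y) y) e))

    open Density f

    -- For M = OPT and `v` the value, `Gap` is σ (OPT - AVG), free of division.
    Gap V : ℕ
    V   = Sumᴺ (λ y → χ y * v y)
    Gap = M * σ ∸ V

    G : ℕ
    G = G₀ d ρ balanced ^ d

    1≤G₀ : 1 ≤ G₀ d ρ balanced
    1≤G₀ = *-mono-≤ {1} {2 * ρ} (≤-trans 1≤ρ (m≤m+n ρ _)) (*-mono-≤ 1≤d 1≤d)

    -- The swap of a and b then fixes y, yet it changes the sign of the difference.
    inactive : ∀ {P a b} → Unique (pts P) → (a , b) ∈ P → ∀ y → lookup y a ≡ lookup y b → Δ P f y ≡ 0ℤ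
    inactive {P} u ab∈ y e = double-zero _ (trans (cong (_+ᶻ Δ P f y) (trans (sym (cong (Δ P f) (swap-id y e))) (Δ-anti P f u ab∈ y))) (ℤ.+-inverseˡ (Δ P f y)))

    -- Where the difference is not zero each pair carries opposite signs. Swapping a pair only
    -- negates the difference, so the pairs can be turned one after another into the orientation ⊖,
    -- ⊕.
    orient : ∀ {R} → Unique (pts R) → ∀ Q → (∀ {p} → p ∈ Q → p ∈ R) → Unique (pts Q) → ∀ y → Δ R f y ≢ 0ℤ →
             Σ[ z ∈ Assignment n ] (Δ R f z ≢ 0ℤ × match (spec Q) z ≡ 1)
    orient uR [] sub u y h = y , h , refl
    orient {R} uR ((a , b) ∷ Q) sub ((_ ∷ a≢) ∷ b≢ ∷ u) y h =
      let z , hz , mz = orient uR Q (λ p → sub (there p)) u y h in turn z hz mz (lookup z a) (lookup z b) refl refl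
      where
      turn : ∀ z → Δ R f z ≢ 0ℤ → match (spec Q) z ≡ 1 → ∀ s t → lookup z a ≡ s → lookup z b ≡ t →
             Σ[ z ∈ Assignment n ] (Δ R f z ≢ 0ℤ × match (spec ((a , b) ∷ Q)) z ≡ 1)
      turn z hz mz ⊖ ⊖ za zb = ⊥-elim (hz (inactive uR (sub (here refl)) z (trans za (sym zb))))
      turn z hz mz ⊕ ⊕ za zb = ⊥-elim (hz (inactive uR (sub (here refl)) z (trans za (sym zb))))
      turn z hz mz ⊖ ⊕ za zb = z , hz , cong₂ _*_ (cong (is ⊖) za) (cong₂ _*_ (cong (is ⊕) zb) mz)
      turn z hz mz ⊕ ⊖ za zb = swap a b z ,
        (λ e → hz (trans (sym (ℤ.neg-involutive (Δ R f z))) (cong -ᶻ_ (trans (sym (Δ-anti R f uR (sub (here refl)) z)) e)))) ,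
        cong₂ _*_ (cong (is ⊖) (trans (swap-left a b z) zb)) (cong₂ _*_ (cong (is ⊕) (trans (swap-right a b z) za)) (trans (match-spec-swap k Q z a≢ b≢) mz))

    agree-spec : ∀ P y z → match (spec P) y ≢ 0 → match (spec P) z ≢ 0 → ∀ i → i ∈ pts P → lookup y i ≡ lookup z i
    agree-spec ((a , b) ∷ P) y z hy hz i = go
      where
      y₁ = match-∷ a ⊖ ((b , ⊕) ∷ spec P) y hy
      z₁ = match-∷ a ⊖ ((b , ⊕) ∷ spec P) z hz
      y₂ = match-∷ b ⊕ (spec P) y (proj₂ y₁)
      z₂ = match-∷ b ⊕ (spec P) z (proj₂ z₁)
      go : i ∈ a ∷ b ∷ pts P → lookup y i ≡ lookup z i
      go (here refl)         = trans (proj₁ y₁) (sym (proj₁ z₁))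
      go (there (here refl)) = trans (proj₁ y₂) (sym (proj₁ z₂))
      go (there (there i∈))  = agree-spec P y z (proj₂ y₂) (proj₂ z₂) i i∈

    -- A difference which is invariant under all disjoint swaps has constant absolute value where it is active.
    size-maximal : ∀ P → Unique (pts P) → length P ≤ d → ∀ y → Δ P f y ≢ 0ℤ →
      (∀ a b y → Unique (pts ((a , b) ∷ P)) → Δ ((a , b) ∷ P) f y ≡ 0ℤ) → 2 ^ length P * σ ≤ G * size P
    size-maximal P u ≤d y₀ h maximal = begin
      2 ^ e * σ                                     ≤⟨ *-monoʳ-≤ (2 ^ e) (N-spec d ρ balanced P u ≤d (fits ⊖) (fits ⊕)) ⟩
      2 ^ e * (G₀ d ρ balanced ^ e * N (spec P))    ≤⟨ *-monoʳ-≤ (2 ^ e) (*-mono-≤ (^-monoʳ-≤ (G₀ d ρ balanced) ⦃ >-nonZero 1≤G₀ ⦄ ≤d) (ℕ-∑-mono (vectors signs n) pointwise)) ⟩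
      2 ^ e * (G * S)                               ≡⟨ lem (2 ^ e) G S ⟩
      G * (2 ^ e * S)                               ≡⟨ cong (G *_) (Sum-oriented k P (λ y → ∣ Δ P f y ∣) u
                                                         (λ p y → trans (cong ∣_∣ (Δ-anti P f u p y)) (ℤ.∣-i∣≡∣i∣ (Δ P f y))) (λ p y e → cong ∣_∣ (inactive u p y e))) ⟨
      G * size P                                    ∎
      where
      open ≤-Reasoning

      e = length P
      oriented = orient u P (λ p → p) u y₀ h
      z  = proj₁ oriented
      hz = proj₁ (proj₂ oriented)
      mz = proj₂ (proj₂ oriented)
      S = Sumᴺ (λ y → ∣ Δ P f y ∣ * match (spec P) y)
      lem : ∀ a b c → a * (b * c) ≡ b * (a * c)
      lem = solve-∀
      z∈ : #⊖ z ≡ k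
      z∈ = support P z hz
      mz≢ : match (spec P) z ≢ 0
      mz≢ e = 1+n≢0 (trans (sym mz) e)
      fits : ∀ s → e ≤ κ s
      fits s = ≤-trans (≤-reflexive (sym (amount-spec s P))) (≤-trans (m≤n+m _ _)
        (≤-reflexive (trans (count-fresh s (spec P) z (subst Unique (sym (positions-spec P)) u) mz≢) (number-slice s z z∈))))
      invariant : ∀ a b y → #⊖ y ≡ k → a ∉ pts P → b ∉ pts P → Δ P f (swap a b y) ≡ Δ P f y
      invariant a b y _ a∉ b∉ = cases (a Fin.≟ b)
        where
        away : ∀ {c} → c ∉ pts P → All (c ≢_) (pts P)
        away c∉ = All.tabulate λ { i∈ refl → c∉ i∈ }
        cases : Dec (a ≡ b) → Δ P f (swap a b y) ≡ Δ P f y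
        cases (yes refl) = cong (Δ P f) (swap-id y refl)
        cases (no a≢b)   = sym (minus-zero _ _ (maximal a b y ((a≢b ∷ away a∉) ∷ away b∉ ∷ u)))
      same : ∀ y → χ y ≢ 0 → match (spec P) y ≢ 0 → Δ P f y ≡ Δ P f z
      same y cy my = connect (_∈ pts P) (Δ P f) k invariant y z (χ-≢0 y cy) z∈ (agree-spec P y z my mz≢)
      -- By `same` the difference takes its value at z, which is a nonzero integer and so has
      -- absolute value at least 1.
      pointwise : ∀ y → χ y * match (spec P) y ≤ ∣ Δ P f y ∣ * match (spec P) y
      pointwise y = cases (χ y) (match (spec P) y) (λ e → e) (λ e → e) (bool≤1 _)
        where
        cases : ∀ c m → (χ y ≡ 0 → c ≡ 0) → (match (spec P) y ≡ 0 → m ≡ 0) → c ≤ 1 → c * m ≤ ∣ Δ P f y ∣ * m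
        cases zero    m       _  _  _   = z≤n
        cases (suc c) zero    _  _  _   = ≤-trans (≤-reflexive (*-zeroʳ (suc c))) z≤n
        cases (suc c) (suc m) cy my c≤1 = *-monoˡ-≤ (suc m) (≤-trans c≤1 (n≢0⇒n>0 λ e →
          hz (trans (sym (same y (λ e → 1+n≢0 (cy e)) (λ e → 1+n≢0 (my e)))) (ℤ.∣i∣≡0⇒i≡0 e))))

    size-∷ : ∀ a b P → size ((a , b) ∷ P) ≤ 2 * size P
    size-∷ a b P = ≤-trans (ℕ-∑-mono (vectors signs n) (λ y → ℤ.∣i-j∣≤∣i∣+∣j∣ (Δ P f y) (Δ P f (swap a b y))))
      (≤-reflexive (trans (ℕΣ.∑-+ (vectors signs n) _ _) (trans (cong (size P +_) (Sumᴺ-swap a b (λ y → ∣ Δ P f y ∣))) (lem (size P)))))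
      where
      lem : ∀ s → s + s ≡ 2 * s
      lem = solve-∀

    -- If some extension of P by a pair has a nonzero difference, the claim for it gives the claim
    -- for P: the left side doubles, while the size at most doubles. Otherwise P is maximal. The
    -- fuel suffices because differences of order above d vanish. Whether an extension exists is
    -- decided classically, which is harmless as the goal is a decidable inequality.
    size-lower : ∀ fuel P → d < length P + fuel → Unique (pts P) → ∀ y → Δ P f y ≢ 0ℤ → 2 ^ length P * σ ≤ G * size P
    size-lower zero       P d< u y h = ⊥-elim (h (deg-f P (subst (d <_) (+-identityʳ _) d<) u y))
    size-lower (suc fuel) P d< u y h = decidable-stable (2 ^ length P * σ ≤? G * size P) λ ¬goal → ¬¬-excluded-middle {A = Extends} λ
      { (yes (a , b , y′ , u′ , h′)) → ¬goal (*-cancelˡ-≤ 2 (≤-trans (≤-reflexive (sym (*-assoc 2 (2 ^ length P) σ)))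
          (≤-trans (size-lower fuel ((a , b) ∷ P) (subst (d <_) (+-suc _ fuel) d<) u′ y′ h′)
          (≤-trans (*-monoʳ-≤ G (size-∷ a b P)) (≤-reflexive (lem G (size P)))))))
      ; (no ¬extends) → ¬goal (size-maximal P u (≮⇒≥ (λ d<P → h (deg-f P d<P u y))) y h
          λ a b y′ u′ → decidable-stable (Δ ((a , b) ∷ P) f y′ ℤ.≟ 0ℤ) λ h′ → ¬extends (a , b , y′ , u′ , h′)) }
      where
      Extends : Set
      Extends = ∃[ a ] ∃[ b ] ∃[ y ] (Unique (pts ((a , b) ∷ P)) × Δ ((a , b) ∷ P) f y ≢ 0ℤ)
      lem : ∀ g s → g * (2 * s) ≡ 2 * (g * s)
      lem = solve-∀

    χv≤ : ∀ y → χ y * v y ≤ M * χ y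
    χv≤ y = cases (χ y) (λ e → e)
      where
      cases : ∀ c → (χ y ≡ 0 → c ≡ 0) → c * v y ≤ M * c
      cases zero    _  = z≤n
      cases (suc c) cy = ≤-trans (*-monoʳ-≤ (suc c) (v≤M y (χ-≢0 y (λ e → 1+n≢0 (cy e))))) (≤-reflexive (*-comm (suc c) M))

    V≤Mσ : V ≤ M * σ
    V≤Mσ = ≤-trans (ℕ-∑-mono (vectors signs n) χv≤) (≤-reflexive (ℕ-∑-* M (vectors signs n) χ))

    NonTrivial : List (Pair n) → Set
    NonTrivial P = Σ[ y ∈ Assignment n ] Δ P f y ≢ 0ℤ

    -- Each member has size at least 2^r σ / G, while `biased-gain` bounds the total size by 2^r
    -- Gap; the powers of 2 cancel.
    family-gain : ∀ {F} r → Family F → All (λ P → length P ≡ r) F → All (λ P → Unique (pts P) × NonTrivial P) F → length F * σ ≤ G * Gap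
    family-gain {F} r fam ls nts = *-cancelˡ-≤ (2 ^ r) ⦃ m^n≢0 2 r ⦄ (begin
      2 ^ r * (length F * σ)   ≤⟨ total ls nts ⟩
      G * ℕΣ.∑ F size          ≤⟨ *-monoʳ-≤ G (m+n≤o⇒n≤o∸m′ (2 ^ r * V) gain) ⟩
      G * (2 ^ r * (M * σ) ∸ 2 ^ r * V) ≡⟨ cong (G *_) (*-distribˡ-∸ (2 ^ r) (M * σ) V) ⟨
      G * (2 ^ r * Gap)        ≡⟨ lem G (2 ^ r) Gap ⟩
      2 ^ r * (G * Gap)        ∎)
      where
      open ≤-Reasoning
      lem : ∀ g c x → g * (c * x) ≡ c * (g * x)
      lem = solve-∀
      m+n≤o⇒n≤o∸m′ : ∀ m {n o} → m + n ≤ o → n ≤ o ∸ m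
      m+n≤o⇒n≤o∸m′ m {n} {o} le = m+n≤o⇒m≤o∸n n (≤-trans (≤-reflexive (+-comm n m)) le)
      gain : 2 ^ r * V + ℕΣ.∑ F size ≤ 2 ^ r * (M * σ)
      gain = ℤ.drop‿+≤+ (subst (_≤ᶻ ℤ.+ (2 ^ r * (M * σ)))
        (trans (cong (λ x → ℤ.+ (2 ^ r) *ᶻ x +ᶻ ℤ.+ ℕΣ.∑ F size) (∑-pos (vectors signs n) (λ y → χ y * v y))) (cong (_+ᶻ ℤ.+ ℕΣ.∑ F size) (sym (ℤ.pos-* (2 ^ r) V))))
        (biased-gain r χ M fam ls χ-swap below))
        where
        below : ∀ y → f y ≤ᶻ ℤ.+ M *ᶻ ℤ.+ χ y
        below y = subst (f y ≤ᶻ_) (ℤ.pos-* M (χ y)) (ℤ.+≤+ (χv≤ y))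
      total : ∀ {F} → All (λ P → length P ≡ r) F → All (λ P → Unique (pts P) × NonTrivial P) F → 2 ^ r * (length F * σ) ≤ G * ℕΣ.∑ F size
      total [] [] = ≤-trans (≤-reflexive (*-zeroʳ (2 ^ r))) z≤n
      total {P ∷ F} (refl ∷ ls) ((u , y , h) ∷ nts) = ≤-trans (≤-reflexive (lem′ (2 ^ r) (length F * σ) σ))
        (≤-trans (+-mono-≤ (size-lower (suc d) P (m≤n+m (suc d) (length P)) u y h) (total ls nts)) (≤-reflexive (sym (*-distribˡ-+ G (size P) _))))
        where
        lem′ : ∀ c x s → c * (s + x) ≡ c * s + c * x
        lem′ = solve-∀

    Flat : ℕ → List (Fin n) → Set
    Flat r X = ∀ P → length P ≡ r → Unique (pts P ++ X) → ∀ y → Δ P f y ≡ 0ℤ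

    allPts : List (List (Pair n)) → List (Fin n)
    allPts []      = []
    allPts (P ∷ F) = pts P ++ allPts F

    ∈-allPts : ∀ {F P} → P ∈ F → ∀ {i} → i ∈ pts P → i ∈ allPts F
    ∈-allPts (here refl) i∈ = ∈-++⁺ˡ i∈
    ∈-allPts {Q ∷ F} (there P∈) i∈ = ∈-++⁺ʳ (pts Q) (∈-allPts P∈ i∈)

    unique-member : ∀ {F P} → P ∈ F → Unique (allPts F) → Unique (pts P)
    unique-member {P ∷ F} (here refl) u = proj₁ (unique-++⁻ (pts P) u)
    unique-member {Q ∷ F} (there P∈)  u = unique-member P∈ (proj₁ (proj₂ (unique-++⁻ (pts Q) u)))

    -- Extending Q by a pair of P gives a difference of order r + 1 that avoids X. It vanishes by
    -- flatness, which says that Δ Q f is invariant under that pair.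
    commutes : ∀ {r X P Q} → Flat (suc r) X → length Q ≡ r → Unique (pts P) → Unique (pts Q) → Unique X →
               (∀ {i j} → i ∈ pts P → j ∈ pts Q → i ≢ j) → (∀ {i j} → i ∈ pts P → j ∈ X → i ≢ j) → (∀ {i j} → i ∈ pts Q → j ∈ X → i ≢ j) →
               Commutes P Q
    commutes {r} {X} {P} {Q} flat l uP uQ uX PQ PX QX {a} {b} ab∈ y = sym (minus-zero _ _ (flat ((a , b) ∷ Q) (cong suc l)
      ((pair-distinct uP ab∈ ∷ away a∈) ∷ away b∈ ∷ Unique.++⁺ uQ uX (λ (i∈ , j∈) → QX i∈ j∈ refl)) y))
      where
      a∈ = proj₁ (∈-pts ab∈)
      b∈ = proj₂ (∈-pts ab∈)
      away : ∀ {c} → c ∈ pts P → All (c ≢_) (pts Q ++ X)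
      away c∈ = All.tabulate λ i∈ → case (∈-++⁻ (pts Q) i∈)
        where
        case : ∀ {i} → i ∈ pts Q ⊎ i ∈ X → _ ≢ i
        case (inj₁ i∈) = PQ c∈ i∈
        case (inj₂ i∈) = PX c∈ i∈

    family : ∀ {r X} → 1 ≤ r → Flat (suc r) X → ∀ F → All (λ P → length P ≡ r) F → Unique (allPts F ++ X) → Family F
    family 1≤r flat []      [] u = []
    family 1≤r flat ([] ∷ F) (refl ∷ ls) u = ⊥-elim (1+n≰n 1≤r)
    family {r} {X} 1≤r flat (P@(_ ∷ _) ∷ F) (l ∷ ls) u =
      let uP , u′ , dis = unique-++⁻ (pts P) (subst Unique (++-assoc (pts P) (allPts F) X) u)
          uF , uX , disF = unique-++⁻ (allPts F) u′
      in add uP (λ {Q} Q∈ →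
        commutes {r} {X} {P} {Q} flat (All.lookup ls Q∈) uP (unique-member Q∈ uF) uX (λ i∈ j∈ → dis i∈ (∈-++⁺ˡ (∈-allPts Q∈ j∈))) (λ i∈ j∈ → dis i∈ (∈-++⁺ʳ (allPts F) j∈)) (λ i∈ j∈ → disF (∈-allPts Q∈ i∈) j∈) ,
        commutes {r} {X} {Q} {P} flat l (unique-member Q∈ uF) uP uX (λ i∈ j∈ → ≢-sym (dis j∈ (∈-++⁺ˡ (∈-allPts Q∈ i∈)))) (λ i∈ j∈ → disF (∈-allPts Q∈ i∈) j∈) (λ i∈ j∈ → dis i∈ (∈-++⁺ʳ (allPts F) j∈)))
      (family 1≤r flat F ls u′)

    length-allPts : ∀ {r} F → All (λ P → length P ≡ r) F → length (allPts F) ≡ length F * (2 * r)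
    length-allPts []      []          = refl
    length-allPts {r} (P ∷ F) (refl ∷ ls) = trans (length-++ (pts P)) (cong₂ _+_ (trans (length-pts P) (lem (length P))) (length-allPts F ls))
      where
      lem : ∀ m → m + m ≡ 2 * m
      lem = solve-∀

    Level : ℕ → List (Fin n) → ℕ → Set
    Level r X c = Σ[ X′ ∈ List (Fin n) ] (Unique X′ × Flat r X′ × length X′ * σ ≤ length X * σ + c)

    -- Tuples are added to F until no nonzero difference of order r avoids both F and X. Each tuple
    -- takes new variables, so n bounds the number of rounds. `family-gain` bounds |F|, and a tuple
    -- adds 2r variables to X. The search is classical, hence the double negation.
    level : ∀ r X → 1 ≤ r → Flat (suc r) X → ∀ fuel F → All (λ P → length P ≡ r) F → All (λ P → Unique (pts P) × NonTrivial P) F →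
            Unique (allPts F ++ X) → n < length (allPts F ++ X) + fuel → ¬ ¬ Level r X (2 * r * (G * Gap))
    level r X 1≤r flat zero F ls nts u n< _ =
      <⇒≱ n< (≤-trans (≤-reflexive (+-identityʳ _)) (≤-trans (unique-length _ (idxs n) u (λ _ → ∈-idxs _)) (≤-reflexive (length-idxs n))))
    level r X 1≤r flat (suc fuel) F ls nts u n< ¬level = ¬¬-excluded-middle {A = Extends} λ
      { (yes (P , l , u′ , y , h)) →
          let u″ = subst Unique (sym (++-assoc (pts P) (allPts F) X)) u′
          in level r X 1≤r flat fuel (P ∷ F) (l ∷ ls) ((proj₁ (unique-++⁻ (pts P) u′) , y , h) ∷ nts) u″ (longer P l) ¬level
      ; (no ¬P) → ¬level (allPts F ++ X , u ,
          (λ P l u′ y → decidable-stable (Δ P f y ℤ.≟ 0ℤ) λ h → ¬P (P , l , u′ , y , h)) , bound) }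
      where
      Extends : Set
      Extends = Σ[ P ∈ List (Pair n) ] (length P ≡ r × Unique (pts P ++ (allPts F ++ X)) × NonTrivial P)
      longer : ∀ P → length P ≡ r → n < length (allPts (P ∷ F) ++ X) + fuel
      longer P l = ≤-trans n< (≤-trans (≤-reflexive (+-suc _ fuel)) (+-monoˡ-≤ fuel
        (≤-trans (+-monoˡ-≤ (length (allPts F ++ X)) (≤-trans 1≤r (≤-trans (≤-reflexive (sym l)) (m≤m+n (length P) (length P)))))
          (≤-reflexive (trans (cong (_+ length (allPts F ++ X)) (sym (length-pts P))) (trans (sym (length-++ (pts P))) (cong length (sym (++-assoc (pts P) (allPts F) X)))))))))
      bound : length (allPts F ++ X) * σ ≤ length X * σ + 2 * r * (G * Gap)
      bound = ≤-trans (≤-reflexive (trans (cong (_* σ) (trans (length-++ (allPts F)) (cong (_+ length X) (length-allPts F ls)))) (lem (length F) (2 * r) (length X) σ)))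
        (+-monoʳ-≤ (length X * σ) (*-monoʳ-≤ (2 * r) (family-gain r (family 1≤r flat F ls u) ls nts)))
        where
        lem : ∀ f r x s → (f * r + x) * s ≡ x * s + r * (f * s)
        lem = solve-∀

    -- The levels from r down to 1 cost 2 (1 + ... + r) = r (r + 1) times G Gap.
    levels : ∀ r X → Unique X → Flat (suc r) X → ¬ ¬ Level 1 X (r * suc r * (G * Gap))
    levels zero    X u flat ¬l = ¬l (X , u , flat , m≤m+n _ _)
    levels (suc r) X u flat ¬l = level (suc r) X (s≤s z≤n) flat (suc n) [] [] [] u (m≤n+m (suc n) (length X)) λ (X₁ , u₁ , flat₁ , le₁) →
      levels r X₁ u₁ flat₁ λ (X₂ , u₂ , flat₂ , le₂) → ¬l (X₂ , u₂ , flat₂ ,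
        ≤-trans le₂ (≤-trans (+-monoˡ-≤ _ le₁) (≤-reflexive (lem (length X * σ) r (G * Gap)))))
      where
      lem : ∀ x r g → x + 2 * suc r * g + r * suc r * g ≡ x + suc r * suc (suc r) * g
      lem = solve-∀

    -- After the last level every swap outside X preserves f. A pair whose swap changes the value
    -- therefore meets X, and disjoint pairs meet it in different variables. The inequality is
    -- decidable, which removes the double negation.
    pairs-bound : ∀ P → Unique (pts P) → (∀ {a b} → (a , b) ∈ P → ∃[ y ] (#⊖ y ≡ k × v y ≢ v (swap a b y))) →
                  length P * σ ≤ d * suc d * (G * Gap)
    pairs-bound P u distinct = decidable-stable (length P * σ ≤? d * suc d * (G * Gap)) λ ¬goal →
      levels d [] [] (λ Q l u′ y → deg-f Q (≤-reflexive (sym l)) (proj₁ (unique-++⁻ (pts Q) u′)) y) λ (X , uX , flat , le) →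
        ¬goal (≤-trans (*-monoˡ-≤ σ (hitting P X u (hit X uX flat))) le)
      where
      open import Data.List.Membership.DecPropositional (Fin._≟_ {n}) using (_∈?_)
      hit : ∀ X → Unique X → Flat 1 X → ∀ {a b} → (a , b) ∈ P → a ∈ X ⊎ b ∈ X
      hit X uX flat {a} {b} ab∈ = cases (a ∈? X) (b ∈? X)
        where
        y  = proj₁ (distinct ab∈)
        y∈ = proj₁ (proj₂ (distinct ab∈))
        away : ∀ {c} → c ∉ X → All (c ≢_) X
        away c∉ = All.tabulate λ { i∈ refl → c∉ i∈ }
        unit : ∀ y → #⊖ y ≡ k → χ y * v y ≡ v y
        unit y y∈ = trans (cong (_* v y) (χ-slice y y∈)) (+-identityʳ (v y))
        f≡ : a ∉ X → b ∉ X → f y ≡ f (swap a b y)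
        f≡ a∉ b∉ = minus-zero _ _ (flat ((a , b) ∷ []) refl ((pair-distinct u ab∈ ∷ away a∉) ∷ away b∉ ∷ uX) y)
        cases : Dec (a ∈ X) → Dec (b ∈ X) → a ∈ X ⊎ b ∈ X
        cases (yes a∈) _        = inj₁ a∈
        cases (no _)   (yes b∈) = inj₂ b∈
        cases (no a∉)  (no b∉)  = ⊥-elim (proj₂ (proj₂ (distinct ab∈)) (trans (sym (unit y y∈))
          (trans (ℤ.+-injective (f≡ a∉ b∉)) (unit (swap a b y) (trans (#⊖-swap a b y) y∈)))))

-- Integers and natural numbers inside the rationals.

module Rationals where
  open import Defs using (fromNat; _⁻¹)
  open import Data.Integer.Base as ℤ using (ℤ; +_)
  import Data.Integer.Properties as ℤ
  open import Data.Maybe.Base using (just; nothing)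
  open import Data.Nat.Base as ℕ using (ℕ; suc)
  import Data.Nat.Properties as ℕ
  open import Data.Rational.Base
  open import Data.Rational.Properties
  open import Data.Rational.Unnormalised.Base as ℚᵘ using (mkℚᵘ; *≡*; *≤*) renaming (_≃_ to _≃ᵘ_)
  import Data.Rational.Unnormalised.Properties as ℚᵘ
  open import Relation.Binary.PropositionalEquality using (_≡_; refl; sym; trans; cong; cong₂)
  open import Relation.Nullary.Decidable.Core using (yes; no)
  open import Tactic.RingSolver.Core.AlmostCommutativeRing using (AlmostCommutativeRing; fromCommutativeRing)
  open import Level using (0ℓ)

  ℚ-ring : AlmostCommutativeRing 0ℓ 0ℓ
  ℚ-ring = fromCommutativeRing +-*-commutativeRing λ x → isZero x (x ≟ 0ℚ)
    where
    open import Data.Maybe.Base using (Maybe)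
    open import Relation.Nullary.Decidable.Core using (Dec)
    isZero : ∀ x → Dec (x ≡ 0ℚ) → Maybe (0ℚ ≡ x)
    isZero x (yes eq) = just (sym eq)
    isZero x (no _)   = nothing

  fromℤ : ℤ → ℚ
  fromℤ i = i / 1

  toℚᵘ-fromℤ : ∀ i → toℚᵘ (fromℤ i) ≃ᵘ mkℚᵘ i 0
  toℚᵘ-fromℤ i = toℚᵘ-fromℚᵘ (mkℚᵘ i 0)

  fromℤ-+ : ∀ i j → fromℤ (i ℤ.+ j) ≡ fromℤ i + fromℤ j
  fromℤ-+ i j = toℚᵘ-injective (ℚᵘ.≃-trans (toℚᵘ-fromℤ (i ℤ.+ j)) (ℚᵘ.≃-trans
    (*≡* (cong (ℤ._* + 1) (cong₂ ℤ._+_ (sym (ℤ.*-identityʳ i)) (sym (ℤ.*-identityʳ j)))))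
    (ℚᵘ.≃-sym (ℚᵘ.≃-trans (toℚᵘ-homo-+ (fromℤ i) (fromℤ j)) (ℚᵘ.+-cong (toℚᵘ-fromℤ i) (toℚᵘ-fromℤ j))))))

  fromℤ-* : ∀ i j → fromℤ (i ℤ.* j) ≡ fromℤ i * fromℤ j
  fromℤ-* i j = toℚᵘ-injective (ℚᵘ.≃-trans (toℚᵘ-fromℤ (i ℤ.* j)) (ℚᵘ.≃-trans (*≡* refl)
    (ℚᵘ.≃-sym (ℚᵘ.≃-trans (toℚᵘ-homo-* (fromℤ i) (fromℤ j)) (ℚᵘ.*-cong (toℚᵘ-fromℤ i) (toℚᵘ-fromℤ j))))))

  fromℤ-injective : ∀ {i j} → fromℤ i ≡ fromℤ j → i ≡ j
  fromℤ-injective {i} {j} eq with *≡* e ← ℚᵘ.≃-trans (ℚᵘ.≃-sym (toℚᵘ-fromℤ i)) (ℚᵘ.≃-trans (ℚᵘ.≃-reflexive (cong toℚᵘ eq)) (toℚᵘ-fromℤ j)) =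
    trans (sym (ℤ.*-identityʳ i)) (trans e (ℤ.*-identityʳ j))

  fromℤ-mono : ∀ {i j} → i ℤ.≤ j → fromℤ i ≤ fromℤ j
  fromℤ-mono {i} {j} i≤j = toℚᵘ-cancel-≤ (ℚᵘ.≤-trans (ℚᵘ.≤-reflexive (toℚᵘ-fromℤ i))
    (ℚᵘ.≤-trans (*≤* (ℤ.*-monoʳ-≤-nonNeg (+ 1) i≤j)) (ℚᵘ.≤-reflexive (ℚᵘ.≃-sym (toℚᵘ-fromℤ j)))))

  fromℤ-cancel : ∀ {i j} → fromℤ i ≤ fromℤ j → i ℤ.≤ j
  fromℤ-cancel {i} {j} le with *≤* e ← ℚᵘ.≤-trans (ℚᵘ.≤-reflexive (ℚᵘ.≃-sym (toℚᵘ-fromℤ i))) (ℚᵘ.≤-trans (toℚᵘ-mono-≤ le) (ℚᵘ.≤-reflexive (toℚᵘ-fromℤ j))) =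
    ℤ.≤-trans (ℤ.≤-reflexive (sym (ℤ.*-identityʳ i))) (ℤ.≤-trans e (ℤ.≤-reflexive (ℤ.*-identityʳ j)))

  fromNat-+ : ∀ m n → fromNat (m ℕ.+ n) ≡ fromNat m + fromNat n
  fromNat-+ m n = fromℤ-+ (+ m) (+ n)

  fromNat-suc : ∀ m → fromNat (suc m) ≡ 1ℚ + fromNat m
  fromNat-suc m = fromNat-+ 1 m

  fromNat-* : ∀ m n → fromNat (m ℕ.* n) ≡ fromNat m * fromNat n
  fromNat-* m n = trans (cong fromℤ (ℤ.pos-* m n)) (fromℤ-* (+ m) (+ n))

  fromNat-mono : ∀ {m n} → m ℕ.≤ n → fromNat m ≤ fromNat n
  fromNat-mono m≤n = fromℤ-mono (ℤ.+≤+ m≤n)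

  0≤fromNat : ∀ m → 0ℚ ≤ fromNat m
  0≤fromNat m = fromNat-mono {0} {m} ℕ.z≤n

  *-denominator : ∀ p → p * fromNat (↧ₙ p) ≡ fromℤ (↥ p)
  *-denominator p@record{} = toℚᵘ-injective (ℚᵘ.≃-trans (toℚᵘ-homo-* p (fromNat (↧ₙ p)))
    (ℚᵘ.≃-trans (ℚᵘ.*-congˡ {toℚᵘ p} (toℚᵘ-fromℤ (↧ p))) (ℚᵘ.≃-trans (*≡* lem) (ℚᵘ.≃-sym (toℚᵘ-fromℤ (↥ p))))))
    where
    lem : (↥ p ℤ.* ↧ p) ℤ.* + 1 ≡ ↥ p ℤ.* + (↧ₙ p ℕ.* 1)
    lem = trans (ℤ.*-identityʳ _) (cong (λ m → ↥ p ℤ.* + m) (sym (ℕ.*-identityʳ (↧ₙ p))))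

  ⁻¹-inverse : ∀ q → 0ℚ < q → q * q ⁻¹ ≡ 1ℚ
  ⁻¹-inverse q 0<q with q ≟ 0ℚ
  ... | yes refl with () ← <-irrefl refl 0<q
  ... | no q≢0   = *-inverseʳ q ⦃ ≢-nonZero q≢0 ⦄

-- The polynomial of an instance takes the values of the instance.

module PolyVal where
  open Rationals
  open Values using (eqSigns; eqSigns-≡; eqSigns-refl; ∈-vectors)
  open Swaps using (bool; unique-vectors)
  open import Defs
  open import Data.Bool.Base using (Bool; true; false; _xor_) renaming (if_then_else_ to ifᵇ_then_else_)
  open import Data.Fin.Base using (Fin; zero; suc)
  open import Data.Fin.Subset using (Subset; ⊥; ⁅_⁆)
  open import Data.List.Base as List using (List; []; _∷_; [_]; _++_; map; concatMap; filterᵇ)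
  open import Data.List.Membership.Propositional using (_∈_; _∉_)
  open import Data.List.Relation.Unary.All as All using (All)
  open import Data.List.Relation.Unary.Any using (here; there)
  open import Data.List.Relation.Unary.AllPairs using ([]; _∷_)
  open import Data.List.Relation.Unary.Unique.Propositional using (Unique)
  open import Data.Nat.Base as ℕ using (zero; suc)
  open import Data.Product.Base using (_,_)
  open import Data.Rational.Base using (ℚ; 0ℚ; 1ℚ; ½; _+_; _*_)
  open import Data.Rational.Properties
  open import Data.Sign.Base using (Sign) renaming (+ to ⊕; - to ⊖)
  open import Data.Vec.Base as Vec using (Vec; []; _∷_; lookup; zipWith)
  open import Function.Base using (_∘_)
  open import Relation.Binary.PropositionalEquality using (_≡_; _≢_; refl; sym; trans; cong; cong₂)
  open import Tactic.RingSolver using (solve-∀)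

  eval-++ : ∀ {n} (f g : Poly n) α → eval (f ++ g) α ≡ eval f α + eval g α
  eval-++ []            g α = sym (+-identityˡ (eval g α))
  eval-++ ((a , S) ∷ f) g α = trans (cong (λ s → a * monomial S α + s) (eval-++ f g α)) (sym (+-assoc (a * monomial S α) _ _))

  -- A common factor disappears because x · x = 1 for a sign x. This also covers constraints in
  -- which a variable is repeated.
  monomial-xor : ∀ {n} (S T : Subset n) α → monomial (zipWith _xor_ S T) α ≡ monomial S α * monomial T α
  monomial-xor []      []      []      = refl
  monomial-xor (s ∷ S) (t ∷ T) (x ∷ α) = trans (cong₂ _*_ (factor s t x) (monomial-xor S T α))
    (lem (ifᵇ s then ±1 x else 1ℚ) (ifᵇ t then ±1 x else 1ℚ) (monomial S α) (monomial T α))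
    where
    lem : ∀ a b c e → a * b * (c * e) ≡ a * c * (b * e)
    lem = solve-∀ ℚ-ring
    factor : ∀ s t x → (ifᵇ s xor t then ±1 x else 1ℚ) ≡ (ifᵇ s then ±1 x else 1ℚ) * (ifᵇ t then ±1 x else 1ℚ)
    factor false t     x = sym (*-identityˡ _)
    factor true  false x = sym (*-identityʳ _)
    factor true  true  ⊕ = refl
    factor true  true  ⊖ = refl

  monomial-⊥ : ∀ {n} (α : Assignment n) → monomial ⊥ α ≡ 1ℚ
  monomial-⊥ []      = refl
  monomial-⊥ (x ∷ α) = trans (*-identityˡ _) (monomial-⊥ α)

  monomial-⁅⁆ : ∀ {n} (i : Fin n) α → monomial ⁅ i ⁆ α ≡ ±1 (lookup α i)
  monomial-⁅⁆ zero    (x ∷ α) = trans (cong (±1 x *_) (monomial-⊥ α)) (*-identityʳ _)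
  monomial-⁅⁆ (suc i) (x ∷ α) = trans (*-identityˡ _) (monomial-⁅⁆ i α)

  eval-⊛ : ∀ {n} (f g : Poly n) α → eval (f ⊛ g) α ≡ eval f α * eval g α
  eval-⊛ []            g α = sym (*-zeroˡ (eval g α))
  eval-⊛ ((a , S) ∷ f) g α = trans (eval-++ (map _ g) (f ⊛ g) α) (trans (cong₂ _+_ (row g) (eval-⊛ f g α)) (lem (a * monomial S α) (eval f α) (eval g α)))
    where
    lem : ∀ x y z → x * z + y * z ≡ (x + y) * z
    lem = solve-∀ ℚ-ring
    lem′ : ∀ a b m t z → a * b * (m * t) + a * m * z ≡ a * m * (b * t + z)
    lem′ = solve-∀ ℚ-ring
    row : ∀ g → eval (map (λ { (b , T) → a * b , zipWith _xor_ S T }) g) α ≡ a * monomial S α * eval g α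
    row []            = sym (*-zeroʳ (a * monomial S α))
    row ((b , T) ∷ g) = trans (cong₂ _+_ (cong (a * b *_) (monomial-xor S T α)) (row g)) (lem′ a b (monomial S α) (monomial T α) (eval g α))

  literal : ∀ {n} → Sign → Fin n → Poly n
  literal s i = (1ℚ , ⊥) ∷ (±1 s , ⁅ i ⁆) ∷ []

  eval-literal : ∀ {n} s (i : Fin n) α → eval (literal s i) α ≡ 1ℚ + ±1 s * ±1 (lookup α i)
  eval-literal s i α rewrite monomial-⊥ α | monomial-⁅⁆ i α = cong₂ _+_ (*-identityˡ 1ℚ) (+-identityʳ (±1 s * ±1 (lookup α i)))

  boolℚ : Bool → ℚ
  boolℚ b = ifᵇ b then 1ℚ else 0ℚ

  -- `c` takes up one factor ½ per literal: 1 + σx is 2 if the signs agree and 0 otherwise.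
  eval-product : ∀ {m n} c (σ : Vec Sign m) (vs : Vec (Fin n) m) α →
    eval (Vec.foldr _ _⊛_ [ (c * ½ ^ m , ⊥) ] (zipWith literal σ vs)) α ≡ c * boolℚ (eqSigns σ (Vec.map (lookup α) vs))
  eval-product c []      []       α rewrite monomial-⊥ α = lem c
    where
    lem : ∀ c → c * 1ℚ * 1ℚ + 0ℚ ≡ c * 1ℚ
    lem = solve-∀ ℚ-ring
  eval-product {suc m} c (s ∷ σ) (v ∷ vs) α = trans (eval-⊛ (literal s v) (rest (c * ½ ^ suc m)) α)
    (trans (cong₂ _*_ (eval-literal s v α) (trans (cong (λ x → eval (rest x) α) (sym (*-assoc c ½ (½ ^ m)))) (eval-product (c * ½) σ vs α)))
           (cases s (lookup α v)))
    where
    rest : ℚ → Poly _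
    rest x = Vec.foldr _ _⊛_ [ (x , ⊥) ] (zipWith literal σ vs)
    e = boolℚ (eqSigns σ (Vec.map (lookup α) vs))
    two : ∀ c e → (1ℚ + 1ℚ) * (c * ½ * e) ≡ c * e
    two c e = trans (lem (1ℚ + 1ℚ) c ½ e) (cong (λ x → x * (c * e)) {x = (1ℚ + 1ℚ) * ½} {y = 1ℚ} refl ∙ *-identityˡ (c * e))
      where
      infixl 5 _∙_
      _∙_ : ∀ {x y z : ℚ} → x ≡ y → y ≡ z → x ≡ z
      _∙_ = trans
      lem : ∀ t c h e → t * (c * h * e) ≡ t * h * (c * e)
      lem = solve-∀ ℚ-ring
    cases : ∀ s x → (1ℚ + ±1 s * ±1 x) * (c * ½ * e) ≡ c * boolℚ (eqSigns (s ∷ σ) (x ∷ Vec.map (lookup α) vs))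
    cases ⊕ ⊕ = two c e
    cases ⊖ ⊖ = two c e
    cases ⊕ ⊖ = trans (*-zeroˡ (c * ½ * e)) (sym (*-zeroʳ c))
    cases ⊖ ⊕ = trans (*-zeroˡ (c * ½ * e)) (sym (*-zeroʳ c))

  constraintPoly : ∀ {d n} → Constraint d n → Poly n
  constraintPoly {d} c = concatMap (λ σ → Vec.foldr _ _⊛_ [ (½ ^ d , ⊥) ] (zipWith literal σ (vars c)))
                                   (filterᵇ (predicate c) (vectors signs d))

  -- Only the sign vector read off from the assignment gives a nonzero product, and it occurs
  -- exactly once in the list of all vectors, so the sum tells whether the predicate contains it.
  eval-constraint : ∀ {d n} (c : Constraint d n) α → eval (constraintPoly c) α ≡ boolℚ (satisfies α c)
  eval-constraint {d} c α = present (vectors signs d) (unique-vectors d) (∈-vectors w)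
    where
    w = Vec.map (lookup α) (vars c)
    P = predicate c
    product : Vec Sign d → Poly _
    product σ = Vec.foldr _ _⊛_ [ (½ ^ d , ⊥) ] (zipWith literal σ (vars c))
    summands : List (Vec Sign d) → ℚ
    summands xs = eval (concatMap product (filterᵇ P xs)) α
    value : ∀ σ → eval (product σ) α ≡ boolℚ (eqSigns σ w)
    value σ = trans (cong (λ x → eval (Vec.foldr _ _⊛_ [ (x , ⊥) ] (zipWith literal σ (vars c))) α) (sym (*-identityˡ (½ ^ d))))
      (trans (eval-product 1ℚ σ (vars c) α) (*-identityˡ _))
    other : ∀ {σ} → σ ≢ w → boolℚ (eqSigns σ w) ≡ 0ℚ
    other {σ} σ≢w with eqSigns σ w in e
    ... | false = refl
    ... | true with () ← σ≢w (eqSigns-≡ σ w e)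
    absent : ∀ xs → w ∉ xs → summands xs ≡ 0ℚ
    absent []       _  = refl
    absent (σ ∷ xs) w∉ with P σ
    ... | false = absent xs (w∉ ∘ there)
    ... | true  = trans (eval-++ (product σ) _ α) (trans (cong₂ _+_ (trans (value σ) (other {σ} λ { refl → w∉ (here refl) })) (absent xs (w∉ ∘ there))) (+-identityˡ 0ℚ))
    present : ∀ xs → Unique xs → w ∈ xs → summands xs ≡ boolℚ (P w)
    present (σ ∷ xs) (σ≢ ∷ u) (here refl) with P w
    ... | false = absent xs (λ w∈ → All.lookup σ≢ w∈ refl)
    ... | true  = trans (eval-++ (product w) _ α) (trans (cong₂ _+_ (trans (value w) (cong boolℚ (eqSigns-refl w))) (absent xs (λ w∈ → All.lookup σ≢ w∈ refl))) (+-identityʳ 1ℚ))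
    present (σ ∷ xs) (σ≢ ∷ u) (there w∈) with P σ
    ... | false = present xs u w∈
    ... | true  = trans (eval-++ (product σ) _ α) (trans (cong₂ _+_ (trans (value σ) (other {σ} (All.lookup σ≢ w∈))) (present xs u w∈)) (+-identityˡ _))

  val-∷ : ∀ {d n} (c : Constraint d n) I α → val (c ∷ I) α ≡ bool (satisfies α c) ℕ.+ val I α
  val-∷ c I α with satisfies α c
  ... | true  = refl
  ... | false = refl

  fromNat-val : ∀ {d n} (c : Constraint d n) I α → fromNat (val (c ∷ I) α) ≡ boolℚ (satisfies α c) + fromNat (val I α)
  fromNat-val c I α = trans (cong fromNat (val-∷ c I α)) (count (satisfies α c) (val I α))
    where
    count : ∀ b m → fromNat (bool b ℕ.+ m) ≡ boolℚ b + fromNat m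
    count true  m = fromNat-suc m
    count false m = sym (+-identityˡ (fromNat m))

  eval-f : ∀ {d n} (I : CSP d n) α → eval f[ I ] α ≡ fromNat (val I α)
  eval-f []      α = refl
  eval-f (c ∷ I) α = trans (eval-++ (constraintPoly c) f[ I ] α) (trans (cong₂ _+_ (eval-constraint c α) (eval-f I α)) (sym (fromNat-val c I α)))

-- Newton interpolation and the polynomial it produces.

module Newton where
  open Rationals
  open PolyVal using (boolℚ; fromNat-val)
  open Algorithm using (Entry; entries; extend; outputs; complete)
  open Values using (#⊖)
  open import Defs
  open import Data.Bool.Base using (Bool; true; false) renaming (if_then_else_ to ifᵇ_then_else_)
  open import Data.Fin.Base using (zero; suc)
  open import Data.Fin.Subset using (Subset; _⊆_; ∣_∣)
  open import Data.List.Base as List using (List; []; _∷_; foldl)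
  open import Data.List.Relation.Unary.All as All using (All; []; _∷_)
  open import Data.Nat.Base as ℕ using (ℕ; zero; suc; s≤s)
  import Data.Nat.Properties as ℕ
  open import Data.Product.Base using (_×_; _,_)
  open import Data.Rational.Base using (ℚ; 0ℚ; 1ℚ; ½; -_; _+_; _-_; _*_)
  open import Data.Rational.Properties
  open import Data.Sign.Base using (Sign) renaming (+ to ⊕; - to ⊖)
  open import Data.Vec.Base as Vec using (Vec; []; _∷_; lookup; here; there)
  open import Function.Base using (_∘_)
  open import Relation.Binary.PropositionalEquality using (_≡_; refl; sym; trans; cong; cong₂; subst)
  open import Tactic.RingSolver using (solve-∀)

  -- A family G assigns to every remaining degree a function of the evaluation point.
  Weights : ℕ → Set
  Weights m = ℕ → Vec Sign m → ℚ

  total-of : ∀ {m} → Weights m → Vec Sign m → List (Entry m) → ℚ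
  total-of G α []                      = 0ℚ
  total-of G α (((b , a) , B , T) ∷ L) = a * monomial T α * G b B + total-of G α L

  indicator : Sign → ℚ
  indicator x = ½ * (1ℚ - ±1 x)

  -- The transpose of `extend`: the value x of the new variable is absorbed into the weights instead
  -- of into the entries. `indicator` is 0 at ⊕ and 1 at ⊖.
  descend : ∀ {m} → Bool → Sign → Weights (suc m) → Weights m
  descend true x G (suc b) B = G (suc b) (⊕ ∷ B) + indicator x * (G b (⊖ ∷ B) - G b (⊕ ∷ B))
  descend _    x G b       B = G b (⊕ ∷ B)

  total-extend : ∀ {m} s x α (G : Weights (suc m)) out (e : Entry m) →
    total-of G (x ∷ α) (extend s out e) ≡ total-of (descend s x G) α (e ∷ []) + total-of G (x ∷ α) out
  total-extend true x α G out ((suc b , a) , B , T) =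
    lem ½ a (±1 x) 1ℚ (monomial T α) (G b (⊖ ∷ B)) (G b (⊕ ∷ B)) (G (suc b) (⊕ ∷ B)) (total-of G (x ∷ α) out)
    where
    lem : ∀ h a x one m g₁ g₀ g o →
      h * a * (1ℚ * m) * g₁ + (- (h * a) * (x * m) * g₁ + (- (h * a) * (1ℚ * m) * g₀ + (h * a * (x * m) * g₀ + (a * (1ℚ * m) * g + o))))
      ≡ a * m * (g + h * (1ℚ - x) * (g₁ - g₀)) + 0ℚ + o
    lem = solve-∀ ℚ-ring
  total-extend true x α G out ((zero , a) , B , T) = lem a (monomial T α) (G 0 (⊕ ∷ B)) (total-of G (x ∷ α) out)
    where
    lem : ∀ a m g o → a * (1ℚ * m) * g + o ≡ a * m * g + 0ℚ + o
    lem = solve-∀ ℚ-ring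
  total-extend false x α G out ((b , a) , B , T) = lem a (monomial T α) (G b (⊕ ∷ B)) (total-of G (x ∷ α) out)
    where
    lem : ∀ a m g o → a * (1ℚ * m) * g + o ≡ a * m * g + 0ℚ + o
    lem = solve-∀ ℚ-ring

  total-foldl : ∀ {m} s x α (G : Weights (suc m)) out (L : List (Entry m)) →
    total-of G (x ∷ α) (foldl (extend s) out L) ≡ total-of (descend s x G) α L + total-of G (x ∷ α) out
  total-foldl s x α G out []      = sym (+-identityˡ _)
  total-foldl s x α G out (e@((b , a) , B , T) ∷ L) = trans (total-foldl s x α G (extend s out e) L)
    (trans (cong (λ t → total-of (descend s x G) α L + t) (total-extend s x α G out e))
           (lem (total-of (descend s x G) α L) (a * monomial T α * descend s x G b B) (total-of G (x ∷ α) out)))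
    where
    lem : ∀ l e o → l + (e + 0ℚ + o) ≡ e + l + o
    lem = solve-∀ ℚ-ring

  interpolant : ∀ {n} → ℕ → Vec Bool n → Weights n → Vec Sign n → ℚ
  interpolant d []      G []      = G d []
  interpolant d (s ∷ S) G (x ∷ α) = interpolant d S (descend s x G) α

  total-entries : ∀ {n} d (S : Vec Bool n) G α → total-of G α (entries d S) ≡ interpolant d S G α
  total-entries d []      G []      = lem (G d [])
    where
    lem : ∀ g → 1ℚ * 1ℚ * g + 0ℚ ≡ g
    lem = solve-∀ ℚ-ring
  total-entries d (s ∷ S) G (x ∷ α) = trans (total-foldl s x α G [] (entries d S)) (trans (+-identityʳ _) (total-entries d S (descend s x G) α))

  masked : ∀ {n} → Vec Bool n → Vec Sign n → Vec Sign n
  masked []          []      = []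
  masked (true  ∷ S) (x ∷ α) = x ∷ masked S α
  masked (false ∷ S) (x ∷ α) = ⊕ ∷ masked S α

  keep : ∀ g h → g + indicator ⊕ * h ≡ g
  keep g h = trans (cong (λ t → g + t) (*-zeroˡ h)) (+-identityʳ g)

  move : ∀ g h → g + indicator ⊖ * (h - g) ≡ h
  move g h = trans (cong (λ t → g + t) (*-identityˡ (h - g))) (lem g h)
    where
    lem : ∀ g h → g + (h - g) ≡ h
    lem = solve-∀ ℚ-ring

  -- `c` counts the entries ⊖ met so far in S, and weights with at least c degrees left agree with
  -- F. Passing an entry ⊖ combines the weights of two neighbouring degrees, so one more degree is
  -- needed from then on; d is enough for a point with at most d entries ⊖ in S.
  interpolates : ∀ {n} d (S : Vec Bool n) c (G : Weights n) (F : Vec Sign n → ℚ) α → (∀ b → c ℕ.≤ b → ∀ B → G b B ≡ F B) → #⊖ (masked S α) ℕ.+ c ℕ.≤ d →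
                 interpolant d S G α ≡ F (masked S α)
  interpolates d []          c G F []      G≡F ≤d = G≡F d ≤d []
  interpolates d (false ∷ S) c G F (x ∷ α) G≡F ≤d = interpolates d S c (descend false x G) (F ∘ (⊕ ∷_)) α (λ b c≤b B → G≡F b c≤b (⊕ ∷ B)) ≤d
  interpolates d (true ∷ S)  c G F (⊕ ∷ α) G≡F ≤d = interpolates d S c (descend true ⊕ G) (F ∘ (⊕ ∷_)) α
    (λ { zero c≤b B → G≡F zero c≤b (⊕ ∷ B) ; (suc b) c≤b B → trans (keep (G (suc b) (⊕ ∷ B)) (G b (⊖ ∷ B) - G b (⊕ ∷ B))) (G≡F (suc b) c≤b (⊕ ∷ B)) }) ≤d
  interpolates d (true ∷ S)  c G F (⊖ ∷ α) G≡F ≤d = interpolates d S (suc c) (descend true ⊖ G) (F ∘ (⊖ ∷_)) α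
    (λ { (suc b) (s≤s c≤b) B → trans (cong₂ (λ u v → u + indicator ⊖ * (G b (⊖ ∷ B) - v)) (G≡F (suc b) (ℕ.m≤n⇒m≤1+n c≤b) (⊕ ∷ B)) (G≡F b c≤b (⊕ ∷ B)))
           (trans (move (F (⊕ ∷ B)) (G b (⊖ ∷ B))) (G≡F b c≤b (⊖ ∷ B))) })
    (subst (ℕ._≤ d) (sym (ℕ.+-suc _ c)) ≤d)

  count : ∀ {n} → Vec Bool n → ℕ
  count []          = 0
  count (true ∷ R)  = suc (count R)
  count (false ∷ R) = count R

  Agree : ∀ {n} → Vec Bool n → Vec Sign n → Vec Sign n → Set
  Agree R B B′ = ∀ i → lookup R i ≡ true → lookup B i ≡ lookup B′ i

  agree-∷ : ∀ {n} r {R : Vec Bool n} x {B B′} → Agree R B B′ → Agree (r ∷ R) (x ∷ B) (x ∷ B′)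
  agree-∷ r x A zero    _ = refl
  agree-∷ r x A (suc i) e = A i e

  -- Here every point is allowed, but the weights depend only on the positions in R. Away from R the
  -- two values in the Newton step coincide and cancel, so degrees are consumed only at entries ⊖ in
  -- R.
  interpolates-local : ∀ {n} d (S R : Vec Bool n) c (G : Weights n) (F : Vec Sign n → ℚ) α → (∀ i → lookup S i ≡ true) →
    (∀ b B B′ → Agree R B B′ → G b B ≡ G b B′) → (∀ b → c ℕ.≤ b → ∀ B → G b B ≡ F B) → count R ℕ.+ c ℕ.≤ d →
    interpolant d S G α ≡ F α
  interpolates-local d []          []      c G F []      all loc G≡F ≤d = G≡F d ≤d []
  interpolates-local d (false ∷ S) (r ∷ R) c G F (x ∷ α) all loc G≡F ≤d with () ← all zero
  interpolates-local d (true ∷ S)  (r ∷ R) c G F (x ∷ α) all loc G≡F ≤d = go r x refl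
    where
    all′ : ∀ i → lookup S i ≡ true
    all′ i = all (suc i)
    loc′ : ∀ b B B′ → Agree R B B′ → descend true x G b B ≡ descend true x G b B′
    loc′ zero    B B′ A = loc zero (⊕ ∷ B) (⊕ ∷ B′) (agree-∷ r ⊕ A)
    loc′ (suc b) B B′ A = cong₂ (λ u v → u + indicator x * v) (loc (suc b) (⊕ ∷ B) (⊕ ∷ B′) (agree-∷ r ⊕ A))
      (cong₂ _-_ (loc b (⊖ ∷ B) (⊖ ∷ B′) (agree-∷ r ⊖ A)) (loc b (⊕ ∷ B) (⊕ ∷ B′) (agree-∷ r ⊕ A)))
    go : ∀ r′ x′ → (r′ , x′) ≡ (r , x) → interpolant d S (descend true x G) α ≡ F (x ∷ α)
    go true ⊖ refl = interpolates-local d S R (suc c) (descend true ⊖ G) (F ∘ (⊖ ∷_)) α all′ loc′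
      (λ { (suc b) (s≤s c≤b) B → trans (cong₂ (λ u v → u + indicator ⊖ * (G b (⊖ ∷ B) - v)) (G≡F (suc b) (ℕ.m≤n⇒m≤1+n c≤b) (⊕ ∷ B)) (G≡F b c≤b (⊕ ∷ B)))
             (trans (move (F (⊕ ∷ B)) (G b (⊖ ∷ B))) (G≡F b c≤b (⊖ ∷ B))) })
      (subst (ℕ._≤ d) (sym (ℕ.+-suc (count R) c)) ≤d)
    go true ⊕ refl = interpolates-local d S R (suc c) (descend true ⊕ G) (F ∘ (⊕ ∷_)) α all′ loc′
      (λ { (suc b) (s≤s c≤b) B → trans (keep (G (suc b) (⊕ ∷ B)) (G b (⊖ ∷ B) - G b (⊕ ∷ B))) (G≡F (suc b) (ℕ.m≤n⇒m≤1+n c≤b) (⊕ ∷ B)) })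
      (subst (ℕ._≤ d) (sym (ℕ.+-suc (count R) c)) ≤d)
    go false x refl = interpolates-local d S R c (descend true x G) (F ∘ (x ∷_)) α all′ loc′
      (λ { zero c≤b B → trans (irrelevant zero ⊕ x B) (G≡F zero c≤b (x ∷ B))
         ; (suc b) c≤b B → trans (trans (cong (λ v → G (suc b) (⊕ ∷ B) + indicator x * (v - G b (⊕ ∷ B))) (irrelevant b ⊖ ⊕ B))
             (lem (G (suc b) (⊕ ∷ B)) (indicator x) (G b (⊕ ∷ B)))) (trans (irrelevant (suc b) ⊕ x B) (G≡F (suc b) c≤b (x ∷ B))) }) ≤d
      where
      irrelevant : ∀ b x x′ B → G b (x ∷ B) ≡ G b (x′ ∷ B)
      irrelevant b x x′ B = loc b (x ∷ B) (x′ ∷ B) λ { zero () ; (suc i) _ → refl }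
      lem : ∀ g y v → g + y * (v - v) ≡ g
      lem = solve-∀ ℚ-ring

  interpolant-cong : ∀ {n} d (S : Vec Bool n) {G H : Weights n} α → (∀ b B → G b B ≡ H b B) → interpolant d S G α ≡ interpolant d S H α
  interpolant-cong d []      []      e = e d []
  interpolant-cong d (s ∷ S) {G} {H} (x ∷ α) e = interpolant-cong d S α (step s)
    where
    step : ∀ s b B → descend s x G b B ≡ descend s x H b B
    step true  (suc b) B = cong₂ (λ u v → u + indicator x * v) (e (suc b) (⊕ ∷ B)) (cong₂ _-_ (e b (⊖ ∷ B)) (e b (⊕ ∷ B)))
    step true  zero    B = e zero (⊕ ∷ B)
    step false b       B = e b (⊕ ∷ B)

  interpolant-+ : ∀ {n} d (S : Vec Bool n) (G H : Weights n) α →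
    interpolant d S (λ b B → G b B + H b B) α ≡ interpolant d S G α + interpolant d S H α
  interpolant-+ d []      G H []      = refl
  interpolant-+ d (s ∷ S) G H (x ∷ α) = trans (interpolant-cong d S α (step s)) (interpolant-+ d S (descend s x G) (descend s x H) α)
    where
    lem : ∀ a b y c e f g → (a + b) + y * ((c + e) - (f + g)) ≡ (a + y * (c - f)) + (b + y * (e - g))
    lem = solve-∀ ℚ-ring
    step : ∀ s b B → descend s x (λ b B → G b B + H b B) b B ≡ descend s x G b B + descend s x H b B
    step true  (suc b) B = lem (G (suc b) (⊕ ∷ B)) (H (suc b) (⊕ ∷ B)) (indicator x) (G b (⊖ ∷ B)) (H b (⊖ ∷ B)) (G b (⊕ ∷ B)) (H b (⊕ ∷ B))
    step true  zero    B = refl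
    step false b       B = refl

  interpolant-0 : ∀ {n} d (S : Vec Bool n) α → interpolant d S (λ _ _ → 0ℚ) α ≡ 0ℚ
  interpolant-0 d []      []      = refl
  interpolant-0 d (s ∷ S) (x ∷ α) = trans (interpolant-cong d S α (step s)) (interpolant-0 d S α)
    where
    lem : ∀ y → 0ℚ + y * (0ℚ - 0ℚ) ≡ 0ℚ
    lem = solve-∀ ℚ-ring
    step : ∀ s b B → descend s x (λ _ _ → 0ℚ) b B ≡ 0ℚ
    step true  (suc b) B = lem (indicator x)
    step true  zero    B = refl
    step false b       B = refl

  module _ {d n : ℕ} (I : CSP d n) (k : ℕ) (S : Vec Bool n) where

    value-at : Weights n
    value-at _ B = fromNat (val I (complete k S B))

    eval-block : ∀ (J : CSP d n) (y : Assignment n) a T (g : Poly n) α →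
      eval (foldl (λ g c → ifᵇ satisfies y c then (a , T) ∷ g else g) g J) α ≡ a * monomial T α * fromNat (val J y) + eval g α
    eval-block []      y a T g α = lem (a * monomial T α) (eval g α)
      where
      lem : ∀ m e → e ≡ m * 0ℚ + e
      lem = solve-∀ ℚ-ring
    eval-block (c ∷ J) y a T g α = trans (eval-block J y a T (ifᵇ satisfies y c then (a , T) ∷ g else g) α)
      (trans (step (satisfies y c) (fromNat (val J y))) (cong (λ v → a * monomial T α * v + eval g α) (sym (fromNat-val c J y))))
      where
      lem : ∀ m v e → m * v + (m + e) ≡ m * (1ℚ + v) + e
      lem = solve-∀ ℚ-ring
      step : ∀ b v → a * monomial T α * v + eval (ifᵇ b then (a , T) ∷ g else g) α ≡ a * monomial T α * (boolℚ b + v) + eval g α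
      step true  v = lem (a * monomial T α) v (eval g α)
      step false v = cong (λ v → a * monomial T α * v + eval g α) (sym (+-identityˡ v))

    eval-outputs : ∀ L α → eval (outputs I k S L) α ≡ total-of value-at α L
    eval-outputs L α = trans (go [] L) (+-identityʳ _)
      where
      go : ∀ g L → eval (foldl (λ g ((_ , a) , B , T) → foldl (λ g c → ifᵇ satisfies (complete k S B) c then (a , T) ∷ g else g) g I) g L) α
           ≡ total-of value-at α L + eval g α
      go g []                      = sym (+-identityˡ (eval g α))
      go g (((b , a) , B , T) ∷ L) = trans (go _ L) (trans (cong (λ e → total-of value-at α L + e) (eval-block I (complete k S B) a T g α))
        (lem (total-of value-at α L) (a * monomial T α * value-at b B) (eval g α)))
        where
        lem : ∀ l t e → l + (t + e) ≡ t + l + e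
        lem = solve-∀ ℚ-ring

    eval-kernel : ∀ α → eval (outputs I k S (entries d S)) α ≡ interpolant d S value-at α
    eval-kernel α = trans (eval-outputs (entries d S) α) (total-entries d S value-at α)

  -- A variable enters the monomial only where the remaining degree drops by one, so their sum stays
  -- at most d.
  Admissible : ∀ {m} → ℕ → Vec Bool m → Entry m → Set
  Admissible d S ((b , _) , _ , T) = ∣ T ∣ ℕ.+ b ℕ.≤ d × T ⊆ S

  admissible : ∀ {n} d (S : Vec Bool n) → All (Admissible d S) (entries d S)
  admissible d []      = (ℕ.≤-refl , λ ()) ∷ []
  admissible d (s ∷ S) = go (entries d S) [] (admissible d S) []
    where
    off : ∀ {T} → T ⊆ S → (false ∷ T) ⊆ (s ∷ S)
    off T⊆S (there i∈) = there (T⊆S i∈)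
    on : ∀ {T} → T ⊆ S → (true ∷ T) ⊆ (true ∷ S)
    on T⊆S here       = here
    on T⊆S (there i∈) = there (T⊆S i∈)
    off′ : ∀ {T} → T ⊆ S → (false ∷ T) ⊆ (true ∷ S)
    off′ T⊆S (there i∈) = there (T⊆S i∈)
    one : ∀ s′ out e → s′ ≡ s → Admissible d S e → All (Admissible d (s ∷ S)) out → All (Admissible d (s ∷ S)) (extend s′ out e)
    one true  out ((suc b , a) , B , T) refl (le , T⊆S) o =
      (le′ , off′ T⊆S) ∷ (le″ , on T⊆S) ∷ (le′ , off′ T⊆S) ∷ (le″ , on T⊆S) ∷ (le , off′ T⊆S) ∷ o
      where
      le″ : suc (∣ T ∣) ℕ.+ b ℕ.≤ d
      le″ = subst (ℕ._≤ d) (ℕ.+-suc ∣ T ∣ b) le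
      le′ : ∣ T ∣ ℕ.+ b ℕ.≤ d
      le′ = ℕ.≤-trans (ℕ.n≤1+n _) le″
    one true  out ((zero , a) , B , T)  eq (le , T⊆S) o = (le , off T⊆S) ∷ o
    one false out ((b , a) , B , T)     eq (le , T⊆S) o = (le , off T⊆S) ∷ o
    go : ∀ L out → All (Admissible d S) L → All (Admissible d (s ∷ S)) out → All (Admissible d (s ∷ S)) (foldl (extend s) out L)
    go []      out []       o = o
    go (e ∷ L) out (p ∷ ps) o = go L (extend s out e) ps (one s out e refl p o)

  all-outputs : ∀ {d n} (Q : Subset n → Set) (I : CSP d n) k S (L : List (Entry n)) → All (λ (_ , _ , T) → Q T) L →
                All (λ (_ , T) → Q T) (outputs I k S L)
  all-outputs {n = n} Q I k S L ps = go L ps [] []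
    where
    block : ∀ (J : CSP _ n) y a T g → Q T → All (λ (_ , T) → Q T) g → All (λ (_ , T) → Q T) (foldl (λ g c → ifᵇ satisfies y c then (a , T) ∷ g else g) g J)
    block []      y a T g q qs = qs
    block (c ∷ J) y a T g q qs with satisfies y c
    ... | true  = block J y a T ((a , T) ∷ g) q (q ∷ qs)
    ... | false = block J y a T g q qs
    go : ∀ L → All (λ (_ , _ , T) → Q T) L → ∀ g → All (λ (_ , T) → Q T) g →
         All (λ (_ , T) → Q T) (foldl (λ g ((_ , a) , B , T) → foldl (λ g c → ifᵇ satisfies (complete k S B) c then (a , T) ∷ g else g) g I) g L)
    go []                      []       g qs = qs
    go (((b , a) , B , T) ∷ L) (p ∷ ps) g qs = go L ps _ (block I (complete k S B) a T g p qs)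

-- The visited points and the greedy set of pairs.

module Hitting where
  open Values
  open Algorithm using (expand; iterate; pair-step; matching)
  open Sums
  open Swaps
  open Differences
  open Gain
  open Certificate using (minus-zero)
  open import Defs using (Assignment; CSP; Constraint; vars; predicate; satisfies; val)
  open import Data.Bool.Base using (true; false; if_then_else_; T)
  open import Data.Empty using (⊥-elim)
  open import Data.Fin.Base using (Fin; zero; suc)
  open import Data.Integer.Base as ℤ using (ℤ; 0ℤ; _-_) renaming (_+_ to _+ᶻ_)
  import Data.Integer.Properties as ℤ
  open import Data.List.Base as List using (List; []; _∷_; [_]; foldl)
  open import Data.List.Membership.Propositional using (_∈_; _∉_)
  open import Data.List.Properties using (length-map)
  open import Data.List.Relation.Unary.All as All using (All; []; _∷_)
  open import Data.List.Relation.Unary.Any using (here; there)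
  open import Data.List.Relation.Unary.AllPairs using ([]; _∷_)
  open import Data.List.Relation.Unary.Unique.Propositional using (Unique)
  open import Data.Nat.Base using (ℕ; zero; suc; _+_; _≤_; z≤n; s≤s⁻¹; _≡ᵇ_)
  open import Data.Nat.Properties
  open import Data.Product.Base using (_×_; _,_; Σ-syntax; ∃-syntax)
  open import Data.Sum.Base using (_⊎_; inj₁; inj₂)
  open import Data.Vec.Base as Vec using (Vec; []; _∷_; lookup; toList)
  open import Data.Vec.Properties using (length-toList)
  open import Function.Base using (_∘_)
  open import Relation.Binary.PropositionalEquality using (_≡_; _≢_; refl; sym; trans; cong; cong₂; subst)

  module _ {A B : Set} (g : B → A → B) (Q : B → Set) where

    foldl-invariant : ∀ xs → (∀ b x → x ∈ xs → Q b → Q (g b x)) → ∀ b → Q b → Q (foldl g b xs)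
    foldl-invariant []       h b q = q
    foldl-invariant (x ∷ xs) h b q = foldl-invariant xs (λ b z z∈ → h b z (there z∈)) (g b x) (h b x (here refl) q)

    foldl-reaches : ∀ {x xs} → x ∈ xs → (∀ b x → Q b → Q (g b x)) → (∀ b → Q (g b x)) → ∀ b → Q (foldl g b xs)
    foldl-reaches {x} {_ ∷ xs} (here refl) keep reach b = foldl-invariant xs (λ b z _ → keep b z) (g b x) (reach b)
    foldl-reaches {x} {z ∷ _}  (there x∈)  keep reach b = foldl-reaches x∈ keep reach (g b z)

  ∈ᵇ-complete : ∀ {n} {i : Fin n} {H} → i ∈ H → ∈ᵇ i H ≡ true
  ∈ᵇ-complete {i = i} i∈ = foldl-reaches _ (_≡ true) i∈ keep (λ b → reach b) false
    where
    keep : ∀ b h → b ≡ true → (if h ≡ᶠ i then true else b) ≡ true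
    keep b h refl with h ≡ᶠ i
    ... | true  = refl
    ... | false = refl
    reach : ∀ b → (if i ≡ᶠ i then true else b) ≡ true
    reach b rewrite ≡ᶠ-refl i = refl

  ∈ᵇ-sound : ∀ {n} {i : Fin n} H → ∈ᵇ i H ≡ true → i ∈ H
  ∈ᵇ-sound {i = i} H = foldl-invariant _ (λ b → b ≡ true → i ∈ H) H step false (λ ())
    where
    step : ∀ b h → h ∈ H → (b ≡ true → i ∈ H) → (if h ≡ᶠ i then true else b) ≡ true → i ∈ H
    step b h h∈ q eq with h ≡ᶠ i in e
    ... | true  = subst (_∈ H) (≡ᶠ-≡ h i e) h∈
    ... | false = q eq

  ∉ᵇ : ∀ {n} {i : Fin n} {H} → ∈ᵇ i H ≡ false → i ∉ H
  ∉ᵇ eq i∈ with () ← trans (sym eq) (∈ᵇ-complete i∈)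

  module _ {n : ℕ} where
    private
      g₃ : Assignment n → Fin n → List (Assignment n) → Fin n → List (Assignment n)
      g₃ y i acc j = swap i j y ∷ acc
      g₂ : Assignment n → List (Assignment n) → Fin n → List (Assignment n)
      g₂ y acc i = foldl (g₃ y i) acc (idxs n)
      g₁ : List (Assignment n) → Assignment n → List (Assignment n)
      g₁ acc y = foldl (g₂ y) acc (idxs n)

    ∈-expand : ∀ {y : Assignment n} {L} i j → y ∈ L → swap i j y ∈ expand L
    ∈-expand {y} i j y∈ = foldl-reaches g₁ Q y∈ (λ acc z → foldl-invariant (g₂ z) Q (idxs n) (λ acc a _ → keep z a acc) acc)
      (λ acc → foldl-reaches (g₂ y) Q (∈-idxs i) (λ acc a → keep y a acc)
        (λ acc → foldl-reaches (g₃ y i) Q (∈-idxs j) (λ _ _ → there) (λ _ → here refl) acc) acc) []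
      where
      Q : List (Assignment n) → Set
      Q acc = swap i j y ∈ acc
      keep : ∀ z a acc → Q acc → Q (g₂ z acc a)
      keep z a = foldl-invariant (g₃ z a) Q (idxs n) (λ _ _ _ → there)

    expand-invariant : (Q : Assignment n → Set) → (∀ i j y → Q y → Q (swap i j y)) → ∀ L → (∀ {y} → y ∈ L → Q y) → ∀ {y} → y ∈ expand L → Q y
    expand-invariant Q h L q = foldl-invariant g₁ Qs L
      (λ acc y y∈ → foldl-invariant (g₂ y) Qs (idxs n) (λ acc i _ → foldl-invariant (g₃ y i) Qs (idxs n)
        (λ { acc j _ p (here refl) → h i j y (q y∈) ; acc j _ p (there z∈) → p z∈ }) acc) acc) [] (λ ())
      where
      Qs : List (Assignment n) → Set
      Qs acc = ∀ {y} → y ∈ acc → Q y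

  iterate-suc : ∀ {A : Set} (f : A → A) m a → iterate f (suc m) a ≡ f (iterate f m a)
  iterate-suc f zero    a = refl
  iterate-suc f (suc m) a = iterate-suc f m (f a)

  iterate-slice : ∀ {n} k d (L : List (Assignment n)) → (∀ {y} → y ∈ L → #⊖ y ≡ k) → ∀ {y} → y ∈ iterate expand d L → #⊖ y ≡ k
  iterate-slice k zero    L h = h
  iterate-slice k (suc d) L h = iterate-slice k d (expand L) (expand-invariant (λ y → #⊖ y ≡ k) (λ i j y e → trans (#⊖-swap i j y) e) L h)

  -- Each round of `expand` can undo one of the swaps that separate z from β. The index `i` is for
  -- rounds that are left over: swapping i with itself keeps the point.
  reachable : ∀ {n} (β : Assignment n) → Fin n → ∀ d z → #⊖ z ≡ #⊖ β → inside (plus β) z ≤ d → z ∈ iterate expand d [ β ]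
  reachable β i zero    z z∈ ≤0 = here (coincide β z z∈ (n≤0⇒n≡0 ≤0))
  reachable β i (suc d) z z∈ ≤d with redPairs (plus β) z (≤-reflexive (inside≡outside β z z∈))
  ... | [] , _ , _ , e = subst (z ∈_) (sym (iterate-suc expand d [ β ])) (subst (_∈ expand (iterate expand d [ β ])) (swap-id {a = i} {i} z refl)
          (∈-expand i i (reachable β i d z z∈ (≤-trans (≤-reflexive (sym e)) z≤n))))
  ... | (a , b) ∷ _ , _ , ((Sa , za) , (Sb , zb)) ∷ _ , _ = subst (z ∈_) (sym (iterate-suc expand d [ β ])) (subst (_∈ expand (iterate expand d [ β ])) (swap-involutive a b z)
          (∈-expand a b (reachable β i d (swap a b z) (trans (#⊖-swap a b z) z∈)
            (s≤s⁻¹ (≤-trans (≤-reflexive (inside-swap (plus β) z Sa za Sb zb)) ≤d)))))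

  satisfies-local : ∀ {d n} (c : Constraint d n) → Local (toList (vars c)) (λ y → satisfies y c)
  satisfies-local c y z e = cong (predicate c) (go (vars c) e)
    where
    go : ∀ {d} (vs : Vec (Fin _) d) → (∀ i → i ∈ toList vs → lookup y i ≡ lookup z i) → Vec.map (lookup y) vs ≡ Vec.map (lookup z) vs
    go []       e = refl
    go (v ∷ vs) e = cong₂ _∷_ (e v (here refl)) (go vs (λ i i∈ → e i (there i∈)))

  val-sum : ∀ {d n} (I : CSP d n) y → ℤ.+ val I y ≡ List.foldr (λ c s → ℤ.+ bool (satisfies y c) +ᶻ s) 0ℤ I
  val-sum []      y = refl
  val-sum (c ∷ I) y with satisfies y c
  ... | true  = cong (ℤ.+ 1 +ᶻ_) (val-sum I y)
  ... | false = trans (val-sum I y) (sym (ℤ.+-identityˡ _))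

  val-deg : ∀ {d n} (I : CSP d n) → Deg≤ d (λ y → ℤ.+ val I y)
  val-deg I = deg-cong (λ y → sym (val-sum I y)) (deg-sum (λ c y → ℤ.+ bool (satisfies y c)) I λ c _ →
    local-deg {X = toList (vars c)} (λ y z e → cong (ℤ.+_ ∘ bool) (satisfies-local c y z e)) (≤-reflexive (length-toList (vars c))))

  val-swap-deg : ∀ {d n} (I : CSP d n) i j → Deg≤ d (λ y → ℤ.+ val I (swap i j y))
  val-swap-deg I i j = deg-cong (λ y → sym (val-sum I (swap i j y))) (deg-sum (λ c y → ℤ.+ bool (satisfies (swap i j y) c)) I λ c _ →
    local-deg {X = List.map (sw i j) (toList (vars c))} (λ y z e → cong (ℤ.+_ ∘ bool) (local-swap {h = λ y → satisfies y c} i j (satisfies-local c) y z e))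
      (≤-reflexive (trans (length-map (sw i j) (toList (vars c))) (length-toList (vars c)))))

  module _ {d n : ℕ} (I : CSP d n) (β : Assignment n) where

    points : List (Assignment n)
    points = iterate expand d [ β ]

    points-slice : ∀ {y} → y ∈ points → #⊖ y ≡ #⊖ β
    points-slice = iterate-slice (#⊖ β) d [ β ] λ { (here refl) → refl }

    H : List (Fin n)
    H = matching I points

    Covered : Assignment n → Fin n → Fin n → List (Fin n) → Set
    Covered y i j H = i ∈ H ⊎ j ∈ H ⊎ val I y ≡ val I (swap i j y)

    covered-grow : ∀ {y i j H} a b → Covered y i j H → Covered y i j (a ∷ b ∷ H)
    covered-grow a b (inj₁ i∈)        = inj₁ (there (there i∈))
    covered-grow a b (inj₂ (inj₁ j∈)) = inj₂ (inj₁ (there (there j∈)))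
    covered-grow a b (inj₂ (inj₂ e))  = inj₂ (inj₂ e)

    step-cases : (R : List (Fin n) → Set) → ∀ y H i j →
      (i ∈ H → R H) → (j ∈ H → R H) → (val I y ≡ val I (swap i j y) → R H) →
      (i ∉ H → j ∉ H → val I y ≢ val I (swap i j y) → R (i ∷ j ∷ H)) → R (pair-step I y H i j)
    step-cases R y H i j r₁ r₂ r₃ r₄ with ∈ᵇ i H in ei
    ... | true  = r₁ (∈ᵇ-sound H ei)
    ... | false with ∈ᵇ j H in ej
    ...   | true  = r₂ (∈ᵇ-sound H ej)
    ...   | false with val I y ≡ᵇ val I (swap i j y) in ev
    ...     | true  = r₃ (≡ᵇ⇒≡ _ _ (subst T (sym ev) _))
    ...     | false = r₄ (∉ᵇ ei) (∉ᵇ ej) λ e → subst T ev (≡⇒≡ᵇ _ _ e)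

    private
      h₂ : Assignment n → List (Fin n) → Fin n → List (Fin n)
      h₂ y H i = foldl (λ H j → pair-step I y H i j) H (idxs n)
      h₁ : List (Fin n) → Assignment n → List (Fin n)
      h₁ H y = foldl (h₂ y) H (idxs n)

    -- Processing y, i and j covers the pair, and H only grows afterwards.
    covers : ∀ {y} → y ∈ points → ∀ i j → Covered y i j H
    covers {y} y∈ i j = foldl-reaches h₁ Q y∈
      (λ H z → foldl-invariant (h₂ z) Q (idxs n) (λ H a _ → keep₁ z a H) H)
      (λ H → foldl-reaches (h₂ y) Q (∈-idxs i) (λ H a → keep₁ y a H)
        (λ H → foldl-reaches (λ H b → pair-step I y H i b) Q (∈-idxs j) (λ H b → keep y i b H)
          (λ H → step-cases Q y H i j inj₁ (inj₂ ∘ inj₁) (inj₂ ∘ inj₂) (λ _ _ _ → inj₁ (here refl))) H) H) []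
      where
      Q : List (Fin n) → Set
      Q = Covered y i j
      keep : ∀ z a b H → Q H → Q (pair-step I z H a b)
      keep z a b H c = step-cases Q z H a b (λ _ → c) (λ _ → c) (λ _ → c) (λ _ _ _ → covered-grow {y} {i} {j} {H} a b c)
      keep₁ : ∀ z a H → Q H → Q (h₂ z H a)
      keep₁ z a = foldl-invariant (λ H b → pair-step I z H a b) Q (idxs n) (λ H b _ → keep z a b H)

    Matched : List (Fin n) → Set
    Matched H = Σ[ P ∈ List (Pair n) ] (H ≡ pts P × Unique (pts P) ×
      (∀ {a b} → (a , b) ∈ P → ∃[ y ] (#⊖ y ≡ #⊖ β × val I y ≢ val I (swap a b y))))

    matched : Matched H
    matched = foldl-invariant h₁ Matched points (λ H y y∈ → foldl-invariant (h₂ y) Matched (idxs n) (λ H i _ →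
      foldl-invariant (λ H j → pair-step I y H i j) Matched (idxs n) (λ H j _ → step y y∈ H i j) H) H) [] ([] , refl , [] , λ ())
      where
      step : ∀ y → y ∈ points → ∀ H i j → Matched H → Matched (pair-step I y H i j)
      step y y∈ H i j m@(P , refl , u , h) = step-cases Matched y H i j (λ _ → m) (λ _ → m) (λ _ → m) λ i∉ j∉ v≢ →
        (i , j) ∷ P , refl , ((λ { refl → v≢ (cong (val I) (sym (swap-id {a = i} y refl))) }) ∷ away i∉) ∷ away j∉ ∷ u ,
        λ { (here refl) → y , points-slice y∈ , v≢ ; (there p) → h p }
        where
        away : ∀ {c} → c ∉ pts P → All (c ≢_) (pts P)
        away c∉ = All.tabulate λ { i∈ refl → c∉ i∈ }

    -- The change of the value under the swap of i and j is again a function of degree at most d. As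
    -- i and j are outside H, it vanishes at the visited points, which include every point of the
    -- slice with at most d entries ⊖ in `plus β`; `descent` extends this to the slice.
    symmetric : ∀ {i j} → i ∉ H → j ∉ H → ∀ y → #⊖ y ≡ #⊖ β → val I (swap i j y) ≡ val I y
    symmetric {i} {j} i∉ j∉ y y∈ = sym (ℤ.+-injective (minus-zero _ _
      (descent (plus β) (#⊖ β) (λ y → ℤ.+ val I y - ℤ.+ val I (swap i j y)) (deg-− (val-deg I) (val-swap-deg I i j))
        (λ z z∈ → ≤-reflexive (∑-plus β z z∈)) base y y∈)))
      where
      base : ∀ z → #⊖ z ≡ #⊖ β → inside (plus β) z ≤ d → ℤ.+ val I z - ℤ.+ val I (swap i j z) ≡ 0ℤ
      base z z∈ ≤d with covers (reachable β i d z z∈ ≤d) i j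
      ... | inj₁ i∈        = ⊥-elim (i∉ i∈)
      ... | inj₂ (inj₁ j∈) = ⊥-elim (j∉ j∈)
      ... | inj₂ (inj₂ e)  = trans (cong (λ m → ℤ.+ val I z - ℤ.+ m) (sym e)) (ℤ.+-inverseʳ (ℤ.+ val I z))

-- The interpolation polynomial is a kernel.

module Kernel where
  open Rationals
  open Values
  open Algorithm using (choose; mask; entries; outputs; complete; fill)
  open Sums
  open Swaps
  open Differences
  open Certificate using (unique-length)
  open Hitting
  open PolyVal using (eval-f; boolℚ; fromNat-val)
  open Newton
  open import Defs using (Assignment; CSP; vars; satisfies; val; fromNat; Poly; eval; monomial; ±1; f[_])
  open import Data.Bool.Base using (Bool; true; false; T; _∧_)
  open import Data.Fin.Base using (Fin; zero; suc)
  open import Data.Fin.Subset using (Subset; _⊆_; ∣_∣)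
  open import Data.List.Base as List using (List; []; _∷_; length)
  open import Data.List.Membership.Propositional using (_∈_)
  open import Data.List.Membership.Propositional.Properties using (∈-map⁺)
  open import Data.List.Properties using (length-map)
  open import Data.List.Relation.Unary.All as All using (All; []; _∷_)
  open import Data.List.Relation.Unary.Any using (here; there)
  open import Data.Nat.Base as ℕ using (ℕ; zero; suc; _∸_; _≤_; z≤n; s≤s)
  import Data.Nat.Properties as ℕ
  open import Data.Product.Base using (_,_; proj₁; proj₂)
  open import Data.Rational.Base using (0ℚ; 1ℚ; _+_; _-_; _*_; -_)
  open import Data.Rational.Properties using (+-inverseʳ; +-identityʳ; +-identityˡ)
  open import Data.Sign.Base using () renaming (+ to ⊕; - to ⊖)
  open import Data.Vec.Base as Vec using (Vec; []; _∷_; lookup; toList)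
  open import Data.Vec.Properties using (length-toList; lookup∘tabulate)
  open import Function.Base using (_∘_)
  open import Relation.Binary.PropositionalEquality using (_≡_; refl; sym; trans; cong; cong₂; subst)
  open import Tactic.RingSolver using (solve-∀)

  private
    interchange₁ : ∀ x y z w → (x + y) - (z + w) ≡ (x - z) + (y - w)
    interchange₁ = solve-∀ ℚ-ring
    interchange₂ : ∀ x y z w → (x - y) - (z - w) ≡ (x - z) - (y - w)
    interchange₂ = solve-∀ ℚ-ring

  module ℚΔ = Diff _+_ _-_ 0ℚ +-inverseʳ +-identityʳ (+-identityˡ 0ℚ) interchange₁ interchange₂

  difference-zero : ∀ p q → p - q ≡ 0ℚ → p ≡ q
  difference-zero p q eq = trans (lem p q) (trans (cong (_+ q) eq) (+-identityˡ q))
    where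
    lem : ∀ p q → p ≡ p - q + q
    lem = solve-∀ ℚ-ring

  elements : ∀ {n} → Subset n → List (Fin n)
  elements []          = []
  elements (true ∷ T)  = zero ∷ List.map suc (elements T)
  elements (false ∷ T) = List.map suc (elements T)

  length-elements : ∀ {n} (T : Subset n) → length (elements T) ≡ ∣ T ∣
  length-elements []          = refl
  length-elements (true ∷ T)  = cong suc (trans (length-map suc (elements T)) (length-elements T))
  length-elements (false ∷ T) = trans (length-map suc (elements T)) (length-elements T)

  monomial-local : ∀ {n} (T : Subset n) → Local (elements T) (monomial T)
  monomial-local []          []      []      e = refl
  monomial-local (true ∷ T)  (x ∷ y) (w ∷ z) e = cong₂ (λ s m → ±1 s * m) (e zero (here refl)) (monomial-local T y z (λ i i∈ → e (suc i) (there (∈-map⁺ suc i∈))))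
  monomial-local (false ∷ T) (x ∷ y) (w ∷ z) e = cong (1ℚ *_) (monomial-local T y z (λ i i∈ → e (suc i) (∈-map⁺ suc i∈)))

  eval-deg : ∀ {n d} (g : Poly n) → All (λ (_ , T) → ∣ T ∣ ≤ d) g → ℚΔ.Deg≤ d (eval g)
  eval-deg []            []       = ℚΔ.local-deg {X = []} (λ _ _ _ → refl) z≤n
  eval-deg ((a , T) ∷ g) (p ∷ ps) = ℚΔ.deg-+ {g = λ y → a * monomial T y} {eval g}
    (ℚΔ.local-deg {X = elements T} (λ y z e → cong (a *_) (monomial-local T y z e)) (ℕ.≤-trans (ℕ.≤-reflexive (length-elements T)) p)) (eval-deg g ps)

  val-degℚ : ∀ {d n} (I : CSP d n) → ℚΔ.Deg≤ d (λ y → fromNat (val I y))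
  val-degℚ []      = ℚΔ.local-deg {X = []} (λ _ _ _ → refl) z≤n
  val-degℚ (c ∷ I) = ℚΔ.deg-cong (λ y → sym (fromNat-val c I y)) (ℚΔ.deg-+ {g = λ y → boolℚ (satisfies y c)} {λ y → fromNat (val I y)}
    (ℚΔ.local-deg {X = toList (vars c)} (λ y z e → cong boolℚ (satisfies-local c y z e)) (ℕ.≤-reflexive (length-toList (vars c)))) (val-degℚ I))

  ∣∣-sum : ∀ {n} (S : Subset n) → ∣ S ∣ ≡ ∑ᶠ (bool ∘ lookup S)
  ∣∣-sum []          = refl
  ∣∣-sum (true ∷ S)  = sym (trans (∑ᶠ-suc (bool ∘ lookup (true ∷ S))) (trans (ℕ.+-comm _ 1) (cong suc (sym (∣∣-sum S)))))
  ∣∣-sum (false ∷ S) = sym (trans (∑ᶠ-suc (bool ∘ lookup (false ∷ S))) (trans (ℕ.+-identityʳ _) (sym (∣∣-sum S))))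

  count-sum : ∀ {n} (S : Vec Bool n) → count S ≡ ∑ᶠ (bool ∘ lookup S)
  count-sum []          = refl
  count-sum (true ∷ S)  = sym (trans (∑ᶠ-suc (bool ∘ lookup (true ∷ S))) (trans (ℕ.+-comm _ 1) (cong suc (sym (count-sum S)))))
  count-sum (false ∷ S) = sym (trans (∑ᶠ-suc (bool ∘ lookup (false ∷ S))) (trans (ℕ.+-identityʳ _) (sym (count-sum S))))

  lookup-mask : ∀ {n} (H : List (Fin n)) i → lookup (mask H) i ≡ ∈ᵇ i H
  lookup-mask H i = lookup∘tabulate (λ i → ∈ᵇ i H) i

  sum-mask : ∀ {n} (H : List (Fin n)) → ∑ᶠ (bool ∘ lookup (mask H)) ≤ length H
  sum-mask {n} H = ℕ.≤-trans (ℕ.≤-reflexive (sym (length-select φ))) (unique-length (select φ) H (unique-select φ)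
    λ i∈ → ∈ᵇ-sound H (trans (sym (lookup-mask H _)) (All.lookup (all-select φ) i∈)))
    where
    φ = lookup (mask H)

  inside-masked : ∀ {n} (S : Vec Bool n) z → inside (lookup S) z ≡ #⊖ (masked S z)
  inside-masked []          []      = refl
  inside-masked (true ∷ S)  (⊖ ∷ z) = trans (∑ᶠ-suc (λ i → bool (lookup (true ∷ S) i ∧ is⊖ (lookup (⊖ ∷ z) i)))) (trans (ℕ.+-comm _ 1) (cong suc (inside-masked S z)))
  inside-masked (true ∷ S)  (⊕ ∷ z) = trans (∑ᶠ-suc (λ i → bool (lookup (true ∷ S) i ∧ is⊖ (lookup (⊕ ∷ z) i)))) (trans (ℕ.+-identityʳ _) (inside-masked S z))
  inside-masked (false ∷ S) (x ∷ z) = trans (∑ᶠ-suc (λ i → bool (lookup (false ∷ S) i ∧ is⊖ (lookup (x ∷ z) i)))) (trans (ℕ.+-identityʳ _) (inside-masked S z))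

  fill-inside : ∀ {n} (S : Vec Bool n) z q i → lookup S i ≡ true → lookup (proj₂ (fill S (masked S z) q)) i ≡ lookup z i
  fill-inside (true ∷ S) (x ∷ z) q zero    e = refl
  fill-inside (true ∷ S) (x ∷ z) q (suc i) e = fill-inside S z q i e
  fill-inside (false ∷ S) (x ∷ z) q (suc i) e with fill S (masked S z) q | fill-inside S z q i e
  ... | zero  , w | eq = eq
  ... | suc _ , w | eq = eq

  fill-count : ∀ {n} (S : Vec Bool n) z q → #⊖ (proj₂ (fill S (masked S z) q)) ℕ.+ proj₁ (fill S (masked S z) q) ≡ #⊖ (masked S z) ℕ.+ q
  fill-count []          []      q = refl
  fill-count (true ∷ S)  (⊖ ∷ z) q = cong suc (fill-count S z q)
  fill-count (true ∷ S)  (⊕ ∷ z) q = fill-count S z q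
  fill-count (false ∷ S) (x ∷ z) q with fill S (masked S z) q | fill-count S z q
  ... | zero  , w | eq = eq
  ... | suc r , w | eq = trans (sym (ℕ.+-suc (#⊖ w) r)) eq

  -- The places outside S suffice, since z itself is such a completion.
  fill-exhausts : ∀ {n} (S : Vec Bool n) z q → #⊖ (masked S z) ℕ.+ q ≤ #⊖ z → proj₁ (fill S (masked S z) q) ≡ 0
  fill-exhausts S z q le = ℕ.n≤0⇒n≡0 (go S z q 0 (ℕ.≤-trans le (ℕ.≤-reflexive (sym (ℕ.+-identityʳ (#⊖ z))))))
    where
    go : ∀ {n} (S : Vec Bool n) z q e → #⊖ (masked S z) ℕ.+ q ≤ #⊖ z ℕ.+ e → proj₁ (fill S (masked S z) q) ≤ e
    go []          []      q e le = le
    go (true ∷ S)  (⊖ ∷ z) q e (s≤s le) = go S z q e le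
    go (true ∷ S)  (⊕ ∷ z) q e le = go S z q e le
    go (false ∷ S) (⊖ ∷ z) q e le with fill S (masked S z) q | go S z q (suc e) (ℕ.≤-trans le (ℕ.≤-reflexive (sym (ℕ.+-suc (#⊖ z) e))))
    ... | zero  , w | le′     = z≤n
    ... | suc r , w | s≤s le′ = le′
    go (false ∷ S) (⊕ ∷ z) q e le with fill S (masked S z) q | go S z q e le
    ... | zero  , w | le′ = z≤n
    ... | suc r , w | le′ = ℕ.<⇒≤ le′

  masked≤ : ∀ {n} (S : Vec Bool n) z → #⊖ (masked S z) ≤ #⊖ z
  masked≤ []          []      = z≤n
  masked≤ (true ∷ S)  (⊖ ∷ z) = s≤s (masked≤ S z)
  masked≤ (true ∷ S)  (⊕ ∷ z) = masked≤ S z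
  masked≤ (false ∷ S) (⊖ ∷ z) = ℕ.m≤n⇒m≤1+n (masked≤ S z)
  masked≤ (false ∷ S) (⊕ ∷ z) = masked≤ S z

  complete-slice : ∀ {n} (S : Vec Bool n) z → #⊖ (complete (#⊖ z) S (masked S z)) ≡ #⊖ z
  complete-slice S z = trans (sym (trans (cong (#⊖ w ℕ.+_) (fill-exhausts S z q (ℕ.≤-reflexive eq))) (ℕ.+-identityʳ (#⊖ w)))) (trans (fill-count S z q) eq)
    where
    q = #⊖ z ∸ #⊖ (masked S z)
    w = proj₂ (fill S (masked S z) q)
    eq : #⊖ (masked S z) ℕ.+ q ≡ #⊖ z
    eq = ℕ.m+[n∸m]≡n (masked≤ S z)

  complete-all : ∀ {n} (S : Vec Bool n) B k → (∀ i → lookup S i ≡ true) → complete k S B ≡ B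
  complete-all S B k all = go S B (k ∸ #⊖ B) all
    where
    go : ∀ {n} (S : Vec Bool n) B q → (∀ i → lookup S i ≡ true) → proj₂ (fill S B q) ≡ B
    go []          []      q all = refl
    go (true ∷ S)  (b ∷ B) q all = cong (b ∷_) (go S B q (all ∘ suc))
    go (false ∷ S) (b ∷ B) q all with () ← all zero

  -- Interpolation is linear in the weights, so constraints can be treated one by one, and each of
  -- them depends on at most d variables.
  interpolant-val : ∀ {d n} (S : Vec Bool n) (I : CSP d n) α → (∀ i → lookup S i ≡ true) →
                    interpolant d S (λ _ B → fromNat (val I B)) α ≡ fromNat (val I α)
  interpolant-val {d} S []      α all = interpolant-0 d S α
  interpolant-val {d} S (c ∷ I) α all = trans (interpolant-cong d S α (λ _ B → fromNat-val c I B))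
    (trans (interpolant-+ d S (λ _ B → boolℚ (satisfies B c)) (λ _ B → fromNat (val I B)) α)
    (trans (cong₂ _+_ (interpolates-local d S R 0 (λ _ B → boolℚ (satisfies B c)) (λ B → boolℚ (satisfies B c)) α all
        (λ _ B B′ A → cong boolℚ (satisfies-local c B B′ (λ i i∈ → A i (trans (lookup-mask (toList (vars c)) i) (∈ᵇ-complete i∈))))) (λ _ _ _ → refl) small)
      (interpolant-val S I α all)) (sym (fromNat-val c I α))))
    where
    R = mask (toList (vars c))
    small : count R ℕ.+ 0 ≤ d
    small = ℕ.≤-trans (ℕ.≤-reflexive (trans (ℕ.+-identityʳ _) (count-sum R))) (ℕ.≤-trans (sum-mask (toList (vars c))) (ℕ.≤-reflexive (length-toList (vars c))))

  module _ {d n : ℕ} (I : CSP d n) (β : Assignment n) where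

    private
      k = #⊖ β

    kernelPoly : List (Fin n) → Poly n
    kernelPoly H₂ = outputs I k (mask H₂) (entries d (mask H₂))

    kernel-degree : ∀ H₂ → All (λ (_ , T) → ∣ T ∣ ≤ d) (kernelPoly H₂)
    kernel-degree H₂ = all-outputs (λ T → ∣ T ∣ ≤ d) I k (mask H₂) (entries d (mask H₂))
      (All.map (λ (le , _) → ℕ.≤-trans (ℕ.m≤m+n _ _) le) (admissible d (mask H₂)))

    kernel-vars : ∀ H₂ → All (λ (_ , T) → T ⊆ mask H₂) (kernelPoly H₂)
    kernel-vars H₂ = all-outputs (λ T → T ⊆ mask H₂) I k (mask H₂) (entries d (mask H₂)) (All.map (λ (_ , s) {x} → s {x}) (admissible d (mask H₂)))

    -- The difference of value and polynomial has degree at most d, so by `descent` only points z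
    -- with at most d entries ⊖ in H matter. There the interpolation returns the value at the
    -- completed point w, which agrees with z on H, and swaps outside H do not change the value.
    agrees-small : length (H I β) ≤ #⊕ β → ∀ α → #⊖ α ≡ k → eval (kernelPoly (H I β)) α ≡ fromNat (val I α)
    agrees-small small α α∈ = sym (difference-zero (fromNat (val I α)) (eval g α) (ℚΔ.descent (lookup S) k
      (λ y → fromNat (val I y) - eval g y) (ℚΔ.deg-− (val-degℚ I) (eval-deg g (kernel-degree (H I β)))) room base α α∈))
      where
      S = mask (H I β)
      g = kernelPoly (H I β)
      room : ∀ z → #⊖ z ≡ k → ∑ᶠ (bool ∘ lookup S) ≤ #⊕ z
      room z z∈ = ℕ.≤-trans (sum-mask (H I β)) (ℕ.≤-trans small (ℕ.≤-reflexive (trans (#⊕-sum β) (∑-plus β z z∈))))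
      base : ∀ z → #⊖ z ≡ k → inside (lookup S) z ≤ d → fromNat (val I z) - eval g z ≡ 0ℚ
      base z z∈ ≤d = trans (cong (λ e → fromNat (val I z) - e) (trans (eval-kernel I k S z) (trans
          (interpolates d S 0 (value-at I k S) (λ B → fromNat (val I (complete k S B))) z (λ _ _ _ → refl)
            (ℕ.≤-trans (ℕ.≤-reflexive (trans (ℕ.+-identityʳ _) (sym (inside-masked S z)))) ≤d))
          (cong fromNat same)))) (+-inverseʳ (fromNat (val I z)))
        where
        w = complete k S (masked S z)
        w∈ : #⊖ w ≡ k
        w∈ = trans (cong (λ k → #⊖ (complete k S (masked S z))) (sym z∈)) (trans (complete-slice S z) z∈)
        same : val I w ≡ val I z
        same = connect (_∈ H I β) (val I) k (λ a b y y∈ a∉ b∉ → symmetric I β a∉ b∉ y y∈) w z w∈ z∈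
          (λ i i∈ → fill-inside S z _ i (trans (lookup-mask (H I β) i) (∈ᵇ-complete i∈)))

    agrees-all : ∀ α → eval (kernelPoly (idxs n)) α ≡ fromNat (val I α)
    agrees-all α = trans (eval-kernel I k S α) (trans (interpolant-cong d S α (λ _ B → cong (fromNat ∘ val I) (complete-all S B k all))) (interpolant-val S I α all))
      where
      S = mask (idxs n)
      all : ∀ i → lookup S i ≡ true
      all i = trans (lookup-mask (idxs n) i) (∈ᵇ-complete (∈-idxs i))

    kernel-agrees : ∀ α → #⊖ α ≡ k → eval (kernelPoly (choose β (H I β))) α ≡ eval f[ I ] α
    kernel-agrees α α∈ with #⊕ β ℕ.<ᵇ length (H I β) in e
    ... | true  = trans (agrees-all α) (sym (eval-f I α))
    ... | false = trans (agrees-small (ℕ.≮⇒≥ λ lt → subst T e (ℕ.<⇒<ᵇ lt)) α α∈) (sym (eval-f I α))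

    kernel-size : ∀ (H₂ : List (Fin n)) → ∣ mask H₂ ∣ ≤ length H₂
    kernel-size H₂ = ℕ.≤-trans (ℕ.≤-reflexive (∣∣-sum (mask H₂))) (sum-mask H₂)

-- Rational inequalities and the choice of ρ.

module Consts where
  open Rationals
  open import Defs
  open import Data.Integer.Base as ℤ using (+_; -[1+_]; +[1+_])
  open import Data.Nat.Base as ℕ using (ℕ; zero; suc; z≤n; s≤s)
  import Data.Nat.Properties as ℕ
  import Data.Nat.DivMod as ℕ
  open import Data.Product.Base using (_×_; _,_; Σ-syntax; ∃-syntax; proj₁; proj₂)
  open import Data.Rational.Base hiding (floor; ceiling)
  open import Data.Rational.Properties
  open import Data.Sum.Base using (inj₁; inj₂)
  open import Relation.Binary.PropositionalEquality using (_≡_; refl; sym; trans; cong; cong₂)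
  open import Relation.Nullary.Negation.Core using (¬_; contradiction)
  open import Tactic.RingSolver using (solve-∀)

  <⇒≱ : ∀ {a b : ℚ} → a < b → ¬ (b ≤ a)
  <⇒≱ a<b b≤a = <-irrefl refl (<-≤-trans a<b b≤a)

  p≤∣p∣ : ∀ p → p ≤ ∣ p ∣
  p≤∣p∣ p with ≤-total 0ℚ p
  ... | inj₁ 0≤p = ≤-reflexive (sym (0≤p⇒∣p∣≡p 0≤p))
  ... | inj₂ p≤0 = ≤-trans p≤0 (0≤∣p∣ p)

  *-mono : ∀ {a b c e} → 0ℚ ≤ a → 0ℚ ≤ e → a ≤ b → c ≤ e → a * c ≤ b * e
  *-mono {a} {b} {c} {e} 0≤a 0≤e a≤b c≤e = ≤-trans (*-monoˡ-≤-nonNeg a ⦃ nonNegative 0≤a ⦄ c≤e) (*-monoʳ-≤-nonNeg e ⦃ nonNegative 0≤e ⦄ a≤b)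

  *-nonneg : ∀ {a b} → 0ℚ ≤ a → 0ℚ ≤ b → 0ℚ ≤ a * b
  *-nonneg {a} {b} 0≤a 0≤b = ≤-trans (≤-reflexive (sym (*-zeroʳ a))) (*-monoˡ-≤-nonNeg a ⦃ nonNegative 0≤a ⦄ 0≤b)

  square-nonneg : ∀ a → 0ℚ ≤ a * a
  square-nonneg a with ≤-total 0ℚ a
  ... | inj₁ 0≤a = *-nonneg 0≤a 0≤a
  ... | inj₂ a≤0 = ≤-trans (*-nonneg (neg-antimono-≤ a≤0) (neg-antimono-≤ a≤0)) (≤-reflexive (lem a))
    where
    lem : ∀ a → - a * - a ≡ a * a
    lem = solve-∀ ℚ-ring

  *-cancelˡ : ∀ {a b c} → 0ℚ < a → a * b ≤ a * c → b ≤ c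
  *-cancelˡ {a} 0<a = *-cancelˡ-≤-pos a ⦃ positive 0<a ⦄

  ^-nonneg : ∀ {a} d → 0ℚ ≤ a → 0ℚ ≤ a ^ d
  ^-nonneg zero    0≤a = 0≤fromNat 1
  ^-nonneg (suc d) 0≤a = *-nonneg 0≤a (^-nonneg d 0≤a)

  ^-mono : ∀ {a b} d → 0ℚ ≤ a → a ≤ b → a ^ d ≤ b ^ d
  ^-mono zero    0≤a a≤b = ≤-refl
  ^-mono (suc d) 0≤a a≤b = *-mono 0≤a (^-nonneg d (≤-trans 0≤a a≤b)) a≤b (^-mono d 0≤a a≤b)

  ^-* : ∀ a b d → (a * b) ^ d ≡ a ^ d * b ^ d
  ^-* a b zero    = refl
  ^-* a b (suc d) = trans (cong (a * b *_) (^-* a b d)) (lem a b (a ^ d) (b ^ d))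
    where
    lem : ∀ a b x y → a * b * (x * y) ≡ a * x * (b * y)
    lem = solve-∀ ℚ-ring

  fromNat-^ : ∀ m d → fromNat (m ℕ.^ d) ≡ fromNat m ^ d
  fromNat-^ m zero    = refl
  fromNat-^ m (suc d) = trans (fromNat-* m (m ℕ.^ d)) (cong (fromNat m *_) (fromNat-^ m d))

  limit-≤ : ∀ {a b} → (∀ δ → 0ℚ < δ → a ≤ b + δ) → a ≤ b
  limit-≤ {a} {b} h = ≮⇒≥ λ b<a → let
      0<a-b = ≤-<-trans (≤-reflexive (sym (+-inverseʳ b))) (+-monoˡ-< (- b) b<a)
      δ     = ½ * (a - b)
      0<δ   = ≤-<-trans (≤-reflexive (sym (*-zeroʳ ½))) (*-monoʳ-<-pos ½ 0<a-b)
      b+δ<a = <-≤-trans (≤-<-trans (≤-reflexive (sym (+-identityʳ (b + δ)))) (+-monoʳ-< (b + δ) 0<δ)) (≤-reflexive (lem a b))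
    in <⇒≱ b+δ<a (h δ 0<δ)
    where
    lem′ : ∀ h a b → b + h * (a - b) + h * (a - b) ≡ b + (h + h) * (a - b)
    lem′ = solve-∀ ℚ-ring
    lem″ : ∀ a b → b + 1ℚ * (a - b) ≡ a
    lem″ = solve-∀ ℚ-ring
    lem : ∀ a b → b + ½ * (a - b) + ½ * (a - b) ≡ a
    lem a b = trans (lem′ ½ a b) (lem″ a b)

  positive-numerator : ∀ {p} → 0ℚ < p → ∃[ u ] (↥ p ≡ +[1+ u ])
  positive-numerator {mkℚ +[1+ u ] _ _} _ = u , refl
  positive-numerator {mkℚ (+ 0) d c} 0<p = contradiction (≤-reflexive (↥p≡0⇒p≡0 (mkℚ (+ 0) d c) refl)) (<⇒≱ 0<p)
  positive-numerator {mkℚ -[1+ u ] d c} 0<p with () ← positive 0<p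

  reciprocal : ∀ x → 0ℚ < x → Σ[ m ∈ ℕ ] (1ℚ ≤ fromNat (suc m) * x × fromNat m * x ≤ 1ℚ)
  reciprocal x 0<x with u , x≡ ← positive-numerator 0<x = m , above , below
    where
    v = ↧ₙ x
    -- The integer part of 1 / x, as x = (u + 1) / v.
    m = v ℕ./ suc u
    xv : x * fromNat v ≡ fromNat (suc u)
    xv = trans (*-denominator x) (cong fromℤ x≡)
    0<v : 0ℚ < fromNat v
    0<v = <-≤-trans (positive⁻¹ 1ℚ) (fromNat-mono {1} {v} (s≤s z≤n))
    rearrange : ∀ a → fromNat v * (fromNat a * x) ≡ fromNat (a ℕ.* suc u)
    rearrange a = trans (lem (fromNat v) (fromNat a) x) (trans (cong (fromNat a *_) xv) (sym (fromNat-* a (suc u))))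
      where
      lem : ∀ v a x → v * (a * x) ≡ a * (x * v)
      lem = solve-∀ ℚ-ring
    above : 1ℚ ≤ fromNat (suc m) * x
    above = *-cancelˡ 0<v (≤-trans (≤-reflexive (*-identityʳ (fromNat v))) (≤-trans (fromNat-mono {v} {suc m ℕ.* suc u}
      (ℕ.≤-trans (ℕ.≤-reflexive (ℕ.m≡m%n+[m/n]*n v (suc u))) (ℕ.+-monoˡ-≤ (m ℕ.* suc u) (ℕ.<⇒≤ (ℕ.m%n<n v (suc u)))))) (≤-reflexive (sym (rearrange (suc m))))))
    below : fromNat m * x ≤ 1ℚ
    below = *-cancelˡ 0<v (≤-trans (≤-reflexive (rearrange m)) (≤-trans (fromNat-mono {m ℕ.* suc u} {v} (ℕ.m/n*n≤m v (suc u))) (≤-reflexive (sym (*-identityʳ (fromNat v))))))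

  -- The last clause keeps ρ close to 1 / p₀, as the size of the kernel grows with ρ.
  Threshold : ℝ → ℕ → Set
  Threshold p₀ ρ = ∀ p → seq p₀ ≤ˢ const p → const p ≤ˢ (λ i → 1ℚ - seq p₀ i) →
    0ℚ < p × 1ℚ ≤ fromNat ρ * p × 1ℚ ≤ fromNat ρ * (1ℚ - p) × 2 ℕ.≤ ρ ×
    ∃[ N ] (∀ i → N ℕ.≤ i → 0ℚ < seq p₀ i × seq p₀ i < 1ℚ × fromNat (5 ℕ.* ρ) * seq p₀ i ≤ fromNat 8)

  -- With η = ε / 50 let x be a late member of the sequence minus η. Then 49 η ≤ x, and late members
  -- q lie between x and x + 2η ≤ (51/49) x. Take ρ = ⌊1/x⌋ + 1. For an admissible p both p and 1 -
  -- p are at least x, so x ≤ 1/2 and ρ x ≤ 1 + x ≤ 3/2, whence 5 ρ q ≤ 5 · (51/49) · (3/2) = 765/98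
  -- < 8.
  find-threshold : ∀ p₀ → const 0ℚ <ˢ seq p₀ → Σ[ ρ ∈ ℕ ] Threshold p₀ ρ
  find-threshold p₀ (ε , 0<ε , N₀ , ε≤) = ρ , λ p lo hi →
      let x≤p  = lower p lo
          x≤1-p = upper p hi
          2x≤1 = ≤-trans (+-mono-≤ x≤p x≤1-p) (≤-reflexive (lem₁ p))
      in <-≤-trans 0<x x≤p , ≤-trans 1≤ρx (scale ρ x≤p) , ≤-trans 1≤ρx (scale ρ x≤1-p) , two 2x≤1 ,
         M , λ i M≤i → let q≤ = proj₂ (near i M≤i)
                       in <-≤-trans 0<x (proj₁ (near i M≤i)) , below-one 2x≤1 (seq p₀ i) q≤ , eight 2x≤1 (seq p₀ i) q≤
    where
    0<1/50 : 0ℚ < fromNat 50 ⁻¹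
    0<1/50 = positive⁻¹ (fromNat 50 ⁻¹)
    η = fromNat 50 ⁻¹ * ε
    0<η : 0ℚ < η
    0<η = ≤-<-trans (≤-reflexive (sym (*-zeroʳ (fromNat 50 ⁻¹)))) (*-monoʳ-<-pos (fromNat 50 ⁻¹) 0<ε)
    50η : fromNat 50 * η ≡ ε
    50η = trans (sym (*-assoc (fromNat 50) (fromNat 50 ⁻¹) ε)) (*-identityˡ ε)
    N₁ = proj₁ (cauchy p₀ η 0<η)
    M = N₀ ℕ.⊔ N₁
    x = seq p₀ M - η
    49η≤x : fromNat 49 * η ≤ x
    49η≤x = ≤-trans (≤-reflexive (trans (lem (fromNat 49) η) (cong (_- η) (trans (cong (_* η) (sym (fromNat-+ 49 1))) 50η))))
      (+-monoˡ-≤ (- η) (≤-trans (≤-reflexive (sym (+-identityˡ ε))) (ε≤ M (ℕ.m≤m⊔n N₀ N₁))))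
      where
      lem : ∀ a η → a * η ≡ (a + 1ℚ) * η - η
      lem = solve-∀ ℚ-ring
    0<x : 0ℚ < x
    0<x = <-≤-trans (≤-<-trans (≤-reflexive (sym (*-zeroʳ (fromNat 49)))) (*-monoʳ-<-pos (fromNat 49) 0<η)) 49η≤x
    m = proj₁ (reciprocal x 0<x)
    ρ = suc m
    1≤ρx : 1ℚ ≤ fromNat ρ * x
    1≤ρx = proj₁ (proj₂ (reciprocal x 0<x))
    ρx≤ : fromNat ρ * x ≤ 1ℚ + x
    ρx≤ = ≤-trans (≤-reflexive (trans (cong (_* x) (fromNat-suc m)) (lem (fromNat m) x))) (+-monoˡ-≤ x (proj₂ (proj₂ (reciprocal x 0<x))))
      where
      lem : ∀ m x → (1ℚ + m) * x ≡ m * x + x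
      lem = solve-∀ ℚ-ring
    scale : ∀ m {a b} → a ≤ b → fromNat m * a ≤ fromNat m * b
    scale m = *-monoˡ-≤-nonNeg (fromNat m) ⦃ nonNegative (0≤fromNat m) ⦄
    near : ∀ i → M ℕ.≤ i → x ≤ seq p₀ i × seq p₀ i ≤ x + fromNat 2 * η
    near i M≤i = low , high
      where
      close = proj₂ (cauchy p₀ η 0<η) i M (ℕ.≤-trans (ℕ.m≤n⊔m N₀ N₁) M≤i) (ℕ.m≤n⊔m N₀ N₁)
      d = seq p₀ i - seq p₀ M
      d≤ : d ≤ η
      d≤ = ≤-trans (p≤∣p∣ d) close
      -η≤ : - η ≤ d
      -η≤ = ≤-trans (neg-antimono-≤ close) (≤-trans (neg-antimono-≤ (≤-trans (p≤∣p∣ (- d)) (≤-reflexive (∣-p∣≡∣p∣ d)))) (≤-reflexive (neg-neg d)))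
        where
        neg-neg : ∀ d → - - d ≡ d
        neg-neg = solve-∀ ℚ-ring
      low : x ≤ seq p₀ i
      low = ≤-trans (+-monoʳ-≤ (seq p₀ M) -η≤) (≤-reflexive (lem (seq p₀ M) (seq p₀ i)))
        where
        lem : ∀ a b → a + (b - a) ≡ b
        lem = solve-∀ ℚ-ring
      high : seq p₀ i ≤ x + fromNat 2 * η
      high = ≤-trans (≤-reflexive (lem (seq p₀ i) (seq p₀ M))) (≤-trans (+-monoʳ-≤ (seq p₀ M) d≤) (≤-reflexive (lem′ (seq p₀ M) η)))
        where
        lem : ∀ b a → b ≡ a + (b - a)
        lem = solve-∀ ℚ-ring
        lem′ : ∀ a η → a + η ≡ a - η + (1ℚ + 1ℚ) * η
        lem′ = solve-∀ ℚ-ring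
    lower : ∀ p → seq p₀ ≤ˢ const p → x ≤ p
    lower p lo = limit-≤ λ δ 0<δ → let N , h = lo δ 0<δ in
      ≤-trans (proj₁ (near (M ℕ.⊔ N) (ℕ.m≤m⊔n M N))) (h (M ℕ.⊔ N) (ℕ.m≤n⊔m M N))
    upper : ∀ p → const p ≤ˢ (λ i → 1ℚ - seq p₀ i) → x ≤ 1ℚ - p
    upper p hi = limit-≤ λ δ 0<δ → let N , h = hi δ 0<δ
                                       i = M ℕ.⊔ N in
      ≤-trans (proj₁ (near i (ℕ.m≤m⊔n M N))) (≤-trans (≤-reflexive (lem (seq p₀ i) p δ))
        (≤-trans (+-monoˡ-≤ (seq p₀ i - p) (h i (ℕ.m≤n⊔m M N))) (≤-reflexive (lem′ (seq p₀ i) p δ))))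
      where
      lem : ∀ q p δ → q ≡ p + (q - p)
      lem = solve-∀ ℚ-ring
      lem′ : ∀ q p δ → 1ℚ - q + δ + (q - p) ≡ 1ℚ - p + δ
      lem′ = solve-∀ ℚ-ring
    lem₁ : ∀ p → p + (1ℚ - p) ≡ 1ℚ
    lem₁ = solve-∀ ℚ-ring
    two : x + x ≤ 1ℚ → 2 ℕ.≤ ρ
    two 2x≤1 = ℕ.≮⇒≥ λ { (s≤s (s≤s m≤0)) → <⇒≱ (strict m≤0) 1≤ρx }
      where
      strict : m ℕ.≤ 0 → fromNat ρ * x < 1ℚ
      strict m≤0 = <-≤-trans (≤-<-trans (≤-reflexive (trans (cong (λ m → fromNat (suc m) * x) (ℕ.n≤0⇒n≡0 m≤0)) (trans (*-identityˡ x) (sym (+-identityʳ x))))) (+-monoʳ-< x 0<x)) 2x≤1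
    2η≤ : fromNat 49 * (fromNat 2 * η) ≤ fromNat 2 * x
    2η≤ = ≤-trans (≤-reflexive (lem (fromNat 49) (fromNat 2) η)) (scale 2 49η≤x)
      where
      lem : ∀ a b η → a * (b * η) ≡ b * (a * η)
      lem = solve-∀ ℚ-ring
    51x : ∀ q → q ≤ x + fromNat 2 * η → fromNat 49 * q ≤ fromNat 51 * x
    51x q q≤ = ≤-trans (scale 49 q≤) (≤-trans (≤-reflexive (*-distribˡ-+ (fromNat 49) x _)) (≤-trans (+-monoʳ-≤ (fromNat 49 * x) 2η≤)
      (≤-reflexive (trans (sym (*-distribʳ-+ x (fromNat 49) (fromNat 2))) (cong (_* x) (sym (fromNat-+ 49 2)))))))
    0<49 : 0ℚ < fromNat 49
    0<49 = positive⁻¹ (fromNat 49)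
    2x : x + x ≤ 1ℚ → fromNat 2 * x ≤ 1ℚ
    2x h = ≤-trans (≤-reflexive (lem x)) h
      where
      lem : ∀ x → (1ℚ + 1ℚ) * x ≡ x + x
      lem = solve-∀ ℚ-ring
    below-one : x + x ≤ 1ℚ → ∀ q → q ≤ x + fromNat 2 * η → q < 1ℚ
    below-one 2x≤1 q q≤ = ≰⇒> λ 1≤q → <⇒≱ {fromNat 51} {fromNat 98} (from-lt 51 98 (ℕ.≤ᵇ⇒≤ 52 98 _))
      (≤-trans (≤-reflexive (trans (fromNat-* 2 49) (sym (trans (*-identityʳ _) refl))))
      (≤-trans (≤-reflexive (*-assoc (fromNat 2) (fromNat 49) 1ℚ)) (≤-trans (scale 2 (scale 49 1≤q)) (≤-trans (scale 2 (51x q q≤))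
        (≤-trans (≤-reflexive (lem (fromNat 2) (fromNat 51) x)) (≤-trans (scale 51 (2x 2x≤1)) (≤-reflexive (*-identityʳ (fromNat 51)))))))))
      where
      lem : ∀ a b x → a * (b * x) ≡ b * (a * x)
      lem = solve-∀ ℚ-ring
      from-lt : ∀ a b → suc a ℕ.≤ b → fromNat a < fromNat b
      from-lt a b le = <-≤-trans (≤-<-trans (≤-reflexive (sym (+-identityˡ (fromNat a)))) (+-monoˡ-< (fromNat a) (positive⁻¹ 1ℚ)))
        (≤-trans (≤-reflexive (sym (fromNat-suc a))) (fromNat-mono le))
    eight : x + x ≤ 1ℚ → ∀ q → q ≤ x + fromNat 2 * η → fromNat (5 ℕ.* ρ) * q ≤ fromNat 8
    eight 2x≤1 q q≤ = *-cancelˡ (positive⁻¹ (fromNat 98)) (begin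
      fromNat 98 * (fromNat (5 ℕ.* ρ) * q)                  ≡⟨ cong₂ (λ a b → a * (b * q)) (fromNat-* 2 49) (fromNat-* 5 ρ) ⟩
      fromNat 2 * fromNat 49 * (fromNat 5 * fromNat ρ * q)  ≡⟨ e₁ (fromNat 2) (fromNat 49) (fromNat 5) (fromNat ρ) q ⟩
      fromNat 2 * (fromNat 5 * (fromNat ρ * (fromNat 49 * q))) ≤⟨ scale 2 (scale 5 (scale ρ (51x q q≤))) ⟩
      fromNat 2 * (fromNat 5 * (fromNat ρ * (fromNat 51 * x))) ≡⟨ e₂ (fromNat 2) (fromNat 5) (fromNat ρ) (fromNat 51) x ⟩
      fromNat 5 * fromNat 51 * (fromNat 2 * (fromNat ρ * x))   ≡⟨ cong (_* (fromNat 2 * (fromNat ρ * x))) (sym (fromNat-* 5 51)) ⟩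
      fromNat 255 * (fromNat 2 * (fromNat ρ * x))            ≤⟨ scale 255 (≤-trans (scale 2 ρx≤) (≤-trans (≤-reflexive (*-distribˡ-+ (fromNat 2) 1ℚ x)) (+-monoʳ-≤ (fromNat 2 * 1ℚ) (2x 2x≤1)))) ⟩
      fromNat 255 * (fromNat 2 * 1ℚ + 1ℚ)                    ≡⟨ cong (fromNat 255 *_) (cong (_+ 1ℚ) (*-identityʳ (fromNat 2))) ⟩
      fromNat 255 * (fromNat 2 + 1ℚ)                         ≡⟨ trans (cong (fromNat 255 *_) (sym (fromNat-+ 2 1))) (sym (fromNat-* 255 3)) ⟩
      fromNat 765                                            ≤⟨ fromNat-mono {765} {784} (ℕ.≤ᵇ⇒≤ 765 784 _) ⟩
      fromNat 784                                            ≡⟨ fromNat-* 98 8 ⟩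
      fromNat 98 * fromNat 8                                 ∎)
      where
      open ≤-Reasoning
      e₁ : ∀ a b c r q → a * b * (c * r * q) ≡ a * (c * (r * (b * q)))
      e₁ = solve-∀ ℚ-ring
      e₂ : ∀ a c r f x → a * (c * (r * (f * x))) ≡ c * f * (a * (r * x))
      e₂ = solve-∀ ℚ-ring

-- Comparison of the certificate factor with C.

module Constant where
  open Growth using (^-distribʳ-*)
  open Rationals
  open Consts
  open import Defs
  open import Data.Nat.Base as ℕ using (ℕ; zero; suc; _!; z≤n; s≤s)
  import Data.Nat.Properties as ℕ
  import Data.Nat.Tactic.RingSolver as ℕ-Solver
  open import Data.Rational.Base hiding (floor; ceiling)
  open import Data.Rational.Properties
  open import Relation.Binary.PropositionalEquality using (_≡_; sym; trans; cong; cong₂; subst₂)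
  open import Tactic.RingSolver using (solve-∀)

  n≤n! : ∀ d → d ℕ.≤ d !
  n≤n! zero    = z≤n
  n≤n! (suc d) = ℕ.≤-trans (ℕ.≤-reflexive (sym (ℕ.*-identityʳ (suc d)))) (ℕ.*-monoʳ-≤ (suc d) (ℕ.1≤n! d))

  -- For d ≥ 2 the ratio K / L ≤ 2 is absorbed by d, so K^d ≤ L^d d^d. What remains is d^(2 + 5d),
  -- and 2 + 5d ≤ 6d ≤ 3d² together with d ≤ d! finishes the estimate.
  factorial-bound : ∀ K L d → K ℕ.≤ L ℕ.* 2 → 2 ℕ.≤ d →
    let D = d ℕ.^ d in
    suc d ℕ.* suc d ℕ.* (K ℕ.^ d ℕ.* (D ℕ.* D ℕ.* (D ℕ.* D))) ℕ.≤ 10 ℕ.* (L ℕ.^ d ℕ.* (d !) ℕ.^ (3 ℕ.* d ℕ.^ 2))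
  factorial-bound K L d K≤ 2≤d = begin
    suc d ℕ.* suc d ℕ.* (K ℕ.^ d ℕ.* Q)           ≤⟨ ℕ.*-mono-≤ (ℕ.*-mono-≤ sd sd) (ℕ.*-monoˡ-≤ Q Kd) ⟩
    2 ℕ.* d ℕ.* (2 ℕ.* d) ℕ.* (L ℕ.^ d ℕ.* D ℕ.* Q)    ≡⟨ e₁ d (L ℕ.^ d) D ⟩
    4 ℕ.* (L ℕ.^ d ℕ.* (d ℕ.* d ℕ.* (D ℕ.* (D ℕ.* (D ℕ.* (D ℕ.* (D ℕ.* 1)))))))  ≤⟨ ℕ.*-mono-≤ (ℕ.≤ᵇ⇒≤ 4 10 _) (ℕ.*-monoʳ-≤ (L ℕ.^ d) power) ⟩
    10 ℕ.* (L ℕ.^ d ℕ.* (d !) ℕ.^ (3 ℕ.* d ℕ.^ 2)) ∎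
    where
    open ℕ.≤-Reasoning
    D = d ℕ.^ d
    Q = D ℕ.* D ℕ.* (D ℕ.* D)
    instance
      d≢0 : ℕ.NonZero d
      d≢0 = ℕ.>-nonZero (ℕ.<-≤-trans (s≤s z≤n) 2≤d)
    e₁ : ∀ d l D → 2 ℕ.* d ℕ.* (2 ℕ.* d) ℕ.* (l ℕ.* D ℕ.* (D ℕ.* D ℕ.* (D ℕ.* D))) ≡ 4 ℕ.* (l ℕ.* (d ℕ.* d ℕ.* (D ℕ.* (D ℕ.* (D ℕ.* (D ℕ.* (D ℕ.* 1)))))))
    e₁ = ℕ-Solver.solve-∀
    sd : suc d ℕ.≤ 2 ℕ.* d
    sd = ℕ.≤-trans (ℕ.+-monoˡ-≤ d (ℕ.≤-trans (s≤s z≤n) 2≤d)) (ℕ.≤-reflexive (cong (d ℕ.+_) (sym (ℕ.+-identityʳ d))))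
    Kd : K ℕ.^ d ℕ.≤ L ℕ.^ d ℕ.* D
    Kd = ℕ.≤-trans (ℕ.^-monoˡ-≤ d (ℕ.≤-trans K≤ (ℕ.*-monoʳ-≤ L 2≤d))) (ℕ.≤-reflexive (^-distribʳ-* L d d))
    exponent : 2 ℕ.+ d ℕ.* 5 ℕ.≤ 3 ℕ.* d ℕ.^ 2
    exponent = ℕ.≤-trans (ℕ.+-monoˡ-≤ (d ℕ.* 5) 2≤d) (ℕ.≤-trans (ℕ.≤-reflexive (e d))
      (ℕ.≤-trans (ℕ.*-monoʳ-≤ 3 (ℕ.*-monoʳ-≤ d 2≤d)) (ℕ.≤-reflexive (cong (λ x → 3 ℕ.* (d ℕ.* x)) (sym (ℕ.*-identityʳ d))))))
      where
      e : ∀ d → d ℕ.+ d ℕ.* 5 ≡ 3 ℕ.* (d ℕ.* 2)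
      e = ℕ-Solver.solve-∀
    power : d ℕ.* d ℕ.* D ℕ.^ 5 ℕ.≤ (d !) ℕ.^ (3 ℕ.* d ℕ.^ 2)
    power = begin
      d ℕ.* d ℕ.* D ℕ.^ 5                 ≡⟨ cong₂ ℕ._*_ (cong (d ℕ.*_) (sym (ℕ.*-identityʳ d))) (ℕ.^-*-assoc d d 5) ⟩
      d ℕ.^ 2 ℕ.* d ℕ.^ (d ℕ.* 5)         ≡⟨ sym (ℕ.^-distribˡ-+-* d 2 (d ℕ.* 5)) ⟩
      d ℕ.^ (2 ℕ.+ d ℕ.* 5)               ≤⟨ ℕ.^-monoʳ-≤ d exponent ⟩
      d ℕ.^ (3 ℕ.* d ℕ.^ 2)               ≤⟨ ℕ.^-monoˡ-≤ (3 ℕ.* d ℕ.^ 2) (n≤n! d) ⟩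
      (d !) ℕ.^ (3 ℕ.* d ℕ.^ 2)           ∎

  -- The bases are 65536 = 16⁴ and 60 · 625 = 30 · 2 · 5⁴, each times 4; their ratio is below 2. For
  -- d = 1 the factorial gives nothing, and 4 · 262144 ≤ 10 · 150000 is checked by evaluation.
  core : ∀ d → 1 ℕ.≤ d → let D = d ℕ.^ d in
    suc d ℕ.* suc d ℕ.* ((65536 ℕ.* 4) ℕ.^ d ℕ.* (D ℕ.* D ℕ.* (D ℕ.* D))) ℕ.≤ 10 ℕ.* ((60 ℕ.* (625 ℕ.* 4)) ℕ.^ d ℕ.* (d !) ℕ.^ (3 ℕ.* d ℕ.^ 2))
  core (suc zero)    _ = ℕ.≤ᵇ⇒≤ _ _ _
  core (suc (suc e)) _ = factorial-bound (65536 ℕ.* 4) (60 ℕ.* (625 ℕ.* 4)) (suc (suc e)) (ℕ.≤ᵇ⇒≤ _ _ _) (s≤s (s≤s z≤n))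

  -- A pair has two variables, the level estimate contributes d (d + 1) (2ρd²)^d, and falling back on all variables costs another factor ρ.
  certificateFactor : ℕ → ℕ → ℕ
  certificateFactor d ρ = 2 ℕ.* (d ℕ.* suc d) ℕ.* (2 ℕ.* ρ ℕ.* (d ℕ.* d)) ℕ.^ d ℕ.* ρ

  -- The proof compares both sides after dividing by ρ^(2d+2), using ρ ≥ 2 for the remaining powers of ρ.
  factor-bound : ∀ d ρ → 1 ℕ.≤ d → 2 ℕ.≤ ρ → let A = certificateFactor d ρ in
    16 ℕ.^ (4 ℕ.* d) ℕ.* (A ℕ.* A) ℕ.≤ 160 ℕ.* d ℕ.^ 2 ℕ.* 30 ℕ.^ d ℕ.* 2 ℕ.^ d ℕ.* (d !) ℕ.^ (3 ℕ.* d ℕ.^ 2) ℕ.* (5 ℕ.* ρ) ℕ.^ (4 ℕ.* d)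
  -- The factor 4 makes room for w² = 4v² with v = 2^(d - 1), so that the spare ρ²v² fits below
  -- ρ^(2d).
  factor-bound d@(suc e) ρ 1≤d 2≤ρ = ℕ.*-cancelˡ-≤ 4 (begin
    4 ℕ.* (16 ℕ.^ (4 ℕ.* d) ℕ.* (A ℕ.* A))
      ≡⟨ cong₂ (λ x y → 4 ℕ.* (x ℕ.* (2 ℕ.* (d ℕ.* suc d) ℕ.* y ℕ.* ρ ℕ.* (2 ℕ.* (d ℕ.* suc d) ℕ.* y ℕ.* ρ)))) (sym (ℕ.^-*-assoc 16 4 d)) powers ⟩
    4 ℕ.* (k ℕ.* (2 ℕ.* (d ℕ.* suc d) ℕ.* (w ℕ.* B ℕ.* (D ℕ.* D)) ℕ.* ρ ℕ.* (2 ℕ.* (d ℕ.* suc d) ℕ.* (w ℕ.* B ℕ.* (D ℕ.* D)) ℕ.* ρ)))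
      ≡⟨ e₁ k d (suc d) w B D ρ ⟩
    16 ℕ.* (d ℕ.* d) ℕ.* (B ℕ.* B ℕ.* (ρ ℕ.* ρ)) ℕ.* (suc d ℕ.* suc d ℕ.* (k ℕ.* (w ℕ.* w) ℕ.* (D ℕ.* D ℕ.* (D ℕ.* D))))
      ≤⟨ ℕ.*-monoʳ-≤ (16 ℕ.* (d ℕ.* d) ℕ.* (B ℕ.* B ℕ.* (ρ ℕ.* ρ))) core′ ⟩
    16 ℕ.* (d ℕ.* d) ℕ.* (B ℕ.* B ℕ.* (ρ ℕ.* ρ)) ℕ.* (10 ℕ.* (h ℕ.* w ℕ.* (g ℕ.* (w ℕ.* w)) ℕ.* F))
      ≡⟨ e₂ d B ρ h v g F w ⟩
    4 ℕ.* (160 ℕ.* (d ℕ.* d) ℕ.* h ℕ.* w ℕ.* F ℕ.* (g ℕ.* (B ℕ.* B ℕ.* (ρ ℕ.* v ℕ.* (ρ ℕ.* v)))))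
      ≤⟨ ℕ.*-monoʳ-≤ 4 (ℕ.*-monoʳ-≤ (160 ℕ.* (d ℕ.* d) ℕ.* h ℕ.* w ℕ.* F) (ℕ.*-monoʳ-≤ g (ℕ.*-monoʳ-≤ (B ℕ.* B) (ℕ.*-mono-≤ ρv ρv)))) ⟩
    4 ℕ.* (160 ℕ.* (d ℕ.* d) ℕ.* h ℕ.* w ℕ.* F ℕ.* (g ℕ.* (B ℕ.* B ℕ.* (B ℕ.* B))))
      ≡⟨ cong₂ (λ x y → 4 ℕ.* (160 ℕ.* (d ℕ.* x) ℕ.* h ℕ.* w ℕ.* F ℕ.* y)) (sym (ℕ.*-identityʳ d)) (sym powers′) ⟩
    4 ℕ.* (160 ℕ.* d ℕ.^ 2 ℕ.* h ℕ.* w ℕ.* F ℕ.* (5 ℕ.* ρ) ℕ.^ (4 ℕ.* d)) ∎)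
    where
    open ℕ.≤-Reasoning
    A = certificateFactor d ρ
    k = 65536 ℕ.^ d
    h = 30 ℕ.^ d
    g = 625 ℕ.^ d
    v = 2 ℕ.^ e
    w = 2 ℕ.^ d
    B = ρ ℕ.^ d
    D = d ℕ.^ d
    F = (d !) ℕ.^ (3 ℕ.* d ℕ.^ 2)
    ρv : ρ ℕ.* v ℕ.≤ B
    ρv = ℕ.*-monoʳ-≤ ρ (ℕ.^-monoˡ-≤ e 2≤ρ)
    powers : (2 ℕ.* ρ ℕ.* (d ℕ.* d)) ℕ.^ d ≡ w ℕ.* B ℕ.* (D ℕ.* D)
    powers = trans (^-distribʳ-* (2 ℕ.* ρ) (d ℕ.* d) d) (cong₂ ℕ._*_ (^-distribʳ-* 2 ρ d) (^-distribʳ-* d d d))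
    powers′ : (5 ℕ.* ρ) ℕ.^ (4 ℕ.* d) ≡ g ℕ.* (B ℕ.* B ℕ.* (B ℕ.* B))
    powers′ = trans (sym (ℕ.^-*-assoc (5 ℕ.* ρ) 4 d)) (trans (cong (ℕ._^ d) (fourth ρ))
      (trans (^-distribʳ-* 625 (ρ ℕ.* ρ ℕ.* (ρ ℕ.* ρ)) d) (cong (g ℕ.*_) (trans (^-distribʳ-* (ρ ℕ.* ρ) (ρ ℕ.* ρ) d) (cong₂ ℕ._*_ (^-distribʳ-* ρ ρ d) (^-distribʳ-* ρ ρ d))))))
      where
      fourth : ∀ ρ → 5 ℕ.* ρ ℕ.* (5 ℕ.* ρ ℕ.* (5 ℕ.* ρ ℕ.* (5 ℕ.* ρ ℕ.* 1))) ≡ 625 ℕ.* (ρ ℕ.* ρ ℕ.* (ρ ℕ.* ρ))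
      fourth = ℕ-Solver.solve-∀
    four : 4 ℕ.^ d ≡ w ℕ.* w
    four = ^-distribʳ-* 2 2 d
    core′ : suc d ℕ.* suc d ℕ.* (k ℕ.* (w ℕ.* w) ℕ.* (D ℕ.* D ℕ.* (D ℕ.* D))) ℕ.≤ 10 ℕ.* (h ℕ.* w ℕ.* (g ℕ.* (w ℕ.* w)) ℕ.* F)
    core′ = subst₂ (λ x y → suc d ℕ.* suc d ℕ.* (x ℕ.* (D ℕ.* D ℕ.* (D ℕ.* D))) ℕ.≤ 10 ℕ.* (y ℕ.* F))
      (trans (^-distribʳ-* 65536 4 d) (cong (k ℕ.*_) four))
      (trans (^-distribʳ-* 60 (625 ℕ.* 4) d) (cong₂ ℕ._*_ (^-distribʳ-* 30 2 d) (trans (^-distribʳ-* 625 4 d) (cong (g ℕ.*_) four)))) (core d 1≤d)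
    e₁ : ∀ k d s w B D ρ → 4 ℕ.* (k ℕ.* (2 ℕ.* (d ℕ.* s) ℕ.* (w ℕ.* B ℕ.* (D ℕ.* D)) ℕ.* ρ ℕ.* (2 ℕ.* (d ℕ.* s) ℕ.* (w ℕ.* B ℕ.* (D ℕ.* D)) ℕ.* ρ)))
      ≡ 16 ℕ.* (d ℕ.* d) ℕ.* (B ℕ.* B ℕ.* (ρ ℕ.* ρ)) ℕ.* (s ℕ.* s ℕ.* (k ℕ.* (w ℕ.* w) ℕ.* (D ℕ.* D ℕ.* (D ℕ.* D))))
    e₁ = ℕ-Solver.solve-∀
    e₂ : ∀ d B ρ h v g F w → 16 ℕ.* (d ℕ.* d) ℕ.* (B ℕ.* B ℕ.* (ρ ℕ.* ρ)) ℕ.* (10 ℕ.* (h ℕ.* w ℕ.* (g ℕ.* (2 ℕ.* v ℕ.* (2 ℕ.* v))) ℕ.* F))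
      ≡ 4 ℕ.* (160 ℕ.* (d ℕ.* d) ℕ.* h ℕ.* w ℕ.* F ℕ.* (g ℕ.* (B ℕ.* B ℕ.* (ρ ℕ.* v ℕ.* (ρ ℕ.* v)))))
    e₂ = ℕ-Solver.solve-∀

  -- The two ratios a and b are reciprocal, so a² + b² ≥ 2ab = 2.
  ratios : ∀ {q} → 0ℚ < q → q < 1ℚ → fromNat 2 ≤ ((1ℚ - q) * q ⁻¹) ^ 2 + (q * (1ℚ - q) ⁻¹) ^ 2
  ratios {q} 0<q q<1 = ≤-trans (≤-reflexive (trans (sym (+-identityˡ (fromNat 2))) (cong (λ x → 0ℚ + (1ℚ + 1ℚ) * x) (sym product))))
    (≤-trans (+-monoˡ-≤ ((1ℚ + 1ℚ) * (a * b)) (square-nonneg (a - b))) (≤-reflexive (lem a b)))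
    where
    a = (1ℚ - q) * q ⁻¹
    b = q * (1ℚ - q) ⁻¹
    0<1-q : 0ℚ < 1ℚ - q
    0<1-q = ≤-<-trans (≤-reflexive (sym (+-inverseʳ q))) (+-monoˡ-< (- q) q<1)
    product : a * b ≡ 1ℚ
    product = trans (swap (1ℚ - q) (q ⁻¹) q ((1ℚ - q) ⁻¹)) (trans (cong₂ _*_ (⁻¹-inverse q 0<q) (⁻¹-inverse (1ℚ - q) 0<1-q)) (*-identityˡ 1ℚ))
      where
      swap : ∀ w x y z → w * x * (y * z) ≡ y * x * (w * z)
      swap = solve-∀ ℚ-ring
    lem : ∀ a b → (a - b) * (a - b) + (1ℚ + 1ℚ) * (a * b) ≡ a * (a * 1ℚ) + b * (b * 1ℚ)
    lem = solve-∀ ℚ-ring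

  -- Since 5ρq ≤ 8, the last factor y = 1 / 2q of the constant satisfies 16 y ≥ 5ρ.
  factor≤C : ∀ d ρ {q} → 1 ℕ.≤ d → 2 ℕ.≤ ρ → 0ℚ < q → q < 1ℚ → fromNat (5 ℕ.* ρ) * q ≤ fromNat 8 →
    fromNat (certificateFactor d ρ ℕ.* certificateFactor d ρ) ≤ C d q
  factor≤C d ρ {q} 1≤d 2≤ρ 0<q q<1 5ρq≤8 = *-cancelˡ 0<16^ (begin
    fromNat (16 ℕ.^ (4 ℕ.* d)) * fromNat (A ℕ.* A)                  ≡⟨ sym (fromNat-* (16 ℕ.^ (4 ℕ.* d)) (A ℕ.* A)) ⟩
    fromNat (16 ℕ.^ (4 ℕ.* d) ℕ.* (A ℕ.* A))                        ≤⟨ fromNat-mono (factor-bound d ρ 1≤d 2≤ρ) ⟩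
    fromNat (X ℕ.* 2 ℕ.^ d ℕ.* F ℕ.* (5 ℕ.* ρ) ℕ.^ (4 ℕ.* d))         ≡⟨ expand ⟩
    fromNat X * fromNat 2 ^ d * fromNat F * fromNat (5 ℕ.* ρ) ^ (4 ℕ.* d)
      ≤⟨ *-mono (*-nonneg (*-nonneg (0≤fromNat X) (^-nonneg d (0≤fromNat 2))) (0≤fromNat F)) (^-nonneg (4 ℕ.* d) 0≤16y)
           (*-monoʳ-≤-nonNeg (fromNat F) ⦃ nonNegative (0≤fromNat F) ⦄
             (*-monoˡ-≤-nonNeg (fromNat X) ⦃ nonNegative (0≤fromNat X) ⦄ (^-mono d (0≤fromNat 2) (ratios 0<q q<1))))
           (^-mono (4 ℕ.* d) (0≤fromNat (5 ℕ.* ρ)) 5ρ≤16y) ⟩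
    fromNat X * E ^ d * fromNat F * (fromNat 16 * y) ^ (4 ℕ.* d)    ≡⟨ cong (fromNat X * E ^ d * fromNat F *_) (^-* (fromNat 16) y (4 ℕ.* d)) ⟩
    fromNat X * E ^ d * fromNat F * (fromNat 16 ^ (4 ℕ.* d) * y ^ (4 ℕ.* d)) ≡⟨ lem (fromNat X * E ^ d * fromNat F) (fromNat 16 ^ (4 ℕ.* d)) (y ^ (4 ℕ.* d)) ⟩
    fromNat 16 ^ (4 ℕ.* d) * C d q                                  ≡⟨ cong (_* C d q) (sym (fromNat-^ 16 (4 ℕ.* d))) ⟩
    fromNat (16 ℕ.^ (4 ℕ.* d)) * C d q                              ∎)
    where
    open ≤-Reasoning
    A = certificateFactor d ρ
    X = 160 ℕ.* d ℕ.^ 2 ℕ.* 30 ℕ.^ d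
    F = (d !) ℕ.^ (3 ℕ.* d ℕ.^ 2)
    E = ((1ℚ - q) * q ⁻¹) ^ 2 + (q * (1ℚ - q) ⁻¹) ^ 2
    y = (fromNat 2 * q) ⁻¹
    lem : ∀ a b c → a * (b * c) ≡ b * (a * c)
    lem = solve-∀ ℚ-ring
    0<16^ : 0ℚ < fromNat (16 ℕ.^ (4 ℕ.* d))
    0<16^ = <-≤-trans (positive⁻¹ 1ℚ) (fromNat-mono {1} (ℕ.>-nonZero⁻¹ (16 ℕ.^ (4 ℕ.* d)) ⦃ ℕ.m^n≢0 16 (4 ℕ.* d) ⦄))
    expand : fromNat (X ℕ.* 2 ℕ.^ d ℕ.* F ℕ.* (5 ℕ.* ρ) ℕ.^ (4 ℕ.* d)) ≡ fromNat X * fromNat 2 ^ d * fromNat F * fromNat (5 ℕ.* ρ) ^ (4 ℕ.* d)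
    expand = trans (fromNat-* (X ℕ.* 2 ℕ.^ d ℕ.* F) ((5 ℕ.* ρ) ℕ.^ (4 ℕ.* d))) (cong₂ _*_
      (trans (fromNat-* (X ℕ.* 2 ℕ.^ d) F) (cong (_* fromNat F) (trans (fromNat-* X (2 ℕ.^ d)) (cong (fromNat X *_) (fromNat-^ 2 d)))))
      (fromNat-^ (5 ℕ.* ρ) (4 ℕ.* d)))
    0<2q : 0ℚ < fromNat 2 * q
    0<2q = ≤-<-trans (≤-reflexive (sym (*-zeroʳ (fromNat 2)))) (*-monoʳ-<-pos (fromNat 2) 0<q)
    y-inverse : fromNat 2 * q * y ≡ 1ℚ
    y-inverse = ⁻¹-inverse (fromNat 2 * q) 0<2q
    0≤y : 0ℚ ≤ y
    0≤y = *-cancelˡ 0<2q (≤-trans (≤-reflexive (*-zeroʳ (fromNat 2 * q))) (≤-trans (0≤fromNat 1) (≤-reflexive (sym y-inverse))))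
    5ρ≤16y : fromNat (5 ℕ.* ρ) ≤ fromNat 16 * y
    5ρ≤16y = begin
      fromNat (5 ℕ.* ρ)                          ≡⟨ sym (*-identityʳ (fromNat (5 ℕ.* ρ))) ⟩
      fromNat (5 ℕ.* ρ) * 1ℚ                     ≡⟨ cong (fromNat (5 ℕ.* ρ) *_) (sym y-inverse) ⟩
      fromNat (5 ℕ.* ρ) * (fromNat 2 * q * y)    ≡⟨ lem′ (fromNat (5 ℕ.* ρ)) (fromNat 2) q y ⟩
      fromNat 2 * (fromNat (5 ℕ.* ρ) * q * y)    ≤⟨ *-monoˡ-≤-nonNeg (fromNat 2) (*-monoʳ-≤-nonNeg y ⦃ nonNegative 0≤y ⦄ 5ρq≤8) ⟩
      fromNat 2 * (fromNat 8 * y)                ≡⟨ sym (*-assoc (fromNat 2) (fromNat 8) y) ⟩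
      fromNat 2 * fromNat 8 * y                  ≡⟨ cong (_* y) (sym (fromNat-* 2 8)) ⟩
      fromNat 16 * y                             ∎
      where
      lem′ : ∀ a t q y → a * (t * q * y) ≡ t * (a * q * y)
      lem′ = solve-∀ ℚ-ring
    0≤16y : 0ℚ ≤ fromNat 16 * y
    0≤16y = *-nonneg (0≤fromNat 16) 0≤y

-- OPT and AVG in terms of the points with exactly k entries ⊖.

module Average where
  open Rationals
  open Consts
  open Values using (#⊖; ∈-vectors)
  open Sums
  open Levels
  open Gain
  open import Defs
  open import Data.Integer.Base as ℤ using (ℤ; +_)
  import Data.Integer.Properties as ℤ
  open import Data.List.Base using ([]; _∷_; map; filter; length)
  open import Data.List.Extrema.Nat using (xs≤max)
  open import Data.List.Membership.Propositional using (_∈_)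
  open import Data.List.Membership.Propositional.Properties using (∈-filter⁺; ∈-map⁺)
  open import Data.List.Properties using (length-map)
  open import Data.List.Relation.Unary.All as All using (All)
  open import Data.Nat.Base as ℕ using (ℕ; suc)
  import Data.Nat.Properties as ℕ
  open import Data.Rational.Base hiding (floor; ceiling)
  open import Data.Rational.Properties
  open import Data.Sign.Base using () renaming (+ to ⊕; - to ⊖)
  open import Data.Vec.Base using ([]; _∷_)
  open import Relation.Binary.PropositionalEquality using (_≡_; refl; sym; trans; cong; cong₂)
  open import Relation.Nullary.Decidable.Core using (yes; no)
  open import Relation.Nullary.Negation.Core using (¬_; contradiction)
  open import Relation.Unary using (Pred; Decidable)
  open import Tactic.RingSolver using (solve-∀)
  open import Level using (0ℓ)

  total-signs : ∀ {n} (α : Assignment n) → total α ≡ fromNat n - fromNat 2 * fromNat (#⊖ α)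
  total-signs []      = refl
  total-signs {suc n} (⊖ ∷ α) = trans (cong (λ x → - 1ℚ + x) (total-signs α)) (trans (lem (fromNat n) (fromNat (#⊖ α)))
    (sym (cong₂ (λ x y → x - (1ℚ + 1ℚ) * y) (fromNat-suc n) (fromNat-suc (#⊖ α)))))
    where
    lem : ∀ n k → - 1ℚ + (n - (1ℚ + 1ℚ) * k) ≡ 1ℚ + n - (1ℚ + 1ℚ) * (1ℚ + k)
    lem = solve-∀ ℚ-ring
  total-signs {suc n} (⊕ ∷ α) = trans (cong (λ x → 1ℚ + x) (total-signs α)) (trans (lem (fromNat n) (fromNat 2 * fromNat (#⊖ α)))
    (cong (_- fromNat 2 * fromNat (#⊖ α)) (sym (fromNat-suc n))))
    where
    lem : ∀ n k → 1ℚ + (n - k) ≡ 1ℚ + n - k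
    lem = solve-∀ ℚ-ring

  fromNat-injective : ∀ {m n} → fromNat m ≡ fromNat n → m ≡ n
  fromNat-injective e = ℤ.+-injective (fromℤ-injective e)

  module _ {A : Set} {P : Pred A 0ℓ} (P? : Decidable P) (χ : A → ℕ) (one : ∀ {x} → P x → χ x ≡ 1) (none : ∀ {x} → ¬ P x → χ x ≡ 0) where

    length-filter-∑ : ∀ xs → length (filter P? xs) ≡ ℕΣ.∑ xs χ
    length-filter-∑ []       = refl
    length-filter-∑ (x ∷ xs) with P? x
    ... | yes px = trans (cong suc (length-filter-∑ xs)) (cong (ℕ._+ ℕΣ.∑ xs χ) (sym (one px)))
    ... | no ¬px = trans (length-filter-∑ xs) (cong (ℕ._+ ℕΣ.∑ xs χ) (sym (none ¬px)))

    sum-filter-∑ : ∀ (h : A → ℕ) xs → sumℚ (map (λ x → fromNat (h x)) (filter P? xs)) ≡ fromNat (ℕΣ.∑ xs (λ x → χ x ℕ.* h x))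
    sum-filter-∑ h []       = refl
    sum-filter-∑ h (x ∷ xs) with P? x
    ... | yes px = trans (cong (λ s → fromNat (h x) + s) (sum-filter-∑ h xs)) (trans (sym (fromNat-+ (h x) _))
                     (cong (λ c → fromNat (c ℕ.+ ℕΣ.∑ xs (λ x → χ x ℕ.* h x))) (sym (trans (cong (ℕ._* h x) (one px)) (ℕ.+-identityʳ (h x))))))
    ... | no ¬px = trans (sum-filter-∑ h xs) (cong (λ c → fromNat (c ℕ.* h x ℕ.+ ℕΣ.∑ xs (λ x → χ x ℕ.* h x))) (sym (none ¬px)))

  module _ {d n} (I : CSP d n) (p : ℚ) (k : ℕ) (k≡pn : fromNat k ≡ p * fromNat n) where
    open Slice {n} k

    level-total : (1ℚ - fromNat 2 * p) * fromNat n ≡ fromNat n - fromNat 2 * fromNat k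
    level-total = trans (lem (fromNat 2) p (fromNat n)) (cong (λ x → fromNat n - fromNat 2 * x) (sym k≡pn))
      where
      lem : ∀ t p n → (1ℚ - t * p) * n ≡ n - t * (p * n)
      lem = solve-∀ ℚ-ring

    inSlice? : Decidable (InSlice {n} p)
    inSlice? α = total α ≟ (1ℚ - fromNat 2 * p) * fromNat n

    inSlice⁺ : ∀ (α : Assignment n) → #⊖ α ≡ k → InSlice p α
    inSlice⁺ α refl = trans (total-signs α) (sym level-total)

    inSlice⁻ : ∀ (α : Assignment n) → InSlice p α → #⊖ α ≡ k
    inSlice⁻ α e = fromNat-injective (trans (lem (fromNat n) (fromNat (#⊖ α))) (trans (cong (λ x → ½ * (fromNat n - x))
      (trans (sym (total-signs α)) (trans e level-total))) (sym (lem (fromNat n) (fromNat k)))))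
      where
      lem′ : ∀ h n x t → h * (n - (n - t * x)) ≡ h * t * x
      lem′ = solve-∀ ℚ-ring
      lem : ∀ n x → x ≡ ½ * (n - (n - fromNat 2 * x))
      lem n x = sym (trans (lem′ ½ n x (fromNat 2)) (*-identityˡ x))

    χ-outside : ∀ {α : Assignment n} → ¬ InSlice p α → χ α ≡ 0
    χ-outside {α} ∉slice with χ α ℕ.≟ 0
    ... | yes e = e
    ... | no  e = contradiction (inSlice⁺ α (χ-≢0 α e)) ∉slice

    slice-length : length (slice n p) ≡ σ
    slice-length = length-filter-∑ inSlice? χ (λ {α} e → χ-slice α (inSlice⁻ α e)) (λ {α} → χ-outside {α}) (vectors signs n)

    slice-sum : sumℚ (map (λ α → fromNat (val I α)) (slice n p)) ≡ fromNat (Sumᴺ (λ α → χ α ℕ.* val I α))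
    slice-sum = sum-filter-∑ inSlice? χ (λ {α} e → χ-slice α (inSlice⁻ α e)) (λ {α} → χ-outside {α}) (val I) (vectors signs n)

    ∈-slice : ∀ (α : Assignment n) → #⊖ α ≡ k → α ∈ slice n p
    ∈-slice α e = ∈-filter⁺ inSlice? (∈-vectors α) (inSlice⁺ α e)

    val≤OPT : ∀ α → #⊖ α ≡ k → val I α ℕ.≤ OPT I p
    val≤OPT α e = All.lookup (xs≤max 0 (map (val I) (slice n p))) (∈-map⁺ (val I) (∈-slice α e))

    average-bound : ∀ t → 0 ℕ.< σ → fromNat (Sumᴺ (λ α → χ α ℕ.* val I α)) + fromNat (σ) * t ≤ fromNat (OPT I p ℕ.* σ) →
      AVG I p + t ≤ fromNat (OPT I p)
    average-bound t 0<σ h = *-cancelˡ 0<fσ (≤-trans (≤-reflexive expand) (≤-trans h (≤-reflexive (trans (fromNat-* (OPT I p) σ) (*-comm (fromNat (OPT I p)) (fromNat σ))))))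
      where
      V = Sumᴺ (λ α → χ α ℕ.* val I α)
      0<fσ : 0ℚ < fromNat σ
      0<fσ = <-≤-trans (positive⁻¹ 1ℚ) (fromNat-mono {1} {σ} 0<σ)
      avg : AVG I p ≡ fromNat V * fromNat σ ⁻¹
      avg = cong₂ (λ x m → x * fromNat m ⁻¹) slice-sum (trans (length-map _ (slice n p)) slice-length)
      lem : ∀ s v i t → s * (v * i + t) ≡ v * (s * i) + s * t
      lem = solve-∀ ℚ-ring
      expand : fromNat σ * (AVG I p + t) ≡ fromNat V + fromNat σ * t
      expand = trans (cong (λ a → fromNat σ * (a + t)) avg) (trans (lem (fromNat σ) (fromNat V) (fromNat σ ⁻¹) t)
        (cong (_+ fromNat σ * t) (trans (cong (fromNat V *_) (⁻¹-inverse (fromNat σ) 0<fσ)) (*-identityʳ (fromNat V)))))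

-- Correctness of both answers.

module Main where
  open Rationals
  open Consts
  open Constant
  open Average
  open Values using (#⊖; #⊕; length-idxs; ∈-vectors)
  open Sums
  open Swaps using (#⊖+#⊕)
  open Levels
  open Differences
  open Certificate
  open Gain
  open Algorithm using (base; choose; certifies; algorithm; mask)
  open Hitting using (H; matched; val-deg)
  open Kernel
  open import Defs hiding (if_then_else_)
  open import Data.Bool.Base using (Bool; true; false; T; if_then_else_)
  open import Data.Fin.Base as Fin using (Fin; zero; suc; toℕ)
  open import Data.Fin.Subset using (∣_∣)
  open import Data.Integer.Base as ℤ using (ℤ; +_; -[1+_])
  import Data.Integer.Properties as ℤ
  open import Data.List.Base using (List; length)
  open import Data.List.Membership.Propositional using (_∈_)
  open import Data.List.Relation.Unary.Any using (here; there)
  open import Data.Nat.Base as ℕ using (ℕ; zero; suc; s≤s; z≤n)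
  import Data.Nat.Properties as ℕ
  import Data.Nat.Tactic.RingSolver as ℕ-Solver
  open import Data.Product.Base using (_,_; proj₁; proj₂; ∃-syntax)
  open import Data.Rational.Base hiding (floor; ceiling; ∣_∣)
  open import Data.Rational.Properties
  open import Data.Sign.Base using () renaming (+ to ⊕; - to ⊖)
  open import Data.Sum.Base using (inj₁; inj₂)
  open import Data.Vec.Base using (tabulate)
  open import Function.Base using (_∘_)
  open import Relation.Binary.PropositionalEquality using (_≡_; refl; sym; trans; cong; subst; module ≡-Reasoning)
  open import Relation.Nullary.Negation.Core using (contradiction)
  open import Tactic.RingSolver using (solve-∀)

  T-injective : ∀ {a b} → (T a → T b) → (T b → T a) → a ≡ b
  T-injective {true}  {true}  f g = refl
  T-injective {false} {false} f g = refl
  T-injective {true}  {false} f g with () ← f _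
  T-injective {false} {true}  f g with () ← g _

  #⊖-initial : ∀ n k → k ℕ.≤ n → (φ : Fin n → Bool) → (∀ i → φ i ≡ (toℕ i ℕ.<ᵇ k)) → #⊖ (tabulate (λ i → if φ i then ⊖ else ⊕)) ≡ k
  #⊖-initial zero    zero    _         φ e = refl
  #⊖-initial (suc n) zero    _         φ e rewrite e zero = #⊖-initial n zero z≤n (φ ∘ suc) (e ∘ suc)
  #⊖-initial (suc n) (suc k) (s≤s k≤n) φ e rewrite e zero = cong suc (#⊖-initial n k k≤n (φ ∘ suc) (e ∘ suc))

  -- As n u = k v, the condition (i + 1) v ≤ n u says that i < k.
  #⊖-base : ∀ {n u v k} → k ℕ.≤ n → 0 ℕ.< v → n ℕ.* u ≡ k ℕ.* v → #⊖ (base n u v) ≡ k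
  #⊖-base {n} {u} {v@(suc _)} {k} k≤n _ nu≡kv = #⊖-initial n k k≤n _ λ i → T-injective
    (λ h → ℕ.≤⇒≤ᵇ (ℕ.*-cancelʳ-≤ (suc (toℕ i)) k v (ℕ.≤-trans (ℕ.≤ᵇ⇒≤ _ _ h) (ℕ.≤-reflexive nu≡kv))))
    (λ h → ℕ.≤⇒≤ᵇ (ℕ.≤-trans (ℕ.*-monoˡ-≤ v (ℕ.≤ᵇ⇒≤ (suc (toℕ i)) k h)) (ℕ.≤-reflexive (sym nu≡kv))))

  -- One factor n is at most ρ times the smaller of k and l, the other at most twice the larger.
  balance : ∀ {n k l ρ} → k ℕ.+ l ≡ n → n ℕ.≤ ρ ℕ.* k → n ℕ.≤ ρ ℕ.* l → n ℕ.* n ℕ.≤ 2 ℕ.* ρ ℕ.* (k ℕ.* l)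
  balance {n} {k} {l} {ρ} refl ≤k ≤l with ℕ.≤-total k l
  ... | inj₁ k≤l = ℕ.≤-trans (ℕ.*-mono-≤ ≤k (ℕ.+-monoˡ-≤ l k≤l)) (ℕ.≤-reflexive (lem ρ k l))
    where
    lem : ∀ ρ k l → ρ ℕ.* k ℕ.* (l ℕ.+ l) ≡ 2 ℕ.* ρ ℕ.* (k ℕ.* l)
    lem = ℕ-Solver.solve-∀
  ... | inj₂ l≤k = ℕ.≤-trans (ℕ.*-mono-≤ ≤l (ℕ.+-monoʳ-≤ k l≤k)) (ℕ.≤-reflexive (lem ρ k l))
    where
    lem : ∀ ρ k l → ρ ℕ.* l ℕ.* (k ℕ.+ k) ≡ 2 ℕ.* ρ ℕ.* (k ℕ.* l)
    lem = ℕ-Solver.solve-∀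

  scaled : ∀ t A → fromNat (↧ₙ t) * (fromNat A * t) ≡ fromNat A * fromℤ (↥ t)
  scaled t A = trans (lem (fromNat (↧ₙ t)) (fromNat A) t) (cong (fromNat A *_) (*-denominator t))
    where
    lem : ∀ v a t → v * (a * t) ≡ a * (t * v)
    lem = solve-∀ ℚ-ring

  0<denominator : ∀ t → 0ℚ < fromNat (↧ₙ t)
  0<denominator t = <-≤-trans (positive⁻¹ 1ℚ) (fromNat-mono {1} {↧ₙ t} (s≤s z≤n))

  certifies-true : ∀ t m A → certifies t m A ≡ true → fromNat A * t ≤ fromNat m
  certifies-true t m A c = *-cancelˡ (0<denominator t) (≤-trans (≤-reflexive (scaled t A)) (≤-trans (compare c) (≤-reflexive
    (trans (cong fromNat (ℕ.*-comm m (↧ₙ t))) (fromNat-* (↧ₙ t) m)))))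
    where
    compare : certifies t m A ≡ true → fromNat A * fromℤ (↥ t) ≤ fromNat (m ℕ.* ↧ₙ t)
    compare c with ↥ t
    ... | + u      = ≤-trans (≤-reflexive (sym (fromNat-* A u))) (fromNat-mono {A ℕ.* u} {m ℕ.* ↧ₙ t} (ℕ.≤ᵇ⇒≤ (A ℕ.* u) (m ℕ.* ↧ₙ t) (subst T (sym c) _)))
    ... | -[1+ u ] = ≤-trans (*-monoˡ-≤-nonNeg (fromNat A) ⦃ nonNegative (0≤fromNat A) ⦄ (fromℤ-mono { -[1+ u ]} {+ 0} ℤ.-≤+))
                       (≤-trans (≤-reflexive (*-zeroʳ (fromNat A))) (0≤fromNat (m ℕ.* ↧ₙ t)))

  certifies-false : ∀ t m A → certifies t m A ≡ false → fromNat m ≤ fromNat A * t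
  certifies-false t m A c = *-cancelˡ (0<denominator t) (≤-trans (≤-reflexive (sym (trans (cong fromNat (ℕ.*-comm m (↧ₙ t))) (fromNat-* (↧ₙ t) m))))
    (≤-trans (compare c) (≤-reflexive (sym (scaled t A)))))
    where
    compare : certifies t m A ≡ false → fromNat (m ℕ.* ↧ₙ t) ≤ fromNat A * fromℤ (↥ t)
    compare c with ↥ t
    ... | + u = ≤-trans (fromNat-mono {m ℕ.* ↧ₙ t} {A ℕ.* u} (ℕ.<⇒≤ (ℕ.≰⇒> λ le → subst T c (ℕ.≤⇒≤ᵇ le)))) (≤-reflexive (fromNat-* A u))

  module _ {d n} (1≤d : 1 ℕ.≤ d) (I : CSP d n) (p : ℚ) (ρ k l : ℕ) (2≤ρ : 2 ℕ.≤ ρ) (k+l≡n : k ℕ.+ l ≡ n)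
           (k≡pn : fromNat k ≡ p * fromNat n) (n≤ρk : n ℕ.≤ ρ ℕ.* k) (n≤ρl : n ℕ.≤ ρ ℕ.* l) (β : Assignment n) (β∈ : #⊖ β ≡ k) where
    open Slice {n} k using (σ; χ; χ-slice)

    private
      1≤ρ : 1 ℕ.≤ ρ
      1≤ρ = ℕ.≤-trans (s≤s z≤n) 2≤ρ
      A = certificateFactor d ρ
      H₂ : List (Fin n)
      H₂ = choose β (H I β)
      m = length H₂
      #⊕β : #⊕ β ≡ l
      #⊕β = ℕ.+-cancelˡ-≡ k _ _ (trans (cong (ℕ._+ #⊕ β) (sym β∈)) (trans (#⊖+#⊕ β) (sym k+l≡n)))
      balanced : n ℕ.* n ℕ.≤ 2 ℕ.* ρ ℕ.* (k ℕ.* (n ℕ.∸ k))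
      balanced = subst (λ x → n ℕ.* n ℕ.≤ 2 ℕ.* ρ ℕ.* (k ℕ.* x)) (sym (trans (cong (ℕ._∸ k) (sym k+l≡n)) (ℕ.m+n∸m≡n k l))) (balance {n} {k} {l} {ρ} k+l≡n n≤ρk n≤ρl)
      gap average : ℕ
      gap     = Gap k d ρ (OPT I p) (val I) (val-deg I) (val≤OPT I p k k≡pn) balanced 1≤d 1≤ρ
      average = V k d ρ (OPT I p) (val I) (val-deg I) (val≤OPT I p k k≡pn) balanced 1≤d 1≤ρ
      average≤ : average ℕ.≤ OPT I p ℕ.* σ
      average≤ = V≤Mσ k d ρ (OPT I p) (val I) (val-deg I) (val≤OPT I p k k≡pn) balanced 1≤d 1≤ρ

    -- All n variables are taken only if #⊕ β < |H|, and n ≤ ρ l with l = #⊕ β, so the fallback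
    -- enlarges the set by at most the factor ρ.
    length-choose : m ℕ.≤ ρ ℕ.* length (H I β)
    length-choose with #⊕ β ℕ.<ᵇ length (H I β) in e
    ... | true  = ℕ.≤-trans (ℕ.≤-reflexive (length-idxs n)) (ℕ.≤-trans n≤ρl (ℕ.*-monoʳ-≤ ρ
                    (ℕ.≤-trans (ℕ.≤-reflexive (sym #⊕β)) (ℕ.<⇒≤ (ℕ.<ᵇ⇒< _ _ (subst T (sym e) _))))))
    ... | false = ℕ.≤-trans (ℕ.≤-reflexive (sym (ℕ.*-identityˡ _))) (ℕ.*-monoˡ-≤ (length (H I β)) 1≤ρ)

    gap-bound : m ℕ.* σ ℕ.≤ A ℕ.* gap
    gap-bound = let P , H≡ , u , distinct = matched I β in begin
      m ℕ.* σ                                    ≤⟨ ℕ.*-monoˡ-≤ σ length-choose ⟩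
      ρ ℕ.* length (H I β) ℕ.* σ                 ≡⟨ cong (λ x → ρ ℕ.* x ℕ.* σ) (trans (cong length H≡) (length-pts P)) ⟩
      ρ ℕ.* (length P ℕ.+ length P) ℕ.* σ               ≡⟨ lem₁ ρ (length P) σ ⟩
      ρ ℕ.* 2 ℕ.* (length P ℕ.* σ)
        ≤⟨ ℕ.*-monoʳ-≤ (ρ ℕ.* 2) (pairs-bound k d ρ (OPT I p) (val I) (val-deg I) (val≤OPT I p k k≡pn) balanced 1≤d 1≤ρ P u
             λ ab∈ → let y , y∈ , v≢ = distinct ab∈ in y , trans y∈ β∈ , v≢) ⟩
      ρ ℕ.* 2 ℕ.* (d ℕ.* suc d ℕ.* ((2 ℕ.* ρ ℕ.* (d ℕ.* d)) ℕ.^ d ℕ.* gap)) ≡⟨ lem₂ ρ (d ℕ.* suc d) ((2 ℕ.* ρ ℕ.* (d ℕ.* d)) ℕ.^ d) gap ⟩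
      A ℕ.* gap                                  ∎
      where
      open ℕ.≤-Reasoning
      lem₁ : ∀ r x s → r ℕ.* (x ℕ.+ x) ℕ.* s ≡ r ℕ.* 2 ℕ.* (x ℕ.* s)
      lem₁ = ℕ-Solver.solve-∀
      lem₂ : ∀ r x y g → r ℕ.* 2 ℕ.* (x ℕ.* (y ℕ.* g)) ≡ 2 ℕ.* x ℕ.* y ℕ.* r ℕ.* g
      lem₂ = ℕ-Solver.solve-∀

    0<A : 0 ℕ.< A
    0<A = ℕ.*-mono-≤ {1} {_} {1} {ρ} (ℕ.*-mono-≤ {1} {2 ℕ.* (d ℕ.* suc d)} {1} (ℕ.*-mono-≤ {1} {2} (s≤s z≤n) (ℕ.*-mono-≤ {1} {d} {1} 1≤d (s≤s z≤n)))
      (ℕ.≤-trans (ℕ.≤-reflexive (sym (ℕ.^-zeroˡ d))) (ℕ.^-monoˡ-≤ d (ℕ.*-mono-≤ {1} {2 ℕ.* ρ} {1} (ℕ.*-mono-≤ {1} {2} {1} (s≤s z≤n) 1≤ρ) (ℕ.*-mono-≤ {1} {d} {1} 1≤d 1≤d))))) 1≤ρ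

    0<σ : 0 ℕ.< σ
    0<σ = ℕ.≤-trans (ℕ.≤-reflexive (sym (χ-slice β β∈))) (∑-member (∈-vectors β))
      where
      ∑-member : ∀ {xs} → β ∈ xs → χ β ℕ.≤ ℕΣ.∑ xs χ
      ∑-member (here refl)            = ℕ.m≤m+n _ _
      ∑-member (there {x = x} β∈xs) = ℕ.≤-trans (∑-member β∈xs) (ℕ.m≤n+m _ (χ x))

    -- A t ≤ m and m σ ≤ A Gap give σ t ≤ Gap, which is the claim multiplied by σ.
    certified : ∀ t → fromNat A * t ≤ fromNat m → AVG I p + t ≤ fromNat (OPT I p)
    certified t At≤m = average-bound I p k k≡pn t 0<σ (≤-trans (+-monoʳ-≤ (fromNat average) σt≤gap)
      (≤-reflexive (trans (sym (fromNat-+ average gap)) (cong fromNat (ℕ.m+[n∸m]≡n average≤)))))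
      where
      swap-factors : ∀ a s t → a * (s * t) ≡ s * (a * t)
      swap-factors = solve-∀ ℚ-ring
      σt≤gap : fromNat σ * t ≤ fromNat gap
      σt≤gap = *-cancelˡ (<-≤-trans (positive⁻¹ 1ℚ) (fromNat-mono {1} {A} 0<A)) (begin
        fromNat A * (fromNat σ * t)   ≡⟨ swap-factors (fromNat A) (fromNat σ) t ⟩
        fromNat σ * (fromNat A * t)   ≤⟨ *-monoˡ-≤-nonNeg (fromNat σ) ⦃ nonNegative (0≤fromNat σ) ⦄ At≤m ⟩
        fromNat σ * fromNat m         ≡⟨ trans (sym (fromNat-* σ m)) (cong fromNat (ℕ.*-comm σ m)) ⟩
        fromNat (m ℕ.* σ)             ≤⟨ fromNat-mono gap-bound ⟩
        fromNat (A ℕ.* gap)           ≡⟨ fromNat-* A gap ⟩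
        fromNat A * fromNat gap       ∎)
        where open ≤-Reasoning

    kernel-small : ∀ t {q} → 0ℚ < q → q < 1ℚ → fromNat (5 ℕ.* ρ) * q ≤ fromNat 8 → fromNat m ≤ fromNat A * t →
      fromNat ∣ mask H₂ ∣ ≤ C d q * t ^ 2
    kernel-small t {q} 0<q q<1 5ρq≤8 m≤At = begin
      fromNat ∣ mask H₂ ∣                 ≤⟨ fromNat-mono (kernel-size I β H₂) ⟩
      fromNat m                           ≤⟨ fromNat-mono (m≤m² m) ⟩
      fromNat (m ℕ.* m)                   ≡⟨ fromNat-* m m ⟩
      fromNat m * fromNat m               ≤⟨ *-mono (0≤fromNat m) (≤-trans (0≤fromNat m) m≤At) m≤At m≤At ⟩
      fromNat A * t * (fromNat A * t)     ≡⟨ lem (fromNat A) t ⟩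
      fromNat A * fromNat A * t ^ 2       ≡⟨ cong (_* t ^ 2) (sym (fromNat-* A A)) ⟩
      fromNat (A ℕ.* A) * t ^ 2           ≤⟨ *-monoʳ-≤-nonNeg (t ^ 2) ⦃ nonNegative 0≤t² ⦄ (factor≤C d ρ 1≤d 2≤ρ 0<q q<1 5ρq≤8) ⟩
      C d q * t ^ 2                       ∎
      where
      open ≤-Reasoning
      m≤m² : ∀ m → m ℕ.≤ m ℕ.* m
      m≤m² zero      = z≤n
      m≤m² m@(suc _) = ℕ.m≤m*n m m
      lem : ∀ a t → a * t * (a * t) ≡ a * a * (t * (t * 1ℚ))
      lem = solve-∀ ℚ-ring
      0≤t² : 0ℚ ≤ t ^ 2
      0≤t² = ≤-trans (square-nonneg t) (≤-reflexive (cong (t *_) (sym (*-identityʳ t))))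

    kernel-correct : IsKernel I p (mask H₂) (kernelPoly I β H₂)
    kernel-correct = record
      { degree≤d = kernel-degree I β H₂
      ; varsIn   = kernel-vars I β H₂
      ; agrees   = λ α α∈ → kernel-agrees I β α (trans (inSlice⁻ I p k k≡pn α α∈) (sym β∈))
      }

  fromNat-cancel : ∀ {m n} → fromNat m ≤ fromNat n → m ℕ.≤ n
  fromNat-cancel le = ℤ.drop‿+≤+ (fromℤ-cancel le)

  record Split (n : ℕ) (p : ℚ) (ρ : ℕ) : Set where
    field
      {k l} : ℕ
      k+l≡n : k ℕ.+ l ≡ n
      k≡pn  : fromNat k ≡ p * fromNat n
      n≤ρk  : n ℕ.≤ ρ ℕ.* k
      n≤ρl  : n ℕ.≤ ρ ℕ.* l

  split : ∀ n p ρ → 0ℚ < p → 1 ℕ.≤ ρ → 1ℚ ≤ fromNat ρ * p → 1ℚ ≤ fromNat ρ * (1ℚ - p) → ∃[ i ] (p * fromNat n ≡ i / 1) → Split n p ρ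
  split n p ρ 0<p 1≤ρ 1≤ρp 1≤ρ[1-p] (-[1+ i ] , pn≡) =
    contradiction (fromℤ-cancel {+ 0} { -[1+ i ]} (≤-trans (*-nonneg (<⇒≤ 0<p) (0≤fromNat n)) (≤-reflexive pn≡))) λ ()
  split n p ρ 0<p 1≤ρ 1≤ρp 1≤ρ[1-p] (+ k , pn≡) = record
    { k     = k
    ; l     = n ℕ.∸ k
    ; k+l≡n = ℕ.m+[n∸m]≡n (ℕ.*-cancelˡ-≤ ρ ⦃ ℕ.>-nonZero 1≤ρ ⦄ (ℕ.≤-trans (ℕ.m≤n+m (ρ ℕ.* k) n) n+ρk≤ρn))
    ; k≡pn  = sym pn≡
    ; n≤ρk  = fromNat-cancel (≤-trans (scale 1≤ρp) (≤-reflexive (trans (*-assoc (fromNat ρ) p (fromNat n)) (trans (cong (fromNat ρ *_) pn≡) (sym (fromNat-* ρ k))))))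
    ; n≤ρl  = ℕ.≤-trans (ℕ.m+n≤o⇒m≤o∸n n n+ρk≤ρn) (ℕ.≤-reflexive (sym (ℕ.*-distribˡ-∸ ρ n k)))
    }
    where
    scale : ∀ {x} → 1ℚ ≤ x → fromNat n ≤ x * fromNat n
    scale {x} 1≤x = ≤-trans (≤-reflexive (sym (*-identityˡ (fromNat n)))) (*-monoʳ-≤-nonNeg (fromNat n) ⦃ nonNegative (0≤fromNat n) ⦄ 1≤x)
    lem : ∀ r p n → r * (1ℚ - p) * n + r * (p * n) ≡ r * n
    lem = solve-∀ ℚ-ring
    n+ρk≤ρn : n ℕ.+ ρ ℕ.* k ℕ.≤ ρ ℕ.* n
    n+ρk≤ρn = fromNat-cancel (begin
      fromNat (n ℕ.+ ρ ℕ.* k)                                                  ≡⟨ trans (fromNat-+ n (ρ ℕ.* k)) (cong (λ x → fromNat n + x) (fromNat-* ρ k)) ⟩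
      fromNat n + fromNat ρ * fromNat k                                        ≤⟨ +-monoˡ-≤ (fromNat ρ * fromNat k) (scale 1≤ρ[1-p]) ⟩
      fromNat ρ * (1ℚ - p) * fromNat n + fromNat ρ * fromNat k                 ≡⟨ cong (λ x → fromNat ρ * (1ℚ - p) * fromNat n + fromNat ρ * x) (sym pn≡) ⟩
      fromNat ρ * (1ℚ - p) * fromNat n + fromNat ρ * (p * fromNat n)           ≡⟨ lem (fromNat ρ) p (fromNat n) ⟩
      fromNat ρ * fromNat n                                                    ≡⟨ sym (fromNat-* ρ n) ⟩
      fromNat (ρ ℕ.* n)                                                        ∎)
      where open ≤-Reasoning

  base-in-slice : ∀ {n p u k l} → k ℕ.+ l ≡ n → fromNat k ≡ p * fromNat n → ↥ p ≡ + u → #⊖ (base n u (↧ₙ p)) ≡ k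
  base-in-slice {n} {p} {u} {k} {l} refl k≡pn p≡ = #⊖-base (ℕ.m≤m+n k l) (s≤s z≤n) (fromNat-injective (begin
    fromNat (n ℕ.* u)                       ≡⟨ fromNat-* n u ⟩
    fromNat n * fromNat u                   ≡⟨ cong (fromNat n *_) (sym (trans (*-denominator p) (cong fromℤ p≡))) ⟩
    fromNat n * (p * fromNat (↧ₙ p))        ≡⟨ lem (fromNat n) p (fromNat (↧ₙ p)) ⟩
    p * fromNat n * fromNat (↧ₙ p)          ≡⟨ cong (_* fromNat (↧ₙ p)) (sym k≡pn) ⟩
    fromNat k * fromNat (↧ₙ p)              ≡⟨ sym (fromNat-* k (↧ₙ p)) ⟩
    fromNat (k ℕ.* ↧ₙ p)                    ∎))
    where
    open ≡-Reasoning
    lem : ∀ n p v → n * (p * v) ≡ p * n * v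
    lem = solve-∀ ℚ-ring

  correct : ∀ {d} → 1 ℕ.≤ d → ∀ {p₀ ρ} → Threshold p₀ ρ → ∀ {n} (I : CSP d n) t p u → ↥ p ≡ + u → seq p₀ ≤ˢ const p → const p ≤ˢ (λ i → 1ℚ - seq p₀ i) →
            ∃[ i ] (p * fromNat n ≡ i / 1) → Correct p₀ I t p (algorithm (certificateFactor d ρ) I t u (↧ₙ p))
  correct {d} 1≤d {p₀} {ρ} admits {n} I t p u p≡ lo hi pn = by-answer (certifies t (length H₂) (certificateFactor d ρ)) refl
    where
    β : Assignment n
    β = base n u (↧ₙ p)
    H₂ : List (Fin n)
    H₂ = choose β (H I β)
    facts = admits p lo hi
    2≤ρ = proj₁ (proj₂ (proj₂ (proj₂ facts)))
    N  = proj₁ (proj₂ (proj₂ (proj₂ (proj₂ facts))))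
    eventually = proj₂ (proj₂ (proj₂ (proj₂ (proj₂ facts))))
    open Split (split n p ρ (proj₁ facts) (ℕ.≤-trans (s≤s z≤n) 2≤ρ) (proj₁ (proj₂ facts)) (proj₁ (proj₂ (proj₂ facts))) pn)
    β∈ : #⊖ β ≡ k
    β∈ = base-in-slice {p = p} k+l≡n k≡pn p≡
    by-answer : ∀ b → certifies t (length H₂) (certificateFactor d ρ) ≡ b →
      Correct p₀ I t p (if b then OPT≥AVG+t else kernel (mask H₂) (kernelPoly I β H₂))
    by-answer true  c = certified 1≤d I p ρ k l 2≤ρ k+l≡n k≡pn n≤ρk n≤ρl β β∈ t (certifies-true t (length H₂) _ c)
    by-answer false c =
      (λ ε 0<ε → N , λ i N≤i → let 0<q , q<1 , 5ρq≤8 = eventually i N≤i in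
        ≤-trans (kernel-small 1≤d I p ρ k l 2≤ρ k+l≡n k≡pn n≤ρk n≤ρl β β∈ t 0<q q<1 5ρq≤8 (certifies-false t (length H₂) _ c))
                (≤-trans (≤-reflexive (sym (+-identityʳ _))) (+-monoʳ-≤ (C d (seq p₀ i) * t ^ 2) (<⇒≤ 0<ε)))) ,
      kernel-correct 1≤d I p ρ k l 2≤ρ k+l≡n k≡pn n≤ρk n≤ρl β β∈

open Consts
open Constant
open Main
open Algorithm using (algorithm)
open TimedProgram using (program; timed-program)
open import Defs
open import Data.Nat.Base as ℕ using (ℕ; suc)
open import Data.Product.Base using (_×_; Σ-syntax; ∃-syntax; _,_; proj₁; proj₂)
open import Data.Rational.Base using (ℚ; 0ℚ; 1ℚ; _-_; _*_; _/_; ↧ₙ_)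
open import Relation.Binary.PropositionalEquality.Core using (_≡_)

theorem6p1 :
    Σ[ c ∈ ℕ ] (∀ (d : ℕ) → 1 ℕ.≤ d →
      ∀ (p₀ : ℝ) → const 0ℚ <ˢ seq p₀ → seq p₀ <ˢ const 1ℚ →
      Σ[ A ∈ Program ] Σ[ K ∈ ℕ ]
        (∀ (n : ℕ) (I : CSP d n) (t p : ℚ) →
          seq p₀ ≤ˢ const p → const p ≤ˢ (λ i → 1ℚ - seq p₀ i) →
          ∃[ k ] (p * fromNat n ≡ k / 1) →
          Σ[ out ∈ Output n ] Σ[ τ ∈ ℕ ]
            (A on codeInput I t p outputs codeOutput out inTime τ
             × τ ℕ.≤ timeBound c K d n (codeInput I t p)
             × Correct p₀ I t p out)))
theorem6p1 = proj₁ timed-program , λ d 1≤d p₀ 0<p₀ _ →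
  -- The real number p₀ leaves its trace in the program only through ρ, which is read off from a
  -- single member of its sequence.
  let ρ , admits = find-threshold p₀ 0<p₀
      A          = certificateFactor d ρ
      K , timed  = proj₂ timed-program d 1≤d A
  in program d A , K , λ n I t p lo hi pn →
       let u , p≡        = positive-numerator (proj₁ (admits p lo hi))
           τ , runs , τ≤ = timed I t p (suc u) p≡
       in algorithm A I t (suc u) (↧ₙ p) , τ , runs , τ≤ , correct 1≤d admits I t p (suc u) p≡ lo hi pn
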